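{- Let $F$ be a graph on $k$ vertices and let $s$ be a positive integer. For every multigraph $G$ of order $n$ in which every edge-multiplicity is at most $s$, $\nu_F^*(G)-\nu_F(G)=o_{s,k}(n^2)$; that is, for every $\delta>0$ there is $N$ depending only on $\delta,s,k$ (and $F$) such that $\nu_F^*(G)-\nu_F(G)\le\delta n^2$ whenever $n\ge N$.
   Context: A copy of $F$ in a multigraph $G$ is a set $H\subseteq E(G)$ of $|E(F)|$ edges which together form a subgraph isomorphic to $F$; $\binom{G}{F}$ denotes the set of copies. The $F$-packing number $\nu_F(G)$ is the maximum number of pairwise edge-disjoint copies of $F$ in $G$. A fractional $F$-packing is a function $\psi:\binom{G}{F}\to[0,\infty)$ with $\sum\{\psi(H): H\in\binom{G}{F}, e\in H\}\le1$ for every edge $e$ of $G$ (equivalently, viewing $G$ as a simple graph with edge weights $w(e)$ equal to multiplicities, the sum over copies containing the pair $e$ is at most $w(e)$); $\nu_F^*(G)$ is the maximum of $\sum_H\psi(H)$ over fractional $F$-packings. -}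

module Defs where

open import Data.Nat as ℕ using (ℕ)
open import Data.Bool using (Bool; true; false; _∧_; _∨_; if_then_else_)
open import Data.Fin using (Fin)
open import Data.Fin.Properties using (_≟_)
open import Data.List using (List; []; _∷_; map; foldr; length; filter)
open import Data.Product using (Σ; _×_; _,_; proj₁; proj₂)
open import Data.Rational using (ℚ; 0ℚ; _+_; _≤_; _/_)
open import Relation.Nullary.Decidable using (⌊_⌋)
open import Relation.Binary.PropositionalEquality using (_≡_)
open import Function.Definitions using (Injective)
open import Data.List using (allFin)

record Graph (k : ℕ) : Set where
  field
    adj   : Fin k → Fin k → Bool
    sym   : ∀ u v → adj u v ≡ adj v u
    irref : ∀ u → adj u u ≡ false
open Graph public

record Multigraph (n : ℕ) : Set where
  field
    mult     : Fin n → Fin n → ℕ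
    msym     : ∀ a b → mult a b ≡ mult b a
    loopless : ∀ a → mult a a ≡ 0
open Multigraph public

MultBounded : ∀ {n} → ℕ → Multigraph n → Set
MultBounded s G = ∀ a b → mult G a b ℕ.≤ s

-- An injective map V(F) → V(G); its image edge set is a copy of F
-- (every copy of F, viewed as a set of vertex pairs, arises this way).
Embedding : ℕ → ℕ → Set
Embedding k n = Σ (Fin k → Fin n) λ φ → Injective _≡_ _≡_ φ

anyL : ∀ {A : Set} → (A → Bool) → List A → Bool
anyL p = foldr (λ x b → p x ∨ b) false

covers : ∀ {k n} → Graph k → Embedding k n → Fin n → Fin n → Bool
covers {k} F (φ , _) a b =
  anyL (λ u → anyL (λ v → adj F u v ∧ (⌊ φ u ≟ a ⌋ ∧ ⌊ φ v ≟ b ⌋)) (allFin k)) (allFin k)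

-- An F-packing: a list of copies such that every pair {a,b} lies in at most
-- mult a b of them (i.e. copies can be assigned pairwise edge-disjoint
-- parallel edges of the multigraph).
IsPacking : ∀ {k n} → Graph k → Multigraph n → List (Embedding k n) → Set
IsPacking F G P = ∀ a b → length (filter (λ φ → covers F φ a b ≡? true) P) ℕ.≤ mult G a b
  where
  open import Data.Bool.Properties using () renaming (_≟_ to _≡?_)

ℕtoℚ : ℕ → ℚ
ℕtoℚ m = Data.Integer.+ m / 1
  where import Data.Integer

-- A fractional F-packing, represented as a finite list of (copy, weight)
-- pairs with nonnegative rational weights; the weight of a copy H is the
-- sum of weights of the entries whose image is H.
FracPacking : ℕ → ℕ → Set
FracPacking k n = List (Embedding k n × ℚ)

load : ∀ {k n} → Graph k → FracPacking k n → Fin n → Fin n → ℚ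
load F ψ a b = foldr (λ x r → if covers F (proj₁ x) a b then proj₂ x + r else r) 0ℚ ψ

value : ∀ {k n} → FracPacking k n → ℚ
value ψ = foldr (λ x r → proj₂ x + r) 0ℚ ψ

IsFracPacking : ∀ {k n} → Graph k → Multigraph n → FracPacking k n → Set
IsFracPacking F G ψ =
  (∀ x → x ∈ ψ → 0ℚ ≤ proj₂ x) × (∀ a b → load F ψ a b ≤ ℕtoℚ (mult G a b))
  where open import Data.List.Membership.Propositional using (_∈_)

{-# OPTIONS --safe #-}
module Submission where

-- The fractional packing ψ is first spread out.  A regular partition of G (Szemerédi, by
-- an energy decrement on step functions) is taken, and every copy of F in ψ whose edges
-- lie in regular, dense and large pairs of cells is replaced by the uniform weighting of
-- all homomorphisms of F into the same tuple of cells.  The counting lemma (a telescoping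
-- argument that resamples the two ends of one edge) shows that this keeps the total weight
-- and, outside a few pairs of vertices, the load constraints, while any two edges of G now
-- lie together in copies of total weight O(1/n).
--
-- Such a spread-out fractional packing is rounded by the nibble.  View the parallel edges
-- of G as vertices of a hypergraph and copies of F as its edges.  Copies are removed one at
-- a time, at random with probability proportional to their weight, and vertices of small
-- load are discarded so that all vertices die at the same rate.  The excess load over a
-- decreasing target q stays small in mean square, and the number of copies taken plus the
-- (rescaled) weight of the surviving ones has non-negative drift up to this excess, so a
-- good choice exists in every step by averaging.

open import Data.Bool using (Bool; true; false; _∧_; not; if_then_else_)
import Data.Bool.Properties as Bool
open import Data.Empty using (⊥-elim)
import Data.Fin as 𝔽
open import Data.Fin using (Fin; zero; suc; toℕ; fromℕ<; combine; funToFin; finToFun)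
import Data.Fin.Properties as Fin
import Data.Integer as ℤ
import Data.Integer.Properties as ℤ
open import Data.List using (List; []; _∷_; _++_; map; concatMap; length; filter; allFin; tabulate; lookup; cartesianProduct; replicate)
open import Data.List.Membership.Propositional using (_∈_; find; lose)
open import Data.List.Membership.Propositional.Properties using (∈-++⁻; ∈-map⁻; ∈-concatMap⁺; ∈-map⁺; ∈-concatMap⁻; ∈-allFin; ∈-filter⁻; ∈-filter⁺; ∈-cartesianProduct⁺; ∈-lookup)
import Data.List.Properties as List
open import Data.List.Relation.Unary.All as All using (All; []; _∷_)
import Data.List.Relation.Unary.All.Properties as All
open import Data.List.Relation.Unary.AllPairs using ([]; _∷_)
open import Data.List.Relation.Unary.Any as Any using (here; there; Any; any?)
import Data.List.Relation.Unary.Any.Properties as Any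
open import Data.List.Relation.Unary.Unique.Propositional using (Unique)
import Data.List.Relation.Unary.Unique.Propositional.Properties as Unique
import Data.Nat as ℕ
open import Data.Nat using (ℕ)
import Data.Nat.Coprimality as ℕ
import Data.Nat.Properties as ℕ
open import Data.Product using (_×_; _,_; proj₁; proj₂; ∃-syntax)
import Data.Rational.Unnormalised as ℚᵘ
import Data.Rational.Unnormalised.Properties as ℚᵘ
open import Data.Sum using (_⊎_; inj₁; inj₂)
open import Data.Vec as Vec using (Vec; []; _∷_; _[_]≔_)
import Data.Vec.Properties as Vec
open import Defs hiding (sym)
open import Function using (_∘_)
open import Function.Definitions using (Injective)
open import Level using (0ℓ)
open import Relation.Binary.Definitions using (tri<; tri≈; tri>; DecidableEquality)
open import Relation.Binary.PropositionalEquality using (_≡_; refl; _≢_; sym; trans; cong; cong₂; subst; subst₂)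
open import Relation.Nullary using (Dec; yes; no; does; ¬_)
open import Relation.Nullary.Decidable using (map′; ¬?; _⊎-dec_; _×-dec_; isYes; _→-dec_)
open import Relation.Nullary.Decidable.Core using (dec⇒maybe)
import Relation.Unary as U
import Tactic.RingSolver.Core.AlmostCommutativeRing as ACR

-- Two edges of G may have a constant amount of ψ in common, whereas rounding needs small codegrees;
-- spreading is what produces them. The counting error is controlled only in total over a pair of
-- cells, so single pairs of vertices may still be loaded beyond what the nibble tolerates. They are
-- cut out, and comparing total loads shows that little weight is lost with them. This forces ε to
-- be small against the tolerance α of the nibble and fixes the order of the constants: δ′ and α,
-- then ρ, ε, the bound on the number of cells, γ, and last the threshold for n. Regularity is
-- tested with functions into {0, ..., K} instead of subsets: when all but the two ends of one edge
-- are frozen, the multiplicities of the other edges form exactly such functions of the two ends.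
-- The nibble uses no concentration inequality. Expectations are finite weighted sums in ℚ, and a
-- guarantee for the remaining steps is proved by induction on their number. Only loads above the
-- target need control, in mean square, since loads below it are made up for by discarding vertices.

module RingIdentities where
  open import Data.Rational
  open import Data.Rational.Properties

  ℚ-ring : ACR.AlmostCommutativeRing 0ℓ 0ℓ
  ℚ-ring = ACR.fromCommutativeRing +-*-commutativeRing (λ x → dec⇒maybe (0ℚ ≟ x))

  open import Tactic.RingSolver.NonReflective ℚ-ring using (solve; _⊜_; Κ; _⊕_; _⊗_; ⊝_)

  -- The solver runs on variables only; the long sums of the later proofs enter by instantiation.
  ring₁ : ∀ a b → a + (b - a) ≡ b
  ring₁ = solve 2 (λ a b → (a ⊕ (b ⊕ ⊝ a)) ⊜ b) refl

  ring₂ : ∀ x → (- x) * (- x) ≡ x * x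
  ring₂ = solve 1 (λ x → ⊝ x ⊗ ⊝ x ⊜ x ⊗ x) refl

  ring₃ : ∀ N O → N - (1ℚ + (N + O)) ≡ - (1ℚ + O)
  ring₃ = solve 2 (λ N O → (N ⊕ ⊝ (Κ 1ℚ ⊕ (N ⊕ O))) ⊜ ⊝ (Κ 1ℚ ⊕ O)) refl

  ring₄ : ∀ O → - (1ℚ + O) + (1ℚ + O) ≡ 0ℚ
  ring₄ = solve 1 (λ O → (⊝ (Κ 1ℚ ⊕ O) ⊕ (Κ 1ℚ ⊕ O)) ⊜ Κ 0ℚ) refl

  ring₅ : ∀ a b → a + a * b ≡ a * (1ℚ + b)
  ring₅ = solve 2 (λ a b → (a ⊕ a ⊗ b) ⊜ a ⊗ (Κ 1ℚ ⊕ b)) refl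

  ring₆ : ∀ C d i → d * (C * i) ≡ C * (i * d)
  ring₆ = solve 3 (λ C d i → d ⊗ (C ⊗ i) ⊜ C ⊗ (i ⊗ d)) refl

  ring₇ : ∀ d s a → d * s * a ≡ d * (a * s)
  ring₇ = solve 3 (λ d s a → d ⊗ s ⊗ a ⊜ d ⊗ (a ⊗ s)) refl

  ring₈ : ∀ a b c d → (a + b) + (c + d) ≡ (a + c) + (b + d)
  ring₈ = solve 4 (λ a b c d → (a ⊕ b ⊕ (c ⊕ d)) ⊜ (a ⊕ c ⊕ (b ⊕ d))) refl

  ring₉ : ∀ c l → c + l * c ≡ (1ℚ + l) * c
  ring₉ = solve 2 (λ c l → (c ⊕ l ⊗ c) ⊜ (Κ 1ℚ ⊕ l) ⊗ c) refl

  ring₁₀ : ∀ p B g → p * (B - g) ≡ p * B - p * g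
  ring₁₀ = solve 3 (λ p B g → p ⊗ (B ⊕ ⊝ g) ⊜ (p ⊗ B ⊕ ⊝ (p ⊗ g))) refl

  ring₁₁ : ∀ a b c d → a * b * (c * d) ≡ a * c * (b * d)
  ring₁₁ = solve 4 (λ a b c d → a ⊗ b ⊗ (c ⊗ d) ⊜ a ⊗ c ⊗ (b ⊗ d)) refl

  ring₁₂ : ∀ a b → - (b - a) ≡ a - b
  ring₁₂ = solve 2 (λ a b → ⊝ (b ⊕ ⊝ a) ⊜ (a ⊕ ⊝ b)) refl

  ring₁₃ : ∀ a b → a + (b - a) ≡ b + 0ℚ
  ring₁₃ = solve 2 (λ a b → (a ⊕ (b ⊕ ⊝ a)) ⊜ (b ⊕ Κ 0ℚ)) refl

  ring₁₄ : ∀ a b → a + 0ℚ ≡ b + (a - b)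
  ring₁₄ = solve 2 (λ a b → (a ⊕ Κ 0ℚ) ⊜ (b ⊕ (a ⊕ ⊝ b))) refl

  ring₁₅ : ∀ a → 1ℚ + a - 1ℚ ≡ a
  ring₁₅ = solve 1 (λ a → (Κ 1ℚ ⊕ a ⊕ ⊝ Κ 1ℚ) ⊜ a) refl

  ring₁₆ : ∀ a b c → a * (b * c) ≡ b * (a * c)
  ring₁₆ = solve 3 (λ a b c → a ⊗ (b ⊗ c) ⊜ b ⊗ (a ⊗ c)) refl

  ring₁₇ : ∀ a → 1ℚ - a + a ≡ 1ℚ
  ring₁₇ = solve 1 (λ a → (Κ 1ℚ ⊕ ⊝ a ⊕ a) ⊜ Κ 1ℚ) refl

  ring₁₈ : ∀ k s p → 1ℚ - (k + s) + ((p - (1ℚ - s)) + k * (1ℚ - p)) ≡ (1ℚ - k) * p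
  ring₁₈ = solve 3 (λ k s p → (Κ 1ℚ ⊕ ⊝ (k ⊕ s) ⊕ (p ⊕ ⊝ (Κ 1ℚ ⊕ ⊝ s) ⊕ k ⊗ (Κ 1ℚ ⊕ ⊝ p))) ⊜ (Κ 1ℚ ⊕ ⊝ k) ⊗ p) refl

  ring₁₉ : ∀ k s x p y → (1ℚ - k) * p + ((1ℚ - k) * (1ℚ - s + x - p) + (k * x + y)) ≡ 1ℚ - (k + s) + (k * s + (y + x))
  ring₁₉ = solve 5 (λ k s x p y → ((Κ 1ℚ ⊕ ⊝ k) ⊗ p ⊕ ((Κ 1ℚ ⊕ ⊝ k) ⊗ (Κ 1ℚ ⊕ ⊝ s ⊕ x ⊕ ⊝ p) ⊕ (k ⊗ x ⊕ y))) ⊜ (Κ 1ℚ ⊕ ⊝ (k ⊕ s) ⊕ (k ⊗ s ⊕ (y ⊕ x)))) refl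

  ring₂₀ : ∀ Ω M t κ Q err tA bu W X E₁ E₂ Z →
    Ω * M - Ω * ((1ℚ + t) * κ * Q) - Ω * ((1ℚ + t) * err) + (bu * (E₁ - (W - (1ℚ + 1ℚ) * X)) + (t * κ * (Ω * Q + Z - E₂) + (Ω * (κ * Q) + Ω * err - (bu * ((1ℚ + 1ℚ) * X) + t * κ * Z))))
    ≡ (Ω * M - (tA + bu * W)) + (tA + bu * E₁ - t * κ * E₂ - Ω * (t * err))
  ring₂₀ = solve 13 (λ Ω M t κ Q err tA bu W X E₁ E₂ Z → (Ω ⊗ M ⊕ ⊝ (Ω ⊗ ((Κ 1ℚ ⊕ t) ⊗ κ ⊗ Q)) ⊕ ⊝ (Ω ⊗ ((Κ 1ℚ ⊕ t) ⊗ err)) ⊕ (bu ⊗ (E₁ ⊕ ⊝ (W ⊕ ⊝ ((Κ 1ℚ ⊕ Κ 1ℚ) ⊗ X))) ⊕ (t ⊗ κ ⊗ (Ω ⊗ Q ⊕ Z ⊕ ⊝ E₂) ⊕ (Ω ⊗ (κ ⊗ Q) ⊕ Ω ⊗ err ⊕ ⊝ (bu ⊗ ((Κ 1ℚ ⊕ Κ 1ℚ) ⊗ X) ⊕ t ⊗ κ ⊗ Z))))) ⊜ (Ω ⊗ M ⊕ ⊝ (tA ⊕ bu ⊗ W) ⊕ (tA ⊕ bu ⊗ E₁ ⊕ ⊝ (t ⊗ κ ⊗ E₂) ⊕ ⊝ (Ω ⊗ (t ⊗ err))))) refl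

  ring₂₁ : ∀ q m U h h′ t Q N k e → q * m * ((1ℚ + 1ℚ) * U * U * h′ * t * Q) + q * m * (N * t * ((1ℚ + 1ℚ) * U * U * h + k * e * U))
    ≡ q * U * ((1ℚ + 1ℚ) * U * (N * h + h′ * Q) + k * (N * e)) * (t * m)
  ring₂₁ = solve 10 (λ q m U h h′ t Q N k e → (q ⊗ m ⊗ ((Κ 1ℚ ⊕ Κ 1ℚ) ⊗ U ⊗ U ⊗ h′ ⊗ t ⊗ Q) ⊕ q ⊗ m ⊗ (N ⊗ t ⊗ ((Κ 1ℚ ⊕ Κ 1ℚ) ⊗ U ⊗ U ⊗ h ⊕ k ⊗ e ⊗ U))) ⊜ q ⊗ U ⊗ ((Κ 1ℚ ⊕ Κ 1ℚ) ⊗ U ⊗ (N ⊗ h ⊕ h′ ⊗ Q) ⊕ k ⊗ (N ⊗ e)) ⊗ (t ⊗ m)) refl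

  ring₂₂ : ∀ a t → 1ℚ - (1ℚ + a) * t ≡ 1ℚ - a * t - t
  ring₂₂ = solve 2 (λ a t → (Κ 1ℚ ⊕ ⊝ ((Κ 1ℚ ⊕ a) ⊗ t)) ⊜ (Κ 1ℚ ⊕ ⊝ (a ⊗ t) ⊕ ⊝ t)) refl

  ring₂₃ : ∀ a b c → a * (b * c) ≡ a * c * b
  ring₂₃ = solve 3 (λ a b c → a ⊗ (b ⊗ c) ⊜ a ⊗ c ⊗ b) refl

  ring₂₄ : ∀ a t → a - t + t ≡ a
  ring₂₄ = solve 2 (λ a t → (a ⊕ ⊝ t ⊕ t) ⊜ a) refl

  ring₂₅ : ∀ x r P → x * (1ℚ - r * P) ≡ x - r * x * P
  ring₂₅ = solve 3 (λ x r P → x ⊗ (Κ 1ℚ ⊕ ⊝ (r ⊗ P)) ⊜ (x ⊕ ⊝ (r ⊗ x ⊗ P))) refl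

  ring₂₆ : ∀ x t P → x - (x - t) * P ≡ t + (x - t) * (1ℚ - P)
  ring₂₆ = solve 3 (λ x t P → (x ⊕ ⊝ ((x ⊕ ⊝ t) ⊗ P)) ⊜ (t ⊕ (x ⊕ ⊝ t) ⊗ (Κ 1ℚ ⊕ ⊝ P))) refl

  ring₂₇ : ∀ t r x P → t + r * x * (1ℚ - P) ≡ t + r * (x * (1ℚ - P))
  ring₂₇ = solve 4 (λ t r x P → (t ⊕ r ⊗ x ⊗ (Κ 1ℚ ⊕ ⊝ P)) ⊜ (t ⊕ r ⊗ (x ⊗ (Κ 1ℚ ⊕ ⊝ P)))) refl

  ring₂₈ : ∀ m t k y b → m * (t + (1ℚ - k * t - t) * y * b) ≡ t * m + (m - k * (t * m) - t * m) * y * b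
  ring₂₈ = solve 5 (λ m t k y b → m ⊗ (t ⊕ (Κ 1ℚ ⊕ ⊝ (k ⊗ t) ⊕ ⊝ t) ⊗ y ⊗ b) ⊜ (t ⊗ m ⊕ (m ⊕ ⊝ (k ⊗ (t ⊗ m)) ⊕ ⊝ (t ⊗ m)) ⊗ y ⊗ b)) refl

  ring₂₉ : ∀ m k y b → 1ℚ + (m - k * 1ℚ - 1ℚ) * y * b ≡ 1ℚ + b * y * (m - (1ℚ + k))
  ring₂₉ = solve 4 (λ m k y b → (Κ 1ℚ ⊕ (m ⊕ ⊝ (k ⊗ Κ 1ℚ) ⊕ ⊝ Κ 1ℚ) ⊗ y ⊗ b) ⊜ (Κ 1ℚ ⊕ b ⊗ y ⊗ (m ⊕ ⊝ (Κ 1ℚ ⊕ k)))) refl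

  ring₃₀ : ∀ z s → z * (z * s) ≡ s * (z * z)
  ring₃₀ = solve 2 (λ z s → z ⊗ (z ⊗ s) ⊜ s ⊗ (z ⊗ z)) refl

  ring₃₁ : ∀ n → n * (1ℚ + 1ℚ) + n * 1ℚ ≡ n * (1ℚ + (1ℚ + 1ℚ))
  ring₃₁ = solve 1 (λ n → (n ⊗ (Κ 1ℚ ⊕ Κ 1ℚ) ⊕ n ⊗ Κ 1ℚ) ⊜ n ⊗ (Κ 1ℚ ⊕ (Κ 1ℚ ⊕ Κ 1ℚ))) refl

  ring₃₂ : ∀ n q U → n * (1ℚ + (1ℚ + 1ℚ)) * (q * U) ≡ q * (n * (1ℚ + (1ℚ + 1ℚ)) * U)
  ring₃₂ = solve 3 (λ n q U → n ⊗ (Κ 1ℚ ⊕ (Κ 1ℚ ⊕ Κ 1ℚ)) ⊗ (q ⊗ U) ⊜ q ⊗ (n ⊗ (Κ 1ℚ ⊕ (Κ 1ℚ ⊕ Κ 1ℚ)) ⊗ U)) refl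

  ring₃₃ : ∀ q k → q - k * q ≡ q * (1ℚ - k)
  ring₃₃ = solve 2 (λ q k → (q ⊕ ⊝ (k ⊗ q)) ⊜ q ⊗ (Κ 1ℚ ⊕ ⊝ k)) refl

  ring₃₄ : ∀ q m k t → q * m * (k * t * q) ≡ k * (q * q) * (t * m)
  ring₃₄ = solve 4 (λ q m k t → q ⊗ m ⊗ (k ⊗ t ⊗ q) ⊜ k ⊗ (q ⊗ q) ⊗ (t ⊗ m)) refl

  ring₃₅ : ∀ k q t → k * (q * q) * (k * t * q) ≡ k * k * (q * (q * q)) * t
  ring₃₅ = solve 3 (λ k q t → k ⊗ (q ⊗ q) ⊗ (k ⊗ t ⊗ q) ⊜ k ⊗ k ⊗ (q ⊗ (q ⊗ q)) ⊗ t) refl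

  ring₃₆ : ∀ t b u y q m r → t + b * (u * y) * (t * (q * m - r * q)) ≡ t + b * y * (m - r) * t * (q * u)
  ring₃₆ = solve 7 (λ t b u y q m r → (t ⊕ b ⊗ (u ⊗ y) ⊗ (t ⊗ (q ⊗ m ⊕ ⊝ (r ⊗ q)))) ⊜ (t ⊕ b ⊗ y ⊗ (m ⊕ ⊝ r) ⊗ t ⊗ (q ⊗ u))) refl

  ring₃₇ : ∀ t w → t + w * t * 1ℚ ≡ (1ℚ + w) * t
  ring₃₇ = solve 2 (λ t w → (t ⊕ w ⊗ t ⊗ Κ 1ℚ) ⊜ (Κ 1ℚ ⊕ w) ⊗ t) refl

  ring₃₈ : ∀ w t → w * t ≡ 1ℚ * (w * t)
  ring₃₈ = solve 2 (λ w t → w ⊗ t ⊜ Κ 1ℚ ⊗ (w ⊗ t)) refl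

  ring₃₉ : ∀ q u m b t → q * u * (m * b * t) ≡ q * m * (b * u * t)
  ring₃₉ = solve 5 (λ q u m b t → q ⊗ u ⊗ (m ⊗ b ⊗ t) ⊜ q ⊗ m ⊗ (b ⊗ u ⊗ t)) refl

  ring₄₀ : ∀ U N h h′ Q k e → U * ((1ℚ + 1ℚ) * (N * h + h′ * Q)) + k * (N * e) ≡ 1ℚ * ((1ℚ + 1ℚ) * U * (N * h + h′ * Q) + k * (N * e))
  ring₄₀ = solve 7 (λ U N h h′ Q k e → (U ⊗ ((Κ 1ℚ ⊕ Κ 1ℚ) ⊗ (N ⊗ h ⊕ h′ ⊗ Q)) ⊕ k ⊗ (N ⊗ e)) ⊜ Κ 1ℚ ⊗ ((Κ 1ℚ ⊕ Κ 1ℚ) ⊗ U ⊗ (N ⊗ h ⊕ h′ ⊗ Q) ⊕ k ⊗ (N ⊗ e))) refl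

  ring₄₁ : ∀ Ω a b c → Ω * (a - b - c) ≡ Ω * a - Ω * b - Ω * c
  ring₄₁ = solve 4 (λ Ω a b c → Ω ⊗ (a ⊕ ⊝ b ⊕ ⊝ c) ⊜ (Ω ⊗ a ⊕ ⊝ (Ω ⊗ b) ⊕ ⊝ (Ω ⊗ c))) refl

  ring₄₂ : ∀ a b c → a ≡ a - b - c + b + c
  ring₄₂ = solve 3 (λ a b c → a ⊜ (a ⊕ ⊝ b ⊕ ⊝ c ⊕ b ⊕ c)) refl

  ring₄₃ : ∀ g w k e l → g + w - k - e + (l + k + e - w) ≡ g + l
  ring₄₃ = solve 5 (λ g w k e l → (g ⊕ w ⊕ ⊝ k ⊕ ⊝ e ⊕ (l ⊕ k ⊕ e ⊕ ⊝ w)) ⊜ (g ⊕ l)) refl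

  ring₄₄ : ∀ x u t → x * (1ℚ - 1ℚ) * u * t ≡ 0ℚ
  ring₄₄ = solve 3 (λ x u t → x ⊗ (Κ 1ℚ ⊕ ⊝ Κ 1ℚ) ⊗ u ⊗ t ⊜ Κ 0ℚ) refl

  ring₄₅ : ∀ a b c → 0ℚ + 0ℚ * a * b + 0ℚ * c ≡ 0ℚ
  ring₄₅ = solve 3 (λ a b c → (Κ 0ℚ ⊕ Κ 0ℚ ⊗ a ⊗ b ⊕ Κ 0ℚ ⊗ c) ⊜ Κ 0ℚ) refl

  ring₄₆ : ∀ a → 1ℚ ≡ 1ℚ * (1ℚ - 0ℚ * a)
  ring₄₆ = solve 1 (λ a → Κ 1ℚ ⊜ Κ 1ℚ ⊗ (Κ 1ℚ ⊕ ⊝ (Κ 0ℚ ⊗ a))) refl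

  ring₄₇ : ∀ a b c d → a * b * (c * d) ≡ d * (c * (a * b))
  ring₄₇ = solve 4 (λ a b c d → a ⊗ b ⊗ (c ⊗ d) ⊜ d ⊗ (c ⊗ (a ⊗ b))) refl

  ring₄₈ : ∀ a b c → a + (b + (c - (a + b)) * 1ℚ) ≡ c
  ring₄₈ = solve 3 (λ a b c → (a ⊕ (b ⊕ (c ⊕ ⊝ (a ⊕ b)) ⊗ Κ 1ℚ)) ⊜ c) refl

  ring₄₉ : ∀ a b → a * (- b) ≡ - (a * b)
  ring₄₉ = solve 2 (λ a b → a ⊗ ⊝ b ⊜ ⊝ (a ⊗ b)) refl

  ring₅₀ : ∀ q d x → q + (x - (q - d)) ≡ d + x
  ring₅₀ = solve 3 (λ q d x → (q ⊕ (x ⊕ ⊝ (q ⊕ ⊝ d))) ⊜ (d ⊕ x)) refl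

  ring₅₁ : ∀ a b c h → a * (b * c) * h ≡ a * c * (h * b)
  ring₅₁ = solve 4 (λ a b c h → a ⊗ (b ⊗ c) ⊗ h ⊜ a ⊗ c ⊗ (h ⊗ b)) refl

  ring₅₂ : ∀ a c h → a * c * (h * 1ℚ) ≡ h * (a * c)
  ring₅₂ = solve 3 (λ a c h → a ⊗ c ⊗ (h ⊗ Κ 1ℚ) ⊜ h ⊗ (a ⊗ c)) refl

  ring₅₃ : ∀ a b s → a * b - a * s ≡ a * (b - s)
  ring₅₃ = solve 3 (λ a b s → (a ⊗ b ⊕ ⊝ (a ⊗ s)) ⊜ a ⊗ (b ⊕ ⊝ s)) refl

  ring₅₄ : ∀ a b s → a - b - s ≡ a - (b + s)
  ring₅₄ = solve 3 (λ a b s → (a ⊕ ⊝ b ⊕ ⊝ s) ⊜ (a ⊕ ⊝ (b ⊕ s))) refl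

  ring₅₅ : ∀ a b c d → a * (b * (c * d)) ≡ a * (b * c) * d
  ring₅₅ = solve 4 (λ a b c d → a ⊗ (b ⊗ (c ⊗ d)) ⊜ a ⊗ (b ⊗ c) ⊗ d) refl

  ring₅₆ : ∀ a b → a * (1ℚ - b) ≡ a - a * b
  ring₅₆ = solve 2 (λ a b → a ⊗ (Κ 1ℚ ⊕ ⊝ b) ⊜ (a ⊕ ⊝ (a ⊗ b))) refl

  ring₅₇ : ∀ a s → 1ℚ - a + (a - (1ℚ - s)) ≡ s
  ring₅₇ = solve 2 (λ a s → (Κ 1ℚ ⊕ ⊝ a ⊕ (a ⊕ ⊝ (Κ 1ℚ ⊕ ⊝ s))) ⊜ s) refl

  ring₅₈ : ∀ a b c d → a * b * (c * d) ≡ b * (c * (a * d))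
  ring₅₈ = solve 4 (λ a b c d → a ⊗ b ⊗ (c ⊗ d) ⊜ b ⊗ (c ⊗ (a ⊗ d))) refl

  ring₅₉ : ∀ a b → a * (b * a) ≡ a * a * b
  ring₅₉ = solve 2 (λ a b → a ⊗ (b ⊗ a) ⊜ a ⊗ a ⊗ b) refl

  ring₆₀ : ∀ c o k x → c * (o - k + x) ≡ c * (o + x) - c * k
  ring₆₀ = solve 4 (λ c o k x → c ⊗ (o ⊕ ⊝ k ⊕ x) ⊜ (c ⊗ (o ⊕ x) ⊕ ⊝ (c ⊗ k))) refl

  ring₆₁ : ∀ Ω e g Y z → Ω * (e * e + (1ℚ + 1ℚ) * e * g + g * g) - (1ℚ + 1ℚ) * e * Y + z ≡ Ω * (e * e) + ((1ℚ + 1ℚ) * (e * (Ω * g - Y)) + z + Ω * g * g)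
  ring₆₁ = solve 5 (λ Ω e g Y z → (Ω ⊗ (e ⊗ e ⊕ (Κ 1ℚ ⊕ Κ 1ℚ) ⊗ e ⊗ g ⊕ g ⊗ g) ⊕ ⊝ ((Κ 1ℚ ⊕ Κ 1ℚ) ⊗ e ⊗ Y) ⊕ z) ⊜ (Ω ⊗ (e ⊗ e) ⊕ ((Κ 1ℚ ⊕ Κ 1ℚ) ⊗ (e ⊗ (Ω ⊗ g ⊕ ⊝ Y)) ⊕ z ⊕ Ω ⊗ g ⊗ g))) refl

  ring₆₂ : ∀ r α → (1ℚ + 1ℚ) * ((1ℚ + 1ℚ) * ((1ℚ + 1ℚ) * (r * r * α))) + r * α * ((1ℚ + 1ℚ) * (1ℚ + 1ℚ) * r) ≡ (1ℚ + 1ℚ) * (1ℚ + 1ℚ) * (1ℚ + (1ℚ + 1ℚ)) * (r * r * α)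
  ring₆₂ = solve 2 (λ r α → ((Κ 1ℚ ⊕ Κ 1ℚ) ⊗ ((Κ 1ℚ ⊕ Κ 1ℚ) ⊗ ((Κ 1ℚ ⊕ Κ 1ℚ) ⊗ (r ⊗ r ⊗ α))) ⊕ r ⊗ α ⊗ ((Κ 1ℚ ⊕ Κ 1ℚ) ⊗ (Κ 1ℚ ⊕ Κ 1ℚ) ⊗ r)) ⊜ (Κ 1ℚ ⊕ Κ 1ℚ) ⊗ (Κ 1ℚ ⊕ Κ 1ℚ) ⊗ (Κ 1ℚ ⊕ (Κ 1ℚ ⊕ Κ 1ℚ)) ⊗ (r ⊗ r ⊗ α)) refl

  ring₆₃ : ∀ D D′ q g → D′ - (q - g) ≡ D - q - ((D - D′) - g)
  ring₆₃ = solve 4 (λ D D′ q g → (D′ ⊕ ⊝ (q ⊕ ⊝ g)) ⊜ (D ⊕ ⊝ q ⊕ ⊝ (D ⊕ ⊝ D′ ⊕ ⊝ g))) refl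

  ring₆₄ : ∀ e g Δ w → (e - (Δ - g)) * (e - (Δ - g)) + ((1ℚ + 1ℚ) * (g * Δ) + (w - Δ) * Δ) ≡ e * e + (1ℚ + 1ℚ) * e * g + g * g - ((1ℚ + 1ℚ) * e) * Δ + w * Δ
  ring₆₄ = solve 4 (λ e g Δ w → ((e ⊕ ⊝ (Δ ⊕ ⊝ g)) ⊗ (e ⊕ ⊝ (Δ ⊕ ⊝ g)) ⊕ ((Κ 1ℚ ⊕ Κ 1ℚ) ⊗ (g ⊗ Δ) ⊕ (w ⊕ ⊝ Δ) ⊗ Δ)) ⊜ (e ⊗ e ⊕ (Κ 1ℚ ⊕ Κ 1ℚ) ⊗ e ⊗ g ⊕ g ⊗ g ⊕ ⊝ ((Κ 1ℚ ⊕ Κ 1ℚ) ⊗ e ⊗ Δ) ⊕ w ⊗ Δ)) refl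

  ring₆₅ : ∀ D Ω k R → D * (k - R) ≡ Ω * D - D * (Ω - k + R)
  ring₆₅ = solve 4 (λ D Ω k R → D ⊗ (k ⊕ ⊝ R) ⊜ (Ω ⊗ D ⊕ ⊝ (D ⊗ (Ω ⊕ ⊝ k ⊕ R)))) refl

  ring₆₆ : ∀ e D q k R → e * (k * (q * q) - D * (k * q - R)) ≡ e * D * R - k * q * (e * (D - q))
  ring₆₆ = solve 5 (λ e D q k R → e ⊗ (k ⊗ (q ⊗ q) ⊕ ⊝ (D ⊗ (k ⊗ q ⊕ ⊝ R))) ⊜ (e ⊗ D ⊗ R ⊕ ⊝ (k ⊗ q ⊗ (e ⊗ (D ⊕ ⊝ q))))) refl

  ring₆₇ : ∀ z → 1ℚ - 0ℚ * z ≡ 1ℚ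
  ring₆₇ = solve 1 (λ z → (Κ 1ℚ ⊕ ⊝ (Κ 0ℚ ⊗ z)) ⊜ Κ 1ℚ) refl

  ring₆₈ : ∀ n z w → 1ℚ - (1ℚ + n) * z + (n * z * z + (1ℚ - z) * (w - (1ℚ - n * z))) ≡ (1ℚ - z) * w
  ring₆₈ = solve 3 (λ n z w → (Κ 1ℚ ⊕ ⊝ ((Κ 1ℚ ⊕ n) ⊗ z) ⊕ (n ⊗ z ⊗ z ⊕ (Κ 1ℚ ⊕ ⊝ z) ⊗ (w ⊕ ⊝ (Κ 1ℚ ⊕ ⊝ (n ⊗ z))))) ⊜ (Κ 1ℚ ⊕ ⊝ z) ⊗ w) refl

  ring₆₉ : ∀ z → 1ℚ * (1ℚ + 0ℚ * z) ≡ 1ℚ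
  ring₆₉ = solve 1 (λ z → Κ 1ℚ ⊗ (Κ 1ℚ ⊕ Κ 0ℚ ⊗ z) ⊜ Κ 1ℚ) refl

  ring₇₀ : ∀ w n z → (1ℚ - z) * w * (1ℚ + (1ℚ + n) * z) + w * ((1ℚ + n) * (z * z)) ≡ w * (1ℚ + n * z)
  ring₇₀ = solve 3 (λ w n z → ((Κ 1ℚ ⊕ ⊝ z) ⊗ w ⊗ (Κ 1ℚ ⊕ (Κ 1ℚ ⊕ n) ⊗ z) ⊕ w ⊗ ((Κ 1ℚ ⊕ n) ⊗ (z ⊗ z))) ⊜ w ⊗ (Κ 1ℚ ⊕ n ⊗ z)) refl

  ring₇₁ : ∀ P N k1 L U h km R α τ k → P + km * (N * α) + L * (N * ((1ℚ + 1ℚ) * U * U * h + km * ((1ℚ + 1ℚ) * (1ℚ + 1ℚ) * (1ℚ + (1ℚ + 1ℚ)) * (R * α) + R * τ) * U)) + N * ((1ℚ + 1ℚ) * (k * τ) + k1)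
    ≡ P + N * (k1 + L * ((1ℚ + 1ℚ) * U * U) * h + (km + L * (km * ((1ℚ + 1ℚ) * (1ℚ + 1ℚ) * (1ℚ + (1ℚ + 1ℚ)) * R) * U)) * α + ((1ℚ + 1ℚ) * k + L * (km * R * U)) * τ)
  ring₇₁ = solve 11 (λ P N k1 L U h km R α τ k → (P ⊕ km ⊗ (N ⊗ α) ⊕ L ⊗ (N ⊗ ((Κ 1ℚ ⊕ Κ 1ℚ) ⊗ U ⊗ U ⊗ h ⊕ km ⊗ ((Κ 1ℚ ⊕ Κ 1ℚ) ⊗ (Κ 1ℚ ⊕ Κ 1ℚ) ⊗ (Κ 1ℚ ⊕ (Κ 1ℚ ⊕ Κ 1ℚ)) ⊗ (R ⊗ α) ⊕ R ⊗ τ) ⊗ U)) ⊕ N ⊗ ((Κ 1ℚ ⊕ Κ 1ℚ) ⊗ (k ⊗ τ) ⊕ k1)) ⊜ (P ⊕ N ⊗ (k1 ⊕ L ⊗ ((Κ 1ℚ ⊕ Κ 1ℚ) ⊗ U ⊗ U) ⊗ h ⊕ (km ⊕ L ⊗ (km ⊗ ((Κ 1ℚ ⊕ Κ 1ℚ) ⊗ (Κ 1ℚ ⊕ Κ 1ℚ) ⊗ (Κ 1ℚ ⊕ (Κ 1ℚ ⊕ Κ 1ℚ)) ⊗ R) ⊗ U)) ⊗ α ⊕ ((Κ 1ℚ ⊕ Κ 1ℚ) ⊗ k ⊕ L ⊗ (km ⊗ R ⊗ U)) ⊗ τ))) refl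

  ring₇₂ : ∀ d → d + d + d + d ≡ (1ℚ + 1ℚ) * (1ℚ + 1ℚ) * d
  ring₇₂ = solve 1 (λ d → (d ⊕ d ⊕ d ⊕ d) ⊜ (Κ 1ℚ ⊕ Κ 1ℚ) ⊗ (Κ 1ℚ ⊕ Κ 1ℚ) ⊗ d) refl

  ring₇₃ : ∀ T N τ w → T * (N * τ * w) ≡ (T * τ) * (N * w)
  ring₇₃ = solve 4 (λ T N τ w → T ⊗ (N ⊗ τ ⊗ w) ⊜ T ⊗ τ ⊗ (N ⊗ w)) refl

  ring₇₄ : ∀ T U h τ → T * ((1ℚ + 1ℚ) * U * U * h * τ) ≡ (T * τ) * ((1ℚ + 1ℚ) * U * U * h)
  ring₇₄ = solve 4 (λ T U h τ → T ⊗ ((Κ 1ℚ ⊕ Κ 1ℚ) ⊗ U ⊗ U ⊗ h ⊗ τ) ⊜ T ⊗ τ ⊗ ((Κ 1ℚ ⊕ Κ 1ℚ) ⊗ U ⊗ U ⊗ h)) refl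

  ring₇₅ : ∀ d a b → d * (a * b) ≡ a * (b * d)
  ring₇₅ = solve 3 (λ d a b → d ⊗ (a ⊗ b) ⊜ a ⊗ (b ⊗ d)) refl

  ring₇₆ : ∀ a b t → a * (b * t) * (1ℚ + 1ℚ) ≡ t * ((1ℚ + 1ℚ) * b * a)
  ring₇₆ = solve 3 (λ a b t → a ⊗ (b ⊗ t) ⊗ (Κ 1ℚ ⊕ Κ 1ℚ) ⊜ t ⊗ ((Κ 1ℚ ⊕ Κ 1ℚ) ⊗ b ⊗ a)) refl

  ring₇₇ : ∀ a → 1ℚ * a * 1ℚ ≡ a
  ring₇₇ = solve 1 (λ a → Κ 1ℚ ⊗ a ⊗ Κ 1ℚ ⊜ a) refl

  ring₇₈ : ∀ a → 1ℚ + (1ℚ - a * (1ℚ + 1ℚ)) ≡ (1ℚ + 1ℚ) * (1ℚ - a)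
  ring₇₈ = solve 1 (λ a → (Κ 1ℚ ⊕ (Κ 1ℚ ⊕ ⊝ (a ⊗ (Κ 1ℚ ⊕ Κ 1ℚ)))) ⊜ (Κ 1ℚ ⊕ Κ 1ℚ) ⊗ (Κ 1ℚ ⊕ ⊝ a)) refl

  ring₇₉ : ∀ a t → t + (1ℚ - (1ℚ + a) * t) ≡ 1ℚ - a * t
  ring₇₉ = solve 2 (λ a t → (t ⊕ (Κ 1ℚ ⊕ ⊝ ((Κ 1ℚ ⊕ a) ⊗ t))) ⊜ (Κ 1ℚ ⊕ ⊝ (a ⊗ t))) refl

  ring₈₀ : ∀ x t y → (x - t) * y ≡ x * y - t * y
  ring₈₀ = solve 3 (λ x t y → (x ⊕ ⊝ t) ⊗ y ⊜ (x ⊗ y ⊕ ⊝ (t ⊗ y))) refl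

  ring₈₁ : ∀ a w → 1ℚ - (1ℚ - a) * (1ℚ - w) + a * w ≡ a + w
  ring₈₁ = solve 2 (λ a w → (Κ 1ℚ ⊕ ⊝ ((Κ 1ℚ ⊕ ⊝ a) ⊗ (Κ 1ℚ ⊕ ⊝ w)) ⊕ a ⊗ w) ⊜ (a ⊕ w)) refl

  ring₈₂ : ∀ b t → t ≡ b * t + (1ℚ - b) * t
  ring₈₂ = solve 2 (λ b t → t ⊜ (b ⊗ t ⊕ (Κ 1ℚ ⊕ ⊝ b) ⊗ t)) refl

  ring₈₃ : ∀ z w n → (z + w) * (n * (1ℚ + 1ℚ)) ≡ n * ((1ℚ + 1ℚ) * z + (1ℚ + 1ℚ) * w)
  ring₈₃ = solve 3 (λ z w n → (z ⊕ w) ⊗ (n ⊗ (Κ 1ℚ ⊕ Κ 1ℚ)) ⊜ n ⊗ ((Κ 1ℚ ⊕ Κ 1ℚ) ⊗ z ⊕ (Κ 1ℚ ⊕ Κ 1ℚ) ⊗ w)) refl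

  ring₈₄ : ∀ X l s w → (X - l * (s * w)) * (X - l * (s * w)) ≡ X * X - (1ℚ + 1ℚ) * l * s * (X * w) + l * l * (s * s) * (w * w)
  ring₈₄ = solve 4 (λ X l s w → (X ⊕ ⊝ (l ⊗ (s ⊗ w))) ⊗ (X ⊕ ⊝ (l ⊗ (s ⊗ w))) ⊜ (X ⊗ X ⊕ ⊝ ((Κ 1ℚ ⊕ Κ 1ℚ) ⊗ l ⊗ s ⊗ (X ⊗ w)) ⊕ l ⊗ l ⊗ (s ⊗ s) ⊗ (w ⊗ w))) refl

  ring₈₅ : ∀ P l s D l² G → P - (1ℚ + 1ℚ) * l * s * D + l² * G ≡ P - (1ℚ + 1ℚ) * l * (s * D) + l² * G
  ring₈₅ = solve 6 (λ P l s D l² G → (P ⊕ ⊝ ((Κ 1ℚ ⊕ Κ 1ℚ) ⊗ l ⊗ s ⊗ D) ⊕ l² ⊗ G) ⊜ (P ⊕ ⊝ ((Κ 1ℚ ⊕ Κ 1ℚ) ⊗ l ⊗ (s ⊗ D)) ⊕ l² ⊗ G)) refl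

  ring₈₆ : ∀ P l e S → P - (1ℚ + 1ℚ) * l * (e * S) + l * (e * S) ≡ P - l * e * S
  ring₈₆ = solve 4 (λ P l e S → (P ⊕ ⊝ ((Κ 1ℚ ⊕ Κ 1ℚ) ⊗ l ⊗ (e ⊗ S)) ⊕ l ⊗ (e ⊗ S)) ⊜ (P ⊕ ⊝ (l ⊗ e ⊗ S))) refl

  ring₈₇ : ∀ W U x → W - (U + x) ≡ W - U - x
  ring₈₇ = solve 3 (λ W U x → (W ⊕ ⊝ (U ⊕ x)) ⊜ (W ⊕ ⊝ U ⊕ ⊝ x)) refl

  ring₈₈ : ∀ x → (x - 0ℚ) * (x - 0ℚ) ≡ x * x
  ring₈₈ = solve 1 (λ x → (x ⊕ ⊝ Κ 0ℚ) ⊗ (x ⊕ ⊝ Κ 0ℚ) ⊜ x ⊗ x) refl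

  ring₈₉ : ∀ P l s → P - l * (0ℚ * s) ≡ P
  ring₈₉ = solve 3 (λ P l s → (P ⊕ ⊝ (l ⊗ (Κ 0ℚ ⊗ s))) ⊜ P) refl

  ring₉₀ : ∀ l k S → l * l * (S * k) ≡ l * (l * k * S)
  ring₉₀ = solve 3 (λ l k S → l ⊗ l ⊗ (S ⊗ k) ⊜ l ⊗ (l ⊗ k ⊗ S)) refl

  ring₉₁ : ∀ t x → (1ℚ + t) * x - x ≡ t * x
  ring₉₁ = solve 2 (λ t x → ((Κ 1ℚ ⊕ t) ⊗ x ⊕ ⊝ x) ⊜ t ⊗ x) refl

  ring₉₂ : ∀ t l θ n → t * (l * θ) * n ≡ t * (l * (θ * n))
  ring₉₂ = solve 4 (λ t l θ n → t ⊗ (l ⊗ θ) ⊗ n ⊜ t ⊗ (l ⊗ (θ ⊗ n))) refl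

  ring₉₃ : ∀ s → s ≡ s * 1ℚ
  ring₉₃ = solve 1 (λ s → s ⊜ s ⊗ Κ 1ℚ) refl

  ring₉₄ : ∀ a e S → a * e * S ≡ a * S * e
  ring₉₄ = solve 3 (λ a e S → a ⊗ e ⊗ S ⊜ a ⊗ S ⊗ e) refl

  ring₉₅ : ∀ w u → (w - u) * (1ℚ * 1ℚ) ≡ w + - u
  ring₉₅ = solve 2 (λ w u → (w ⊕ ⊝ u) ⊗ (Κ 1ℚ ⊗ Κ 1ℚ) ⊜ (w ⊕ ⊝ u)) refl

  ring₉₆ : ∀ s u → s * (- u) ≡ - (u * s)
  ring₉₆ = solve 2 (λ s u → s ⊗ ⊝ u ⊜ ⊝ (u ⊗ s)) refl

  ring₉₇ : ∀ S s U d → S * (s * (U - d)) ≡ - s * (d * S - U * S)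
  ring₉₇ = solve 4 (λ S s U d → S ⊗ (s ⊗ (U ⊕ ⊝ d)) ⊜ ⊝ s ⊗ (d ⊗ S ⊕ ⊝ (U ⊗ S))) refl

  ring₉₈ : ∀ w d u p → (w - d) * p ≡ (w - u) * p + (u - d) * p
  ring₉₈ = solve 4 (λ w d u p → (w ⊕ ⊝ d) ⊗ p ⊜ ((w ⊕ ⊝ u) ⊗ p ⊕ (u ⊕ ⊝ d) ⊗ p)) refl

  ring₉₉ : ∀ s D v G → s * (D + v * G) ≡ s * D + s * v * G
  ring₉₉ = solve 4 (λ s D v G → s ⊗ (D ⊕ v ⊗ G) ⊜ (s ⊗ D ⊕ s ⊗ v ⊗ G)) refl

  ring₁₀₀ : ∀ e S K → e * S + e * (S * K) ≡ e * (1ℚ + K) * S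
  ring₁₀₀ = solve 3 (λ e S K → (e ⊗ S ⊕ e ⊗ (S ⊗ K)) ⊜ e ⊗ (Κ 1ℚ ⊕ K) ⊗ S) refl

  ring₁₀₁ : ∀ e l z → e * l * z ≡ l * (e * z)
  ring₁₀₁ = solve 3 (λ e l z → e ⊗ l ⊗ z ⊜ l ⊗ (e ⊗ z)) refl

  ring₁₀₂ : ∀ s B d D A C → s * (B - d * D * A) ≡ s * (B - D * C) + D * (s * (C - d * A))
  ring₁₀₂ = solve 6 (λ s B d D A C → s ⊗ (B ⊕ ⊝ (d ⊗ D ⊗ A)) ⊜ (s ⊗ (B ⊕ ⊝ (D ⊗ C)) ⊕ D ⊗ (s ⊗ (C ⊕ ⊝ (d ⊗ A))))) refl

  ring₁₀₃ : ∀ n K e Z → n * (K * e * Z) + K * (e * Z) ≡ (1ℚ + n) * (K * e * Z)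
  ring₁₀₃ = solve 4 (λ n K e Z → (n ⊗ (K ⊗ e ⊗ Z) ⊕ K ⊗ (e ⊗ Z)) ⊜ (Κ 1ℚ ⊕ n) ⊗ (K ⊗ e ⊗ Z)) refl

  ring₁₀₄ : ∀ DZ e S → DZ - e + (e - - 1ℚ * (S - DZ)) ≡ S
  ring₁₀₄ = solve 3 (λ DZ e S → (DZ ⊕ ⊝ e ⊕ (e ⊕ ⊝ (⊝ Κ 1ℚ ⊗ (S ⊕ ⊝ DZ)))) ⊜ S) refl

  ring₁₀₅ : ∀ S D e → S + (e - 1ℚ * (S - D)) ≡ D + e
  ring₁₀₅ = solve 3 (λ S D e → (S ⊕ (e ⊕ ⊝ (Κ 1ℚ ⊗ (S ⊕ ⊝ D)))) ⊜ (D ⊕ e)) refl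

  ring₁₀₆ : ∀ t a b c d → t * (a * b + c * d) ≡ a * (b * t) + d * (c * t)
  ring₁₀₆ = solve 5 (λ t a b c d → t ⊗ (a ⊗ b ⊕ c ⊗ d) ⊜ (a ⊗ (b ⊗ t) ⊕ d ⊗ (c ⊗ t))) refl

  ring₁₀₇ : ∀ i a b j → i * a * (b * j) ≡ i * (a * b) * j
  ring₁₀₇ = solve 4 (λ i a b j → i ⊗ a ⊗ (b ⊗ j) ⊜ i ⊗ (a ⊗ b) ⊗ j) refl

  ring₁₀₈ : ∀ C D d S A → C * (D * A) * (d * S) ≡ C * (d * D) * (S * A)
  ring₁₀₈ = solve 5 (λ C D d S A → C ⊗ (D ⊗ A) ⊗ (d ⊗ S) ⊜ C ⊗ (d ⊗ D) ⊗ (S ⊗ A)) refl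

  ring₁₀₉ : ∀ C r K e Z → C * (r * (K * e * Z)) ≡ C * Z * (r * (K * e))
  ring₁₀₉ = solve 5 (λ C r K e Z → C ⊗ (r ⊗ (K ⊗ e ⊗ Z)) ⊜ C ⊗ Z ⊗ (r ⊗ (K ⊗ e))) refl

  ring₁₁₀ : ∀ a → 1ℚ + (1ℚ + a * (1ℚ + 1ℚ)) ≡ (1ℚ + a) * (1ℚ + 1ℚ)
  ring₁₁₀ = solve 1 (λ a → (Κ 1ℚ ⊕ (Κ 1ℚ ⊕ a ⊗ (Κ 1ℚ ⊕ Κ 1ℚ))) ⊜ (Κ 1ℚ ⊕ a) ⊗ (Κ 1ℚ ⊕ Κ 1ℚ)) refl

  ring₁₁₁ : ∀ a b → 1ℚ - a * b + (1ℚ - a) * (1ℚ - b) ≡ 1ℚ - a + (1ℚ - b)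
  ring₁₁₁ = solve 2 (λ a b → (Κ 1ℚ ⊕ ⊝ (a ⊗ b) ⊕ (Κ 1ℚ ⊕ ⊝ a) ⊗ (Κ 1ℚ ⊕ ⊝ b)) ⊜ (Κ 1ℚ ⊕ ⊝ a ⊕ (Κ 1ℚ ⊕ ⊝ b))) refl

  ring₁₁₂ : ∀ a b c d w → (a + (b + (c + d))) * w ≡ a * w + (b * w + (c * w + d * w))
  ring₁₁₂ = solve 5 (λ a b c d w → (a ⊕ (b ⊕ (c ⊕ d))) ⊗ w ⊜ (a ⊗ w ⊕ (b ⊗ w ⊕ (c ⊗ w ⊕ d ⊗ w)))) refl

  ring₁₁₃ : ∀ n t m r → n * t + (n * m + (n * m + n * r)) ≡ n * (t + (m + (m + r)))
  ring₁₁₃ = solve 4 (λ n t m r → (n ⊗ t ⊕ (n ⊗ m ⊕ (n ⊗ m ⊕ n ⊗ r))) ⊜ n ⊗ (t ⊕ (m ⊕ (m ⊕ r)))) refl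

  ring₁₁₄ : ∀ M g n s → n * s * (M * (g * n)) ≡ n * n * (M * g * s)
  ring₁₁₄ = solve 4 (λ M g n s → n ⊗ s ⊗ (M ⊗ (g ⊗ n)) ⊜ n ⊗ n ⊗ (M ⊗ g ⊗ s)) refl

  ring₁₁₅ : ∀ w t → (1ℚ + 1ℚ) * (w * t) ≡ w * (t + t)
  ring₁₁₅ = solve 2 (λ w t → (Κ 1ℚ ⊕ Κ 1ℚ) ⊗ (w ⊗ t) ⊜ w ⊗ (t ⊕ t)) refl

  ring₁₁₆ : ∀ k i Z K → k * (k * (i * Z)) * K ≡ k * k * (K * i) * Z
  ring₁₁₆ = solve 4 (λ k i Z K → k ⊗ (k ⊗ (i ⊗ Z)) ⊗ K ⊜ k ⊗ k ⊗ (K ⊗ i) ⊗ Z) refl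

  ring₁₁₇ : ∀ w A h X v Y → w + (A - (w - w * h) + (X + (v + Y) - A)) ≡ X + (w * h + (v + Y))
  ring₁₁₇ = solve 6 (λ w A h X v Y → (w ⊕ (A ⊕ ⊝ (w ⊕ ⊝ (w ⊗ h)) ⊕ (X ⊕ (v ⊕ Y) ⊕ ⊝ A))) ⊜ (X ⊕ (w ⊗ h ⊕ (v ⊕ Y)))) refl

  ring₁₁₈ : ∀ o q → o * q + (1ℚ - o) * q ≡ q
  ring₁₁₈ = solve 2 (λ o q → (o ⊗ q ⊕ (Κ 1ℚ ⊕ ⊝ o) ⊗ q) ⊜ q) refl

  ring₁₁₉ : ∀ c a b d → c * (a + (b + d)) ≡ c * a + (c * b + c * d)
  ring₁₁₉ = solve 4 (λ c a b d → c ⊗ (a ⊕ (b ⊕ d)) ⊜ (c ⊗ a ⊕ (c ⊗ b ⊕ c ⊗ d))) refl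

  ring₁₂₀ : ∀ o d c q → o * (d * (c * q)) ≡ d * (o * (c * q))
  ring₁₂₀ = solve 4 (λ o d c q → o ⊗ (d ⊗ (c ⊗ q)) ⊜ d ⊗ (o ⊗ (c ⊗ q))) refl

  ring₁₂₁ : ∀ x w d → x * (0ℚ * w) ≡ 0ℚ * w * d
  ring₁₂₁ = solve 3 (λ x w d → x ⊗ (Κ 0ℚ ⊗ w) ⊜ Κ 0ℚ ⊗ w ⊗ d) refl

  ring₁₂₂ : ∀ S Y → S + S + (1ℚ + 1ℚ) * Y ≡ (1ℚ + 1ℚ) * (S + Y)
  ring₁₂₂ = solve 2 (λ S Y → (S ⊕ S ⊕ (Κ 1ℚ ⊕ Κ 1ℚ) ⊗ Y) ⊜ (Κ 1ℚ ⊕ Κ 1ℚ) ⊗ (S ⊕ Y)) refl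

  ring₁₂₃ : ∀ S a Y → a * S + (S + Y - (1ℚ + a) * S) ≡ Y
  ring₁₂₃ = solve 3 (λ S a Y → (a ⊗ S ⊕ (S ⊕ Y ⊕ ⊝ ((Κ 1ℚ ⊕ a) ⊗ S))) ⊜ Y) refl

  ring₁₂₄ : ∀ i Y → i * Y + Y ≡ (1ℚ + i) * Y
  ring₁₂₄ = solve 2 (λ i Y → (i ⊗ Y ⊕ Y) ⊜ (Κ 1ℚ ⊕ i) ⊗ Y) refl

  ring₁₂₅ : ∀ p q s t u v → (p * q + s * t) * (u + v) ≡ p * (q * (u * 1ℚ)) + p * (q * (v * 1ℚ)) + (s * (t * (u * 1ℚ)) + s * (t * (v * 1ℚ)))
  ring₁₂₅ = solve 6 (λ p q s t u v → (p ⊗ q ⊕ s ⊗ t) ⊗ (u ⊕ v) ⊜ (p ⊗ (q ⊗ (u ⊗ Κ 1ℚ)) ⊕ p ⊗ (q ⊗ (v ⊗ Κ 1ℚ)) ⊕ (s ⊗ (t ⊗ (u ⊗ Κ 1ℚ)) ⊕ s ⊗ (t ⊗ (v ⊗ Κ 1ℚ))))) refl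

  ring₁₂₆ : ∀ i Z → i * (i * (i * Z)) + i * (i * (i * Z)) + (i * (i * (i * Z)) + i * (i * (i * Z))) ≡ (1ℚ + 1ℚ) * (1ℚ + 1ℚ) * (i * (i * i)) * Z
  ring₁₂₆ = solve 2 (λ i Z → (i ⊗ (i ⊗ (i ⊗ Z)) ⊕ i ⊗ (i ⊗ (i ⊗ Z)) ⊕ (i ⊗ (i ⊗ (i ⊗ Z)) ⊕ i ⊗ (i ⊗ (i ⊗ Z)))) ⊜ (Κ 1ℚ ⊕ Κ 1ℚ) ⊗ (Κ 1ℚ ⊕ Κ 1ℚ) ⊗ (i ⊗ (i ⊗ i)) ⊗ Z) refl

  ring₁₂₇ : ∀ K r C q Z → K * (r * (r * (C * (q * Z)))) ≡ C * Z * (r * r * (K * q))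
  ring₁₂₇ = solve 5 (λ K r C q Z → K ⊗ (r ⊗ (r ⊗ (C ⊗ (q ⊗ Z)))) ⊜ C ⊗ Z ⊗ (r ⊗ r ⊗ (K ⊗ q))) refl

  ring₁₂₈ : ∀ n s R r K g j → n * n * s * (R * (r * r * (K * ((1ℚ + 1ℚ) * (1ℚ + 1ℚ) * (g * j * (g * j * (g * j))))))) ≡ s * (R * (r * r * (K * ((1ℚ + 1ℚ) * (1ℚ + 1ℚ) * (g * (g * g)))))) * (n * j * (n * j) * j)
  ring₁₂₈ = solve 7 (λ n s R r K g j → n ⊗ n ⊗ s ⊗ (R ⊗ (r ⊗ r ⊗ (K ⊗ ((Κ 1ℚ ⊕ Κ 1ℚ) ⊗ (Κ 1ℚ ⊕ Κ 1ℚ) ⊗ (g ⊗ j ⊗ (g ⊗ j ⊗ (g ⊗ j))))))) ⊜ s ⊗ (R ⊗ (r ⊗ r ⊗ (K ⊗ ((Κ 1ℚ ⊕ Κ 1ℚ) ⊗ (Κ 1ℚ ⊕ Κ 1ℚ) ⊗ (g ⊗ (g ⊗ g)))))) ⊗ (n ⊗ j ⊗ (n ⊗ j) ⊗ j)) refl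

  ring₁₂₉ : ∀ s R k K g j → s * (R * (k * k * (K * (g * j)))) ≡ s * (R * (k * k * (K * g))) * j
  ring₁₂₉ = solve 6 (λ s R k K g j → s ⊗ (R ⊗ (k ⊗ k ⊗ (K ⊗ (g ⊗ j)))) ⊜ s ⊗ (R ⊗ (k ⊗ k ⊗ (K ⊗ g))) ⊗ j) refl

  ring₁₃₀ : ∀ s i r t K R e → s * (t * (K * e) * R) + (1ℚ + i) * (s * (r * (t * (K * e) * R))) ≡ s * (1ℚ + (1ℚ + i) * r) * (t * K * R) * e
  ring₁₃₀ = solve 7 (λ s i r t K R e → (s ⊗ (t ⊗ (K ⊗ e) ⊗ R) ⊕ (Κ 1ℚ ⊕ i) ⊗ (s ⊗ (r ⊗ (t ⊗ (K ⊗ e) ⊗ R)))) ⊜ s ⊗ (Κ 1ℚ ⊕ (Κ 1ℚ ⊕ i) ⊗ r) ⊗ (t ⊗ K ⊗ R) ⊗ e) refl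

  ring₁₃₁ : ∀ P n s d h v i r t m ρ → P + d * (n * s) + (n * s * h + (n * s * v + (1ℚ + i) * (n * s * (r * h)))) + n * (t * s + (m + (m + ρ)))
    ≡ P + n * (s * d + (s * h + (1ℚ + i) * (s * (r * h))) + s * v + s * t + m + m + ρ)
  ring₁₃₁ = solve 11 (λ P n s d h v i r t m ρ → (P ⊕ d ⊗ (n ⊗ s) ⊕ (n ⊗ s ⊗ h ⊕ (n ⊗ s ⊗ v ⊕ (Κ 1ℚ ⊕ i) ⊗ (n ⊗ s ⊗ (r ⊗ h)))) ⊕ n ⊗ (t ⊗ s ⊕ (m ⊕ (m ⊕ ρ)))) ⊜ (P ⊕ n ⊗ (s ⊗ d ⊕ (s ⊗ h ⊕ (Κ 1ℚ ⊕ i) ⊗ (s ⊗ (r ⊗ h))) ⊕ s ⊗ v ⊕ s ⊗ t ⊕ m ⊕ m ⊕ ρ))) refl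

  ring₁₃₂ : ∀ h → h + h + h + h + h + h + h + h ≡ (1ℚ + 1ℚ) * (1ℚ + 1ℚ) * (1ℚ + 1ℚ) * h
  ring₁₃₂ = solve 1 (λ h → (h ⊕ h ⊕ h ⊕ h ⊕ h ⊕ h ⊕ h ⊕ h) ⊜ (Κ 1ℚ ⊕ Κ 1ℚ) ⊗ (Κ 1ℚ ⊕ Κ 1ℚ) ⊗ (Κ 1ℚ ⊕ Κ 1ℚ) ⊗ h) refl

-- Rational arithmetic: order, inverses, finite sums and products, positive parts.

module Rationals where
  open import Data.Rational
  open import Data.Rational.Properties
  open RingIdentities

  2ℚ : ℚ
  2ℚ = 1ℚ + 1ℚ

  ≤-by : ∀ {a b} c → 0ℚ ≤ c → a + c ≡ b → a ≤ b
  ≤-by {a} c 0≤c refl = subst (_≤ a + c) (+-identityʳ a) (+-monoʳ-≤ a 0≤c)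

  0≤-diff : ∀ {a b} → a ≤ b → 0ℚ ≤ b - a
  0≤-diff {a} {b} a≤b = subst (_≤ b - a) (+-inverseʳ a) (+-monoˡ-≤ (- a) a≤b)

  diff-0≤ : ∀ {a b} → 0ℚ ≤ b - a → a ≤ b
  diff-0≤ {a} {b} h = ≤-by (b - a) h (ring₁ a b)

  0≤+ : ∀ {a b} → 0ℚ ≤ a → 0ℚ ≤ b → 0ℚ ≤ a + b
  0≤+ = +-mono-≤

  0≤* : ∀ {a b} → 0ℚ ≤ a → 0ℚ ≤ b → 0ℚ ≤ a * b
  0≤* {a} {b} 0≤a 0≤b =
    nonNegative⁻¹ (a * b) {{nonNeg*nonNeg⇒nonNeg a {{nonNegative 0≤a}} b {{nonNegative 0≤b}}}}

  0<* : ∀ {a b} → 0ℚ < a → 0ℚ < b → 0ℚ < a * b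
  0<* {a} {b} 0<a 0<b = positive⁻¹ (a * b) {{pos*pos⇒pos a {{positive 0<a}} b {{positive 0<b}}}}

  *-monoˡ : ∀ {a b c} → 0ℚ ≤ c → a ≤ b → c * a ≤ c * b
  *-monoˡ {c = c} 0≤c = *-monoˡ-≤-nonNeg c {{nonNegative 0≤c}}

  *-monoʳ : ∀ {a b c} → 0ℚ ≤ c → a ≤ b → a * c ≤ b * c
  *-monoʳ {c = c} 0≤c = *-monoʳ-≤-nonNeg c {{nonNegative 0≤c}}

  *-mono : ∀ {a b c d} → 0ℚ ≤ c → 0ℚ ≤ b → a ≤ b → c ≤ d → a * c ≤ b * d
  *-mono 0≤c 0≤b a≤b c≤d = ≤-trans (*-monoʳ 0≤c a≤b) (*-monoˡ 0≤b c≤d)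

  *-cancelˡ : ∀ {a b c} → 0ℚ < c → c * a ≤ c * b → a ≤ b
  *-cancelˡ {c = c} 0<c = *-cancelˡ-≤-pos c {{positive 0<c}}

  neg-mono : ∀ {a b} → a ≤ b → - b ≤ - a
  neg-mono = neg-antimono-≤

  -‿mono : ∀ {a b c d} → a ≤ b → c ≤ d → a - d ≤ b - c
  -‿mono a≤b c≤d = +-mono-≤ a≤b (neg-mono c≤d)

  0≤1 : 0ℚ ≤ 1ℚ
  0≤1 = *≤* (ℤ.+≤+ ℕ.z≤n)

  0<1 : 0ℚ < 1ℚ
  0<1 = *<* (ℤ.+<+ (ℕ.s≤s ℕ.z≤n))

  0≤2 : 0ℚ ≤ 2ℚ
  0≤2 = 0≤+ 0≤1 0≤1

  ≤-≡ : ∀ {a b c} → a ≤ b → b ≡ c → a ≤ c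
  ≤-≡ h refl = h

  ≡-≤ : ∀ {a b c} → a ≡ b → b ≤ c → a ≤ c
  ≡-≤ refl h = h

  0≤x² : ∀ x → 0ℚ ≤ x * x
  0≤x² x with ≤-total 0ℚ x
  ... | inj₁ h = 0≤* h h
  ... | inj₂ h = ≤-≡ (0≤* (neg-mono h) (neg-mono h)) (ring₂ x)

  -- Total, with value 0 at 0, so that terms carry no proofs of non-vanishing; an empty pair of
  -- cells gets density 0.
  inv : ℚ → ℚ
  inv p with p ≟ 0ℚ
  ... | yes _ = 0ℚ
  ... | no p≢0 = (1/ p) {{≢-nonZero p≢0}}

  inv-* : ∀ {p} → 0ℚ < p → inv p * p ≡ 1ℚ
  inv-* {p} 0<p with p ≟ 0ℚ
  ... | yes refl = ⊥-elim (<-irrefl refl 0<p)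
  ... | no p≢0 = *-inverseˡ p {{≢-nonZero p≢0}}

  0<inv : ∀ {p} → 0ℚ < p → 0ℚ < inv p
  0<inv {p} 0<p with <-cmp 0ℚ (inv p)
  ... | tri< h _ _ = h
  ... | tri≈ _ z _ = ⊥-elim (<-irrefl (trans (sym (*-zeroˡ p)) (trans (cong (_* p) z) (inv-* 0<p))) 0<1)
  ... | tri> _ _ h = ⊥-elim (<-irrefl refl (<-≤-trans 0<1 (≡-≤ (sym (inv-* 0<p))
          (≤-≡ (*-monoʳ (<⇒≤ 0<p) (<⇒≤ h)) (*-zeroˡ p)))))

  opaque
    ι : ℕ → ℚ
    ι = ℕtoℚ

    ι≡ℕtoℚ : ∀ m → ι m ≡ ℕtoℚ m
    ι≡ℕtoℚ m = refl

    ι-0 : ι 0 ≡ 0ℚ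
    ι-0 = refl

    ι-1 : ι 1 ≡ 1ℚ
    ι-1 = refl

    ι-mkℚ : ∀ m → ι m ≡ mkℚ (ℤ.+ m) 0 (ℕ.sym (ℕ.1-coprimeTo m))
    ι-mkℚ m = normalize-coprime (ℕ.sym (ℕ.1-coprimeTo m))

    ι-+ : ∀ m n → ι (m ℕ.+ n) ≡ ι m + ι n
    ι-+ m n rewrite ι-mkℚ m | ι-mkℚ n = cong (_/ 1) (cong₂ ℤ._+_ (sym (ℤ.*-identityʳ (ℤ.+ m))) (sym (ℤ.*-identityʳ (ℤ.+ n))))

    ι-* : ∀ m n → ι (m ℕ.* n) ≡ ι m * ι n
    ι-* m n rewrite ι-mkℚ m | ι-mkℚ n = cong (_/ 1) (ℤ.pos-* m n)

    0≤ι : ∀ m → 0ℚ ≤ ι m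
    0≤ι m rewrite ι-mkℚ m = *≤* (subst₂ ℤ._≤_ refl (sym (ℤ.*-identityʳ (ℤ.+ m))) (ℤ.+≤+ ℕ.z≤n))

  ι-suc : ∀ m → ι (ℕ.suc m) ≡ 1ℚ + ι m
  ι-suc m = trans (ι-+ 1 m) (cong (_+ ι m) ι-1)

  ι-mono : ∀ {m n} → m ℕ.≤ n → ι m ≤ ι n
  ι-mono {m} {n} m≤n with ℕ.m≤n⇒∃[o]m+o≡n m≤n
  ... | o , refl = ≤-by (ι o) (0≤ι o) (sym (ι-+ m o))

  0<ι : ∀ m → 0ℚ < ι (ℕ.suc m)
  0<ι m = <-≤-trans 0<1 (≤-by (ι m) (0≤ι m) (sym (ι-suc m)))

  ι-cancel : ∀ {m n} → ι m ≤ ι n → m ℕ.≤ n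
  ι-cancel {m} {n} h with m ℕ.≤? n
  ... | yes p = p
  ... | no ¬p = ⊥-elim (<-irrefl refl (<-≤-trans 0<1 (≤-trans (≤-by (ι o) (0≤ι o) refl) 1+o≤0)))
    where
    n<m = ℕ.≰⇒> ¬p
    o = proj₁ (ℕ.m≤n⇒∃[o]m+o≡n n<m)
    eq : ι m ≡ 1ℚ + (ι n + ι o)
    eq = trans (cong ι (sym (proj₂ (ℕ.m≤n⇒∃[o]m+o≡n n<m)))) (trans (ι-suc (n ℕ.+ o)) (cong (1ℚ +_) (ι-+ n o)))
    1+o≤0 : 1ℚ + ι o ≤ 0ℚ
    1+o≤0 = ≤-by (- (1ℚ + ι o)) (≤-≡ (0≤-diff (≡-≤ (sym eq) h)) (ring₃ (ι n) (ι o))) (trans (+-comm (1ℚ + ι o) _) (ring₄ (ι o)))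

  opaque
    unfolding ι

    archimedean : ∀ p → ∃[ m ] p ≤ ι m
    archimedean p@(mkℚ (ℤ.+ n) d _) = n , ≤-trans (≤-reflexive (sym (↥p/↧p≡p p))) (lem n d)
      where
      lem : ∀ n d → (ℤ.+ n) / ℕ.suc d ≤ ι n
      lem n d = toℚᵘ-cancel-≤ (ℚᵘ.≤-trans (ℚᵘ.≤-reflexive (toℚᵘ-fromℚᵘ (ℚᵘ.mkℚᵘ (ℤ.+ n) d)))
        (ℚᵘ.≤-trans (ℚᵘ.*≤* (ℤ.*-monoˡ-≤-nonNeg (ℤ.+ n) (ℤ.+≤+ (ℕ.s≤s ℕ.z≤n)))) (ℚᵘ.≤-reflexive (ℚᵘ.≃-sym (toℚᵘ-fromℚᵘ (ℚᵘ.mkℚᵘ (ℤ.+ n) 0))))))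
    archimedean p@(mkℚ (ℤ.-[1+ n ]) d _) = 0 , nonPositive⁻¹ p

  -- The value is 1/(1+m) for a natural number m ≥ C/δ, hence at most 1 whatever the sign of C. The
  -- chain of constants of the proof is built from this lemma.
  small : ∀ C {δ} → 0ℚ < δ → ∃[ α ] (0ℚ < α × α ≤ 1ℚ × C * α ≤ δ)
  small C {δ} 0<δ with archimedean (C * inv δ)
  ... | m , h = α , 0<α , α≤1 , Cα≤δ
    where
    s = 1ℚ + ι m
    0<s : 0ℚ < s
    0<s = <-≤-trans 0<1 (≤-by (ι m) (0≤ι m) refl)
    α = inv s
    0<α = 0<inv 0<s
    α≤1 : α ≤ 1ℚ
    α≤1 = ≤-by (α * ι m) (0≤* (<⇒≤ 0<α) (0≤ι m)) (trans (ring₅ α (ι m)) (inv-* 0<s))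
    C≤ : C ≤ δ * s
    C≤ = ≡-≤ (trans (sym (*-identityʳ C)) (trans (cong (C *_) (sym (inv-* 0<δ))) (sym (ring₆ C δ (inv δ)))))
           (*-monoˡ (<⇒≤ 0<δ) (≤-trans h (≤-by 1ℚ 0≤1 (+-comm (ι m) 1ℚ))))
    Cα≤δ : C * α ≤ δ
    Cα≤δ = ≤-≡ (*-monoʳ (<⇒≤ 0<α) C≤) (trans (ring₇ δ s α) (trans (cong (δ *_) (inv-* 0<s)) (*-identityʳ δ)))

  -- Sums, products and indicators are opaque so that unification solves
  -- ∑ xs f = ∑ ys g argument by argument.

  private variable A B : Set

  opaque
    ∑ : List A → (A → ℚ) → ℚ
    ∑ [] f = 0ℚ
    ∑ (x ∷ xs) f = f x + ∑ xs f

  syntax ∑ xs (λ x → e) = ∑[ x ∈ xs ] e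

  opaque
    unfolding ∑

    ∑-[] : (f : A → ℚ) → ∑ [] f ≡ 0ℚ
    ∑-[] f = refl

    ∑-∷ : ∀ x (xs : List A) f → ∑ (x ∷ xs) f ≡ f x + ∑ xs f
    ∑-∷ x xs f = refl

    ∑-cong∈ : ∀ (xs : List A) {f g : A → ℚ} → (∀ {x} → x ∈ xs → f x ≡ g x) → ∑ xs f ≡ ∑ xs g
    ∑-cong∈ [] h = refl
    ∑-cong∈ (x ∷ xs) h = cong₂ _+_ (h (here refl)) (∑-cong∈ xs (h ∘ there))

    ∑-cong : ∀ (xs : List A) {f g : A → ℚ} → (∀ x → f x ≡ g x) → ∑ xs f ≡ ∑ xs g
    ∑-cong xs h = ∑-cong∈ xs (λ {x} _ → h x)

    ∑-mono∈ : ∀ (xs : List A) {f g : A → ℚ} → (∀ {x} → x ∈ xs → f x ≤ g x) → ∑ xs f ≤ ∑ xs g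
    ∑-mono∈ [] h = ≤-refl
    ∑-mono∈ (x ∷ xs) h = +-mono-≤ (h (here refl)) (∑-mono∈ xs (h ∘ there))

    ∑-mono : ∀ (xs : List A) {f g : A → ℚ} → (∀ x → f x ≤ g x) → ∑ xs f ≤ ∑ xs g
    ∑-mono xs h = ∑-mono∈ xs (λ {x} _ → h x)

    ∑-0 : ∀ (xs : List A) → ∑ xs (λ _ → 0ℚ) ≡ 0ℚ
    ∑-0 [] = refl
    ∑-0 (x ∷ xs) = trans (+-identityˡ _) (∑-0 xs)

    0≤∑∈ : ∀ (xs : List A) {f : A → ℚ} → (∀ {x} → x ∈ xs → 0ℚ ≤ f x) → 0ℚ ≤ ∑ xs f
    0≤∑∈ xs h = ≡-≤ (sym (∑-0 xs)) (∑-mono∈ xs h)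

    0≤∑ : ∀ (xs : List A) {f : A → ℚ} → (∀ x → 0ℚ ≤ f x) → 0ℚ ≤ ∑ xs f
    0≤∑ xs h = 0≤∑∈ xs (λ {x} _ → h x)


    ∑-+ : ∀ (xs : List A) f g → ∑[ x ∈ xs ] (f x + g x) ≡ ∑ xs f + ∑ xs g
    ∑-+ [] f g = refl
    ∑-+ (x ∷ xs) f g = trans (cong (f x + g x +_) (∑-+ xs f g)) (ring₈ (f x) (g x) _ _)

    ∑-*ˡ : ∀ (xs : List A) c f → ∑[ x ∈ xs ] (c * f x) ≡ c * ∑ xs f
    ∑-*ˡ [] c f = sym (*-zeroʳ c)
    ∑-*ˡ (x ∷ xs) c f = trans (cong (c * f x +_) (∑-*ˡ xs c f)) (sym (*-distribˡ-+ c (f x) _))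

    ∑-*ʳ : ∀ (xs : List A) c f → ∑[ x ∈ xs ] (f x * c) ≡ ∑ xs f * c
    ∑-*ʳ xs c f = trans (∑-cong xs (λ x → *-comm (f x) c)) (trans (∑-*ˡ xs c f) (*-comm c _))

    ∑-neg : ∀ (xs : List A) f → ∑[ x ∈ xs ] (- f x) ≡ - ∑ xs f
    ∑-neg [] f = refl
    ∑-neg (x ∷ xs) f = trans (cong (- f x +_) (∑-neg xs f)) (sym (neg-distrib-+ (f x) _))

    ∑-- : ∀ (xs : List A) f g → ∑[ x ∈ xs ] (f x - g x) ≡ ∑ xs f - ∑ xs g
    ∑-- xs f g = trans (∑-+ xs f (λ x → - g x)) (cong (∑ xs f +_) (∑-neg xs g))

    ∑-const : ∀ (xs : List A) c → ∑[ x ∈ xs ] c ≡ ι (length xs) * c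
    ∑-const [] c = sym (trans (cong (_* c) ι-0) (*-zeroˡ c))
    ∑-const (x ∷ xs) c = trans (cong (c +_) (∑-const xs c)) (trans (ring₉ c (ι (length xs))) (cong (_* c) (sym (ι-suc (length xs)))))

    ∑-1 : ∀ (xs : List A) → ∑[ x ∈ xs ] 1ℚ ≡ ι (length xs)
    ∑-1 xs = trans (∑-const xs 1ℚ) (*-identityʳ _)

    ∑-swap : ∀ (xs : List A) (ys : List B) (f : A → B → ℚ) →
      ∑[ x ∈ xs ] ∑[ y ∈ ys ] f x y ≡ ∑[ y ∈ ys ] ∑[ x ∈ xs ] f x y
    ∑-swap [] ys f = sym (∑-0 ys)
    ∑-swap (x ∷ xs) ys f = trans (cong (∑ ys (f x) +_) (∑-swap xs ys f)) (sym (∑-+ ys (f x) _))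

    ∑-++ : ∀ (xs ys : List A) f → ∑ (xs ++ ys) f ≡ ∑ xs f + ∑ ys f
    ∑-++ [] ys f = sym (+-identityˡ _)
    ∑-++ (x ∷ xs) ys f = trans (cong (f x +_) (∑-++ xs ys f)) (sym (+-assoc (f x) _ _))

    ∑-map : ∀ (g : A → B) xs f → ∑ (map g xs) f ≡ ∑ xs (f ∘ g)
    ∑-map g [] f = refl
    ∑-map g (x ∷ xs) f = cong (f (g x) +_) (∑-map g xs f)

    ∑-concatMap : ∀ (g : A → List B) xs f → ∑ (concatMap g xs) f ≡ ∑[ x ∈ xs ] ∑ (g x) f
    ∑-concatMap g [] f = refl
    ∑-concatMap g (x ∷ xs) f = trans (∑-++ (g x) (concatMap g xs) f) (cong (∑ (g x) f +_) (∑-concatMap g xs f))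

    term≤∑ : ∀ {xs : List A} {f : A → ℚ} → (∀ {x} → x ∈ xs → 0ℚ ≤ f x) → ∀ {x} → x ∈ xs → f x ≤ ∑ xs f
    term≤∑ {xs = x ∷ xs} h (here refl) = ≤-by _ (0≤∑∈ xs (h ∘ there)) refl
    term≤∑ {xs = y ∷ xs} {f} h (there x∈) = ≤-trans (term≤∑ (h ∘ there) x∈) (≤-by (f y) (h (here refl)) (+-comm (∑ xs f) (f y)))

    -- If `g x < B` held at every term of positive weight, the non-negative terms `p x * (B - g x)`
    -- would sum to at most 0, which forces all weights to vanish. Positivity of the chosen weight
    -- is recorded because it later certifies that a chosen edge is alive.
    ∑-pick : ∀ (xs : List A) (p g : A → ℚ) B → (∀ {x} → x ∈ xs → 0ℚ ≤ p x) → 0ℚ < ∑ xs p →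
      ∑ xs p * B ≤ ∑[ x ∈ xs ] (p x * g x) → ∃[ x ] (x ∈ xs × 0ℚ < p x × B ≤ g x)
    ∑-pick xs p g B 0≤p 0<s h with go xs 0≤p
      where
      go : ∀ xs → (∀ {x} → x ∈ xs → 0ℚ ≤ p x) →
        (∃[ x ] (x ∈ xs × 0ℚ < p x × B ≤ g x)) ⊎ (∀ {x} → x ∈ xs → p x ≡ 0ℚ ⊎ g x < B)
      go [] _ = inj₂ (λ ())
      go (x ∷ xs) nn with go xs (nn ∘ there) | p x ≟ 0ℚ | B ≤? g x
      ... | inj₁ (y , y∈ , r) | _ | _ = inj₁ (y , there y∈ , r)
      ... | inj₂ k | yes z | _ = inj₂ (λ { (here refl) → inj₁ z ; (there m) → k m })
      ... | inj₂ k | no ≢0 | no ¬b = inj₂ (λ { (here refl) → inj₂ (≰⇒> ¬b) ; (there m) → k m })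
      ... | inj₂ k | no ≢0 | yes b with 0ℚ <? p x
      ...   | yes pos = inj₁ (x , here refl , pos , b)
      ...   | no ¬pos = ⊥-elim (≢0 (≤-antisym (≮⇒≥ ¬pos) (nn (here refl))))
    ... | inj₁ r = r
    ... | inj₂ k = ⊥-elim (<-irrefl refl (<-≤-trans 0<s (≤-reflexive (all0 xs (λ m → m)))))
      where
      nn : ∀ {x} → x ∈ xs → 0ℚ ≤ p x * (B - g x)
      nn {x} m with k m
      ... | inj₁ z rewrite z = ≤-reflexive (sym (*-zeroˡ (B - g x)))
      ... | inj₂ lt = 0≤* (0≤p m) (0≤-diff (<⇒≤ lt))
      total : ∑[ x ∈ xs ] (p x * (B - g x)) ≤ 0ℚ
      total = ≡-≤ (trans (∑-cong xs (λ x → ring₁₀ (p x) B (g x))) (trans (∑-- xs (λ x → p x * B) (λ x → p x * g x)) (cong (_- ∑[ x ∈ xs ] (p x * g x)) (∑-*ʳ xs B p))))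
        (≤-≡ (-‿mono h (≤-refl {∑[ x ∈ xs ] (p x * g x)})) (+-inverseʳ (∑[ x ∈ xs ] (p x * g x))))
      zero-term : ∀ {x} → x ∈ xs → p x * (B - g x) ≤ 0ℚ
      zero-term m = ≤-trans (term≤∑ nn m) total
      p0 : ∀ {x} → x ∈ xs → p x ≡ 0ℚ
      p0 {x} m with k m
      ... | inj₁ z = z
      ... | inj₂ lt with 0ℚ <? p x
      ...   | no ¬pos = ≤-antisym (≮⇒≥ ¬pos) (0≤p m)
      ...   | yes pos = ⊥-elim (<-irrefl refl (<-≤-trans (0<* pos (≤∧≢⇒<′ lt)) (zero-term m)))
        where
        ≤∧≢⇒<′ : g x < B → 0ℚ < B - g x
        ≤∧≢⇒<′ lt = subst (_< B - g x) (+-inverseʳ (g x)) (+-monoˡ-< (- g x) lt)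
      all0 : ∀ ys → (∀ {x} → x ∈ ys → x ∈ xs) → ∑ ys p ≡ 0ℚ
      all0 [] _ = refl
      all0 (y ∷ ys) s = trans (cong₂ _+_ (p0 (s (here refl))) (all0 ys (s ∘ there))) (+-identityˡ 0ℚ)

  opaque
    ⟦_⟧ : Bool → ℚ
    ⟦ true ⟧ = 1ℚ
    ⟦ false ⟧ = 0ℚ

    ⟦true⟧ : ⟦ true ⟧ ≡ 1ℚ
    ⟦true⟧ = refl

    ⟦false⟧ : ⟦ false ⟧ ≡ 0ℚ
    ⟦false⟧ = refl

    0≤⟦⟧ : ∀ b → 0ℚ ≤ ⟦ b ⟧
    0≤⟦⟧ true = 0≤1
    0≤⟦⟧ false = ≤-refl

    ⟦⟧≤1 : ∀ b → ⟦ b ⟧ ≤ 1ℚ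
    ⟦⟧≤1 true = ≤-refl
    ⟦⟧≤1 false = 0≤1

    ⟦∧⟧ : ∀ a b → ⟦ a ∧ b ⟧ ≡ ⟦ a ⟧ * ⟦ b ⟧
    ⟦∧⟧ true b = sym (*-identityˡ _)
    ⟦∧⟧ false b = sym (*-zeroˡ ⟦ b ⟧)

    ⟦not⟧ : ∀ b → ⟦ not b ⟧ ≡ 1ℚ - ⟦ b ⟧
    ⟦not⟧ true = refl
    ⟦not⟧ false = refl

  ⟦_⟧ᵈ : {P : Set} → Dec P → ℚ
  ⟦ d ⟧ᵈ = ⟦ does d ⟧

  opaque
    unfolding ⟦_⟧

    ⟦⟧ᵈ-yes : ∀ {P : Set} (d : Dec P) → P → ⟦ d ⟧ᵈ ≡ 1ℚ
    ⟦⟧ᵈ-yes (yes _) p = refl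
    ⟦⟧ᵈ-yes (no ¬p) p = ⊥-elim (¬p p)

    ⟦⟧ᵈ-no : ∀ {P : Set} (d : Dec P) → ¬ P → ⟦ d ⟧ᵈ ≡ 0ℚ
    ⟦⟧ᵈ-no (yes p) ¬p = ⊥-elim (¬p p)
    ⟦⟧ᵈ-no (no _) _ = refl

    ⟦⟧ᵈ-≤ : ∀ {P Q : Set} (d : Dec P) (e : Dec Q) → (P → Q) → ⟦ d ⟧ᵈ ≤ ⟦ e ⟧ᵈ
    ⟦⟧ᵈ-≤ (yes p) e f = ≤-reflexive (sym (⟦⟧ᵈ-yes e (f p)))
    ⟦⟧ᵈ-≤ (no _) e f = 0≤⟦⟧ (does e)

    ⟦⟧ᵈ-cong : ∀ {P Q : Set} (d : Dec P) (e : Dec Q) → (P → Q) → (Q → P) → ⟦ d ⟧ᵈ ≡ ⟦ e ⟧ᵈ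
    ⟦⟧ᵈ-cong d e f g = ≤-antisym (⟦⟧ᵈ-≤ d e f) (⟦⟧ᵈ-≤ e d g)

    ⟦⟧ᵈ-subst : ∀ {x y : A} (d : Dec (x ≡ y)) (f : A → ℚ) → ⟦ d ⟧ᵈ * f x ≡ ⟦ d ⟧ᵈ * f y
    ⟦⟧ᵈ-subst (yes refl) f = refl
    ⟦⟧ᵈ-subst {x = x} {y} (no _) f = trans (*-zeroˡ (f x)) (sym (*-zeroˡ (f y)))

  opaque
    unfolding ∑ ⟦_⟧

    ∑-filter : ∀ {P : U.Pred A 0ℓ} (P? : U.Decidable P) xs f → ∑ (filter P? xs) f ≡ ∑[ x ∈ xs ] (⟦ P? x ⟧ᵈ * f x)
    ∑-filter P? [] f = refl
    ∑-filter P? (x ∷ xs) f with P? x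
    ... | yes _ = cong₂ _+_ (sym (*-identityˡ (f x))) (∑-filter P? xs f)
    ... | no _ = trans (∑-filter P? xs f) (trans (sym (+-identityˡ _)) (cong (_+ _) (sym (*-zeroˡ (f x)))))

  opaque
    unfolding ∑ ⟦_⟧

    ∑-tabulate : ∀ {n} (g : Fin n → A) f → ∑ (tabulate g) f ≡ ∑ (allFin n) (f ∘ g)
    ∑-tabulate {n = ℕ.zero} g f = refl
    ∑-tabulate {n = ℕ.suc n} g f = cong (f (g zero) +_) (trans (∑-tabulate (g ∘ suc) f) (sym (∑-tabulate suc (f ∘ g))))

    ∑-suc : ∀ {n} (f : Fin (ℕ.suc n) → ℚ) → ∑ (allFin (ℕ.suc n)) f ≡ f zero + ∑ (allFin n) (f ∘ suc)
    ∑-suc f = cong (f zero +_) (∑-tabulate suc f)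

    ∑-δ : ∀ {n} (a : Fin n) (f : Fin n → ℚ) → ∑[ b ∈ allFin n ] (⟦ a Fin.≟ b ⟧ᵈ * f b) ≡ f a
    ∑-δ {ℕ.suc n} zero f = trans (∑-suc (λ b → ⟦ zero Fin.≟ b ⟧ᵈ * f b))
      (trans (cong₂ _+_ (*-identityˡ (f zero)) (trans (∑-cong (allFin n) (λ b → *-zeroˡ (f (suc b)))) (∑-0 (allFin n)))) (+-identityʳ _))
    ∑-δ {ℕ.suc n} (suc a) f = trans (∑-suc (λ b → ⟦ suc a Fin.≟ b ⟧ᵈ * f b))
      (trans (cong₂ _+_ (*-zeroˡ (f zero)) (trans (∑-cong (allFin n) (λ b → cong (_* f (suc b)) (⟦⟧ᵈ-cong (suc a Fin.≟ suc b) (a Fin.≟ b) Fin.suc-injective (cong suc)))) (∑-δ a (f ∘ suc)))) (+-identityˡ _))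

  length-allFin : ∀ n → length (allFin n) ≡ n
  length-allFin n = Data.List.Properties.length-tabulate {n = n} (λ i → i)
    where import Data.List.Properties

  opaque
    ∏ : List A → (A → ℚ) → ℚ
    ∏ [] f = 1ℚ
    ∏ (x ∷ xs) f = f x * ∏ xs f

  syntax ∏ xs (λ x → e) = ∏[ x ∈ xs ] e

  opaque
    unfolding ∏

    ∏-[] : (f : A → ℚ) → ∏ [] f ≡ 1ℚ
    ∏-[] f = refl

    ∏-∷ : ∀ x (xs : List A) f → ∏ (x ∷ xs) f ≡ f x * ∏ xs f
    ∏-∷ x xs f = refl

    ∏-1 : ∀ (xs : List A) → ∏[ x ∈ xs ] 1ℚ ≡ 1ℚ
    ∏-1 [] = refl
    ∏-1 (x ∷ xs) = trans (*-identityˡ _) (∏-1 xs)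

    ∏-cong : ∀ (xs : List A) {f g : A → ℚ} → (∀ x → f x ≡ g x) → ∏ xs f ≡ ∏ xs g
    ∏-cong [] h = refl
    ∏-cong (x ∷ xs) h = cong₂ _*_ (h x) (∏-cong xs h)

    0≤∏ : ∀ (xs : List A) {f : A → ℚ} → (∀ x → 0ℚ ≤ f x) → 0ℚ ≤ ∏ xs f
    0≤∏ [] h = 0≤1
    0≤∏ (x ∷ xs) h = 0≤* (h x) (0≤∏ xs h)

    0<∏ : ∀ (xs : List A) {f : A → ℚ} → (∀ x → 0ℚ < f x) → 0ℚ < ∏ xs f
    0<∏ [] h = 0<1
    0<∏ (x ∷ xs) h = 0<* (h x) (0<∏ xs h)

    ∏-mono : ∀ (xs : List A) {f g : A → ℚ} → (∀ x → 0ℚ ≤ f x) → (∀ x → f x ≤ g x) → ∏ xs f ≤ ∏ xs g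
    ∏-mono [] h k = ≤-refl
    ∏-mono (x ∷ xs) h k = *-mono (0≤∏ xs h) (≤-trans (h x) (k x)) (k x) (∏-mono xs h k)

    ∏-* : ∀ (xs : List A) f g → ∏[ x ∈ xs ] (f x * g x) ≡ ∏ xs f * ∏ xs g
    ∏-* [] f g = sym (*-identityˡ 1ℚ)
    ∏-* (x ∷ xs) f g = trans (cong (f x * g x *_) (∏-* xs f g)) (ring₁₁ (f x) (g x) _ _)

    ∏-tabulate : ∀ {n} (g : Fin n → A) f → ∏ (tabulate g) f ≡ ∏ (allFin n) (f ∘ g)
    ∏-tabulate {n = ℕ.zero} g f = refl
    ∏-tabulate {n = ℕ.suc n} g f = cong (f (g zero) *_) (trans (∏-tabulate (g ∘ suc) f) (sym (∏-tabulate suc (f ∘ g))))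

    ∏-suc : ∀ {n} (f : Fin (ℕ.suc n) → ℚ) → ∏ (allFin (ℕ.suc n)) f ≡ f zero * ∏ (allFin n) (f ∘ suc)
    ∏-suc f = cong (f zero *_) (∏-tabulate suc f)

  _^_ : ℚ → ℕ → ℚ
  x ^ ℕ.zero = 1ℚ
  x ^ ℕ.suc n = x * x ^ n

  infixr 8 _^_

  0≤^ : ∀ {x} n → 0ℚ ≤ x → 0ℚ ≤ x ^ n
  0≤^ ℕ.zero h = 0≤1
  0≤^ (ℕ.suc n) h = 0≤* h (0≤^ n h)

  0<^ : ∀ {x} n → 0ℚ < x → 0ℚ < x ^ n
  0<^ ℕ.zero h = 0<1
  0<^ (ℕ.suc n) h = 0<* h (0<^ n h)

  ^-mono : ∀ {x y} n → 0ℚ ≤ x → x ≤ y → x ^ n ≤ y ^ n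
  ^-mono ℕ.zero _ _ = ≤-refl
  ^-mono (ℕ.suc n) 0≤x x≤y = *-mono (0≤^ n 0≤x) (≤-trans 0≤x x≤y) x≤y (^-mono n 0≤x x≤y)

  1≤^ : ∀ {x} n → 1ℚ ≤ x → 1ℚ ≤ x ^ n
  1≤^ ℕ.zero _ = ≤-refl
  1≤^ (ℕ.suc n) h = ≤-trans (≤-reflexive (sym (*-identityˡ 1ℚ))) (*-mono 0≤1 (≤-trans 0≤1 h) h (1≤^ n h))

  infix 9 _⁺

  opaque
    _⁺ : ℚ → ℚ
    x ⁺ = x ⊔ 0ℚ

    0≤⁺ : ∀ x → 0ℚ ≤ x ⁺
    0≤⁺ x = p≤q⊔p x 0ℚ

    x≤⁺ : ∀ x → x ≤ x ⁺
    x≤⁺ x = p≤p⊔q x 0ℚ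

    ⁺-lub : ∀ {x y} → x ≤ y → 0ℚ ≤ y → x ⁺ ≤ y
    ⁺-lub = ⊔-lub

    ⁺-0≤ : ∀ {x} → 0ℚ ≤ x → x ⁺ ≡ x
    ⁺-0≤ = p≥q⇒p⊔q≡p

    ⁺-≤0 : ∀ {x} → x ≤ 0ℚ → x ⁺ ≡ 0ℚ
    ⁺-≤0 = p≤q⇒p⊔q≡q


  ⁺-cases : ∀ x → (0ℚ ≤ x × x ⁺ ≡ x) ⊎ (x ≤ 0ℚ × x ⁺ ≡ 0ℚ)
  ⁺-cases x with ≤-total 0ℚ x
  ... | inj₁ h = inj₁ (h , ⁺-0≤ h)
  ... | inj₂ h = inj₂ (h , ⁺-≤0 h)

  ⁺-* : ∀ x → x ⁺ * x ≡ x ⁺ * x ⁺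
  ⁺-* x with ⁺-cases x
  ... | inj₁ (_ , e) = cong (x ⁺ *_) (sym e)
  ... | inj₂ (_ , e) rewrite e = trans (*-zeroˡ x) (sym (*-zeroˡ 0ℚ))

  -- The square of the positive part lies below the parabola that touches it at `y`. This allows a
  -- second-moment recursion without derivatives.
  ⁺-² : ∀ y d → (y - d) ⁺ * (y - d) ⁺ ≤ (y ⁺ - d) * (y ⁺ - d)
  ⁺-² y d with ⁺-cases (y - d)
  ... | inj₁ (h , e) rewrite e = *-mono h (≤-trans h k) k k
    where
    k : y - d ≤ y ⁺ - d
    k = +-monoˡ-≤ (- d) (x≤⁺ y)
  ... | inj₂ (_ , e) rewrite e = ≡-≤ (*-zeroˡ 0ℚ) (0≤x² (y ⁺ - d))

  -- Both sides are the maximum of `a` and `b`.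
  ⁺-flip : ∀ a b → a + (b - a) ⁺ ≡ b + (a - b) ⁺
  ⁺-flip a b = go (⁺-cases (b - a))
    where
    go : (0ℚ ≤ b - a × (b - a) ⁺ ≡ b - a) ⊎ (b - a ≤ 0ℚ × (b - a) ⁺ ≡ 0ℚ) → a + (b - a) ⁺ ≡ b + (a - b) ⁺
    go (inj₁ (h , e)) = trans (cong (a +_) e) (trans (ring₁₃ a b) (cong (b +_) (sym (⁺-≤0 {a - b} (≡-≤ (sym (ring₁₂ a b)) (neg-mono h))))))
    go (inj₂ (h , e)) = trans (cong (a +_) e) (trans (ring₁₄ a b) (cong (b +_) (sym (⁺-0≤ {a - b} (≤-≡ (neg-mono h) (ring₁₂ a b))))))

-- The random greedy process on a weighted hypergraph.

module Nibble where
  open import Data.Rational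
  open import Data.Rational.Properties
  open RingIdentities
  open Rationals

  ≢ᶠ : ∀ {n} → Fin n → Fin n → ℚ
  ≢ᶠ j l = ⟦ not (does (j Fin.≟ l)) ⟧

  ≢ᶠ-≡ : ∀ {n} (j l : Fin n) → ≢ᶠ j l ≡ 1ℚ - ⟦ j Fin.≟ l ⟧ᵈ
  ≢ᶠ-≡ j l = ⟦not⟧ (does (j Fin.≟ l))

  0≤≢ᶠ : ∀ {n} (j l : Fin n) → 0ℚ ≤ ≢ᶠ j l
  0≤≢ᶠ j l = 0≤⟦⟧ _

  ≢ᶠ-suc : ∀ {n} (j l : Fin n) → ≢ᶠ (suc j) (suc l) ≡ ≢ᶠ j l
  ≢ᶠ-suc j l = trans (≢ᶠ-≡ (suc j) (suc l)) (trans (cong (λ z → 1ℚ - z)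
    (⟦⟧ᵈ-cong (suc j Fin.≟ suc l) (j Fin.≟ l) Fin.suc-injective (cong suc))) (sym (≢ᶠ-≡ j l)))

  ∑-≢ᶠ : ∀ {n} (j : Fin (ℕ.suc n)) → ∑[ l ∈ allFin (ℕ.suc n) ] ≢ᶠ j l ≡ ι n
  ∑-≢ᶠ {n} j = trans (∑-cong (allFin (ℕ.suc n)) (≢ᶠ-≡ j))
    (trans (∑-- (allFin (ℕ.suc n)) (λ _ → 1ℚ) (λ l → ⟦ j Fin.≟ l ⟧ᵈ))
    (trans (cong₂ _-_ (trans (∑-1 (allFin (ℕ.suc n))) (trans (cong ι (length-allFin (ℕ.suc n))) (ι-suc n)))
      (trans (∑-cong (allFin (ℕ.suc n)) (λ l → sym (*-identityʳ ⟦ j Fin.≟ l ⟧ᵈ))) (∑-δ j (λ _ → 1ℚ))))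
    (ring₁₅ (ι n))))

  -- Setting one factor to 1 yields the product over the other indices without dividing by a factor
  -- that may be 0.
  except : ∀ {n} → Fin n → (Fin n → ℚ) → Fin n → ℚ
  except j f l = if does (j Fin.≟ l) then 1ℚ else f l

  0≤except : ∀ {n} (j : Fin n) {f : Fin n → ℚ} → (∀ l → 0ℚ ≤ f l) → ∀ l → 0ℚ ≤ except j f l
  0≤except j h l with does (j Fin.≟ l)
  ... | true = 0≤1
  ... | false = h l

  ∏-except : ∀ {n} (j : Fin n) f → ∏ (allFin n) f ≡ f j * ∏ (allFin n) (except j f)
  ∏-except {ℕ.suc n} zero f = trans (∏-suc f) (cong (f zero *_)
    (sym (trans (∏-suc (except zero f)) (*-identityˡ _))))
  ∏-except {ℕ.suc n} (suc j) f = trans (∏-suc f) (trans (cong (f zero *_) (∏-except j (f ∘ suc)))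
    (trans (ring₁₆ (f zero) (f (suc j)) _)
    (cong (f (suc j) *_) (sym (trans (∏-suc (except (suc j) f)) (cong (f zero *_) (∏-cong (allFin n) same)))))))
    where
    same : ∀ l → except (suc j) f (suc l) ≡ except j (f ∘ suc) l
    same l with j Fin.≟ l
    ... | yes _ = refl
    ... | no _ = refl

  -- In the second-moment recursion 8 comes from the cross term and 4 from the term linear in the
  -- loss.
  12ℚ : ℚ
  12ℚ = 2ℚ * 2ℚ * (1ℚ + 2ℚ)

  -- Over ordered pairs, hence twice the second elementary symmetric function; in the Bonferroni
  -- bound this costs only a constant.
  pairs : ∀ {n} → (Fin n → ℚ) → ℚ
  pairs {n} κ = ∑[ l ∈ allFin n ] ∑[ l′ ∈ allFin n ] (≢ᶠ l l′ * (κ l * κ l′))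

  module Bonferroni where

    ∏1-≤1 : ∀ {n} (κ : Fin n → ℚ) → (∀ l → 0ℚ ≤ κ l) → (∀ l → κ l ≤ 1ℚ) → ∏[ l ∈ allFin n ] (1ℚ - κ l) ≤ 1ℚ
    ∏1-≤1 {n} κ h₀ h₁ = ≤-trans (∏-mono (allFin n) (λ l → 0≤-diff (h₁ l)) (λ l → ≤-by (κ l) (h₀ l) (ring₁₇ (κ l))))
      (≤-reflexive (∏-1 (allFin n)))

    lower : ∀ {n} (κ : Fin n → ℚ) → (∀ l → 0ℚ ≤ κ l) → (∀ l → κ l ≤ 1ℚ) →
      1ℚ - ∑ (allFin n) κ ≤ ∏[ l ∈ allFin n ] (1ℚ - κ l)
    lower {ℕ.zero} κ _ _ = ≤-reflexive (trans (cong (λ z → 1ℚ - z) (∑-[] κ)) (sym (∏-[] (λ l → 1ℚ - κ l))))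
    lower {ℕ.suc n} κ h₀ h₁ = ≤-≡ (≡-≤ (cong (λ z → 1ℚ - z) (∑-suc κ)) step) (sym (∏-suc (λ l → 1ℚ - κ l)))
      where
      S = ∑ (allFin n) (κ ∘ suc)
      P = ∏[ l ∈ allFin n ] (1ℚ - κ (suc l))
      step : 1ℚ - (κ zero + S) ≤ (1ℚ - κ zero) * P
      step = ≤-by _ (0≤+ (0≤-diff (lower (κ ∘ suc) (h₀ ∘ suc) (h₁ ∘ suc)))
        (0≤* (h₀ zero) (0≤-diff (∏1-≤1 (κ ∘ suc) (h₀ ∘ suc) (h₁ ∘ suc))))) (ring₁₈ (κ zero) S P)

    upper : ∀ {n} (κ : Fin n → ℚ) → (∀ l → 0ℚ ≤ κ l) → (∀ l → κ l ≤ 1ℚ) →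
      ∏[ l ∈ allFin n ] (1ℚ - κ l) ≤ 1ℚ - ∑ (allFin n) κ + pairs κ
    upper {ℕ.zero} κ _ _ = ≤-reflexive (trans (∏-[] (λ l → 1ℚ - κ l)) (sym (cong₂ (λ y z → 1ℚ - y + z) (∑-[] κ)
      (∑-[] (λ l → ∑[ l′ ∈ allFin 0 ] (≢ᶠ l l′ * (κ l * κ l′)))))))
    upper {ℕ.suc n} κ h₀ h₁ = ≤-trans (≤-reflexive (∏-suc (λ l → 1ℚ - κ l)))
      (≤-trans (≤-by _ (0≤+ (0≤* (0≤-diff (h₁ zero)) (0≤-diff (upper (κ ∘ suc) (h₀ ∘ suc) (h₁ ∘ suc))))
                   (0≤+ (0≤* (h₀ zero) 0≤X) 0≤ΣX)) (ring₁₉ (κ zero) S X P Y))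
      (≤-reflexive (cong₂ (λ s p → 1ℚ - s + p) (sym (∑-suc κ)) (sym pairs-suc))))
      where
      S = ∑ (allFin n) (κ ∘ suc)
      P = ∏[ l ∈ allFin n ] (1ℚ - κ (suc l))
      X = pairs (κ ∘ suc)
      Y = ∑[ l ∈ allFin n ] (κ (suc l) * κ zero)
      0≤X : 0ℚ ≤ X
      0≤X = 0≤∑ (allFin n) (λ l → 0≤∑ (allFin n) (λ l′ → 0≤* (0≤≢ᶠ l l′) (0≤* (h₀ (suc l)) (h₀ (suc l′)))))
      0≤ΣX : 0ℚ ≤ Y
      0≤ΣX = 0≤∑ (allFin n) (λ l → 0≤* (h₀ (suc l)) (h₀ zero))
      row : ∀ l → ∑[ l′ ∈ allFin (ℕ.suc n) ] (≢ᶠ (suc l) l′ * (κ (suc l) * κ l′))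
                ≡ κ (suc l) * κ zero + ∑[ l′ ∈ allFin n ] (≢ᶠ l l′ * (κ (suc l) * κ (suc l′)))
      row l = trans (∑-suc (λ l′ → ≢ᶠ (suc l) l′ * (κ (suc l) * κ l′)))
        (cong₂ _+_ (trans (cong (_* (κ (suc l) * κ zero)) ⟦true⟧) (*-identityˡ (κ (suc l) * κ zero))) (∑-cong (allFin n) (λ l′ → cong (_* (κ (suc l) * κ (suc l′))) (≢ᶠ-suc l l′))))
      pairs-suc : pairs κ ≡ κ zero * S + (Y + X)
      pairs-suc = trans (∑-suc (λ l → ∑[ l′ ∈ allFin (ℕ.suc n) ] (≢ᶠ l l′ * (κ l * κ l′))))
        (cong₂ _+_
          (trans (∑-suc (λ l′ → ≢ᶠ {ℕ.suc n} zero l′ * (κ zero * κ l′)))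
            (trans (cong₂ _+_ (trans (cong (_* (κ zero * κ zero)) ⟦false⟧) (*-zeroˡ (κ zero * κ zero))) (trans (∑-cong (allFin n) (λ l′ → trans (cong (_* (κ zero * κ (suc l′))) ⟦true⟧) (*-identityˡ (κ zero * κ (suc l′))))) (∑-*ˡ (allFin n) (κ zero) (κ ∘ suc)))) (+-identityˡ (κ zero * S))))
          (trans (∑-cong (allFin n) row) (∑-+ (allFin n) (λ l → κ (suc l) * κ zero) (λ l → ∑[ l′ ∈ allFin n ] (≢ᶠ l l′ * (κ (suc l) * κ (suc l′)))))))

  -- `∑-δV` encodes that `vs` lists every vertex exactly once. `H-inj` speaks of listed edges only,
  -- as other elements of `I` may come from degenerate tuples.
  record WeightedHypergraph (r₁ : ℕ) : Set₁ where
    field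
      I V : Set
      _≟V_ : DecidableEquality V
      is : List I
      vs : List V
      H : I → Fin (ℕ.suc r₁) → V
      ψ : I → ℚ
      ∑-δV : ∀ v (f : V → ℚ) → ∑[ u ∈ vs ] (⟦ v ≟V u ⟧ᵈ * f u) ≡ f v
      0≤ψ : ∀ i → 0ℚ ≤ ψ i
      H-inj : ∀ {i} → i ∈ is → ∀ {j l} → H i j ≡ H i l → j ≡ l

  module Hypergraph {r₁ : ℕ} (𝓗 : WeightedHypergraph r₁) where
    open WeightedHypergraph 𝓗

    r : ℕ
    r = ℕ.suc r₁

    js : List (Fin r)
    js = allFin r

    hit : I → Fin r → V → ℚ
    hit i j v = ⟦ H i j ≟V v ⟧ᵈ

    live : (V → Bool) → I → ℚ
    live A i = ∏[ l ∈ js ] ⟦ A (H i l) ⟧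

    liveBut : (V → Bool) → I → Fin r → ℚ
    liveBut A i j = ∏ js (except j (λ l → ⟦ A (H i l) ⟧))

    -- The load of v carried by the edges all of whose other vertices are alive;
    -- v itself may be dead.
    deg : (V → Bool) → V → ℚ
    deg A v = ∑[ i ∈ is ] ∑[ j ∈ js ] (hit i j v * (ψ i * liveBut A i j))

    codeg : V → V → ℚ
    codeg u v = ∑[ i ∈ is ] ∑[ j ∈ js ] ∑[ l ∈ js ] (ψ i * (≢ᶠ j l * (hit i j u * hit i l v)))

    tot : (V → Bool) → ℚ
    tot A = ∑[ i ∈ is ] (ψ i * live A i)

    exc : (V → Bool) → ℚ → V → ℚ
    exc A q v = (deg A v - q) ⁺

    Q : (V → Bool) → ℚ → ℚ
    Q A q = ∑[ v ∈ vs ] (exc A q v * exc A q v)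

    N : ℚ
    N = ι (length vs)

    -- Relative to a live set, so that a matching found among the vertices left by a step can be
    -- extended by the edge which that step took.
    IsMatching : (V → Bool) → List I → Set
    IsMatching A P = ∀ v → ∑[ i ∈ P ] ∑[ j ∈ js ] hit i j v ≤ ⟦ A v ⟧

    module Process (α : ℚ) (0≤α : 0ℚ ≤ α) (codeg≤α : ∀ u v → codeg u v ≤ α) where

      0≤hit : ∀ i j v → 0ℚ ≤ hit i j v
      0≤hit i j v = 0≤⟦⟧ _

      0≤live : ∀ A i → 0ℚ ≤ live A i
      0≤live A i = 0≤∏ js (λ l → 0≤⟦⟧ _)

      0≤liveBut : ∀ A i j → 0ℚ ≤ liveBut A i j
      0≤liveBut A i j = 0≤∏ js (0≤except j (λ l → 0≤⟦⟧ _))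

      live-split : ∀ A i j → live A i ≡ ⟦ A (H i j) ⟧ * liveBut A i j
      live-split A i j = ∏-except j (λ l → ⟦ A (H i l) ⟧)

      live≤liveBut : ∀ A i j → live A i ≤ liveBut A i j
      live≤liveBut A i j = ≡-≤ (live-split A i j)
        (≤-≡ (*-monoʳ (0≤liveBut A i j) (⟦⟧≤1 _)) (*-identityˡ _))

      live≤1 : ∀ A i → live A i ≤ 1ℚ
      live≤1 A i = ≤-trans (∏-mono js (λ l → 0≤⟦⟧ _) (λ l → ⟦⟧≤1 _)) (≤-reflexive (∏-1 js))

      0≤deg : ∀ A v → 0ℚ ≤ deg A v
      0≤deg A v = 0≤∑ is (λ i → 0≤∑ js (λ j → 0≤* (0≤hit i j v) (0≤* (0≤ψ i) (0≤liveBut A i j))))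

      -- One step of the process: take a live edge (with weight proportional to ψ),
      -- discard a single vertex (so that every live vertex is hit at rate at least q), or
      -- do nothing.
      data Option : Set where
        edge : I → Option
        waste : V → Option
        idle : Option

      kill : Option → V → Bool
      kill (edge i) v = does (Fin.any? (λ j → H i j ≟V v))
      kill (waste w) v = does (v ≟V w)
      kill idle v = false

      κ : Option → V → ℚ
      κ o v = ⟦ kill o v ⟧

      0≤κ : ∀ o v → 0ℚ ≤ κ o v
      0≤κ o v = 0≤⟦⟧ _

      κ≤1 : ∀ o v → κ o v ≤ 1ℚ
      κ≤1 o v = ⟦⟧≤1 _

      after : (V → Bool) → Option → V → Bool
      after A o v = A v ∧ not (kill o v)

      κ-edge≤ : ∀ i v → κ (edge i) v ≤ ∑[ j ∈ js ] hit i j v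
      κ-edge≤ i v = go (Fin.any? (λ j → H i j ≟V v))
       where
       go : (d : Dec (∃[ j ] H i j ≡ v)) → ⟦ d ⟧ᵈ ≤ ∑[ j ∈ js ] hit i j v
       go (no _) = ≡-≤ ⟦false⟧ (0≤∑ js (λ j → 0≤hit i j v))
       go (yes (j , eq)) = ≡-≤ (trans ⟦true⟧ (sym (∑-δ j (λ l → 1ℚ))))
        (∑-mono js (λ l → ≡-≤ (*-identityʳ _) (⟦⟧ᵈ-≤ (j Fin.≟ l) (H i l ≟V v) (λ { refl → eq }))))

      κ-edge : ∀ {i} → i ∈ is → ∀ v → ∑[ j ∈ js ] hit i j v ≡ κ (edge i) v
      κ-edge {i} i∈ v = go (Fin.any? (λ j → H i j ≟V v))
       where
       go : (d : Dec (∃[ j ] H i j ≡ v)) → ∑[ j ∈ js ] hit i j v ≡ ⟦ d ⟧ᵈ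
       go (no ¬h) = trans (∑-cong js (λ j → ⟦⟧ᵈ-no (H i j ≟V v) (λ e → ¬h (j , e)))) (trans (∑-0 js) (sym ⟦false⟧))
       go (yes (j , eq)) = trans (∑-cong js (λ l → trans (⟦⟧ᵈ-cong (H i l ≟V v) (j Fin.≟ l)
              (λ e → H-inj i∈ (trans eq (sym e))) (λ { refl → eq })) (sym (*-identityʳ ⟦ j Fin.≟ l ⟧ᵈ)))) (trans (∑-δ j (λ _ → 1ℚ)) (sym ⟦true⟧))

      surv : Fin r → I → Option → ℚ
      surv j i o = ∏[ l ∈ js ] (1ℚ - ≢ᶠ j l * κ o (H i l))

      κ′ : I → Fin r → Option → Fin r → ℚ
      κ′ i j o l = ≢ᶠ j l * κ o (H i l)

      0≤κ′ : ∀ i j o l → 0ℚ ≤ κ′ i j o l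
      0≤κ′ i j o l = 0≤* (0≤≢ᶠ j l) (0≤κ o (H i l))

      κ′≤κ : ∀ i j o l → κ′ i j o l ≤ κ o (H i l)
      κ′≤κ i j o l = ≤-≡ (*-monoʳ (0≤κ o (H i l)) (⟦⟧≤1 (not (does (j Fin.≟ l))))) (*-identityˡ _)

      κ′≤1 : ∀ i j o l → κ′ i j o l ≤ 1ℚ
      κ′≤1 i j o l = ≤-trans (κ′≤κ i j o l) (κ≤1 o (H i l))

      live-after : ∀ A o i → live (after A o) i ≡ live A i * ∏[ l ∈ js ] (1ℚ - κ o (H i l))
      live-after A o i = trans (∏-cong js (λ l → trans (⟦∧⟧ (A (H i l)) _) (cong (⟦ A (H i l) ⟧ *_) (⟦not⟧ (kill o (H i l))))))
        (∏-* js (λ l → ⟦ A (H i l) ⟧) (λ l → 1ℚ - κ o (H i l)))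

      liveBut-after : ∀ A o i j → liveBut (after A o) i j ≡ liveBut A i j * surv j i o
      liveBut-after A o i j = trans (∏-cong js same) (∏-* js (except j (λ l → ⟦ A (H i l) ⟧)) _)
        where
        same : ∀ l → except j (λ l → ⟦ after A o (H i l) ⟧) l ≡ except j (λ l → ⟦ A (H i l) ⟧) l * (1ℚ - ≢ᶠ j l * κ o (H i l))
        same l with does (j Fin.≟ l)
        ... | true = trans (ring₄₆ (κ o (H i l))) (cong (λ z → 1ℚ * (1ℚ - z * κ o (H i l))) (sym ⟦false⟧))
        ... | false = trans (⟦∧⟧ (A (H i l)) _) (cong (⟦ A (H i l) ⟧ *_) (trans (⟦not⟧ (kill o (H i l))) (cong (λ z → 1ℚ - z) (sym (trans (cong (_* κ o (H i l)) ⟦true⟧) (*-identityˡ (κ o (H i l))))))))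

      liveBut-dead : ∀ A i j l → j ≢ l → A (H i l) ≡ false → liveBut A i j ≡ 0ℚ
      liveBut-dead A i j l j≢l dead = trans (∏-except l (except j (λ l → ⟦ A (H i l) ⟧)))
        (trans (cong (_* ∏ js (except l (except j (λ l → ⟦ A (H i l) ⟧)))) fl) (*-zeroˡ (∏ js (except l (except j (λ l → ⟦ A (H i l) ⟧))))))
        where
        fl : except j (λ l → ⟦ A (H i l) ⟧) l ≡ 0ℚ
        fl with j Fin.≟ l
        ... | yes e = ⊥-elim (j≢l e)
        ... | no _ = trans (cong ⟦_⟧ dead) ⟦false⟧

      -- Double counting of incidences between edges and vertices. Only an inequality results,
      -- because `deg A v` also counts edges whose single dead vertex is `v`.
      vertex-sum : ∀ A (h : V → ℚ) → (∀ v → 0ℚ ≤ h v) →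
        ∑[ i ∈ is ] (ψ i * live A i * ∑[ l ∈ js ] h (H i l)) ≤ ∑[ v ∈ vs ] (h v * deg A v)
      vertex-sum A h 0≤h = begin
        ∑[ i ∈ is ] (ψ i * live A i * ∑[ l ∈ js ] h (H i l))
          ≡⟨ ∑-cong is (λ i → cong (ψ i * live A i *_) (∑-cong js (λ l → sym (∑-δV (H i l) h)))) ⟩
        ∑[ i ∈ is ] (ψ i * live A i * ∑[ l ∈ js ] ∑[ v ∈ vs ] (hit i l v * h v))
          ≡⟨ ∑-cong is (λ i → trans (cong (ψ i * live A i *_) (∑-swap js vs (λ l v → hit i l v * h v)))
               (sym (∑-*ˡ vs (ψ i * live A i) (λ v → ∑[ l ∈ js ] (hit i l v * h v))))) ⟩
        ∑[ i ∈ is ] ∑[ v ∈ vs ] (ψ i * live A i * ∑[ l ∈ js ] (hit i l v * h v))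
          ≡⟨ ∑-swap is vs (λ i v → ψ i * live A i * ∑[ l ∈ js ] (hit i l v * h v)) ⟩
        ∑[ v ∈ vs ] ∑[ i ∈ is ] (ψ i * live A i * ∑[ l ∈ js ] (hit i l v * h v))
          ≤⟨ ∑-mono vs (λ v → ∑-mono is (λ i → cell v i)) ⟩
        ∑[ v ∈ vs ] ∑[ i ∈ is ] (h v * ∑[ l ∈ js ] (hit i l v * (ψ i * liveBut A i l)))
          ≡⟨ ∑-cong vs (λ v → ∑-*ˡ is (h v) (λ i → ∑[ l ∈ js ] (hit i l v * (ψ i * liveBut A i l)))) ⟩
        ∑[ v ∈ vs ] (h v * deg A v) ∎
        where
        open ≤-Reasoning
        cell : ∀ v i → ψ i * live A i * ∑[ l ∈ js ] (hit i l v * h v) ≤ h v * ∑[ l ∈ js ] (hit i l v * (ψ i * liveBut A i l))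
        cell v i = ≡-≤ (sym (∑-*ˡ js (ψ i * live A i) (λ l → hit i l v * h v)))
          (≤-≡ (∑-mono js (λ l → ≡-≤ (ring₄₇ (ψ i) (live A i) (hit i l v) (h v))
                 (*-monoˡ (0≤h v) (*-monoˡ (0≤hit i l v) (*-monoˡ (0≤ψ i) (live≤liveBut A i l))))))
            (∑-*ˡ js (h v) (λ l → hit i l v * (ψ i * liveBut A i l))))

      -- `Ω` is the total weight of the options of a step; `room` leaves a non-negative weight for
      -- `idle`.
      record StepState : Set where
        field
          A : V → Bool
          q Ω : ℚ
          0≤q : 0ℚ ≤ q
          q≤1 : q ≤ 1ℚ
          D≤2 : ∀ v → deg A v ≤ 2ℚ
          room : tot A + ∑[ v ∈ vs ] (⟦ A v ⟧ * (q - deg A v) ⁺) ≤ Ω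

      module Step (𝒮 : StepState) where
        open StepState 𝒮

        D : V → ℚ
        D = deg A

        ω : V → ℚ
        ω v = ⟦ A v ⟧ * (q - D v) ⁺

        mx : V → ℚ
        mx v = D v + (q - D v) ⁺

        p : Option → ℚ
        p (edge i) = ψ i * live A i
        p (waste v) = ω v
        p idle = Ω - (tot A + ∑ vs ω)

        0≤p : ∀ o → 0ℚ ≤ p o
        0≤p (edge i) = 0≤* (0≤ψ i) (0≤live A i)
        0≤p (waste v) = 0≤* (0≤⟦⟧ (A v)) (0≤⁺ (q - D v))
        0≤p idle = 0≤-diff room

        opts : List Option
        opts = map edge is ++ (map waste vs ++ (idle ∷ []))

        -- The weights add up to `Ω` and not to 1, so this is `Ω` times an expectation; divisions
        -- are avoided.
        E : (Option → ℚ) → ℚ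
        E g = ∑[ o ∈ opts ] (p o * g o)

        E-split : ∀ g → E g ≡ ∑[ i ∈ is ] (p (edge i) * g (edge i)) + (∑[ v ∈ vs ] (ω v * g (waste v)) + p idle * g idle)
        E-split g = trans (∑-++ (map edge is) (map waste vs ++ (idle ∷ [])) f)
          (cong₂ _+_ (∑-map edge is f) (trans (∑-++ (map waste vs) (idle ∷ []) f)
            (cong₂ _+_ (∑-map waste vs f) (trans (∑-∷ idle [] f) (trans (cong (f idle +_) (∑-[] f)) (+-identityʳ (f idle)))))))
          where
          f : Option → ℚ
          f o = p o * g o

        E-mono : ∀ {g h : Option → ℚ} → (∀ o → g o ≤ h o) → E g ≤ E h
        E-mono k = ∑-mono opts (λ o → *-monoˡ (0≤p o) (k o))

        0≤E : ∀ {g : Option → ℚ} → (∀ o → 0ℚ ≤ g o) → 0ℚ ≤ E g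
        0≤E k = 0≤∑ opts (λ o → 0≤* (0≤p o) (k o))

        E-cong : ∀ {g h : Option → ℚ} → (∀ o → g o ≡ h o) → E g ≡ E h
        E-cong k = ∑-cong opts (λ o → cong (p o *_) (k o))

        ∑p : ∑ opts p ≡ Ω
        ∑p = trans (∑-cong opts (λ o → sym (*-identityʳ (p o)))) (trans (E-split (λ _ → 1ℚ))
          (trans (cong₂ (λ x y → x + (y + p idle * 1ℚ)) (∑-cong is (λ i → *-identityʳ _)) (∑-cong vs (λ v → *-identityʳ (ω v))))
            (ring₄₈ (tot A) (∑ vs ω) Ω)))

        E-const : ∀ c → E (λ _ → c) ≡ Ω * c
        E-const c = trans (∑-*ʳ opts c p) (cong (_* c) ∑p)

        E-+ : ∀ g h → E (λ o → g o + h o) ≡ E g + E h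
        E-+ g h = trans (∑-cong opts (λ o → *-distribˡ-+ (p o) (g o) (h o))) (∑-+ opts (λ o → p o * g o) (λ o → p o * h o))

        E-*ˡ : ∀ c g → E (λ o → c * g o) ≡ c * E g
        E-*ˡ c g = trans (∑-cong opts (λ o → ring₁₆ (p o) c (g o))) (∑-*ˡ opts c (λ o → p o * g o))

        E-neg : ∀ g → E (λ o → - g o) ≡ - E g
        E-neg g = trans (∑-cong opts (λ o → ring₄₉ (p o) (g o))) (∑-neg opts (λ o → p o * g o))

        E-- : ∀ g h → E (λ o → g o - h o) ≡ E g - E h
        E-- g h = trans (E-+ g (λ o → - h o)) (cong (E g +_) (E-neg h))

        E-∑ : ∀ {X : Set} (xs : List X) (g : X → Option → ℚ) → E (λ o → ∑[ x ∈ xs ] g x o) ≡ ∑[ x ∈ xs ] E (g x)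
        E-∑ xs g = trans (∑-cong opts (λ o → sym (∑-*ˡ xs (p o) (λ x → g x o)))) (∑-swap opts xs (λ o x → p o * g x o))

        E-∑∑ : ∀ {X Y : Set} (xs : List X) (ys : List Y) (c : X → Y → ℚ) (g : X → Y → Option → ℚ) →
          E (λ o → ∑[ x ∈ xs ] ∑[ y ∈ ys ] (c x y * g x y o)) ≡ ∑[ x ∈ xs ] ∑[ y ∈ ys ] (c x y * E (g x y))
        E-∑∑ xs ys c g = trans (E-∑ xs (λ x o → ∑[ y ∈ ys ] (c x y * g x y o)))
          (∑-cong xs (λ x → trans (E-∑ ys (λ y o → c x y * g x y o)) (∑-cong ys (λ y → E-*ˡ (c x y) (g x y)))))

        waste-part : ∀ u → ∑[ v ∈ vs ] (ω v * κ (waste v) u) ≡ ω u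
        waste-part u = trans (∑-cong vs (λ v → *-comm (ω v) (κ (waste v) u))) (∑-δV u ω)

        κ-idle : ∀ x u → x * κ idle u ≡ 0ℚ
        κ-idle x u = trans (cong (x *_) ⟦false⟧) (*-zeroʳ x)

        edge-part≤ : ∀ u i → p (edge i) * κ (edge i) u ≤ ∑[ j ∈ js ] (hit i j u * (ψ i * liveBut A i j))
        edge-part≤ u i = ≤-trans (*-monoˡ (0≤p (edge i)) (κ-edge≤ i u))
          (≡-≤ (sym (∑-*ˡ js (p (edge i)) (λ j → hit i j u)))
          (∑-mono js (λ j → ≡-≤ (*-comm (p (edge i)) (hit i j u)) (*-monoˡ (0≤hit i j u) (*-monoˡ (0≤ψ i) (live≤liveBut A i j))))))

        -- Edges contribute at most the load of `u`, and discarding tops it up to the target: the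
        -- rate is at most the larger of `D u` and `q`.
        kill≤ : ∀ u → E (λ o → κ o u) ≤ mx u
        kill≤ u = ≡-≤ (E-split (λ o → κ o u)) (+-mono-≤ (∑-mono is (edge-part≤ u))
          (≡-≤ (cong₂ _+_ (waste-part u) (κ-idle (p idle) u)) (≡-≤ (+-identityʳ (ω u))
            (≤-≡ (*-monoʳ (0≤⁺ (q - D u)) (⟦⟧≤1 (A u))) (*-identityˡ _)))))

        -- When `u` is alive, an edge through it is live as soon as its other vertices are, so the
        -- edges contribute exactly `D u`.
        kill≥ : ∀ u → A u ≡ true → q ≤ E (λ o → κ o u)
        kill≥ u alive = ≤-≡ (≤-≡ (≤-by _ (0≤-diff (x≤⁺ (q - D u))) (ring₅₀ q (D u) ((q - D u) ⁺)))
            (cong₂ _+_ (sym edges) (sym (trans (cong₂ _+_ (trans (waste-part u) (trans (cong (λ b → ⟦ b ⟧ * (q - D u) ⁺) alive) (trans (cong (_* (q - D u) ⁺) ⟦true⟧) (*-identityˡ ((q - D u) ⁺))))) (κ-idle (p idle) u)) (+-identityʳ ((q - D u) ⁺))))))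
            (sym (E-split (λ o → κ o u)))
          where
          slot : ∀ i j → p (edge i) * hit i j u ≡ hit i j u * (ψ i * liveBut A i j)
          slot i j = trans (cong (λ z → ψ i * z * hit i j u) (live-split A i j))
            (trans (ring₅₁ (ψ i) ⟦ A (H i j) ⟧ (liveBut A i j) (hit i j u))
            (trans (cong (ψ i * liveBut A i j *_) (trans (⟦⟧ᵈ-subst (H i j ≟V u) (λ z → ⟦ A z ⟧)) (cong (hit i j u *_) (trans (cong ⟦_⟧ alive) ⟦true⟧))))
            (ring₅₂ (ψ i) (liveBut A i j) (hit i j u))))
          edges : ∑[ i ∈ is ] (p (edge i) * κ (edge i) u) ≡ D u
          edges = ∑-cong∈ is (λ {i} i∈ → trans (cong (p (edge i) *_) (sym (κ-edge i∈ u)))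
            (trans (sym (∑-*ˡ js (p (edge i)) (λ j → hit i j u))) (∑-cong js (slot i))))

        -- Discarding removes a single vertex, so only an edge through both can remove the two
        -- together, and the weight of such edges is a codegree.
        pair≤ : ∀ u u′ → u ≢ u′ → E (λ o → κ o u * κ o u′) ≤ α
        pair≤ u u′ u≢u′ = ≡-≤ (E-split (λ o → κ o u * κ o u′)) (≡-≤ (cong (edges +_) rest)
          (≡-≤ (+-identityʳ edges) (≤-trans (∑-mono is bound) (codeg≤α u u′))))
          where
          edges : ℚ
          edges = ∑[ i ∈ is ] (p (edge i) * (κ (edge i) u * κ (edge i) u′))
          none : ∀ v → κ (waste v) u * κ (waste v) u′ ≡ 0ℚ
          none v with u ≟V v
          ... | yes refl = trans (cong (⟦ true ⟧ *_) (⟦⟧ᵈ-no (u′ ≟V u) (u≢u′ ∘ sym))) (*-zeroʳ ⟦ true ⟧)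
          ... | no _ = trans (cong (_* κ (waste v) u′) ⟦false⟧) (*-zeroˡ (κ (waste v) u′))
          rest : ∑[ v ∈ vs ] (ω v * (κ (waste v) u * κ (waste v) u′)) + p idle * (κ idle u * κ idle u′) ≡ 0ℚ
          rest = cong₂ _+_ (trans (∑-cong vs (λ v → trans (cong (ω v *_) (none v)) (*-zeroʳ (ω v)))) (∑-0 vs))
            (trans (cong (λ z → p idle * (z * κ idle u′)) ⟦false⟧) (trans (cong (p idle *_) (*-zeroˡ (κ idle u′))) (*-zeroʳ (p idle))))
          slots : ∀ i j l → hit i j u * hit i l u′ ≤ ≢ᶠ j l * (hit i j u * hit i l u′)
          slots i j l with j Fin.≟ l
          ... | no _ = ≤-reflexive (sym (trans (cong (_* (hit i j u * hit i l u′)) ⟦true⟧) (*-identityˡ _)))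
          ... | yes refl with H i j ≟V u | H i j ≟V u′
          ...   | yes e | yes e′ = ⊥-elim (u≢u′ (trans (sym e) e′))
          ...   | no _ | e′ = ≤-reflexive (trans (cong (_* ⟦ e′ ⟧ᵈ) ⟦false⟧) (trans (*-zeroˡ ⟦ e′ ⟧ᵈ) (sym (trans (cong (_* (⟦ false ⟧ * ⟦ e′ ⟧ᵈ)) ⟦false⟧) (*-zeroˡ (⟦ false ⟧ * ⟦ e′ ⟧ᵈ))))))
          ...   | yes _ | no _ = ≤-reflexive (trans (cong (⟦ true ⟧ *_) ⟦false⟧) (trans (*-zeroʳ ⟦ true ⟧) (sym (trans (cong (_* (⟦ true ⟧ * ⟦ false ⟧)) ⟦false⟧) (*-zeroˡ (⟦ true ⟧ * ⟦ false ⟧))))))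
          bound : ∀ i → p (edge i) * (κ (edge i) u * κ (edge i) u′) ≤ ∑[ j ∈ js ] ∑[ l ∈ js ] (ψ i * (≢ᶠ j l * (hit i j u * hit i l u′)))
          bound i = begin
            p (edge i) * (κ (edge i) u * κ (edge i) u′)
              ≤⟨ *-mono (0≤* (0≤κ (edge i) u) (0≤κ (edge i) u′)) (0≤ψ i) (≤-≡ (*-monoˡ (0≤ψ i) (live≤1 A i)) (*-identityʳ (ψ i)))
                   (*-mono (0≤κ (edge i) u′) (0≤∑ js (λ j → 0≤hit i j u)) (κ-edge≤ i u) (κ-edge≤ i u′)) ⟩
            ψ i * (∑[ j ∈ js ] hit i j u * ∑[ l ∈ js ] hit i l u′)
              ≡⟨ cong (ψ i *_) (trans (sym (∑-*ʳ js (∑[ l ∈ js ] hit i l u′) (λ j → hit i j u))) (∑-cong js (λ j → sym (∑-*ˡ js (hit i j u) (λ l → hit i l u′))))) ⟩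
            ψ i * ∑[ j ∈ js ] ∑[ l ∈ js ] (hit i j u * hit i l u′)
              ≤⟨ *-monoˡ (0≤ψ i) (∑-mono js (λ j → ∑-mono js (slots i j))) ⟩
            ψ i * ∑[ j ∈ js ] ∑[ l ∈ js ] (≢ᶠ j l * (hit i j u * hit i l u′))
              ≡⟨ trans (sym (∑-*ˡ js (ψ i) (λ j → ∑[ l ∈ js ] (≢ᶠ j l * (hit i j u * hit i l u′))))) (∑-cong js (λ j → sym (∑-*ˡ js (ψ i) (λ l → ≢ᶠ j l * (hit i j u * hit i l u′))))) ⟩
            ∑[ j ∈ js ] ∑[ l ∈ js ] (ψ i * (≢ᶠ j l * (hit i j u * hit i l u′))) ∎
            where open ≤-Reasoning

        mx≤2 : ∀ u → mx u ≤ 2ℚ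
        mx≤2 u = ≤-≡ (+-monoʳ-≤ (D u) (⁺-lub (+-monoˡ-≤ (- D u) (≤-trans q≤1 (≤-by 1ℚ 0≤1 refl))) (0≤-diff (D≤2 u)))) (ring₁ (D u) 2ℚ)

        mx≡ : ∀ u → mx u ≡ q + exc A q u
        mx≡ u = ⁺-flip (D u) q

        0≤exc : ∀ v → 0ℚ ≤ exc A q v
        0≤exc v = 0≤⁺ (D v - q)

        -- By the lower Bonferroni bound a live edge is lost at most at the sum of the rates of its
        -- r vertices, each `q` plus the excess. The excess is charged to the vertices, whose loads
        -- are at most 2; hence the factor 2.
        E-tot : tot A * (Ω - ι r * q) - 2ℚ * ∑[ v ∈ vs ] exc A q v ≤ E (λ o → tot (after A o))
        E-tot = begin
          tot A * (Ω - ι r * q) - 2ℚ * ∑[ v ∈ vs ] exc A q v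
            ≤⟨ +-monoʳ-≤ (tot A * (Ω - ι r * q)) (neg-mono overload) ⟩
          tot A * (Ω - ι r * q) - ∑[ i ∈ is ] (c i * S i)
            ≡⟨ cong (_- ∑[ i ∈ is ] (c i * S i)) (sym (∑-*ʳ is (Ω - ι r * q) c)) ⟩
          ∑[ i ∈ is ] (c i * (Ω - ι r * q)) - ∑[ i ∈ is ] (c i * S i)
            ≡⟨ sym (∑-- is (λ i → c i * (Ω - ι r * q)) (λ i → c i * S i)) ⟩
          ∑[ i ∈ is ] (c i * (Ω - ι r * q) - c i * S i)
            ≤⟨ ∑-mono is (λ i → ≡-≤ (ring₅₃ (c i) (Ω - ι r * q) (S i)) (*-monoˡ (0≤c i) (rate i))) ⟩
          ∑[ i ∈ is ] (c i * E (λ o → 1ℚ - ∑[ l ∈ js ] κ o (H i l)))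
            ≡⟨ sym (trans (E-∑ is (λ i o → c i * (1ℚ - ∑[ l ∈ js ] κ o (H i l)))) (∑-cong is (λ i → E-*ˡ (c i) (λ o → 1ℚ - ∑[ l ∈ js ] κ o (H i l))))) ⟩
          E (λ o → ∑[ i ∈ is ] (c i * (1ℚ - ∑[ l ∈ js ] κ o (H i l))))
            ≤⟨ E-mono (λ o → ∑-mono is (λ i → ≤-≡ (*-monoˡ (0≤c i) (Bonferroni.lower (λ l → κ o (H i l)) (λ l → 0≤κ o (H i l)) (λ l → κ≤1 o (H i l))))
                 (trans (*-assoc (ψ i) (live A i) (∏[ l ∈ js ] (1ℚ - κ o (H i l)))) (cong (ψ i *_) (sym (live-after A o i)))))) ⟩
          E (λ o → tot (after A o)) ∎
          where
          open ≤-Reasoning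
          c : I → ℚ
          c i = ψ i * live A i
          0≤c : ∀ i → 0ℚ ≤ c i
          0≤c i = 0≤p (edge i)
          S : I → ℚ
          S i = ∑[ l ∈ js ] exc A q (H i l)
          rate : ∀ i → Ω - ι r * q - S i ≤ E (λ o → 1ℚ - ∑[ l ∈ js ] κ o (H i l))
          rate i = ≡-≤ (ring₅₄ Ω (ι r * q) (S i)) (≤-≡ (+-monoʳ-≤ Ω (neg-mono kills))
            (sym (trans (E-- (λ _ → 1ℚ) (λ o → ∑[ l ∈ js ] κ o (H i l))) (cong₂ _-_ (trans (E-const 1ℚ) (*-identityʳ Ω)) (E-∑ js (λ l o → κ o (H i l)))))))
            where
            kills : ∑[ l ∈ js ] E (λ o → κ o (H i l)) ≤ ι r * q + S i
            kills = ≤-trans (∑-mono js (λ l → kill≤ (H i l))) (≤-reflexive (trans (∑-cong js (λ l → mx≡ (H i l)))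
              (trans (∑-+ js (λ _ → q) (λ l → exc A q (H i l))) (cong (_+ S i) (trans (∑-const js q) (cong (λ m → ι m * q) (length-allFin r)))))))
          overload : ∑[ i ∈ is ] (c i * S i) ≤ 2ℚ * ∑[ v ∈ vs ] exc A q v
          overload = ≤-trans (vertex-sum A (exc A q) 0≤exc)
            (≤-trans (∑-mono vs (λ v → *-monoˡ (0≤exc v) (D≤2 v))) (≤-reflexive (trans (∑-*ʳ vs 2ℚ (exc A q)) (*-comm (∑ vs (exc A q)) 2ℚ))))

        module At (v : V) where

          c : I → Fin r → ℚ
          c i j = hit i j v * (ψ i * liveBut A i j)

          0≤c : ∀ i j → 0ℚ ≤ c i j
          0≤c i j = 0≤* (0≤hit i j v) (0≤* (0≤ψ i) (0≤liveBut A i j))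

          D′ : Option → ℚ
          D′ o = deg (after A o) v

          D′≡ : ∀ o → D′ o ≡ ∑[ i ∈ is ] ∑[ j ∈ js ] (c i j * surv j i o)
          D′≡ o = ∑-cong is (λ i → ∑-cong js (λ j → trans (cong (λ z → hit i j v * (ψ i * z)) (liveBut-after A o i j))
            (ring₅₅ (hit i j v) (ψ i) (liveBut A i j) (surv j i o))))

          Δ : Option → ℚ
          Δ o = D v - D′ o

          ∑c* : ∀ x → ∑[ i ∈ is ] ∑[ j ∈ js ] (c i j * x) ≡ D v * x
          ∑c* x = trans (∑-cong is (λ i → ∑-*ʳ js x (c i))) (∑-*ʳ is x (λ i → ∑ js (c i)))

          Δ≡ : ∀ o → Δ o ≡ ∑[ i ∈ is ] ∑[ j ∈ js ] (c i j * (1ℚ - surv j i o))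
          Δ≡ o = sym (trans (∑-cong is (λ i → trans (∑-cong js (λ j → ring₅₆ (c i j) (surv j i o))) (∑-- js (c i) (λ j → c i j * surv j i o))))
            (trans (∑-- is (λ i → ∑ js (c i)) (λ i → ∑[ j ∈ js ] (c i j * surv j i o))) (cong (λ z → D v - z) (sym (D′≡ o)))))

          0≤Δ : ∀ o → 0ℚ ≤ Δ o
          0≤Δ o = ≤-≡ (0≤∑ is (λ i → 0≤∑ js (λ j → 0≤* (0≤c i j) (0≤-diff (Bonferroni.∏1-≤1 (κ′ i j o) (0≤κ′ i j o) (κ′≤1 i j o)))))) (sym (Δ≡ o))

          Δ≤ : ∀ o → Δ o ≤ ∑[ i ∈ is ] ∑[ j ∈ js ] (c i j * ∑ js (κ′ i j o))
          Δ≤ o = ≡-≤ (Δ≡ o) (∑-mono is (λ i → ∑-mono js (λ j → *-monoˡ (0≤c i j) (step i j))))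
            where
            step : ∀ i j → 1ℚ - surv j i o ≤ ∑ js (κ′ i j o)
            step i j = ≤-by _ (0≤-diff (Bonferroni.lower (κ′ i j o) (0≤κ′ i j o) (κ′≤1 i j o))) (ring₅₇ (surv j i o) (∑ js (κ′ i j o)))

          weight≤ : ∀ i j → c i j ≤ hit i j v * ψ i
          weight≤ i j = *-monoˡ (0≤hit i j v) (≤-≡ (*-monoˡ (0≤ψ i) (liveBut≤1 i j)) (*-identityʳ (ψ i)))
            where
            liveBut≤1 : ∀ i j → liveBut A i j ≤ 1ℚ
            liveBut≤1 i j = ≤-trans (∏-mono js (0≤except j (λ l → 0≤⟦⟧ (A (H i l)))) le) (≤-reflexive (∏-1 js))
              where
              le : ∀ l → except j (λ l → ⟦ A (H i l) ⟧) l ≤ 1ℚ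
              le l with does (j Fin.≟ l)
              ... | true = ≤-refl
              ... | false = ⟦⟧≤1 (A (H i l))

          spread : ∀ (h : V → ℚ) → ∑[ i ∈ is ] ∑[ j ∈ js ] (hit i j v * ψ i * ∑[ l ∈ js ] (≢ᶠ j l * h (H i l)))
            ≡ ∑[ i ∈ is ] ∑[ j ∈ js ] ∑[ l ∈ js ] (ψ i * (≢ᶠ j l * (hit i j v * h (H i l))))
          spread h = ∑-cong is (λ i → ∑-cong js (λ j → trans (sym (∑-*ˡ js (hit i j v * ψ i) (λ l → ≢ᶠ j l * h (H i l))))
            (∑-cong js (λ l → ring₅₈ (hit i j v) (ψ i) (≢ᶠ j l) (h (H i l))))))

          -- A step removes at most r vertices, and each of them takes from `v` at most the weight
          -- that it shares with `v`, a codegree.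
          Δ≤rα : ∀ o → Δ o ≤ ι r * α
          Δ≤rα o = ≤-trans (Δ≤ o) (≤-trans (∑-mono is (λ i → ∑-mono js (λ j → *-monoʳ (0≤∑ js (0≤κ′ i j o)) (weight≤ i j)))) (bound o))
            where
            L : (V → ℚ) → ℚ
            L h = ∑[ i ∈ is ] ∑[ j ∈ js ] (hit i j v * ψ i * ∑[ l ∈ js ] (≢ᶠ j l * h (H i l)))
            L-mono : ∀ {g h : V → ℚ} → (∀ u → g u ≤ h u) → L g ≤ L h
            L-mono k = ∑-mono is (λ i → ∑-mono js (λ j → *-monoˡ (0≤* (0≤hit i j v) (0≤ψ i)) (∑-mono js (λ l → *-monoˡ (0≤≢ᶠ j l) (k (H i l))))))
            L-∑ : ∀ {X : Set} (xs : List X) (g : X → V → ℚ) → L (λ u → ∑[ x ∈ xs ] g x u) ≡ ∑[ x ∈ xs ] L (g x)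
            L-∑ xs g = trans (∑-cong is (λ i → trans (∑-cong js (λ j → trans (cong (hit i j v * ψ i *_)
                 (trans (∑-cong js (λ l → sym (∑-*ˡ xs (≢ᶠ j l) (λ x → g x (H i l))))) (∑-swap js xs (λ l x → ≢ᶠ j l * g x (H i l)))))
                 (sym (∑-*ˡ xs (hit i j v * ψ i) (λ x → ∑[ l ∈ js ] (≢ᶠ j l * g x (H i l)))))))
               (∑-swap js xs (λ j x → hit i j v * ψ i * ∑[ l ∈ js ] (≢ᶠ j l * g x (H i l))))))
              (∑-swap is xs (λ i x → ∑[ j ∈ js ] (hit i j v * ψ i * ∑[ l ∈ js ] (≢ᶠ j l * g x (H i l)))))
            single : ∀ w → L (λ u → ⟦ u ≟V w ⟧ᵈ) ≤ α
            single w = ≡-≤ (spread (λ u → ⟦ u ≟V w ⟧ᵈ)) (codeg≤α v w)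
            α≤rα : α ≤ ι r * α
            α≤rα = ≤-by (ι r₁ * α) (0≤* (0≤ι r₁) 0≤α) (trans (ring₉ α (ι r₁)) (cong (_* α) (sym (ι-suc r₁))))
            bound : ∀ o → L (κ o) ≤ ι r * α
            bound (edge i′) = ≤-trans (L-mono (κ-edge≤ i′)) (≤-trans (L-mono (λ u → ∑-mono js (λ m → ⟦⟧ᵈ-≤ (H i′ m ≟V u) (u ≟V H i′ m) sym)))
              (≤-trans (≤-reflexive (L-∑ js (λ m u → ⟦ u ≟V H i′ m ⟧ᵈ))) (≤-trans (∑-mono js (λ m → single (H i′ m)))
                (≤-reflexive (trans (∑-const js α) (cong (λ m → ι m * α) (length-allFin r)))))))
            bound (waste w) = ≤-trans (single w) α≤rα
            bound idle = ≤-trans (L-mono (λ u → ≡-≤ ⟦false⟧ (0≤⟦⟧ (does (u ≟V v))))) (≤-trans (single v) α≤rα)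

          -- One factor 2 bounds the rate at which a vertex dies, the other the load of `v`.
          EΔ≤ : E Δ ≤ 2ℚ * 2ℚ * ι r
          EΔ≤ = ≤-trans (E-mono Δ≤) (≡-≤ (E-∑∑ is js c (λ i j o → ∑ js (κ′ i j o)))
            (≤-trans (∑-mono is (λ i → ∑-mono js (λ j → *-monoˡ (0≤c i j) (slot i j))))
            (≡-≤ (∑c* (ι r * 2ℚ)) (≤-≡ (*-monoʳ (0≤* (0≤ι r) 0≤2) (D≤2 v)) (ring₅₉ 2ℚ (ι r))))))
            where
            slot : ∀ i j → E (λ o → ∑ js (κ′ i j o)) ≤ ι r * 2ℚ
            slot i j = ≡-≤ (E-∑ js (λ l o → κ′ i j o l)) (≤-trans (∑-mono js (λ l → ≤-trans (E-mono (λ o → κ′≤κ i j o l)) (≤-trans (kill≤ (H i l)) (mx≤2 (H i l)))))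
              (≤-reflexive (trans (∑-const js 2ℚ) (cong (λ m → ι m * 2ℚ) (length-allFin r)))))

          -- Upper Bonferroni bound for the survival of the r-1 other vertices of an edge at `v`.
          -- The linear term gives the decay; the quadratic one is small because two distinct
          -- vertices rarely die together.
          ED′≤ : E D′ ≤ D v * (Ω - ι r₁ * q + ι r * ι r * α)
          ED′≤ = ≡-≤ (trans (E-cong D′≡) (E-∑∑ is js c (λ i j → surv j i))) (≤-trans (∑-mono∈ is (λ {i} i∈ → ∑-mono js (slot i∈))) (≤-reflexive (∑c* _)))
            where
            slot : ∀ {i} → i ∈ is → ∀ j → c i j * E (surv j i) ≤ c i j * (Ω - ι r₁ * q + ι r * ι r * α)
            slot {i} i∈ j = begin
              c i j * E (surv j i)
                ≤⟨ *-monoˡ (0≤c i j) (E-mono (λ o → Bonferroni.upper (κ′ i j o) (0≤κ′ i j o) (κ′≤1 i j o))) ⟩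
              c i j * E (λ o → 1ℚ - ∑ js (κ′ i j o) + pairs (κ′ i j o))
                ≡⟨ cong (c i j *_) (trans (E-+ (λ o → 1ℚ - ∑ js (κ′ i j o)) (λ o → pairs (κ′ i j o)))
                     (cong (_+ E (λ o → pairs (κ′ i j o))) (trans (E-- (λ _ → 1ℚ) (λ o → ∑ js (κ′ i j o)))
                       (cong₂ _-_ (trans (E-const 1ℚ) (*-identityʳ Ω)) (E-∑ js (λ l o → κ′ i j o l)))))) ⟩
              c i j * (Ω - K + E (λ o → pairs (κ′ i j o)))
                ≤⟨ *-monoˡ (0≤c i j) (+-monoʳ-≤ (Ω - K) pairBound) ⟩
              c i j * (Ω - K + ι r * ι r * α)
                ≡⟨ ring₆₀ (c i j) Ω K (ι r * ι r * α) ⟩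
              c i j * (Ω + ι r * ι r * α) - c i j * K
                ≤⟨ +-monoʳ-≤ (c i j * (Ω + ι r * ι r * α)) (neg-mono kills) ⟩
              c i j * (Ω + ι r * ι r * α) - c i j * (ι r₁ * q)
                ≡⟨ sym (ring₆₀ (c i j) Ω (ι r₁ * q) (ι r * ι r * α)) ⟩
              c i j * (Ω - ι r₁ * q + ι r * ι r * α) ∎
              where
              open ≤-Reasoning
              K : ℚ
              K = ∑[ l ∈ js ] E (λ o → κ′ i j o l)
              one : ∀ l → c i j * (≢ᶠ j l * q) ≤ c i j * E (λ o → κ′ i j o l)
              one l with j Fin.≟ l | Bool._≟_ (A (H i l)) true
              ... | yes _ | _ = *-monoˡ (0≤c i j) (≡-≤ (trans (cong (_* q) ⟦false⟧) (*-zeroˡ q)) (0≤E (λ o → 0≤* (0≤⟦⟧ false) (0≤κ o (H i l)))))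
              ... | no _ | yes alive = *-monoˡ (0≤c i j) (≡-≤ (trans (cong (_* q) ⟦true⟧) (*-identityˡ q))
                      (≤-trans (kill≥ (H i l) alive) (E-mono (λ o → ≤-reflexive (sym (trans (cong (_* κ o (H i l)) ⟦true⟧) (*-identityˡ (κ o (H i l)))))))))
              -- The lower bound `q` on the rate holds for live vertices only; if the vertex is
              -- dead, `liveBut` and with it the coefficient `c i j` vanish.
              ... | no j≢l | no dead = ≤-reflexive (trans (cong (_* (⟦ true ⟧ * q)) c≡0) (trans (*-zeroˡ (⟦ true ⟧ * q)) (sym (trans (cong (_* Y) c≡0) (*-zeroˡ Y)))))
                where
                Y : ℚ
                Y = E (λ o → ⟦ true ⟧ * κ o (H i l))
                c≡0 : c i j ≡ 0ℚ
                c≡0 = trans (cong (λ z → hit i j v * (ψ i * z)) (liveBut-dead A i j l j≢l (Bool.¬-not dead)))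
                  (trans (cong (hit i j v *_) (*-zeroʳ (ψ i))) (*-zeroʳ (hit i j v)))
              kills : c i j * (ι r₁ * q) ≤ c i j * K
              kills = ≡-≤ (trans (cong (λ z → c i j * (z * q)) (sym (∑-≢ᶠ j))) (trans (cong (c i j *_) (sym (∑-*ʳ js q (≢ᶠ j)))) (sym (∑-*ˡ js (c i j) (λ l → ≢ᶠ j l * q)))))
                (≤-trans (∑-mono js one) (≤-reflexive (∑-*ˡ js (c i j) (λ l → E (λ o → κ′ i j o l)))))
              pairBound : E (λ o → pairs (κ′ i j o)) ≤ ι r * ι r * α
              pairBound = ≡-≤ (E-∑∑ js js ≢ᶠ (λ l l′ o → κ′ i j o l * κ′ i j o l′))
                (≤-trans (∑-mono js (λ l → ∑-mono js (two l))) (≤-reflexive (trans (∑-cong js (λ _ → trans (∑-const js α) (cong (λ m → ι m * α) (length-allFin r))))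
                  (trans (∑-const js (ι r * α)) (trans (cong (λ m → ι m * (ι r * α)) (length-allFin r)) (sym (*-assoc (ι r) (ι r) α)))))))
                where
                two : ∀ l l′ → ≢ᶠ l l′ * E (λ o → κ′ i j o l * κ′ i j o l′) ≤ α
                two l l′ with l Fin.≟ l′
                ... | yes _ = ≡-≤ (trans (cong (_* E (λ o → κ′ i j o l * κ′ i j o l′)) ⟦false⟧) (*-zeroˡ (E (λ o → κ′ i j o l * κ′ i j o l′)))) 0≤α
                ... | no l≢l′ = ≡-≤ (trans (cong (_* E (λ o → κ′ i j o l * κ′ i j o l′)) ⟦true⟧) (*-identityˡ _))
                  (≤-trans (E-mono (λ o → *-mono (0≤κ′ i j o l′) (0≤κ o (H i l)) (κ′≤κ i j o l) (κ′≤κ i j o l′)))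
                    (pair≤ (H i l) (H i l′) (λ e → l≢l′ (H-inj i∈ e))))

          e : ℚ
          e = exc A q v

          -- With e the current excess and Δ the random loss, (z⁺)² being 2-smooth
          -- gives exc′² ≤ (e - Δ + g)²; the cross term has the right sign because
          -- the expected loss is at least proportional to D ≥ q whenever e > 0.
          E-exc : ∀ g → 0ℚ ≤ g → Ω * g ≡ ι r₁ * (q * q) →
            E (λ o → exc (after A o) (q - g) v * exc (after A o) (q - g) v) ≤ Ω * (e * e) + (12ℚ * (ι r * ι r * α) + Ω * g * g)
          E-exc g 0≤g Ωg = begin
            E (λ o → exc (after A o) (q - g) v * exc (after A o) (q - g) v)
              ≤⟨ E-mono (λ o → smooth o) ⟩
            E (λ o → e * e + 2ℚ * e * g + g * g - (2ℚ * e) * Δ o + ι r * α * Δ o)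
              ≡⟨ trans (E-+ (λ o → e * e + 2ℚ * e * g + g * g - (2ℚ * e) * Δ o) (λ o → ι r * α * Δ o))
                  (cong₂ _+_ (trans (E-- (λ _ → e * e + 2ℚ * e * g + g * g) (λ o → (2ℚ * e) * Δ o))
                    (cong₂ _-_ (E-const (e * e + 2ℚ * e * g + g * g)) (E-*ˡ (2ℚ * e) Δ))) (E-*ˡ (ι r * α) Δ)) ⟩
            Ω * (e * e + 2ℚ * e * g + g * g) - 2ℚ * e * Y + ι r * α * Y
              ≡⟨ ring₆₁ Ω e g Y (ι r * α * Y) ⟩
            Ω * (e * e) + (2ℚ * (e * (Ω * g - Y)) + ι r * α * Y + Ω * g * g)
              ≤⟨ +-monoʳ-≤ (Ω * (e * e)) (+-monoˡ-≤ (Ω * g * g) (≤-trans (+-mono-≤ (*-monoˡ 0≤2 cross) (*-monoˡ (0≤* (0≤ι r) 0≤α) EΔ≤)) (≤-reflexive (ring₆₂ (ι r) α)))) ⟩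
            Ω * (e * e) + (12ℚ * (ι r * ι r * α) + Ω * g * g) ∎
            where
            open ≤-Reasoning
            Y : ℚ
            Y = E Δ
            smooth : ∀ o → exc (after A o) (q - g) v * exc (after A o) (q - g) v ≤ e * e + 2ℚ * e * g + g * g - (2ℚ * e) * Δ o + ι r * α * Δ o
            smooth o = ≡-≤ (cong (λ z → z ⁺ * z ⁺) (ring₆₃ (D v) (D′ o) q g)) (≤-trans (⁺-² (D v - q) (Δ o - g))
              (≤-by _ (0≤+ (0≤* 0≤2 (0≤* 0≤g (0≤Δ o))) (0≤* (0≤-diff (Δ≤rα o)) (0≤Δ o))) (ring₆₄ e g (Δ o) (ι r * α))))
            R : ℚ
            R = ι r * ι r * α
            0≤R : 0ℚ ≤ R
            0≤R = 0≤* (0≤* (0≤ι r) (0≤ι r)) 0≤α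
            Y≥ : D v * (ι r₁ * q - R) ≤ Y
            Y≥ = ≤-≡ (≡-≤ (ring₆₅ (D v) Ω (ι r₁ * q) R) (+-monoʳ-≤ (Ω * D v) (neg-mono ED′≤))) (sym (trans (E-- (λ _ → D v) D′) (cong (_- E D′) (E-const (D v)))))
            e≤2 : e ≤ 2ℚ
            e≤2 = ⁺-lub (≤-trans (≤-≡ (+-monoʳ-≤ (D v) (neg-mono 0≤q)) (+-identityʳ (D v))) (D≤2 v)) 0≤2
            -- With Ωg = (r-1)q² and the lower bound on `Y`, the left side is at most e D R - (r-1)
            -- q e (D - q), and e (D - q) = e² is non-negative because `e` is the positive part of D
            -- - q.
            cross : e * (Ω * g - Y) ≤ 2ℚ * (2ℚ * R)
            cross = ≤-trans (*-monoˡ (0≤exc v) (-‿mono (≤-reflexive Ωg) Y≥))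
              (≡-≤ (ring₆₆ e (D v) q (ι r₁) R) (≤-trans (≤-≡ (+-monoʳ-≤ (e * D v * R) (neg-mono (0≤* (0≤* (0≤ι r₁) 0≤q) (≤-≡ (0≤x² e) (sym (⁺-* (D v - q))))))) (+-identityʳ (e * D v * R)))
                (≤-≡ (*-monoʳ 0≤R (*-mono (0≤deg A v) 0≤2 e≤2 (D≤2 v))) (*-assoc 2ℚ 2ℚ R))))

        -- The condition on `g` lets the target fall exactly as fast as the expected load of a
        -- vertex that sits at the target, by (r-1)q²/Ω per step. The excess then grows only through
        -- terms of second order.
        E-Q : ∀ g → 0ℚ ≤ g → Ω * g ≡ ι r₁ * (q * q) →
          E (λ o → Q (after A o) (q - g)) ≤ Ω * Q A q + N * (12ℚ * (ι r * ι r * α) + Ω * g * g)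
        E-Q g 0≤g Ωg = ≡-≤ (E-∑ vs (λ v o → exc (after A o) (q - g) v * exc (after A o) (q - g) v))
          (≤-trans (∑-mono vs (λ v → At.E-exc v g 0≤g Ωg))
          (≤-reflexive (trans (∑-+ vs (λ v → Ω * (exc A q v * exc A q v)) (λ _ → X))
            (cong₂ _+_ (∑-*ˡ vs Ω (λ v → exc A q v * exc A q v)) (∑-const vs X)))))
          where
          X : ℚ
          X = 12ℚ * (ι r * ι r * α) + Ω * g * g

        gain : Option → ℚ
        gain (edge _) = 1ℚ
        gain (waste _) = 0ℚ
        gain idle = 0ℚ

        E-gain : E gain ≡ tot A
        E-gain = trans (E-split gain) (trans (cong₂ _+_ (∑-cong is (λ i → *-identityʳ (ψ i * live A i)))
          (cong₂ _+_ (trans (∑-cong vs (λ v → *-zeroʳ (ω v))) (∑-0 vs)) (*-zeroʳ (p idle)))) (+-identityʳ (tot A)))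

      tot≤∑deg : ∀ A → tot A ≤ ∑ vs (deg A)
      tot≤∑deg A = ≤-trans (∑-mono is one) (≤-≡ (vertex-sum A (λ _ → 1ℚ) (λ _ → 0≤1)) (∑-cong vs (λ v → *-identityˡ (deg A v))))
        where
        one : ∀ i → ψ i * live A i ≤ ψ i * live A i * ∑[ l ∈ js ] 1ℚ
        one i = ≤-≡ (≤-by _ (0≤* (0≤* (0≤ψ i) (0≤live A i)) (0≤ι r₁)) (ring₅ (ψ i * live A i) (ι r₁)))
          (cong (ψ i * live A i *_) (trans (sym (ι-suc r₁)) (trans (cong ι (sym (length-allFin r))) (sym (∑-1 js)))))

      tot≤2N : ∀ A → (∀ v → deg A v ≤ 2ℚ) → tot A ≤ N * 2ℚ
      tot≤2N A D≤2 = ≤-trans (tot≤∑deg A) (≤-trans (∑-mono vs D≤2) (≤-reflexive (∑-const vs 2ℚ)))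

      deg-after : ∀ A o v → deg (after A o) v ≤ deg A v
      deg-after A o v = ∑-mono is (λ i → ∑-mono js (λ j → *-monoˡ (0≤hit i j v) (*-monoˡ (0≤ψ i)
        (≡-≤ (liveBut-after A o i j) (≤-≡ (*-monoˡ (0≤liveBut A i j) (Bonferroni.∏1-≤1 (κ′ i j o) (0≤κ′ i j o) (κ′≤1 i j o))) (*-identityʳ _))))))

      live-dead : ∀ A i l → A (H i l) ≡ false → live A i ≡ 0ℚ
      live-dead A i l dead = trans (live-split A i l) (trans (cong (λ b → ⟦ b ⟧ * liveBut A i l) dead)
        (trans (cong (_* liveBut A i l) ⟦false⟧) (*-zeroˡ (liveBut A i l))))

      -- Positive weight forces all vertices of the new edge to be alive, and `P` lives on the
      -- vertices which this edge leaves over.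
      extend-matching : ∀ A i → i ∈ is → 0ℚ < ψ i * live A i → ∀ P → IsMatching (after A (edge i)) P → IsMatching A (i ∷ P)
      extend-matching A i i∈ 0<p P match v = ≡-≤ (∑-∷ i P (λ i → ∑[ j ∈ js ] hit i j v))
        (≤-trans (+-mono-≤ (≤-reflexive (κ-edge i∈ v)) (match v)) (merge (Fin.any? (λ j → H i j ≟V v))))
        where
        alive : ∀ l → A (H i l) ≡ true
        alive l with A (H i l) in e
        ... | true = refl
        ... | false = ⊥-elim (<-irrefl (sym (trans (cong (ψ i *_) (live-dead A i l e)) (*-zeroʳ (ψ i)))) 0<p)
        merge : (d : Dec (∃[ j ] H i j ≡ v)) → ⟦ d ⟧ᵈ + ⟦ A v ∧ not (does d) ⟧ ≤ ⟦ A v ⟧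
        merge (yes (j , refl)) rewrite alive j = ≤-reflexive (trans (cong (⟦ true ⟧ +_) ⟦false⟧) (+-identityʳ ⟦ true ⟧))
        merge (no _) with A v
        ... | true = ≤-reflexive (trans (cong (_+ ⟦ true ⟧) ⟦false⟧) (+-identityˡ ⟦ true ⟧))
        ... | false = ≤-reflexive (trans (cong (_+ ⟦ false ⟧) ⟦false⟧) (+-identityˡ ⟦ false ⟧))

      weaken-matching : ∀ A o P → IsMatching (after A o) P → IsMatching A P
      weaken-matching A o P match v = ≤-trans (match v) (le (A v) (kill o v))
        where
        le : ∀ a b → ⟦ a ∧ not b ⟧ ≤ ⟦ a ⟧
        le true b = ≤-≡ (⟦⟧≤1 (not b)) (sym ⟦true⟧)
        le false b = ≤-refl

      -- q is the current target load and u = 1/q; each step hits a given live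
      -- vertex with probability at least τ, so the target shrinks by x = 1 - (r-1)τ.
      record Rates : Set where
        field
          m τ y Um θ θ′ κm : ℚ
          0<m : 0ℚ < m
          0≤τ : 0ℚ ≤ τ
          τm : τ * m ≡ 1ℚ
          xy : (1ℚ - ι r₁ * τ) * y ≡ 1ℚ
          rτ≤1 : ι r * τ ≤ 1ℚ
          0<y : 0ℚ < y
          0≤θ : 0ℚ ≤ θ
          0≤θ′ : 0ℚ ≤ θ′
          θθ′ : θ * θ′ ≡ 1ℚ
          0≤κm : 0ℚ ≤ κm
          roomy : N * (1ℚ + 2ℚ) * Um ≤ m

      module Run (ℛ : Rates) where
        open Rates ℛ

        x : ℚ
        x = 1ℚ - ι r₁ * τ

        -- Equal to (1 - rτ)/(1 - (r-1)τ), the factor by which `u * tot A` changes in an ideal step: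
        -- the weight loses the proportion rτ while the target is multiplied by `x`.
        ρ : ℚ
        ρ = (x - τ) * y

        -- Chosen together with `err` so that the losses of one step are paid for when the
        -- coefficients `ι T * κ₁` and `ι T * err` drop by one unit of T. The factor θ′ = 1/θ trades
        -- a first moment of the excess for a second one.
        κ₁ : ℚ
        κ₁ = 2ℚ * Um * Um * θ′ * τ

        e₃ : ℚ
        e₃ = 12ℚ * (ι r * ι r * α) + ι r * ι r * τ

        err : ℚ
        err = N * τ * (2ℚ * Um * Um * θ + κm * e₃ * Um)

        -- A geometric series: the ideal process gains u·tot·τ(1 + ρ + ... + ρ^(T-1)) edges in T
        -- steps, and τ/(1-ρ) = x.
        b : ℕ → ℚ
        b T = x * (1ℚ - ρ ^ T)

        0≤x-τ : 0ℚ ≤ x - τ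
        0≤x-τ = ≤-≡ (0≤-diff rτ≤1) (trans (cong (λ z → 1ℚ - z * τ) (ι-suc r₁)) (ring₂₂ (ι r₁) τ))

        τ≤x : τ ≤ x
        τ≤x = diff-0≤ 0≤x-τ

        0≤x : 0ℚ ≤ x
        0≤x = ≤-trans 0≤τ τ≤x

        x≤1 : x ≤ 1ℚ
        x≤1 = ≤-by (ι r₁ * τ) (0≤* (0≤ι r₁) 0≤τ) (ring₁₇ (ι r₁ * τ))

        0≤y : 0ℚ ≤ y
        0≤y = <⇒≤ 0<y

        1≤y : 1ℚ ≤ y
        1≤y = ≡-≤ (sym xy) (≤-≡ (*-monoʳ 0≤y x≤1) (*-identityˡ y))

        0<x : 0ℚ < x
        0<x = subst (0ℚ <_) (trans (sym (*-identityʳ (inv y))) (trans (cong (inv y *_) (sym xy)) (trans (ring₂₃ (inv y) x y) (trans (cong (_* x) (inv-* 0<y)) (*-identityˡ x))))) (0<inv 0<y)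

        ρx : ρ * x ≡ x - τ
        ρx = trans (ring₇ (x - τ) y x) (trans (cong ((x - τ) *_) xy) (*-identityʳ (x - τ)))

        0≤ρ : 0ℚ ≤ ρ
        0≤ρ = 0≤* 0≤x-τ 0≤y

        ρ≤1 : ρ ≤ 1ℚ
        ρ≤1 = ≤-≡ (*-monoʳ 0≤y (≤-by {x - τ} {x} τ 0≤τ (ring₂₄ x τ))) xy

        ρ^≤1 : ∀ T → ρ ^ T ≤ 1ℚ
        ρ^≤1 ℕ.zero = ≤-refl
        ρ^≤1 (ℕ.suc T) = ≤-≡ (*-mono (0≤^ T 0≤ρ) 0≤1 ρ≤1 (ρ^≤1 T)) (*-identityˡ 1ℚ)

        0≤b : ∀ T → 0ℚ ≤ b T
        0≤b T = 0≤* 0≤x (0≤-diff (ρ^≤1 T))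

        b≤1 : ∀ T → b T ≤ 1ℚ
        b≤1 T = ≤-≡ (*-mono (0≤-diff (ρ^≤1 T)) 0≤1 x≤1 (≤-by (ρ ^ T) (0≤^ T 0≤ρ) (ring₁₇ (ρ ^ T)))) (*-identityˡ 1ℚ)

        b-suc : ∀ T → b (ℕ.suc T) ≡ τ + ρ * b T
        b-suc T = trans (ring₂₅ x ρ (ρ ^ T)) (trans (cong (λ z → x - z * ρ ^ T) ρx) (trans (ring₂₆ x τ (ρ ^ T)) (trans (cong (λ z → τ + z * (1ℚ - ρ ^ T)) (sym ρx)) (ring₂₇ τ ρ x (ρ ^ T)))))

        mb : ∀ T → m * b (ℕ.suc T) ≡ 1ℚ + b T * y * (m - ι r)
        mb T = trans (cong (m *_) (b-suc T)) (trans (ring₂₈ m τ (ι r₁) y (b T)) (trans (cong (λ z → z + (m - ι r₁ * z - z) * y * b T) τm)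
          (trans (ring₂₉ m (ι r₁) y (b T)) (cong (λ z → 1ℚ + b T * y * (m - z)) (sym (ι-suc r₁))))))

        -- Either z ≤ θ or z ≤ z²/θ. The process controls the mean square of the excess, whereas the
        -- loss of weight involves its sum.
        ≤θ : ∀ z → 0ℚ ≤ z → z ≤ θ + θ′ * (z * z)
        ≤θ z 0≤z with ≤-total z θ
        ... | inj₁ z≤θ = ≤-trans z≤θ (≤-by (θ′ * (z * z)) (0≤* 0≤θ′ (0≤x² z)) refl)
        ... | inj₂ θ≤z = ≤-trans (≡-≤ (trans (sym (*-identityʳ z)) (trans (cong (z *_) (sym θθ′)) (ring₁₆ z θ θ′)))
                (≤-≡ (*-monoʳ (0≤* 0≤z 0≤θ′) θ≤z) (ring₃₀ z θ′))) (≤-by θ 0≤θ (+-comm (θ′ * (z * z)) θ))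

        -- The guarantee for T further steps from the present state, with u = 1/q. It is charged for
        -- the present excess `Q A q`; this makes the induction work, as every step may then be
        -- taken according to the guarantee left after it.
        Outcome : ℕ → (V → Bool) → ℚ → ℚ → Set
        Outcome T A q u = ∃[ P ] (IsMatching A P × (∀ {i} → i ∈ P → i ∈ is) ×
          b T * u * tot A ≤ ι (length P) + ι T * κ₁ * Q A q + ι T * err)

        -- `u` is multiplied by `y` in each step, so `uUm` keeps 1/q below `Um` until the last
        -- remaining step; `Tκ` bounds the accumulated price of the excess.
        record Position : Set where
          field
            T : ℕ
            A : V → Bool
            q u : ℚ
            qu : q * u ≡ 1ℚ
            0<q : 0ℚ < q
            q≤1 : q ≤ 1ℚ
            0≤u : 0ℚ ≤ u
            uUm : u * y ^ ℕ.suc T ≤ Um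
            Tκ : ι (ℕ.suc T) * κ₁ ≤ κm
            D≤2 : ∀ v → deg A v ≤ 2ℚ

        module Advance (𝒫 : Position) where
          open Position 𝒫

          0≤q : 0ℚ ≤ q
          0≤q = <⇒≤ 0<q
          0≤m : 0ℚ ≤ m
          0≤m = <⇒≤ 0<m
          Ω g u′ t t₊ : ℚ
          Ω = q * m
          g = ι r₁ * τ * q
          u′ = u * y
          t = ι T
          t₊ = ι (ℕ.suc T)
          0<Ω : 0ℚ < Ω
          0<Ω = 0<* 0<q 0<m
          0≤g : 0ℚ ≤ g
          0≤g = 0≤* (0≤* (0≤ι r₁) 0≤τ) 0≤q
          0≤u′ : 0ℚ ≤ u′
          0≤u′ = 0≤* 0≤u 0≤y
          u′Um : u′ * y ^ T ≤ Um
          u′Um = ≡-≤ (*-assoc u y (y ^ T)) uUm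
          u′≤Um : u′ ≤ Um
          u′≤Um = ≤-trans (≡-≤ (sym (*-identityʳ u′)) (*-monoˡ 0≤u′ (1≤^ T 1≤y))) u′Um
          0≤Um : 0ℚ ≤ Um
          0≤Um = ≤-trans 0≤u′ u′≤Um
          u≤Um : u ≤ Um
          u≤Um = ≤-trans (≡-≤ (sym (*-identityʳ u)) (*-monoˡ 0≤u 1≤y)) u′≤Um
          1≤qUm : 1ℚ ≤ q * Um
          1≤qUm = ≡-≤ (sym qu) (*-monoˡ 0≤q u≤Um)
          0≤N : 0ℚ ≤ N
          0≤N = 0≤ι (length vs)
          -- The edges weigh at most 2N and the discarded vertices at most N; since q·Um ≥ 1,
          -- `roomy` makes Ω = q m at least 3N.
          room : tot A + ∑[ v ∈ vs ] (⟦ A v ⟧ * (q - deg A v) ⁺) ≤ Ω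
          room = ≤-trans (+-mono-≤ (tot≤2N A D≤2) (≤-trans (∑-mono vs waste≤1) (≤-reflexive (∑-const vs 1ℚ))))
            (≤-trans (≡-≤ (ring₃₁ N) (≤-trans (≡-≤ (sym (*-identityʳ (N * (1ℚ + 2ℚ)))) (*-monoˡ (0≤* 0≤N (0≤+ 0≤1 0≤2)) 1≤qUm)) (≤-reflexive (ring₃₂ N q Um)))) (*-monoˡ 0≤q roomy))
            where
            waste≤1 : ∀ v → ⟦ A v ⟧ * (q - deg A v) ⁺ ≤ 1ℚ
            waste≤1 v = ≤-≡ (*-mono (0≤⁺ (q - deg A v)) 0≤1 (⟦⟧≤1 (A v)) (⁺-lub (≤-trans (≤-≡ (+-monoʳ-≤ q (neg-mono (0≤deg A v))) (+-identityʳ q)) q≤1) 0≤1)) (*-identityˡ 1ℚ)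
          now : StepState
          now = record { A = A ; q = q ; Ω = Ω ; 0≤q = 0≤q ; q≤1 = q≤1 ; D≤2 = D≤2 ; room = room }
          module S = Step now
          q′≡ : q - g ≡ q * x
          q′≡ = ring₃₃ q (ι r₁ * τ)
          q′u′ : (q - g) * u′ ≡ 1ℚ
          q′u′ = trans (cong (_* u′) q′≡) (trans (ring₁₁ q x u y) (trans (cong₂ _*_ qu xy) (*-identityˡ 1ℚ)))
          0<q′ : 0ℚ < q - g
          0<q′ = subst (0ℚ <_) (sym q′≡) (0<* 0<q 0<x)
          q′≤1 : q - g ≤ 1ℚ
          q′≤1 = ≤-trans (≤-≡ (+-monoʳ-≤ q (neg-mono 0≤g)) (+-identityʳ q)) q≤1
          Tκ′ : ι T * κ₁ ≤ κm
          Tκ′ = ≤-trans (*-monoʳ (0≤* (0≤* (0≤* (0≤* 0≤2 0≤Um) 0≤Um) 0≤θ′) 0≤τ) (ι-mono (ℕ.n≤1+n T))) Tκ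
          -- `B` is the guarantee to be proved for T+1 steps, `G o` the one that remains after
          -- option `o` together with the edge gained by it. It suffices that `G` is at least `B` on
          -- average.
          B : ℚ
          B = b (ℕ.suc T) * u * tot A - t₊ * κ₁ * Q A q - t₊ * err
          G : Option → ℚ
          G o = S.gain o + b T * u′ * tot (after A o) - t * κ₁ * Q (after A o) (q - g) - t * err
          X : ℚ
          X = ∑[ v ∈ vs ] exc A q v
          0≤κ₁ : 0ℚ ≤ κ₁
          0≤κ₁ = 0≤* (0≤* (0≤* (0≤* 0≤2 0≤Um) 0≤Um) 0≤θ′) 0≤τ
          0≤Q : 0ℚ ≤ Q A q
          0≤Q = 0≤∑ vs (λ v → 0≤x² (exc A q v))
          Z : ℚ
          Z = N * (12ℚ * (ι r * ι r * α) + Ω * g * g)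
          EG : S.E G ≡ tot A + b T * u′ * S.E (λ o → tot (after A o)) - t * κ₁ * S.E (λ o → Q (after A o) (q - g)) - Ω * (t * err)
          EG = trans (S.E-- (λ o → S.gain o + b T * u′ * tot (after A o) - t * κ₁ * Q (after A o) (q - g)) (λ _ → t * err))
            (cong₂ _-_ (trans (S.E-- (λ o → S.gain o + b T * u′ * tot (after A o)) (λ o → t * κ₁ * Q (after A o) (q - g)))
              (cong₂ _-_ (trans (S.E-+ S.gain (λ o → b T * u′ * tot (after A o))) (cong₂ _+_ S.E-gain (S.E-*ˡ (b T * u′) (λ o → tot (after A o)))))
                (S.E-*ˡ (t * κ₁) (λ o → Q (after A o) (q - g))))) (S.E-const (t * err)))
          Ωg : Ω * g ≡ ι r₁ * (q * q)
          Ωg = trans (ring₃₄ q m (ι r₁) τ) (trans (cong (ι r₁ * (q * q) *_) τm) (*-identityʳ (ι r₁ * (q * q))))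
          r₁≤r : ι r₁ ≤ ι r
          r₁≤r = ι-mono (ℕ.n≤1+n r₁)
          Ωgg≤ : Ω * g * g ≤ ι r * ι r * τ
          Ωgg≤ = ≡-≤ (trans (cong (_* g) Ωg) (ring₃₅ (ι r₁) q τ)) (≤-≡ (*-monoʳ 0≤τ (*-mono (0≤* 0≤q (0≤* 0≤q 0≤q)) (0≤* (0≤ι r) (0≤ι r)) (*-mono (0≤ι r₁) (0≤ι r) r₁≤r r₁≤r) qqq≤1)) (cong (_* τ) (*-identityʳ (ι r * ι r))))
            where
            qqq≤1 : q * (q * q) ≤ 1ℚ
            qqq≤1 = ≤-trans (*-mono (0≤* 0≤q 0≤q) 0≤1 q≤1 (*-mono 0≤q 0≤1 q≤1 q≤1)) (≤-reflexive refl)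
          Z≤ : Z ≤ N * e₃
          Z≤ = *-monoˡ 0≤N (+-monoʳ-≤ (12ℚ * (ι r * ι r * α)) Ωgg≤)
          X≤ : X ≤ N * θ + θ′ * Q A q
          X≤ = ≤-trans (∑-mono vs (λ v → ≤θ (exc A q v) (S.0≤exc v))) (≤-reflexive (trans (∑-+ vs (λ _ → θ) (λ v → θ′ * (exc A q v * exc A q v)))
            (cong₂ _+_ (∑-const vs θ) (∑-*ˡ vs θ′ (λ v → exc A q v * exc A q v)))))
          -- Without excess the drift is exactly zero: expected gain and expected decay of the
          -- weight combine to the recursion of the series `b`.
          main : tot A + b T * u′ * (tot A * (Ω - ι r * q)) ≡ Ω * (b (ℕ.suc T) * u * tot A)
          main = trans (ring₃₆ (tot A) (b T) u y q m (ι r)) (trans (cong (λ z → tot A + b T * y * (m - ι r) * tot A * z) qu)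
            (trans (ring₃₇ (tot A) (b T * y * (m - ι r))) (trans (cong (λ z → z * tot A) (sym (mb T))) (trans (ring₃₈ (m * b (ℕ.suc T)) (tot A)) (trans (cong (_* (m * b (ℕ.suc T) * tot A)) (sym qu)) (ring₃₉ q u m (b (ℕ.suc T)) (tot A)))))))
          -- The losses, of weight through the excess and by growth of `Q`, carry no factor Ω = q m.
          -- It is inserted by means of 1 ≤ q·Um and τ m = 1, which explains the powers of `Um` and
          -- the factor τ in `κ₁` and `err`.
          loss : b T * u′ * (2ℚ * X) + t * κ₁ * Z ≤ Ω * (κ₁ * Q A q) + Ω * err
          loss = begin
            b T * u′ * (2ℚ * X) + t * κ₁ * Z
              ≤⟨ +-mono-≤ (*-mono (0≤* 0≤2 (0≤∑ vs S.0≤exc)) 0≤Um (≤-≡ (*-mono 0≤u′ 0≤1 (b≤1 T) u′≤Um) (*-identityˡ Um)) (*-monoˡ 0≤2 X≤))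
                          (≤-trans (*-monoˡ (0≤* (0≤ι T) 0≤κ₁) Z≤) (*-monoʳ (0≤* 0≤N 0≤e₃) (≤-trans (*-monoʳ 0≤κ₁ (ι-mono (ℕ.n≤1+n T))) Tκ))) ⟩
            Um * (2ℚ * (N * θ + θ′ * Q A q)) + κm * (N * e₃)
              ≡⟨ ring₄₀ Um N θ θ′ (Q A q) κm e₃ ⟩
            1ℚ * W
              ≤⟨ *-monoʳ 0≤W 1≤qUm ⟩
            q * Um * W
              ≡⟨ sym (trans (ring₂₁ q m Um θ θ′ τ (Q A q) N κm e₃) (trans (cong (λ z → q * Um * W * z) τm) (*-identityʳ (q * Um * W)))) ⟩
            Ω * (κ₁ * Q A q) + Ω * err ∎
            where
            open ≤-Reasoning
            0≤e₃ : 0ℚ ≤ e₃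
            0≤e₃ = 0≤+ (0≤* (0≤* (0≤* 0≤2 0≤2) (0≤+ 0≤1 0≤2)) (0≤* (0≤* (0≤ι r) (0≤ι r)) 0≤α)) (0≤* (0≤* (0≤ι r) (0≤ι r)) 0≤τ)
            W : ℚ
            W = 2ℚ * Um * (N * θ + θ′ * Q A q) + κm * (N * e₃)
            0≤W : 0ℚ ≤ W
            0≤W = 0≤+ (0≤* (0≤* 0≤2 0≤Um) (0≤+ (0≤* 0≤N 0≤θ) (0≤* 0≤θ′ 0≤Q))) (0≤* 0≤κm (0≤* 0≤N 0≤e₃))
          average : ∑ S.opts S.p * B ≤ S.E G
          average = ≡-≤ (cong (_* B) S.∑p) (≤-≡ (≤-by _ slack identity) (sym EG))
            where
            slack : 0ℚ ≤ b T * u′ * (S.E (λ o → tot (after A o)) - (tot A * (Ω - ι r * q) - 2ℚ * X))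
                       + (t * κ₁ * (Ω * Q A q + Z - S.E (λ o → Q (after A o) (q - g))) + (Ω * (κ₁ * Q A q) + Ω * err - (b T * u′ * (2ℚ * X) + t * κ₁ * Z)))
            slack = 0≤+ (0≤* (0≤* (0≤b T) 0≤u′) (0≤-diff S.E-tot)) (0≤+ (0≤* (0≤* (0≤ι T) 0≤κ₁) (0≤-diff (S.E-Q g 0≤g Ωg))) (0≤-diff loss))
            M E₁ E₂ : ℚ
            M = b (ℕ.suc T) * u * tot A
            E₁ = S.E (λ o → tot (after A o))
            E₂ = S.E (λ o → Q (after A o) (q - g))
            identity : Ω * B + (b T * u′ * (E₁ - (tot A * (Ω - ι r * q) - 2ℚ * X)) + (t * κ₁ * (Ω * Q A q + Z - E₂) + (Ω * (κ₁ * Q A q) + Ω * err - (b T * u′ * (2ℚ * X) + t * κ₁ * Z))))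
              ≡ tot A + b T * u′ * E₁ - t * κ₁ * E₂ - Ω * (t * err)
            identity = trans (cong (_+ rest) (trans (ring₄₁ Ω M (t₊ * κ₁ * Q A q) (t₊ * err)) (cong (λ z → Ω * M - Ω * (z * κ₁ * Q A q) - Ω * (z * err)) (ι-suc T))))
              (trans (ring₂₀ Ω M t κ₁ (Q A q) err (tot A) (b T * u′) (tot A * (Ω - ι r * q)) X E₁ E₂ Z)
                (trans (cong (_+ final) (trans (cong (λ z → Ω * M - z) main) (+-inverseʳ (Ω * M)))) (+-identityˡ final)))
              where
              rest final : ℚ
              rest = b T * u′ * (E₁ - (tot A * (Ω - ι r * q) - 2ℚ * X)) + (t * κ₁ * (Ω * Q A q + Z - E₂) + (Ω * (κ₁ * Q A q) + Ω * err - (b T * u′ * (2ℚ * X) + t * κ₁ * Z)))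
              final = tot A + b T * u′ * E₁ - t * κ₁ * E₂ - Ω * (t * err)
          conclude : ∀ o (P : List I) → B ≤ G o → b T * u′ * tot (after A o) ≤ ι (length P) + t * κ₁ * Q (after A o) (q - g) + t * err →
            b (ℕ.suc T) * u * tot A ≤ S.gain o + ι (length P) + t₊ * κ₁ * Q A q + t₊ * err
          conclude o P B≤ ih = ≡-≤ (ring₄₂ (b (ℕ.suc T) * u * tot A) k₊ (t₊ * err))
            (+-monoˡ-≤ (t₊ * err) {B + k₊} {l + k₊} (+-monoˡ-≤ k₊ {B} {l} (≤-trans {B} {G o} {l} B≤ G≤)))
            where
            k₊ l w k′ : ℚ
            k₊ = t₊ * κ₁ * Q A q
            l = S.gain o + ι (length P)
            w = b T * u′ * tot (after A o)
            k′ = t * κ₁ * Q (after A o) (q - g)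
            G≤ : G o ≤ l
            G≤ = ≤-by {G o} {l} (ι (length P) + k′ + t * err - w) (0≤-diff {w} {ι (length P) + k′ + t * err} ih)
              (ring₄₃ (S.gain o) w k′ (t * err) (ι (length P)))
          finish : (∀ o → Outcome T (after A o) (q - g) u′) → ∃[ o ] (o ∈ S.opts × 0ℚ < S.p o × B ≤ G o) → Outcome (ℕ.suc T) A q u
          finish IH (edge i , o∈ , 0<p , B≤) with IH (edge i)
          ... | P , match , P⊆ , ih = i ∷ P , extend-matching A i i∈ 0<p P match , (λ { (here refl) → i∈ ; (there h) → P⊆ h }) ,
            ≤-≡ (conclude (edge i) P B≤ ih) (cong (λ z → z + t₊ * κ₁ * Q A q + t₊ * err) (sym (ι-suc (length P))))
            where
            i∈ : i ∈ is
            i∈ with ∈-++⁻ (map edge is) o∈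
            ... | inj₁ h with ∈-map⁻ edge h
            ...   | _ , h′ , refl = h′
            i∈ | inj₂ h with ∈-++⁻ (map waste vs) h
            ...   | inj₁ h′ with ∈-map⁻ waste h′
            ...     | _ , _ , ()
            i∈ | inj₂ h | inj₂ (here ())
          finish IH (waste w , _ , _ , B≤) with IH (waste w)
          ... | P , match , P⊆ , ih = P , weaken-matching A (waste w) P match , P⊆ , ≤-≡ (conclude (waste w) P B≤ ih) (cong (λ z → z + t₊ * κ₁ * Q A q + t₊ * err) (+-identityˡ (ι (length P))))
          finish IH (idle , _ , _ , B≤) with IH idle
          ... | P , match , P⊆ , ih = P , weaken-matching A idle P match , P⊆ , ≤-≡ (conclude idle P B≤ ih) (cong (λ z → z + t₊ * κ₁ * Q A q + t₊ * err) (+-identityˡ (ι (length P))))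
          advance : (∀ o → Outcome T (after A o) (q - g) u′) → Outcome (ℕ.suc T) A q u
          advance IH = finish IH (∑-pick S.opts S.p G B (λ {o} _ → S.0≤p o) (subst (0ℚ <_) (sym S.∑p) 0<Ω) average)

        run : ∀ T A q u → q * u ≡ 1ℚ → 0ℚ < q → q ≤ 1ℚ → 0ℚ ≤ u → u * y ^ T ≤ Um → ι T * κ₁ ≤ κm →
          (∀ v → deg A v ≤ 2ℚ) → Outcome T A q u
        run ℕ.zero A q u _ _ _ _ _ _ _ = [] , (λ v → ≡-≤ (∑-[] _) (0≤⟦⟧ (A v))) , (λ ()) ,
          ≤-reflexive (trans (ring₄₄ x u (tot A)) (sym (trans (cong (λ z → z + z * κ₁ * Q A q + z * err) ι-0) (ring₄₅ κ₁ (Q A q) err))))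
        run (ℕ.suc T) A q u qu 0<q q≤1 0≤u uUm Tκ D≤2 = M.advance (λ o →
          run T (after A o) (q - M.g) M.u′ M.q′u′ M.0<q′ M.q′≤1 M.0≤u′ M.u′Um M.Tκ′ (λ v → ≤-trans (deg-after A o v) (D≤2 v)))
          where
          position : Position
          position = record { T = T ; A = A ; q = q ; u = u ; qu = qu ; 0<q = 0<q ; q≤1 = q≤1 ; 0≤u = 0≤u ; uUm = uUm ; Tκ = Tκ ; D≤2 = D≤2 }
          module M = Advance position

-- Parameters of the nibble and the resulting matching theorem.

module NibbleTheorem where
  open import Data.Rational
  open import Data.Rational.Properties
  open RingIdentities
  open Rationals
  open Nibble

  bernoulli : ∀ z n → 0ℚ ≤ z → z ≤ 1ℚ → 1ℚ - ι n * z ≤ (1ℚ - z) ^ n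
  bernoulli z ℕ.zero 0≤z z≤1 = ≤-reflexive (trans (cong (λ t → 1ℚ - t * z) ι-0) (ring₆₇ z))
  bernoulli z (ℕ.suc n) 0≤z z≤1 = ≡-≤ (cong (λ t → 1ℚ - t * z) (ι-suc n))
    (≤-by {1ℚ - (1ℚ + ι n) * z} {(1ℚ - z) * (1ℚ - z) ^ n} (ι n * z * z + (1ℚ - z) * ((1ℚ - z) ^ n - (1ℚ - ι n * z)))
      (0≤+ (0≤* (0≤* (0≤ι n) 0≤z) 0≤z) (0≤* (0≤-diff z≤1) (0≤-diff (bernoulli z n 0≤z z≤1)))) (ring₆₈ (ι n) z ((1ℚ - z) ^ n)))

  -- The left side does not increase with n. This stands in for the exponential bound on (1-z)^n.
  geometric-decay : ∀ z n → 0ℚ ≤ z → z ≤ 1ℚ → (1ℚ - z) ^ n * (1ℚ + ι n * z) ≤ 1ℚ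
  geometric-decay z ℕ.zero 0≤z z≤1 = ≤-reflexive (trans (cong (λ t → 1ℚ * (1ℚ + t * z)) ι-0) (ring₆₉ z))
  geometric-decay z (ℕ.suc n) 0≤z z≤1 = ≤-trans (≡-≤ (cong (λ t → (1ℚ - z) * w * (1ℚ + t * z)) (ι-suc n))
    (≤-by {(1ℚ - z) * w * (1ℚ + (1ℚ + ι n) * z)} {w * (1ℚ + ι n * z)} (w * ((1ℚ + ι n) * (z * z)))
      (0≤* (0≤^ n (0≤-diff z≤1)) (0≤* (0≤+ 0≤1 (0≤ι n)) (0≤* 0≤z 0≤z))) (ring₇₀ w (ι n) z))) (geometric-decay z n 0≤z z≤1)
    where
    w : ℚ
    w = (1ℚ - z) ^ n

  ^-* : ∀ x m n → x ^ (m ℕ.* n) ≡ (x ^ n) ^ m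
  ^-* x ℕ.zero n = refl
  ^-* x (ℕ.suc m) n = trans (add n (m ℕ.* n)) (cong (x ^ n *_) (^-* x m n))
    where
    add : ∀ a b → x ^ (a ℕ.+ b) ≡ x ^ a * x ^ b
    add ℕ.zero b = sym (*-identityˡ (x ^ b))
    add (ℕ.suc a) b = trans (cong (x *_) (add a b)) (sym (*-assoc x (x ^ a) (x ^ b)))

  ^-inverse : ∀ {x y} n → x * y ≡ 1ℚ → x ^ n * y ^ n ≡ 1ℚ
  ^-inverse ℕ.zero _ = *-identityˡ 1ℚ
  ^-inverse {x} {y} (ℕ.suc n) xy = trans (ring₁₁ x (x ^ n) y (y ^ n)) (trans (cong₂ _*_ xy (^-inverse n xy)) (*-identityˡ 1ℚ))

  -- The Pippenger–Kahn theorem on fractional matchings, with an error that is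
  -- additive in the number of vertices.
  module Params (r₁ : ℕ) (δ : ℚ) (0<δ : 0ℚ < δ) where
    r : ℕ
    r = ℕ.suc r₁

    δ₀-small : ∃[ d ] (0ℚ < d × d ≤ 1ℚ × 2ℚ * 2ℚ * d ≤ δ)
    δ₀-small = small (2ℚ * 2ℚ) 0<δ
    δ₀ : ℚ
    δ₀ = proj₁ δ₀-small
    0<δ₀ : 0ℚ < δ₀
    0<δ₀ = proj₁ (proj₂ δ₀-small)

    -- The running time Tτ. Taking it at least 2/δ₀ brings ρ^T, the proportion of weight left at the
    -- end, below δ₀/2.
    L : ℕ
    L = proj₁ (archimedean (2ℚ * inv δ₀))

    2≤δ₀L : 2ℚ ≤ δ₀ * ι L
    2≤δ₀L = ≡-≤ (sym (trans (ring₇₅ δ₀ 2ℚ (inv δ₀)) (trans (cong (2ℚ *_) (inv-* 0<δ₀)) (*-identityʳ 2ℚ)))) (*-monoˡ (<⇒≤ 0<δ₀) (proj₂ (archimedean (2ℚ * inv δ₀))))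

    -- The run is divided into this many blocks of `m′` steps; 1/q at most doubles in each, so `Um`
    -- bounds it throughout.
    blocks : ℕ
    blocks = L ℕ.* (2 ℕ.* r)

    Um : ℚ
    Um = 2ℚ ^ blocks

    0≤Um : 0ℚ ≤ Um
    0≤Um = 0≤^ blocks 0≤2

    θ-small : ∃[ t ] (0ℚ < t × t ≤ 1ℚ × ι L * (2ℚ * Um * Um) * t ≤ δ₀)
    θ-small = small (ι L * (2ℚ * Um * Um)) 0<δ₀
    -- `κm` is the value of `ι T * κ₁`, because Tτ = L. It depends on r and δ alone, so α can still
    -- be chosen against it.
    θ θ′ κm : ℚ
    θ = proj₁ θ-small
    θ′ = inv θ
    κm = ι L * (2ℚ * Um * Um * θ′)
    0<θ : 0ℚ < θ
    0<θ = proj₁ (proj₂ θ-small)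
    0≤θ′ : 0ℚ ≤ θ′
    0≤θ′ = <⇒≤ (0<inv 0<θ)
    0≤κm : 0ℚ ≤ κm
    0≤κm = 0≤* (0≤ι L) (0≤* (0≤* (0≤* 0≤2 0≤Um) 0≤Um) 0≤θ′)

    -- The bracket collects the coefficients of α in the final error: `κm` from the excess at the
    -- start, the rest from the growth of the mean square during the run.
    α-small : ∃[ a ] (0ℚ < a × a ≤ 1ℚ × (κm + ι L * (κm * (12ℚ * (ι r * ι r)) * Um)) * a ≤ δ₀)
    α-small = small (κm + ι L * (κm * (12ℚ * (ι r * ι r)) * Um)) 0<δ₀
    α : ℚ
    α = proj₁ α-small
    0<α : 0ℚ < α
    0<α = proj₁ (proj₂ α-small)
    α≤1 : α ≤ 1ℚ
    α≤1 = proj₁ (proj₂ (proj₂ α-small))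

    τ-small : ∃[ t ] (0ℚ < t × t ≤ 1ℚ × (2ℚ * ι r₁ + ι L * (κm * (ι r * ι r) * Um)) * t ≤ δ₀)
    τ-small = small (2ℚ * ι r₁ + ι L * (κm * (ι r * ι r) * Um)) 0<δ₀
    τ₀ : ℚ
    τ₀ = proj₁ τ-small

    N₀ : ℕ
    N₀ = ℕ.suc (proj₁ (archimedean (inv τ₀)))

    K₁ : ℕ
    K₁ = proj₁ (archimedean ((1ℚ + 2ℚ) * Um))

    module Apply (𝓗 : WeightedHypergraph r₁) (N₀≤ : N₀ ℕ.≤ length (WeightedHypergraph.vs 𝓗)) where
      open WeightedHypergraph 𝓗
      open Hypergraph 𝓗 hiding (r)

      -- `m′` is at least 3·N·Um, which gives a step its room. The factor 2r makes m′·r·τ equal to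
      -- 1/2, so that by Bernoulli the target falls by at most a half in m′ steps.
      m′ mℕ T : ℕ
      m′ = length vs ℕ.* ℕ.suc K₁
      mℕ = (2 ℕ.* r) ℕ.* m′
      T = L ℕ.* mℕ

      m τ : ℚ
      m = ι mℕ
      τ = inv m

      1≤N : 1 ℕ.≤ length vs
      1≤N = ℕ.≤-trans (ℕ.s≤s ℕ.z≤n) N₀≤

      N≤m′ : length vs ℕ.≤ m′
      N≤m′ = ℕ.m≤m*n (length vs) (ℕ.suc K₁)

      m′≤m : m′ ℕ.≤ mℕ
      m′≤m = ℕ.m≤n*m m′ (2 ℕ.* r)

      0<m : 0ℚ < m
      0<m = <-≤-trans 0<1 (≡-≤ (sym ι-1) (ι-mono (ℕ.≤-trans 1≤N (ℕ.≤-trans N≤m′ m′≤m))))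

      0<τ : 0ℚ < τ
      0<τ = 0<inv 0<m

      τm : τ * m ≡ 1ℚ
      τm = inv-* 0<m

      τ≤τ₀ : τ ≤ τ₀
      τ≤τ₀ = ≡-≤ (trans (sym (*-identityʳ τ)) (cong (τ *_) (sym (inv-* 0<τ₀))))
        (≤-≡ (*-monoˡ (<⇒≤ 0<τ) (*-monoʳ (<⇒≤ 0<τ₀) big)) (trans (sym (*-assoc τ m τ₀)) (trans (cong (_* τ₀) τm) (*-identityˡ τ₀))))
        where
        0<τ₀ : 0ℚ < τ₀
        0<τ₀ = proj₁ (proj₂ τ-small)
        big : inv τ₀ ≤ m
        big = ≤-trans (proj₂ (archimedean (inv τ₀))) (ι-mono (ℕ.≤-trans (ℕ.n≤1+n _) (ℕ.≤-trans N₀≤ (ℕ.≤-trans N≤m′ m′≤m))))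

      half : ι m′ * (ι r * τ) * 2ℚ ≡ 1ℚ
      half = trans (ring₇₆ (ι m′) (ι r) τ) (trans (cong (τ *_) (sym castm)) τm)
        where
        castm : m ≡ 2ℚ * ι r * ι m′
        castm = trans (ι-* (2 ℕ.* r) m′) (cong (_* ι m′) (trans (ι-* 2 r) (cong (_* ι r) (trans (ι-suc 1) (cong (1ℚ +_) ι-1)))))

      0≤rτ : 0ℚ ≤ ι r * τ
      0≤rτ = 0≤* (0≤ι r) (<⇒≤ 0<τ)

      2r₁τ≤1 : ι m′ * (ι r₁ * τ) * 2ℚ ≤ 1ℚ
      2r₁τ≤1 = ≤-≡ (*-monoʳ 0≤2 (*-monoˡ (0≤ι m′) (*-monoʳ (<⇒≤ 0<τ) (ι-mono (ℕ.n≤1+n r₁))))) half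

      rτ≤1 : ι r * τ ≤ 1ℚ
      rτ≤1 = ≤-trans (≡-≤ (sym (trans (cong (λ z → z * (ι r * τ) * 1ℚ) ι-1) (ring₇₇ (ι r * τ)))) (*-mono 0≤1 (0≤* (0≤ι m′) 0≤rτ)
        (*-monoʳ 0≤rτ (ι-mono (ℕ.≤-trans 1≤N N≤m′))) (≤-by {1ℚ} {2ℚ} 1ℚ 0≤1 refl))) (≤-reflexive half)

      z x : ℚ
      z = ι r₁ * τ
      x = 1ℚ - z

      0≤z : 0ℚ ≤ z
      0≤z = 0≤* (0≤ι r₁) (<⇒≤ 0<τ)

      z≤1 : z ≤ 1ℚ
      z≤1 = ≤-trans (*-monoʳ (<⇒≤ 0<τ) (ι-mono (ℕ.n≤1+n r₁))) rτ≤1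

      1≤2x^ : 1ℚ ≤ 2ℚ * x ^ m′
      1≤2x^ = ≤-trans (≤-by {1ℚ} {2ℚ * (1ℚ - ι m′ * z)} (1ℚ - ι m′ * z * 2ℚ) (0≤-diff 2r₁τ≤1) (ring₇₈ (ι m′ * z))) (*-monoˡ 0≤2 (bernoulli z m′ 0≤z z≤1))

      0<x : 0ℚ < x
      0<x = <-≤-trans 0<τ (≤-by {τ} {x} (1ℚ - ι r * τ) (0≤-diff rτ≤1) (trans (cong (λ w → τ + (1ℚ - w * τ)) (ι-suc r₁)) (ring₇₉ (ι r₁) τ)))

      y : ℚ
      y = inv x

      xy : x * y ≡ 1ℚ
      xy = trans (*-comm x y) (inv-* 0<x)

      y^≤2 : y ^ m′ ≤ 2ℚ
      y^≤2 = ≤-trans (≡-≤ (sym (*-identityˡ (y ^ m′))) (*-monoʳ (0≤^ m′ (<⇒≤ (0<inv 0<x))) 1≤2x^))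
        (≤-reflexive (trans (*-assoc 2ℚ (x ^ m′) (y ^ m′)) (trans (cong (2ℚ *_) (^-inverse m′ xy)) (*-identityʳ 2ℚ))))

      T≡ : T ≡ blocks ℕ.* m′
      T≡ = sym (ℕ.*-assoc L (2 ℕ.* r) m′)

      y^T≤Um : y ^ T ≤ Um
      y^T≤Um = ≡-≤ (trans (cong (y ^_) T≡) (^-* y blocks m′)) (^-mono blocks (0≤^ m′ (<⇒≤ (0<inv 0<x))) y^≤2)

      Tτ : ι T * τ ≡ ι L
      Tτ = trans (cong (_* τ) (ι-* L mℕ)) (trans (*-assoc (ι L) m τ) (trans (cong (ι L *_) (trans (*-comm m τ) τm)) (*-identityʳ (ι L))))

      roomy : N * (1ℚ + 2ℚ) * Um ≤ m
      roomy = ≡-≤ (*-assoc N (1ℚ + 2ℚ) Um) (≤-trans (*-monoˡ (0≤ι (length vs)) (≤-trans (proj₂ (archimedean ((1ℚ + 2ℚ) * Um))) (ι-mono (ℕ.n≤1+n K₁))))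
        (≡-≤ (sym (ι-* (length vs) (ℕ.suc K₁))) (ι-mono m′≤m)))

      -- The process starts at q = u = 1, where every excess is at most α. The weight it does not
      -- turn into edges is the part missing in b T = x(1 - ρ^T), a proportion of at most (r-1)τ +
      -- ρ^T.
      nibble : (∀ u v → codeg u v ≤ α) → ∀ A → (∀ v → deg A v ≤ 1ℚ + α) →
        ∃[ P ] (IsMatching A P × (∀ {i} → i ∈ P → i ∈ is) × tot A ≤ ι (length P) + δ * N)
      nibble codeg≤α A D≤ = P , match , P⊆ , bound
        where
        module Pr = Process α (<⇒≤ 0<α) codeg≤α
        rates : Pr.Rates
        rates = record { m = m ; τ = τ ; y = y ; Um = Um ; θ = θ ; θ′ = θ′ ; κm = κm ; 0<m = 0<m ; 0≤τ = <⇒≤ 0<τ ; τm = τm ; xy = xy ; rτ≤1 = rτ≤1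
          ; 0<y = 0<inv 0<x ; 0≤θ = <⇒≤ 0<θ ; 0≤θ′ = 0≤θ′ ; θθ′ = trans (*-comm θ θ′) (inv-* 0<θ) ; 0≤κm = 0≤κm ; roomy = roomy }
        module R = Pr.Run rates
        Tκ : ι T * R.κ₁ ≡ κm
        Tκ = trans (ring₇₄ (ι T) Um θ′ τ) (cong (_* (2ℚ * Um * Um * θ′)) Tτ)
        D≤2 : ∀ v → deg A v ≤ 2ℚ
        D≤2 v = ≤-trans (D≤ v) (+-monoʳ-≤ 1ℚ α≤1)
        out : R.Outcome T A 1ℚ 1ℚ
        out = R.run T A 1ℚ 1ℚ (*-identityˡ 1ℚ) 0<1 ≤-refl 0≤1 (≡-≤ (*-identityˡ (y ^ T)) y^T≤Um) (≤-reflexive Tκ) D≤2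
        P : List I
        P = proj₁ out
        match : IsMatching A P
        match = proj₁ (proj₂ out)
        P⊆ : ∀ {i} → i ∈ P → i ∈ is
        P⊆ = proj₁ (proj₂ (proj₂ out))
        n p Q₀ w ρT : ℚ
        n = N
        p = ι (length P)
        Q₀ = Q A 1ℚ
        ρT = R.ρ ^ T
        w = 2ℚ * Um * Um * θ + κm * R.e₃ * Um
        0≤n : 0ℚ ≤ n
        0≤n = 0≤ι (length vs)
        result : R.b T * tot A ≤ p + κm * Q₀ + ι L * (n * w)
        result = ≡-≤ (cong (_* tot A) (sym (*-identityʳ (R.b T)))) (≤-≡ (proj₂ (proj₂ (proj₂ out)))
          (cong₂ (λ a c → p + a * Q₀ + c) Tκ (trans (ring₇₃ (ι T) n τ w) (cong (_* (n * w)) Tτ))))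
        Q≤ : Q₀ ≤ n * α
        Q≤ = ≤-trans (∑-mono vs (λ v → *-mono (0≤⁺ _) (<⇒≤ 0<α) (e≤ v) (≤-trans (e≤ v) α≤1))) (≤-reflexive (trans (∑-cong vs (λ _ → *-identityʳ α)) (∑-const vs α)))
          where
          e≤ : ∀ v → exc A 1ℚ v ≤ α
          e≤ v = ⁺-lub (≤-≡ (+-monoˡ-≤ (- 1ℚ) (D≤ v)) (ring₁₅ α)) (<⇒≤ 0<α)
        -- ρ ≤ 1 - τ, and (1-τ)^T ≤ 1/(1 + Tτ) = 1/(1 + L) is already small enough.
        2ρT≤δ₀ : 2ℚ * ρT ≤ δ₀
        2ρT≤δ₀ = ≤-trans (*-monoʳ 0≤ρT 2≤δ₀L) (≤-trans (≡-≤ (ring₇ δ₀ (ι L) ρT) (*-monoˡ (<⇒≤ 0<δ₀) decay)) (≤-reflexive (*-identityʳ δ₀)))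
          where
          0≤ρT : 0ℚ ≤ ρT
          0≤ρT = 0≤^ T R.0≤ρ
          ρ≤ : R.ρ ≤ 1ℚ - τ
          ρ≤ = ≤-trans (≡-≤ (trans (ring₈₀ R.x τ y) (cong (_- τ * y) xy)) (+-monoʳ-≤ 1ℚ (neg-mono (≡-≤ (sym (*-identityʳ τ)) (*-monoˡ (<⇒≤ 0<τ) R.1≤y))))) ≤-refl
          τ≤1 : τ ≤ 1ℚ
          τ≤1 = ≤-trans R.τ≤x R.x≤1
          decay : ρT * ι L ≤ 1ℚ
          decay = ≤-trans (*-mono (0≤ι L) (0≤^ T (0≤-diff τ≤1)) (^-mono T R.0≤ρ ρ≤) (≤-by {ι L} {1ℚ + ι T * τ} 1ℚ 0≤1 (trans (+-comm (ι L) 1ℚ) (cong (1ℚ +_) (sym Tτ))))) (geometric-decay τ T (<⇒≤ 0<τ) τ≤1)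
        tot≤ : tot A ≤ n * 2ℚ
        tot≤ = Pr.tot≤2N A D≤2
        missing : (1ℚ - R.b T) ≤ z + ρT
        missing = ≤-by {1ℚ - R.b T} {z + ρT} (z * ρT) (0≤* 0≤z (0≤^ T R.0≤ρ)) (ring₈₁ z ρT)
        0≤missing : 0ℚ ≤ z + ρT
        0≤missing = 0≤+ 0≤z (0≤^ T R.0≤ρ)
        0≤tot : 0ℚ ≤ tot A
        0≤tot = 0≤∑ is (λ i → 0≤* (0≤ψ i) (Pr.0≤live A i))
        bound : tot A ≤ p + δ * n
        bound = begin
          tot A ≡⟨ ring₈₂ (R.b T) (tot A) ⟩
          R.b T * tot A + (1ℚ - R.b T) * tot A
            ≤⟨ +-mono-≤ {R.b T * tot A} {p + κm * (n * α) + ι L * (n * w)} {(1ℚ - R.b T) * tot A} {n * (2ℚ * z + δ₀)}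
                 (≤-trans result (+-monoˡ-≤ (ι L * (n * w)) (+-monoʳ-≤ p (*-monoˡ 0≤κm Q≤))))
                 (≤-trans (*-mono 0≤tot 0≤missing missing tot≤)
                   (≡-≤ (ring₈₃ z ρT n) (*-monoˡ 0≤n (+-monoʳ-≤ (2ℚ * z) 2ρT≤δ₀)))) ⟩
          p + κm * (n * α) + ι L * (n * w) + n * (2ℚ * z + δ₀)
            ≡⟨ ring₇₁ p n δ₀ (ι L) Um θ κm (ι r * ι r) α τ (ι r₁) ⟩
          p + n * (δ₀ + ι L * (2ℚ * Um * Um) * θ + (κm + ι L * (κm * (12ℚ * (ι r * ι r)) * Um)) * α + (2ℚ * ι r₁ + ι L * (κm * (ι r * ι r) * Um)) * τ)
            ≤⟨ +-monoʳ-≤ p (*-monoˡ 0≤n (+-mono-≤ (+-mono-≤ (+-monoʳ-≤ δ₀ (proj₂ (proj₂ (proj₂ θ-small)))) (proj₂ (proj₂ (proj₂ α-small)))) (≤-trans (*-monoˡ 0≤cτ τ≤τ₀) (proj₂ (proj₂ (proj₂ τ-small)))))) ⟩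
          p + n * (δ₀ + δ₀ + δ₀ + δ₀)
            ≤⟨ +-monoʳ-≤ p (*-monoˡ 0≤n (≡-≤ (ring₇₂ δ₀) (proj₂ (proj₂ (proj₂ δ₀-small))))) ⟩
          p + n * δ ≡⟨ cong (p +_) (*-comm n δ) ⟩
          p + δ * n ∎
          where
          open ≤-Reasoning
          0≤cτ : 0ℚ ≤ 2ℚ * ι r₁ + ι L * (κm * (ι r * ι r) * Um)
          0≤cτ = 0≤+ (0≤* 0≤2 (0≤ι r₁)) (0≤* (0≤ι L) (0≤* (0≤* 0≤κm (0≤* (0≤ι r) (0≤ι r))) 0≤Um))

-- Sums over boxes of tuples.

module Boxes where
  open import Data.Rational
  open import Data.Rational.Properties
  open RingIdentities
  open Rationals

  private variable
    X Y : Set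
    k : ℕ

  box : Vec (List X) k → List (Vec X k)
  box [] = [] ∷ []
  box (l ∷ ls) = concatMap (λ a → map (a ∷_) (box ls)) l

  ∑-box-∷ : ∀ (l : List X) (ls : Vec (List X) k) h → ∑ (box (l ∷ ls)) h ≡ ∑[ a ∈ l ] ∑[ x ∈ box ls ] h (a ∷ x)
  ∑-box-∷ l ls h = trans (∑-concatMap (λ a → map (a ∷_) (box ls)) l h) (∑-cong l (λ a → ∑-map (a ∷_) (box ls) h))

  ∈-box : ∀ (ls : Vec (List X) k) (x : Vec X k) → (∀ i → Vec.lookup x i ∈ Vec.lookup ls i) → x ∈ box ls
  ∈-box [] [] h = here refl
  ∈-box (l ∷ ls) (a ∷ x) h = ∈-concatMap⁺ (λ a → map (a ∷_) (box ls)) (Any.map (λ { refl → ∈-map⁺ (a ∷_) (∈-box ls x (h ∘ suc)) }) (h zero))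

  ∏len : Vec (List X) k → ℚ
  ∏len {k = k} ls = ∏[ u ∈ allFin k ] ι (length (Vec.lookup ls u))

  ∑-box-1 : ∀ (ls : Vec (List X) k) → ∑[ x ∈ box ls ] 1ℚ ≡ ∏len ls
  ∑-box-1 [] = trans (∑-∷ [] [] (λ _ → 1ℚ)) (trans (cong (1ℚ +_) (∑-[] {A = Vec _ 0} (λ _ → 1ℚ))) (trans (+-identityʳ 1ℚ) (sym (∏-[] _))))
  ∑-box-1 (l ∷ ls) = trans (∑-box-∷ l ls (λ _ → 1ℚ)) (trans (∑-cong l (λ _ → ∑-box-1 ls)) (trans (∑-const l (∏len ls)) (sym (∏-suc (λ u → ι (length (Vec.lookup (l ∷ ls) u)))))))

  -- Redrawing coordinate `u` uniformly from its list preserves the uniform distribution on the box.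
  resample : ∀ (ls : Vec (List X) k) u h →
    ∑[ x ∈ box ls ] ∑[ y ∈ Vec.lookup ls u ] h (x [ u ]≔ y) ≡ ι (length (Vec.lookup ls u)) * ∑ (box ls) h
  resample (l ∷ ls) zero h = trans (∑-box-∷ l ls (λ x → ∑[ y ∈ l ] h (x [ zero ]≔ y)))
    (trans (∑-const l (∑[ x ∈ box ls ] ∑[ y ∈ l ] h (y ∷ x))) (cong (ι (length l) *_) (trans (∑-swap (box ls) l (λ x y → h (y ∷ x))) (sym (∑-box-∷ l ls h)))))
  resample (l ∷ ls) (suc u) h = trans (∑-box-∷ l ls (λ x → ∑[ y ∈ Vec.lookup ls u ] h (x [ suc u ]≔ y)))
    (trans (∑-cong l (λ a → resample ls u (λ x → h (a ∷ x)))) (trans (∑-*ˡ l (ι (length (Vec.lookup ls u))) (λ a → ∑[ x ∈ box ls ] h (a ∷ x)))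
    (cong (ι (length (Vec.lookup ls u)) *_) (sym (∑-box-∷ l ls h)))))

  resample₂ : ∀ (ls : Vec (List X) k) u v h →
    ∑[ x ∈ box ls ] ∑[ y ∈ Vec.lookup ls u ] ∑[ z ∈ Vec.lookup ls v ] h ((x [ u ]≔ y) [ v ]≔ z)
      ≡ ι (length (Vec.lookup ls u)) * ι (length (Vec.lookup ls v)) * ∑ (box ls) h
  resample₂ ls u v h = trans (resample ls u (λ x → ∑[ z ∈ Vec.lookup ls v ] h (x [ v ]≔ z)))
    (trans (cong (ι (length (Vec.lookup ls u)) *_) (resample ls v h)) (sym (*-assoc (ι (length (Vec.lookup ls u))) (ι (length (Vec.lookup ls v))) (∑ (box ls) h))))

  ∑-box-∏ : ∀ (ls : Vec (List X) k) (f : Fin k → X → ℚ) →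
    ∑[ x ∈ box ls ] ∏[ u ∈ allFin k ] f u (Vec.lookup x u) ≡ ∏[ u ∈ allFin k ] ∑[ a ∈ Vec.lookup ls u ] f u a
  ∑-box-∏ [] f = trans (∑-∷ [] [] _) (trans (cong₂ _+_ (∏-[] _) (∑-[] {A = Vec _ 0} _)) (trans (+-identityʳ 1ℚ) (sym (∏-[] _))))
  ∑-box-∏ {k = ℕ.suc k} (l ∷ ls) f = trans (∑-box-∷ l ls (λ x → ∏[ u ∈ allFin (ℕ.suc k) ] f u (Vec.lookup x u)))
    (trans (∑-cong l (λ a → trans (∑-cong (box ls) (λ x → ∏-suc (λ u → f u (Vec.lookup (a ∷ x) u)))) (∑-*ˡ (box ls) (f zero a) (λ x → ∏[ u ∈ allFin k ] f (suc u) (Vec.lookup x u)))))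
    (trans (∑-*ʳ l (∑[ x ∈ box ls ] ∏[ u ∈ allFin k ] f (suc u) (Vec.lookup x u)) (f zero))
    (trans (cong (∑ l (f zero) *_) (∑-box-∏ ls (f ∘ suc))) (sym (∏-suc (λ u → ∑[ a ∈ Vec.lookup (l ∷ ls) u ] f u a))))))

-- The regularity lemma for bounded weights.

module Regularity where
  open import Data.Rational
  open import Data.Rational.Properties
  open RingIdentities
  open Rationals
  open Boxes

  sgn : Bool → ℚ
  sgn true = 1ℚ
  sgn false = - 1ℚ

  sgn² : ∀ σ → sgn σ * sgn σ ≡ 1ℚ
  sgn² true = refl
  sgn² false = refl

  cell : ∀ {n M} → (Fin n → Fin M) → Fin M → List (Fin n)
  cell {n} c i = filter (λ a → c a Fin.≟ i) (allFin n)

  size : ∀ {n M} → (Fin n → Fin M) → Fin M → ℚ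
  size c i = ι (length (cell c i))

  0≤size : ∀ {n M} (c : Fin n → Fin M) i → 0ℚ ≤ size c i
  0≤size c i = 0≤ι (length (cell c i))

  ∑-cells : ∀ {n M} (c : Fin n → Fin M) f → ∑[ i ∈ allFin M ] ∑ (cell c i) f ≡ ∑ (allFin n) f
  ∑-cells {n} {M} c f = trans (∑-cong (allFin M) (λ i → ∑-filter (λ a → c a Fin.≟ i) (allFin n) f))
    (trans (∑-swap (allFin M) (allFin n) (λ i a → ⟦ c a Fin.≟ i ⟧ᵈ * f a)) (∑-cong (allFin n) (λ a → ∑-δ (c a) (λ _ → f a))))

  ∑∑-cells : ∀ {n M} (c : Fin n → Fin M) (f : Fin n → Fin n → ℚ) →
    ∑[ i ∈ allFin M ] ∑[ j ∈ allFin M ] ∑[ a ∈ cell c i ] ∑[ b ∈ cell c j ] f a b ≡ ∑[ a ∈ allFin n ] ∑[ b ∈ allFin n ] f a b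
  ∑∑-cells {n} {M} c f = trans (∑-cong (allFin M) (λ i → trans (∑-swap (allFin M) (cell c i) (λ j a → ∑[ b ∈ cell c j ] f a b))
    (∑-cong (cell c i) (λ a → ∑-cells c (f a))))) (∑-cells c (λ a → ∑ (allFin n) (f a)))

  ∈-cell : ∀ {n M} (c : Fin n → Fin M) {i a} → a ∈ cell c i → c a ≡ i
  ∈-cell {n} c {i} a∈ = proj₂ (∈-filter⁻ (λ a → c a Fin.≟ i) {xs = allFin n} a∈)

  -- A cell is split by the values of two witness functions for each of the M² pairs of cells, every
  -- value lying in {0, ..., K}.
  growth : ℕ → ℕ → ℕ
  growth K M = M ℕ.* ((ℕ.suc K ℕ.^ M) ℕ.^ M ℕ.* (ℕ.suc K ℕ.^ M) ℕ.^ M)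

  -- A maximum over the rounds, because the refinement may stop at any of them.
  cellBound : ℕ → ℕ → ℕ → ℕ
  cellBound K ℕ.zero M = M
  cellBound K (ℕ.suc t) M = M ℕ.⊔ cellBound K t (growth K M)

  record RefineData (n : ℕ) : Set where
    field
      W : Fin n → Fin n → ℚ
      K : ℕ
      ε lam : ℚ
      0<ε : 0ℚ < ε
      0<lam : 0ℚ < lam
      lam* : lam * (ι K * ι K * (ι K * ι K)) ≡ ε

  module Refine {n : ℕ} (𝒲 : RefineData n) where
    open RefineData 𝒲

    -- Vectors over a finite set can be enumerated, which makes the existence of a witness of
    -- irregularity decidable.
    Fn : Set
    Fn = Vec (Fin (ℕ.suc K)) n

    val : Fn → Fin n → ℚ
    val f a = ι (toℕ (Vec.lookup f a))

    0≤val : ∀ f a → 0ℚ ≤ val f a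
    0≤val f a = 0≤ι (toℕ (Vec.lookup f a))

    val≤ : ∀ f a → val f a ≤ ι K
    val≤ f a = ι-mono (ℕ.s≤s⁻¹ (Fin.toℕ<n (Vec.lookup f a)))

    fns : List Fn
    fns = box (Vec.replicate n (allFin (ℕ.suc K)))

    ∈-fns : ∀ f → f ∈ fns
    ∈-fns f = ∈-box (Vec.replicate n (allFin (ℕ.suc K))) f
      (λ i → subst (Vec.lookup f i ∈_) (sym (Vec.lookup-replicate i (allFin (ℕ.suc K)))) (∈-allFin (Vec.lookup f i)))

    -- Ũ is any step function for the partition c, not necessarily the cell averages
    -- of W: an irregular pair is repaired by adding ± lam f ⊗ g to Ũ, which lowers the
    -- squared distance Pot.
    module State {M : ℕ} (c : Fin n → Fin M) (Ũ : Fin n → Fin n → ℚ) where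

      disc : Fn → Fn → Fin M → Fin M → ℚ
      disc f g i j = ∑[ a ∈ cell c i ] ∑[ b ∈ cell c j ] ((W a b - Ũ a b) * (val f a * val g b))

      Witness : Fin M → Fin M → Set
      Witness i j = ∃[ f ] ∃[ g ] ∃[ σ ] (ε * (size c i * size c j) < sgn σ * disc f g i j)

      witness? : ∀ i j → Dec (Witness i j)
      witness? i j = map′ to from (any? (λ f → any? (λ g → any? (violates? f g) (true ∷ false ∷ [])) fns) fns)
        where
        Violates : Fn → Fn → Bool → Set
        Violates f g σ = ε * (size c i * size c j) < sgn σ * disc f g i j
        violates? : ∀ f g σ → Dec (Violates f g σ)
        violates? f g σ = ε * (size c i * size c j) <? sgn σ * disc f g i j
        to : Any (λ f → Any (λ g → Any (Violates f g) (true ∷ false ∷ [])) fns) fns → Witness i j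
        to h = let (f , _ , h′) = find h ; (g , _ , h″) = find h′ ; (σ , _ , p) = find h″ in f , g , σ , p
        bool : ∀ σ → σ ∈ (true ∷ false ∷ [])
        bool true = here refl
        bool false = there (here refl)
        from : Witness i j → Any (λ f → Any (λ g → Any (Violates f g) (true ∷ false ∷ [])) fns) fns
        from (f , g , σ , p) = lose (∈-fns f) (lose (∈-fns g) (lose (bool σ) p))

      Irr : ℚ
      Irr = ∑[ i ∈ allFin M ] ∑[ j ∈ allFin M ] (⟦ witness? i j ⟧ᵈ * (size c i * size c j))

      Pot : ℚ
      Pot = ∑[ a ∈ allFin n ] ∑[ b ∈ allFin n ] ((W a b - Ũ a b) * (W a b - Ũ a b))

      corr′ : ∀ {i j} → Dec (Witness i j) → Fin n → Fin n → ℚ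
      corr′ (yes (f , g , σ , _)) a b = lam * (sgn σ * (val f a * val g b))
      corr′ (no _) a b = 0ℚ

      Fᵥ Gᵥ : ∀ {i j} → Dec (Witness i j) → Fin n → Fin (ℕ.suc K)
      Fᵥ (yes (f , g , σ , _)) a = Vec.lookup f a
      Fᵥ (no _) a = zero
      Gᵥ (yes (f , g , σ , _)) a = Vec.lookup g a
      Gᵥ (no _) a = zero

      corr : Fin M → Fin M → Fin n → Fin n → ℚ
      corr i j = corr′ (witness? i j)

      corr-cong : ∀ i j {a a′ b b′} → Fᵥ (witness? i j) a ≡ Fᵥ (witness? i j) a′ → Gᵥ (witness? i j) b ≡ Gᵥ (witness? i j) b′ → corr i j a b ≡ corr i j a′ b′
      corr-cong i j p q with witness? i j
      ... | yes (f , g , σ , _) = cong₂ (λ x y → lam * (sgn σ * (ι (toℕ x) * ι (toℕ y)))) p q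
      ... | no _ = refl

      Ũ′ : Fin n → Fin n → ℚ
      Ũ′ a b = Ũ a b + corr (c a) (c b) a b

      E : ℕ
      E = (ℕ.suc K ℕ.^ M) ℕ.^ M

      M′ : ℕ
      M′ = M ℕ.* (E ℕ.* E)

      code : (Fin M → Fin M → Fin (ℕ.suc K)) → Fin E
      code h = funToFin (λ i → funToFin (h i))

      code-inj : ∀ h h′ → code h ≡ code h′ → ∀ i j → h i j ≡ h′ i j
      code-inj h h′ e i j = funinj (h i) (h′ i) (funinj (λ i → funToFin (h i)) (λ i → funToFin (h′ i)) e i) j
        where
        funinj : ∀ {p q} (f g : Fin p → Fin q) → funToFin f ≡ funToFin g → ∀ i → f i ≡ g i
        funinj f g e i = trans (sym (Fin.finToFun-funToFin f i)) (trans (cong (λ z → finToFun z i) e) (Fin.finToFun-funToFin g i))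

      -- Vertices stay together only if all witness functions, for all pairs of cells, agree on
      -- them; the corrected function is then again constant on pairs of cells.
      c′ : Fin n → Fin M′
      c′ a = combine (c a) (combine (code (λ i j → Fᵥ (witness? i j) a)) (code (λ i j → Gᵥ (witness? i j) a)))

      module _ {a a′ : Fin n} (e : c′ a ≡ c′ a′) where
        private
          parts = Fin.combine-injective (c a) (combine (code (λ i j → Fᵥ (witness? i j) a)) (code (λ i j → Gᵥ (witness? i j) a)))
            (c a′) (combine (code (λ i j → Fᵥ (witness? i j) a′)) (code (λ i j → Gᵥ (witness? i j) a′))) e
          parts′ = Fin.combine-injective (code (λ i j → Fᵥ (witness? i j) a)) (code (λ i j → Gᵥ (witness? i j) a))
            (code (λ i j → Fᵥ (witness? i j) a′)) (code (λ i j → Gᵥ (witness? i j) a′)) (proj₂ parts)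

        c′-c : c a ≡ c a′
        c′-c = proj₁ parts

        c′-F : ∀ i j → Fᵥ (witness? i j) a ≡ Fᵥ (witness? i j) a′
        c′-F = code-inj _ _ (proj₁ parts′)

        c′-G : ∀ i j → Gᵥ (witness? i j) a ≡ Gᵥ (witness? i j) a′
        c′-G = code-inj _ _ (proj₂ parts′)

      Ũ′-step : (∀ {a a′ b b′} → c a ≡ c a′ → c b ≡ c b′ → Ũ a b ≡ Ũ a′ b′) →
        ∀ {a a′ b b′} → c′ a ≡ c′ a′ → c′ b ≡ c′ b′ → Ũ′ a b ≡ Ũ′ a′ b′
      Ũ′-step st {a} {a′} {b} {b′} p q = cong₂ _+_ (st (c′-c p) (c′-c q))
        (trans (cong₂ (λ i j → corr i j a b) (c′-c p) (c′-c q)) (corr-cong (c a′) (c b′) (c′-F p (c a′) (c b′)) (c′-G q (c a′) (c b′))))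

      Pot′ : ℚ
      Pot′ = ∑[ a ∈ allFin n ] ∑[ b ∈ allFin n ] ((W a b - Ũ′ a b) * (W a b - Ũ′ a b))

      -- Expansion of the square. Per unit of `size c i * size c j`, an irregular pair gains at
      -- least 2·lam·ε in the linear term and pays at most lam²·K⁴ = lam·ε in the quadratic one, by
      -- the choice of `lam`.
      cell-drop : ∀ i j → ∑[ a ∈ cell c i ] ∑[ b ∈ cell c j ] ((W a b - Ũ′ a b) * (W a b - Ũ′ a b))
        ≤ ∑[ a ∈ cell c i ] ∑[ b ∈ cell c j ] ((W a b - Ũ a b) * (W a b - Ũ a b)) - lam * ε * (⟦ witness? i j ⟧ᵈ * (size c i * size c j))
      cell-drop i j = ≡-≤ (∑-cong∈ (cell c i) (λ {a} a∈ → ∑-cong∈ (cell c j) (λ {b} b∈ →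
          cong (λ z → z * z) (trans (ring₈₇ (W a b) (Ũ a b) (corr (c a) (c b) a b)) (cong (λ z → W a b - Ũ a b - z) (cong₂ (λ i j → corr i j a b) (∈-cell c a∈) (∈-cell c b∈)))))))
        (drop (witness? i j))
        where
        S P : ℚ
        S = size c i * size c j
        P = ∑[ a ∈ cell c i ] ∑[ b ∈ cell c j ] ((W a b - Ũ a b) * (W a b - Ũ a b))
        X : Fin n → Fin n → ℚ
        X a b = W a b - Ũ a b
        ∑∑ : (Fin n → Fin n → ℚ) → ℚ
        ∑∑ h = ∑[ a ∈ cell c i ] ∑[ b ∈ cell c j ] h a b
        drop : (d : Dec (Witness i j)) → ∑∑ (λ a b → (X a b - corr′ d a b) * (X a b - corr′ d a b)) ≤ P - lam * ε * (⟦ d ⟧ᵈ * S)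
        drop (no _) = ≤-reflexive (trans (∑-cong (cell c i) (λ a → ∑-cong (cell c j) (λ b → ring₈₈ (X a b)))) (sym (trans (cong (λ z → P - lam * ε * (z * S)) ⟦false⟧) (ring₈₉ P (lam * ε) S))))
        drop (yes (f , g , σ , h)) = begin
          ∑∑ (λ a b → (X a b - lam * (sgn σ * w a b)) * (X a b - lam * (sgn σ * w a b)))
            ≡⟨ ∑-cong (cell c i) (λ a → ∑-cong (cell c j) (λ b → trans (ring₈₄ (X a b) lam (sgn σ) (w a b)) (cong (λ z → X a b * X a b - 2ℚ * lam * sgn σ * (X a b * w a b) + z * (w a b * w a b)) (trans (cong (lam * lam *_) (sgn² σ)) (*-identityʳ (lam * lam)))))) ⟩
          ∑∑ (λ a b → X a b * X a b - 2ℚ * lam * sgn σ * (X a b * w a b) + lam * lam * (w a b * w a b))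
            ≡⟨ split ⟩
          P - 2ℚ * lam * sgn σ * disc f g i j + lam * lam * ∑∑ (λ a b → w a b * w a b)
            ≡⟨ ring₈₅ P lam (sgn σ) (disc f g i j) (lam * lam) (∑∑ (λ a b → w a b * w a b)) ⟩
          P - 2ℚ * lam * (sgn σ * disc f g i j) + lam * lam * ∑∑ (λ a b → w a b * w a b)
            ≤⟨ +-mono-≤ {P - 2ℚ * lam * (sgn σ * disc f g i j)} {P - 2ℚ * lam * (ε * S)} (+-monoʳ-≤ P (neg-mono (*-monoˡ (0≤* 0≤2 (<⇒≤ 0<lam)) (<⇒≤ h)))) quad ⟩
          P - 2ℚ * lam * (ε * S) + lam * (ε * S)
            ≡⟨ trans (ring₈₆ P lam ε S) (cong (λ z → P - lam * ε * z) (sym (trans (cong (_* S) ⟦true⟧) (*-identityˡ S)))) ⟩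
          P - lam * ε * (⟦ true ⟧ * S) ∎
          where
          open ≤-Reasoning
          w : Fin n → Fin n → ℚ
          w a b = val f a * val g b
          0≤w : ∀ a b → 0ℚ ≤ w a b
          0≤w a b = 0≤* (0≤val f a) (0≤val g b)
          w≤ : ∀ a b → w a b ≤ ι K * ι K
          w≤ a b = *-mono (0≤val g b) (0≤ι K) (val≤ f a) (val≤ g b)
          KK : ℚ
          KK = ι K * ι K * (ι K * ι K)
          quad : lam * lam * ∑∑ (λ a b → w a b * w a b) ≤ lam * (ε * S)
          quad = ≤-trans (*-monoˡ (0≤* (<⇒≤ 0<lam) (<⇒≤ 0<lam)) (≤-trans (∑-mono (cell c i) (λ a → ∑-mono (cell c j) (λ b → *-mono (0≤w a b) (0≤* (0≤ι K) (0≤ι K)) (w≤ a b) (w≤ a b))))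
              (≤-reflexive (trans (∑-cong (cell c i) (λ _ → ∑-const (cell c j) KK)) (trans (∑-const (cell c i) (size c j * KK)) (sym (*-assoc (size c i) (size c j) KK)))))))
            (≤-reflexive (trans (ring₉₀ lam KK S) (cong (λ z → lam * (z * S)) lam*)))
          split : ∑∑ (λ a b → X a b * X a b - 2ℚ * lam * sgn σ * (X a b * w a b) + lam * lam * (w a b * w a b)) ≡ P - 2ℚ * lam * sgn σ * disc f g i j + lam * lam * ∑∑ (λ a b → w a b * w a b)
          split = trans (∑-cong (cell c i) (λ a → trans (∑-+ (cell c j) (λ b → X a b * X a b - L * (X a b * w a b)) (λ b → lam * lam * (w a b * w a b)))
                (cong₂ _+_ (trans (∑-- (cell c j) (λ b → X a b * X a b) (λ b → L * (X a b * w a b))) (cong (λ z → ∑[ b ∈ cell c j ] (X a b * X a b) - z) (∑-*ˡ (cell c j) L (λ b → X a b * w a b))))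
                  (∑-*ˡ (cell c j) (lam * lam) (λ b → w a b * w a b)))))
            (trans (∑-+ (cell c i) (λ a → ∑[ b ∈ cell c j ] (X a b * X a b) - L * ∑[ b ∈ cell c j ] (X a b * w a b)) (λ a → lam * lam * ∑[ b ∈ cell c j ] (w a b * w a b)))
              (cong₂ _+_ (trans (∑-- (cell c i) (λ a → ∑[ b ∈ cell c j ] (X a b * X a b)) (λ a → L * ∑[ b ∈ cell c j ] (X a b * w a b))) (cong (λ z → P - z) (∑-*ˡ (cell c i) L (λ a → ∑[ b ∈ cell c j ] (X a b * w a b)))))
                (∑-*ˡ (cell c i) (lam * lam) (λ a → ∑[ b ∈ cell c j ] (w a b * w a b)))))
            where
            L : ℚ
            L = 2ℚ * lam * sgn σ

      Pot-drop : Pot′ ≤ Pot - lam * ε * Irr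
      Pot-drop = ≡-≤ (sym (∑∑-cells c (λ a b → (W a b - Ũ′ a b) * (W a b - Ũ′ a b)))) (≤-trans (∑-mono (allFin M) (λ i → ∑-mono (allFin M) (λ j → cell-drop i j)))
        (≤-reflexive (trans (∑-cong (allFin M) (λ i → trans (∑-- (allFin M) (λ j → Pc i j) (λ j → lam * ε * I i j)) (cong (λ z → ∑ (allFin M) (Pc i) - z) (∑-*ˡ (allFin M) (lam * ε) (I i)))))
          (trans (∑-- (allFin M) (λ i → ∑ (allFin M) (Pc i)) (λ i → lam * ε * ∑ (allFin M) (I i)))
            (cong₂ _-_ (∑∑-cells c (λ a b → (W a b - Ũ a b) * (W a b - Ũ a b))) (∑-*ˡ (allFin M) (lam * ε) (λ i → ∑ (allFin M) (I i))))))))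
        where
        Pc I : Fin M → Fin M → ℚ
        Pc i j = ∑[ a ∈ cell c i ] ∑[ b ∈ cell c j ] ((W a b - Ũ a b) * (W a b - Ũ a b))
        I i j = ⟦ witness? i j ⟧ᵈ * (size c i * size c j)

    record Partition (M̄ : ℕ) (η : ℚ) : Set where
      field
        {M} : ℕ
        M≤ : M ℕ.≤ M̄
        c : Fin n → Fin M
        Ũ : Fin n → Fin n → ℚ
        Ũ-step : ∀ {a a′ b b′} → c a ≡ c a′ → c b ≡ c b′ → Ũ a b ≡ Ũ a′ b′
        irr≤ : State.Irr c Ũ ≤ η

    module Round {η : ℚ} (0<η : 0ℚ < η) {M : ℕ} (c : Fin n → Fin M) (Ũ : Fin n → Fin n → ℚ) (irregular : ¬ (State.Irr c Ũ ≤ η)) where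
      open State c Ũ

      drop≤ : lam * ε * η ≤ lam * ε * Irr
      drop≤ = *-monoˡ (<⇒≤ (0<* 0<lam 0<ε)) (<⇒≤ (≰⇒> irregular))

      Pot-positive : lam * ε * η ≤ Pot
      Pot-positive = ≤-trans drop≤ (diff-0≤ (≤-trans 0≤Pot′ Pot-drop))
        where
        0≤Pot′ : 0ℚ ≤ Pot′
        0≤Pot′ = 0≤∑ (allFin n) (λ a → 0≤∑ (allFin n) (λ b → 0≤x² (W a b - Ũ′ a b)))

      Pot-next : Pot′ ≤ Pot - lam * ε * η
      Pot-next = ≤-trans Pot-drop (+-monoʳ-≤ Pot (neg-mono drop≤))

    -- `Pot` is non-negative and starts below t times the drop of an unsuccessful round, so some
    -- round among the first t+1 meets the bound on `Irr`.
    refine : ∀ {η} → 0ℚ < η → ∀ t {M} (c : Fin n → Fin M) (Ũ : Fin n → Fin n → ℚ) →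
      (∀ {a a′ b b′} → c a ≡ c a′ → c b ≡ c b′ → Ũ a b ≡ Ũ a′ b′) → State.Pot c Ũ ≤ ι t * (lam * ε * η) → Partition (cellBound K t M) η
    refine {η} 0<η t {M} c Ũ st pot≤ = go t pot≤ (State.Irr c Ũ ≤? η)
      where
      base : ∀ t → M ℕ.≤ cellBound K t M
      base ℕ.zero = ℕ.≤-refl
      base (ℕ.suc t) = ℕ.m≤m⊔n M _
      go : ∀ t → State.Pot c Ũ ≤ ι t * (lam * ε * η) → Dec (State.Irr c Ũ ≤ η) → Partition (cellBound K t M) η
      go t _ (yes h) = record { M≤ = base t ; c = c ; Ũ = Ũ ; Ũ-step = st ; irr≤ = h }
      go ℕ.zero pot≤ (no irregular) = ⊥-elim (<-irrefl refl (<-≤-trans (0<* (0<* 0<lam 0<ε) 0<η)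
        (≤-trans (Round.Pot-positive 0<η c Ũ irregular) (≤-≡ pot≤ (trans (cong (_* (lam * ε * η)) ι-0) (*-zeroˡ (lam * ε * η)))))))
      go (ℕ.suc t) pot≤ (no irregular) = record
        { M≤ = ℕ.≤-trans (Partition.M≤ rec) (ℕ.m≤n⊔m M _) ; c = Partition.c rec ; Ũ = Partition.Ũ rec ; Ũ-step = Partition.Ũ-step rec ; irr≤ = Partition.irr≤ rec }
        where
        rec : Partition (cellBound K t (growth K M)) η
        rec = refine 0<η t (State.c′ c Ũ) (State.Ũ′ c Ũ) (State.Ũ′-step c Ũ st) (≤-trans (Round.Pot-next 0<η c Ũ irregular)
          (≤-≡ (+-monoˡ-≤ (- (lam * ε * η)) (≤-≡ pot≤ (cong (_* (lam * ε * η)) (ι-suc t)))) (ring₉₁ (ι t) (lam * ε * η))))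

  ∈-cell-own : ∀ {n M} (c : Fin n → Fin M) a → a ∈ cell c (c a)
  ∈-cell-own {n} c a = ∈-filter⁺ (λ b → c b Fin.≟ c a) (∈-allFin a) refl
    where open import Data.List.Membership.Propositional.Properties using (∈-filter⁺)

  0<length : ∀ {A : Set} {xs : List A} {x} → x ∈ xs → 0ℚ < ι (length xs)
  0<length {xs = x ∷ xs} _ = 0<ι (length xs)

  mass : ∀ {n M} → (Fin n → Fin n → ℚ) → (Fin n → Fin M) → Fin M → Fin M → ℚ
  mass W c i j = ∑[ a ∈ cell c i ] ∑[ b ∈ cell c j ] W a b

  density : ∀ {n M} → (Fin n → Fin n → ℚ) → (Fin n → Fin M) → Fin M → Fin M → ℚ
  density W c i j = inv (size c i * size c j) * mass W c i j

  -- `regular` names its cells by vertices in them, so that they are nonempty and the density is a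
  -- true average; `σ` puts both signs of the deviation into one inequality.
  record RegularPartition {n : ℕ} (W : Fin n → Fin n → ℚ) (K : ℕ) (ε θ : ℚ) (M̄ : ℕ) : Set where
    field
      {M} : ℕ
      M≤ : M ℕ.≤ M̄
      c : Fin n → Fin M
      reg : Fin M → Fin M → Bool
      few-irregular : ∑[ i ∈ allFin M ] ∑[ j ∈ allFin M ] (⟦ not (reg i j) ⟧ * (size c i * size c j)) ≤ θ * (ι n * ι n)
      regular : ∀ a b → reg (c a) (c b) ≡ true → ∀ σ (f g : Fin n → ℕ) → (∀ x → f x ℕ.≤ K) → (∀ x → g x ℕ.≤ K) →
        sgn σ * ∑[ x ∈ cell c (c a) ] ∑[ y ∈ cell c (c b) ] ((W x y - density W c (c a) (c b)) * (ι (f x) * ι (g y)))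
          ≤ ε * (size c (c a) * size c (c b))

  record Accuracy : Set where
    field
      s K₁ : ℕ
      ε θ : ℚ
      0<ε : 0ℚ < ε
      0<θ : 0ℚ < θ

  record BoundedWeight (n s : ℕ) : Set where
    field
      W : Fin n → Fin n → ℚ
      0≤W : ∀ a b → 0ℚ ≤ W a b
      W≤s : ∀ a b → W a b ≤ ι s
      0<n : 0ℚ < ι n

  module RegularityLemma (𝒜 : Accuracy) where
    open Accuracy 𝒜
    -- Positive, so that the constant function 1 is a test function and `lam` can be obtained by
    -- division.
    K : ℕ
    K = ℕ.suc K₁

    KK : ℚ
    KK = ι K * ι K

    0<KK : 0ℚ < KK
    0<KK = 0<* (0<ι K₁) (0<ι K₁)

    0<1+KK : 0ℚ < 1ℚ + KK
    0<1+KK = <-≤-trans 0<1 (≤-by KK (<⇒≤ 0<KK) refl)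

    -- Passing from the step function `Ũ` to the true density of a pair of cells costs ε₀K² in
    -- addition to ε₀; hence the factor 1 + K².
    ε₀ lam : ℚ
    ε₀ = ε * inv (1ℚ + KK)
    lam = ε₀ * inv (KK * KK)

    0<ε₀ : 0ℚ < ε₀
    0<ε₀ = 0<* 0<ε (0<inv 0<1+KK)

    0<lam : 0ℚ < lam
    0<lam = 0<* 0<ε₀ (0<inv (0<* 0<KK 0<KK))

    lam* : lam * (KK * KK) ≡ ε₀
    lam* = trans (*-assoc ε₀ (inv (KK * KK)) (KK * KK)) (trans (cong (ε₀ *_) (inv-* (0<* 0<KK 0<KK))) (*-identityʳ ε₀))

    ε₀* : ε₀ * (1ℚ + KK) ≡ ε
    ε₀* = trans (*-assoc ε (inv (1ℚ + KK)) (1ℚ + KK)) (trans (cong (ε *_) (inv-* 0<1+KK)) (*-identityʳ ε))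

    0<drop : 0ℚ < lam * ε₀ * θ
    0<drop = 0<* (0<* 0<lam 0<ε₀) 0<θ

    -- For `Ũ` = 0 the potential is at most s²n², and an unsuccessful round lowers it by
    -- lam·ε₀·θ·n².
    rounds : ℕ
    rounds = proj₁ (archimedean (ι s * ι s * inv (lam * ε₀ * θ)))

    M̄ : ℕ
    M̄ = cellBound K rounds 1

    module _ {n : ℕ} (𝒲 : BoundedWeight n s) where
      open BoundedWeight 𝒲
      refineData : RefineData n
      refineData = record { W = W ; K = K ; ε = ε₀ ; lam = lam ; 0<ε = 0<ε₀ ; 0<lam = 0<lam ; lam* = lam* }

      open Refine refineData

      n² : ℚ
      n² = ι n * ι n

      0<n² : 0ℚ < n²
      0<n² = 0<* 0<n 0<n

      opaque
        partition : Partition M̄ (θ * n²)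
        partition = refine (0<* 0<θ 0<n²) rounds {1} (λ _ → zero) (λ _ _ → 0ℚ) (λ _ _ → refl) start
          where
          enough : ι s * ι s ≤ ι rounds * (lam * ε₀ * θ)
          enough = ≡-≤ (trans (ring₉₃ (ι s * ι s)) (trans (cong (ι s * ι s *_) (sym (inv-* 0<drop))) (sym (*-assoc (ι s * ι s) (inv (lam * ε₀ * θ)) (lam * ε₀ * θ)))))
            (*-monoʳ (<⇒≤ 0<drop) (proj₂ (archimedean (ι s * ι s * inv (lam * ε₀ * θ)))))
          start : ∑[ a ∈ allFin n ] ∑[ b ∈ allFin n ] ((W a b - 0ℚ) * (W a b - 0ℚ)) ≤ ι rounds * (lam * ε₀ * (θ * n²))
          start = ≤-trans (∑-mono (allFin n) (λ a → ∑-mono (allFin n) (λ b → ≡-≤ (ring₈₈ (W a b)) (*-mono (0≤W a b) (0≤ι s) (W≤s a b) (W≤s a b)))))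
            (≤-trans (≤-reflexive (trans (∑-cong (allFin n) (λ _ → ∑-const (allFin n) (ι s * ι s))) (trans (∑-const (allFin n) (ι (length (allFin n)) * (ι s * ι s)))
              (trans (cong (λ m → ι m * (ι m * (ι s * ι s))) (length-allFin n)) (trans (sym (*-assoc (ι n) (ι n) (ι s * ι s))) (*-comm n² (ι s * ι s)))))))
              (≤-≡ (*-monoʳ (<⇒≤ 0<n²) enough) (ring₉₂ (ι rounds) (lam * ε₀) θ n²)))

      module P = Partition partition
      open P using (c; Ũ; Ũ-step)
      open State c Ũ

      reg : Fin P.M → Fin P.M → Bool
      reg i j = not (does (witness? i j))

      not-not : ∀ b → not (not b) ≡ b
      not-not true = refl
      not-not false = refl

      reg-disc : ∀ i j → reg i j ≡ true → ∀ f g σ → sgn σ * disc f g i j ≤ ε₀ * (size c i * size c j)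
      reg-disc i j r f g σ = go (witness? i j) r
        where
        go : (d : Dec (Witness i j)) → not (does d) ≡ true → sgn σ * disc f g i j ≤ ε₀ * (size c i * size c j)
        go (yes _) ()
        go (no ¬w) _ = ≮⇒≥ (λ h → ¬w (f , g , σ , h))

      opp : ∀ σ → sgn (not σ) ≡ - sgn σ
      opp true = refl
      opp false = refl

      toFn : (f : Fin n → ℕ) → (∀ x → f x ℕ.≤ K) → Fn
      toFn f f≤ = Vec.tabulate (λ a → fromℕ< (ℕ.s≤s (f≤ a)))

      val-toFn : ∀ f f≤ a → val (toFn f f≤) a ≡ ι (f a)
      val-toFn f f≤ a = cong ι (trans (cong toℕ (Vec.lookup∘tabulate (λ a → fromℕ< (ℕ.s≤s (f≤ a))) a)) (Fin.toℕ-fromℕ< (ℕ.s≤s (f≤ a))))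

      one : Fn
      one = toFn (λ _ → 1) (λ _ → ℕ.s≤s ℕ.z≤n)

      module Pair (a b : Fin n) (r : reg (c a) (c b) ≡ true) where
        i j : Fin P.M
        i = c a
        j = c b
        S U e d : ℚ
        S = size c i * size c j
        U = Ũ a b
        e = mass W c i j
        d = density W c i j
        ∑∑ : (Fin n → Fin n → ℚ) → ℚ
        ∑∑ h = ∑[ x ∈ cell c i ] ∑[ y ∈ cell c j ] h x y
        ∑∑-cong∈ : ∀ {h h′} → (∀ {x y} → x ∈ cell c i → y ∈ cell c j → h x y ≡ h′ x y) → ∑∑ h ≡ ∑∑ h′
        ∑∑-cong∈ k = ∑-cong∈ (cell c i) (λ x∈ → ∑-cong∈ (cell c j) (k x∈))
        ∑∑-+ : ∀ h h′ → ∑∑ (λ x y → h x y + h′ x y) ≡ ∑∑ h + ∑∑ h′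
        ∑∑-+ h h′ = trans (∑-cong (cell c i) (λ x → ∑-+ (cell c j) (h x) (h′ x))) (∑-+ (cell c i) (λ x → ∑ (cell c j) (h x)) (λ x → ∑ (cell c j) (h′ x)))
        ∑∑-*ˡ : ∀ w h → ∑∑ (λ x y → w * h x y) ≡ w * ∑∑ h
        ∑∑-*ˡ w h = trans (∑-cong (cell c i) (λ x → ∑-*ˡ (cell c j) w (h x))) (∑-*ˡ (cell c i) w (λ x → ∑ (cell c j) (h x)))
        ∑∑-const : ∀ w → ∑∑ (λ _ _ → w) ≡ S * w
        ∑∑-const w = trans (∑-cong (cell c i) (λ _ → ∑-const (cell c j) w)) (trans (∑-const (cell c i) (size c j * w)) (sym (*-assoc (size c i) (size c j) w)))
        0<S : 0ℚ < S
        0<S = 0<* (0<length (∈-cell-own c a)) (0<length (∈-cell-own c b))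
        dS : d * S ≡ e
        dS = trans (ring₉₄ (inv S) e S) (trans (cong (_* e) (inv-* 0<S)) (*-identityˡ e))
        const-U : ∀ {x y} → x ∈ cell c i → y ∈ cell c j → Ũ x y ≡ U
        const-U x∈ y∈ = Ũ-step (∈-cell c x∈) (∈-cell c y∈)
        disc-1 : disc one one i j ≡ e - U * S
        disc-1 = trans (∑∑-cong∈ (λ {x} {y} x∈ y∈ → trans (cong₂ (λ u w → (W x y - u) * w) (const-U x∈ y∈) (cong₂ _*_ (trans (val-toFn (λ _ → 1) (λ _ → ℕ.s≤s ℕ.z≤n) x) ι-1) (trans (val-toFn (λ _ → 1) (λ _ → ℕ.s≤s ℕ.z≤n) y) ι-1))) (ring₉₅ (W x y) U)))
          (trans (∑∑-+ W (λ _ _ → - U)) (cong (e +_) (trans (∑∑-const (- U)) (ring₉₆ S U))))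
        -- The discrepancy of the constant function 1 is (d - U)·S, which is why the opposite sign
        -- is used.
        near : ∀ σ → sgn σ * (U - d) ≤ ε₀
        near σ = *-cancelˡ {sgn σ * (U - d)} {ε₀} {S} 0<S (≡-≤ (trans (ring₉₇ S (sgn σ) U d) (trans (cong (λ z → - sgn σ * (z - U * S)) dS) (trans (cong (- sgn σ *_) (sym disc-1)) (cong (_* disc one one i j) (sym (opp σ))))))
          (≤-≡ (reg-disc i j r one one (not σ)) (*-comm ε₀ S)))
        conclusion : ∀ σ (f g : Fin n → ℕ) → (∀ x → f x ℕ.≤ K) → (∀ x → g x ℕ.≤ K) →
          sgn σ * ∑∑ (λ x y → (W x y - d) * (ι (f x) * ι (g y))) ≤ ε * S
        conclusion σ f g f≤ g≤ = ≡-≤ (trans (cong (sgn σ *_) split) (ring₉₉ (sgn σ) (disc f′ g′ i j) (U - d) G))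
          (≤-trans (+-mono-≤ {sgn σ * disc f′ g′ i j} {ε₀ * S} {sgn σ * (U - d) * G} {ε₀ * (S * KK)} (reg-disc i j r f′ g′ σ) (≤-trans (*-monoʳ 0≤G (near σ)) (*-monoˡ (<⇒≤ 0<ε₀) G≤)))
            (≤-reflexive (trans (ring₁₀₀ ε₀ S KK) (cong (_* S) ε₀*))))
          where
          f′ g′ : Fn
          f′ = toFn f f≤
          g′ = toFn g g≤
          G : ℚ
          G = ∑∑ (λ x y → ι (f x) * ι (g y))
          0≤G : 0ℚ ≤ G
          0≤G = 0≤∑ (cell c i) (λ x → 0≤∑ (cell c j) (λ y → 0≤* (0≤ι (f x)) (0≤ι (g y))))
          G≤ : G ≤ S * KK
          G≤ = ≤-≡ (∑-mono (cell c i) (λ x → ∑-mono (cell c j) (λ y → *-mono (0≤ι (g y)) (0≤ι K) (ι-mono (f≤ x)) (ι-mono (g≤ y))))) (∑∑-const KK)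
          split : ∑∑ (λ x y → (W x y - d) * (ι (f x) * ι (g y))) ≡ disc f′ g′ i j + (U - d) * G
          split = trans (∑∑-cong∈ {h′ = λ x y → (W x y - Ũ x y) * (val f′ x * val g′ y) + (U - d) * (ι (f x) * ι (g y))} (λ {x} {y} x∈ y∈ → trans (ring₉₈ (W x y) d U (ι (f x) * ι (g y)))
              (cong (_+ (U - d) * (ι (f x) * ι (g y))) (sym (cong₂ (λ u w → (W x y - u) * w) (const-U x∈ y∈) (cong₂ _*_ (val-toFn f f≤ x) (val-toFn g g≤ y)))))))
            (trans (∑∑-+ (λ x y → (W x y - Ũ x y) * (val f′ x * val g′ y)) (λ x y → (U - d) * (ι (f x) * ι (g y)))) (cong (disc f′ g′ i j +_) (∑∑-*ˡ (U - d) (λ x y → ι (f x) * ι (g y)))))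

      regularPartition : RegularPartition W K ε θ M̄
      regularPartition = record
        { M≤ = P.M≤
        ; c = c
        ; reg = reg
        ; few-irregular = ≡-≤ (∑-cong (allFin P.M) (λ i → ∑-cong (allFin P.M) (λ j → cong (λ z → ⟦ z ⟧ * (size c i * size c j)) (not-not (does (witness? i j)))))) P.irr≤
        ; regular = λ a b r σ f g f≤ g≤ → Pair.conclusion a b r σ f g f≤ g≤
        }

-- The counting lemma for weighted homomorphisms.

module Counting where
  open import Data.Rational
  open import Data.Rational.Properties
  open RingIdentities
  open Rationals
  open Boxes
  open Nibble using (except; 0≤except)
  open Regularity using (sgn)

  prodℕ : {A : Set} → List A → (A → ℕ) → ℕ
  prodℕ [] f = 1
  prodℕ (x ∷ xs) f = f x ℕ.* prodℕ xs f

  opaque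
    unfolding ∏
    ι-prodℕ : ∀ {A : Set} (xs : List A) f → ι (prodℕ xs f) ≡ ∏[ x ∈ xs ] ι (f x)
    ι-prodℕ [] f = ι-1
    ι-prodℕ (x ∷ xs) f = trans (ι-* (f x) (prodℕ xs f)) (cong (ι (f x) *_) (ι-prodℕ xs f))

  prodℕ-* : ∀ {A : Set} (xs : List A) f g → prodℕ xs f ℕ.* prodℕ xs g ≡ prodℕ xs (λ x → f x ℕ.* g x)
  prodℕ-* [] f g = refl
  prodℕ-* (x ∷ xs) f g = trans (ℕ.[m*n]*[o*p]≡[m*o]*[n*p] (f x) (prodℕ xs f) (g x) (prodℕ xs g)) (cong (f x ℕ.* g x ℕ.*_) (prodℕ-* xs f g))

  prodℕ-cong∈ : ∀ {A : Set} (xs : List A) {f g : A → ℕ} → (∀ {x} → x ∈ xs → f x ≡ g x) → prodℕ xs f ≡ prodℕ xs g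
  prodℕ-cong∈ [] h = refl
  prodℕ-cong∈ (x ∷ xs) h = cong₂ ℕ._*_ (h (here refl)) (prodℕ-cong∈ xs (h ∘ there))

  prodℕ≤ : ∀ {A : Set} (xs : List A) (f : A → ℕ) s → (∀ x → f x ℕ.≤ s) → prodℕ xs f ℕ.≤ s ℕ.^ length xs
  prodℕ≤ [] f s h = ℕ.≤-refl
  prodℕ≤ (x ∷ xs) f s h = ℕ.*-mono-≤ (h x) (prodℕ≤ xs f s h)

  opaque
    unfolding ∏
    ∏-except-filter : ∀ {n} (j : Fin n) f → ∏ (filter (λ l → ¬? (j Fin.≟ l)) (allFin n)) f ≡ ∏ (allFin n) (except j f)
    ∏-except-filter {n} j f = go (allFin n)
      where
      go : ∀ xs → ∏ (filter (λ l → ¬? (j Fin.≟ l)) xs) f ≡ ∏ xs (except j f)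
      go [] = refl
      go (x ∷ xs) with does (j Fin.≟ x)
      ... | true = trans (go xs) (sym (*-identityˡ (∏ xs (except j f))))
      ... | false = cong (f x *_) (go xs)

  -- `separated` is the combinatorial input: the first of two distinct edges has an end off the
  -- second, so the multiplicity at the second depends on at most one end of the first.
  record CellSystem (n k r : ℕ) : Set where
    field
      s : ℕ
      1≤s : 1 ℕ.≤ s
      E : Fin r → Fin k × Fin k
      ends≢ : ∀ l → proj₁ (E l) ≢ proj₂ (E l)
      separated : ∀ {l l′} → l ≢ l′ → (proj₂ (E l) ≢ proj₁ (E l′) × proj₂ (E l) ≢ proj₂ (E l′)) ⊎ (proj₁ (E l) ≢ proj₁ (E l′) × proj₁ (E l) ≢ proj₂ (E l′))
      W : Fin n → Fin n → ℕ
      W≤s : ∀ a b → W a b ℕ.≤ s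
      ls : Vec (List (Fin n)) k
      nonempty : ∀ u → 0ℚ < ι (length (Vec.lookup ls u))
      d : Fin r → ℚ
      ε : ℚ
      0≤ε : 0ℚ ≤ ε
      0≤d : ∀ l → 0ℚ ≤ d l
      d≤s : ∀ l → d l ≤ ι s

  module Count {n k r : ℕ} (𝒞 : CellSystem n k r) where
    open CellSystem 𝒞

    K : ℕ
    K = s ℕ.^ r

    len : Fin k → ℚ
    len u = ι (length (Vec.lookup ls u))

    Z : ℚ
    Z = ∏len ls

    at : Fin r → (Fin n → Fin n → ℕ) → Vec (Fin n) k → ℕ
    at l g x = g (Vec.lookup x (proj₁ (E l))) (Vec.lookup x (proj₂ (E l)))

    Regular : Fin r → Set
    Regular l = ∀ σ (f g : Fin n → ℕ) → (∀ x → f x ℕ.≤ K) → (∀ x → g x ℕ.≤ K) →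
      sgn σ * ∑[ y ∈ Vec.lookup ls (proj₁ (E l)) ] ∑[ z ∈ Vec.lookup ls (proj₂ (E l)) ] ((ι (W y z) - d l) * (ι (f y) * ι (g z)))
        ≤ ε * (len (proj₁ (E l)) * len (proj₂ (E l)))

    module _ (g : Fin r → Fin n → Fin n → ℕ) (g≤s : ∀ l a b → g l a b ℕ.≤ s) where

      P : List (Fin r) → Vec (Fin n) k → ℕ
      P L x = prodℕ L (λ l → at l (g l) x)

      module SingleEdge (l : Fin r) (L : List (Fin r)) (l∉L : ∀ {l′} → l′ ∈ L → l ≢ l′) (|L|≤ : length L ℕ.≤ r) (gl : g l ≡ W) (reg : Regular l) where
        u v : Fin k
        u = proj₁ (E l)
        v = proj₂ (E l)

        touches : Fin r → Bool
        touches l′ = does ((v Fin.≟ proj₁ (E l′)) ⊎-dec (v Fin.≟ proj₂ (E l′)))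

        -- Edges at `v` go into `G`, all others into `F`. An edge at `v` misses `u`, so the first
        -- product depends on `y` and the second on `z` alone; the default 1 keeps both bounded by
        -- `K`.
        Ff Gf : Vec (Fin n) k → Fin n → Fin r → ℕ
        Ff x y l′ = if touches l′ then 1 else at l′ (g l′) (x [ u ]≔ y)
        Gf x z l′ = if touches l′ then at l′ (g l′) (x [ v ]≔ z) else 1

        F G : Vec (Fin n) k → Fin n → ℕ
        F x y = prodℕ L (Ff x y)
        G x z = prodℕ L (Gf x z)

        bounded : ∀ (h : Fin r → ℕ) → (∀ l → h l ℕ.≤ s) → prodℕ L h ℕ.≤ K
        bounded h h≤ = ℕ.≤-trans (prodℕ≤ L h s h≤) (ℕ.^-monoʳ-≤ s {{ℕ.>-nonZero 1≤s}} |L|≤)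

        F≤ : ∀ x y → F x y ℕ.≤ K
        F≤ x y = bounded (Ff x y) le
          where
          le : ∀ l′ → Ff x y l′ ℕ.≤ s
          le l′ with touches l′
          ... | true = 1≤s
          ... | false = g≤s l′ _ _

        G≤ : ∀ x z → G x z ℕ.≤ K
        G≤ x z = bounded (Gf x z) le
          where
          le : ∀ l′ → Gf x z l′ ℕ.≤ s
          le l′ with touches l′
          ... | true = g≤s l′ _ _
          ... | false = 1≤s

        u≢v : u ≢ v
        u≢v = ends≢ l

        module _ (x : Vec (Fin n) k) (y z : Fin n) where
          x″ : Vec (Fin n) k
          x″ = (x [ u ]≔ y) [ v ]≔ z

          at-u : Vec.lookup x″ u ≡ y
          at-u = trans (Vec.lookup∘update′ u≢v (x [ u ]≔ y) z) (Vec.lookup∘update u x y)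

          at-v : Vec.lookup x″ v ≡ z
          at-v = Vec.lookup∘update v (x [ u ]≔ y) z

          off-v : ∀ w → v ≢ w → Vec.lookup x″ w ≡ Vec.lookup (x [ u ]≔ y) w
          off-v w v≢w = Vec.lookup∘update′ (v≢w ∘ sym) (x [ u ]≔ y) z

          off-u : ∀ w → u ≢ w → Vec.lookup x″ w ≡ Vec.lookup (x [ v ]≔ z) w
          off-u w u≢w with v Fin.≟ w
          ... | yes refl = trans at-v (sym (Vec.lookup∘update v x z))
          ... | no v≢w = trans (off-v w v≢w) (trans (Vec.lookup∘update′ (u≢w ∘ sym) x y) (sym (Vec.lookup∘update′ (v≢w ∘ sym) x z)))

          factor : ∀ {l′} → l ≢ l′ → Ff x y l′ ℕ.* Gf x z l′ ≡ at l′ (g l′) x″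
          factor {l′} l≢l′ with v Fin.≟ proj₁ (E l′) | v Fin.≟ proj₂ (E l′) | separated l≢l′
          ... | no p | no q | _ = trans (ℕ.*-identityʳ _) (sym (cong₂ (g l′) (off-v (proj₁ (E l′)) p) (off-v (proj₂ (E l′)) q)))
          ... | yes p | _ | inj₁ (p′ , _) = ⊥-elim (p′ p)
          ... | no _ | yes q | inj₁ (_ , q′) = ⊥-elim (q′ q)
          ... | yes _ | _ | inj₂ (p′ , q′) = trans (ℕ.*-identityˡ _) (sym (cong₂ (g l′) (off-u (proj₁ (E l′)) p′) (off-u (proj₂ (E l′)) q′)))
          ... | no _ | yes _ | inj₂ (p′ , q′) = trans (ℕ.*-identityˡ _) (sym (cong₂ (g l′) (off-u (proj₁ (E l′)) p′) (off-u (proj₂ (E l′)) q′)))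

          P-factor : ι (P L x″) ≡ ι (F x y) * ι (G x z)
          P-factor = trans (cong ι (trans (sym (prodℕ-cong∈ L (λ l′∈ → factor (l∉L l′∈)))) (sym (prodℕ-* L (Ff x y) (Gf x z))))) (ι-* (F x y) (G x z))

        h : Vec (Fin n) k → ℚ
        h x = (ι (at l (g l) x) - d l) * ι (P L x)

        -- Both ends of the edge are redrawn. For each frozen tuple the inner sum is the discrepancy
        -- of the test functions `F x` and `G x`, to which regularity applies.
        single : ∀ σ → sgn σ * ∑ (box ls) h ≤ ε * Z
        single σ = *-cancelˡ {sgn σ * ∑ (box ls) h} {ε * Z} {len u * len v} (0<* (nonempty u) (nonempty v)) (begin
          len u * len v * (sgn σ * ∑ (box ls) h)
            ≡⟨ trans (ring₁₆ (len u * len v) (sgn σ) (∑ (box ls) h)) (cong (sgn σ *_) (sym (resample₂ ls u v h))) ⟩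
          sgn σ * ∑[ x ∈ box ls ] inner x
            ≡⟨ sym (∑-*ˡ (box ls) (sgn σ) inner) ⟩
          ∑[ x ∈ box ls ] (sgn σ * inner x)
            ≤⟨ ∑-mono (box ls) bound ⟩
          ∑[ x ∈ box ls ] (ε * (len u * len v))
            ≡⟨ trans (∑-cong (box ls) (λ _ → sym (*-identityʳ (ε * (len u * len v))))) (trans (∑-*ˡ (box ls) (ε * (len u * len v)) (λ _ → 1ℚ)) (trans (cong (ε * (len u * len v) *_) (∑-box-1 ls)) (ring₁₀₁ ε (len u * len v) Z))) ⟩
          len u * len v * (ε * Z) ∎)
          where
          open ≤-Reasoning
          inner : Vec (Fin n) k → ℚ
          inner x = ∑[ y ∈ Vec.lookup ls u ] ∑[ z ∈ Vec.lookup ls v ] h ((x [ u ]≔ y) [ v ]≔ z)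
          bound : ∀ x → sgn σ * inner x ≤ ε * (len u * len v)
          bound x = ≡-≤ (cong (sgn σ *_) (∑-cong (Vec.lookup ls u) (λ y → ∑-cong (Vec.lookup ls v) (λ z →
              cong₂ (λ a b → (a - d l) * b) (cong ι (trans (cong₂ (g l) (at-u x y z) (at-v x y z)) (cong (λ f → f y z) gl))) (P-factor x y z)))))
            (reg σ (F x) (G x) (F≤ x) (G≤ x))

      ∏d : List (Fin r) → ℚ
      ∏d R = ∏[ l ∈ R ] d l

      ∏g : List (Fin r) → Vec (Fin n) k → ℚ
      ∏g R x = ∏[ l ∈ R ] ι (at l (g l) x)

      opaque
        unfolding ∏
        ∏d≤ : ∀ R → length R ℕ.≤ r → ∏d R ≤ ι K
        ∏d≤ R h = ≤-trans (go R) (ι-mono (ℕ.^-monoʳ-≤ s {{ℕ.>-nonZero 1≤s}} h))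
          where
          go : ∀ R → ∏d R ≤ ι (s ℕ.^ length R)
          go [] = ≤-reflexive (sym ι-1)
          go (l ∷ R) = ≤-≡ (*-mono (0≤∏ R 0≤d) (0≤ι s) (d≤s l) (go R)) (sym (ι-* s (s ℕ.^ length R)))

      -- `l` is moved to `L`, the induction hypothesis replaces the rest of `R` by densities, and
      -- `single` then replaces `l`. The last error is multiplied by the densities of the rest, at
      -- most `K`.
      telescope : ∀ σ R L → Unique R → (∀ {l l′} → l ∈ R → l′ ∈ L → l ≢ l′) → (∀ {l} → l ∈ R → g l ≡ W × Regular l) → length R ℕ.+ length L ℕ.≤ r →
        sgn σ * (∑[ x ∈ box ls ] (∏g R x * ι (P L x)) - ∏d R * ∑[ x ∈ box ls ] ι (P L x)) ≤ ι (length R) * (ι K * ε * Z)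
      telescope σ [] L _ _ _ _ = ≤-reflexive (trans (cong (sgn σ *_) (trans (cong₂ _-_ (∑-cong (box ls) (λ x → trans (cong (_* ι (P L x)) (∏-[] (λ l → ι (at l (g l) x)))) (*-identityˡ (ι (P L x))))) (trans (cong (_* A) (∏-[] d)) (*-identityˡ A))) (+-inverseʳ A)))
        (trans (*-zeroʳ (sgn σ)) (sym (trans (cong (_* (ι K * ε * Z)) ι-0) (*-zeroˡ (ι K * ε * Z))))))
        where
        A : ℚ
        A = ∑[ x ∈ box ls ] ι (P L x)
      telescope σ (l ∷ R) L (l∉R ∷ uR) disj good len≤ = begin
        sgn σ * (∑[ x ∈ box ls ] (∏g (l ∷ R) x * ι (P L x)) - ∏d (l ∷ R) * A)
          ≡⟨ cong₂ (λ a b → sgn σ * (a - b * A)) (∑-cong (box ls) move) (∏-∷ l R d) ⟩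
        sgn σ * (B - d l * ∏d R * A)
          ≡⟨ ring₁₀₂ (sgn σ) B (d l) (∏d R) A C ⟩
        sgn σ * (B - ∏d R * C) + ∏d R * (sgn σ * (C - d l * A))
          ≤⟨ +-mono-≤ {sgn σ * (B - ∏d R * C)} {ι (length R) * (ι K * ε * Z)} {∏d R * (sgn σ * (C - d l * A))} {ι K * (ε * Z)}
               (telescope σ R (l ∷ L) uR disj′ (good ∘ there) len′)
               (≤-trans (*-monoˡ (0≤∏ R 0≤d) one) (*-monoʳ (0≤* 0≤ε 0≤Z) (∏d≤ R lenR))) ⟩
        ι (length R) * (ι K * ε * Z) + ι K * (ε * Z)
          ≡⟨ trans (ring₁₀₃ (ι (length R)) (ι K) ε Z) (cong (_* (ι K * ε * Z)) (sym (ι-suc (length R)))) ⟩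
        ι (length (l ∷ R)) * (ι K * ε * Z) ∎
        where
        open ≤-Reasoning
        A B C : ℚ
        A = ∑[ x ∈ box ls ] ι (P L x)
        C = ∑[ x ∈ box ls ] ι (P (l ∷ L) x)
        B = ∑[ x ∈ box ls ] (∏g R x * ι (P (l ∷ L) x))
        0≤Z : 0ℚ ≤ Z
        0≤Z = 0≤∏ (allFin k) (λ u → 0≤ι (length (Vec.lookup ls u)))
        move : ∀ x → ∏g (l ∷ R) x * ι (P L x) ≡ ∏g R x * ι (P (l ∷ L) x)
        move x = trans (cong (_* ι (P L x)) (∏-∷ l R (λ l → ι (at l (g l) x)))) (trans (ring₁₀₁ (ι (at l (g l) x)) (∏g R x) (ι (P L x))) (cong (∏g R x *_) (sym (ι-* (at l (g l) x) (P L x)))))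
        disj′ : ∀ {m l′} → m ∈ R → l′ ∈ (l ∷ L) → m ≢ l′
        disj′ m∈ (here refl) = λ e → All.lookup l∉R m∈ (sym e)
        disj′ m∈ (there h) = disj (there m∈) h
        len′ : length R ℕ.+ length (l ∷ L) ℕ.≤ r
        len′ = ℕ.≤-trans (ℕ.≤-reflexive (ℕ.+-suc (length R) (length L))) len≤
        lenR : length R ℕ.≤ r
        lenR = ℕ.≤-trans (ℕ.m≤m+n (length R) _) len′
        lenL : length L ℕ.≤ r
        lenL = ℕ.≤-trans (ℕ.m≤n+m (length L) _) len≤
        one : sgn σ * (C - d l * A) ≤ ε * Z
        one = ≡-≤ (cong (sgn σ *_) (sym (trans (∑-cong (box ls) (λ x → trans (ring₈₀ (ι (at l (g l) x)) (d l) (ι (P L x))) (cong (_- d l * ι (P L x)) (sym (ι-* (at l (g l) x) (P L x))))))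
            (trans (∑-- (box ls) (λ x → ι (P (l ∷ L) x)) (λ x → d l * ι (P L x))) (cong (λ w → C - w) (∑-*ˡ (box ls) (d l) (λ x → ι (P L x))))))))
          (SingleEdge.single l L (disj (here refl)) lenL (proj₁ (good (here refl))) (proj₂ (good (here refl))) σ)

    0≤Z : 0ℚ ≤ Z
    0≤Z = 0≤∏ (allFin k) (λ u → 0≤ι (length (Vec.lookup ls u)))

    err : ℚ
    err = ι r * (ι K * ε * Z)

    -- The sign `false` selects the lower bound; it ensures that spreading an entry loses almost
    -- none of its weight.
    count-all : (∀ l → Regular l) → ∏ (allFin r) d * Z - err ≤ ∑[ x ∈ box ls ] ∏[ l ∈ allFin r ] ι (at l W x)
    count-all reg = ≤-by {D * Z - err} {S} (err - - 1ℚ * (S - D * Z)) (0≤-diff tele) (ring₁₀₄ (D * Z) err S)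
      where
      D S : ℚ
      D = ∏ (allFin r) d
      S = ∑[ x ∈ box ls ] ∏[ l ∈ allFin r ] ι (at l W x)
      tele : - 1ℚ * (S - D * Z) ≤ err
      tele = ≤-≡ (≡-≤ (cong (- 1ℚ *_) (cong₂ (λ a b → a - D * b) (∑-cong (box ls) (λ x → sym (trans (cong (∏g (λ _ → W) (λ _ → W≤s) (allFin r) x *_) ι-1) (*-identityʳ (∏g (λ _ → W) (λ _ → W≤s) (allFin r) x))))) (sym (trans (∑-cong (box ls) (λ _ → ι-1)) (∑-box-1 ls)))))
        (telescope (λ _ → W) (λ _ → W≤s) false (allFin r) [] (Unique.allFin⁺ r) (λ _ ()) (λ {l} _ → refl , reg l) (ℕ.≤-reflexive (trans (ℕ.+-identityʳ _) (length-allFin r)))))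
        (cong (λ m → ι m * (ι K * ε * Z)) (length-allFin r))

    pair-sum : ∀ l (b : Fin n → Fin n → ℕ) →
      len (proj₁ (E l)) * len (proj₂ (E l)) * ∑[ x ∈ box ls ] ι (at l b x) ≡ Z * ∑[ y ∈ Vec.lookup ls (proj₁ (E l)) ] ∑[ z ∈ Vec.lookup ls (proj₂ (E l)) ] ι (b y z)
    pair-sum l b = trans (sym (resample₂ ls u v (λ x → ι (at l b x)))) (trans (∑-cong (box ls) (λ x → trans (∑-cong (Vec.lookup ls u) (λ y → ∑-cong (Vec.lookup ls v) (λ z → cong ι (cong₂ b (at-u x y z) (at-v x y z))))) (sym (*-identityˡ B))))
      (trans (∑-*ʳ (box ls) B (λ _ → 1ℚ)) (cong (_* B) (∑-box-1 ls))))
      where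
      u v : Fin k
      u = proj₁ (E l)
      v = proj₂ (E l)
      B : ℚ
      B = ∑[ y ∈ Vec.lookup ls u ] ∑[ z ∈ Vec.lookup ls v ] ι (b y z)
      at-u : ∀ x y z → Vec.lookup ((x [ u ]≔ y) [ v ]≔ z) u ≡ y
      at-u x y z = trans (Vec.lookup∘update′ (ends≢ l) (x [ u ]≔ y) z) (Vec.lookup∘update u x y)
      at-v : ∀ x y z → Vec.lookup ((x [ u ]≔ y) [ v ]≔ z) v ≡ z
      at-v x y z = Vec.lookup∘update v (x [ u ]≔ y) z

    -- Edge `j` carries an arbitrary bounded weight, which stays in the product. With the
    -- multiplicities restricted to a set of pairs as `b`, this measures how much spread weight
    -- passes through that set.
    count-through : ∀ j (b : Fin n → Fin n → ℕ) → (∀ a c → b a c ℕ.≤ s) → (∀ l → Regular l) →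
      ∑[ x ∈ box ls ] (ι (at j b x) * ∏ (allFin r) (except j (λ l → ι (at l W x)))) ≤ ∏ (allFin r) (except j d) * ∑[ x ∈ box ls ] ι (at j b x) + err
    count-through j b b≤s reg = ≤-by {S} {D * A + err} (err - 1ℚ * (S - D * A)) (0≤-diff tele) (ring₁₀₅ S (D * A) err)
      where
      R : List (Fin r)
      R = filter (λ l → ¬? (j Fin.≟ l)) (allFin r)
      g : Fin r → Fin n → Fin n → ℕ
      g l = if does (j Fin.≟ l) then b else W
      g≤s : ∀ l a c → g l a c ℕ.≤ s
      g≤s l a c with does (j Fin.≟ l)
      ... | true = b≤s a c
      ... | false = W≤s a c
      gj : g j ≡ b
      gj with j Fin.≟ j
      ... | yes _ = refl
      ... | no ¬e = ⊥-elim (¬e refl)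
      g≢ : ∀ {l} → j ≢ l → g l ≡ W
      g≢ {l} j≢l with j Fin.≟ l
      ... | yes e = ⊥-elim (j≢l e)
      ... | no _ = refl
      D A S : ℚ
      D = ∏ (allFin r) (except j d)
      A = ∑[ x ∈ box ls ] ι (at j b x)
      S = ∑[ x ∈ box ls ] (ι (at j b x) * ∏ (allFin r) (except j (λ l → ι (at l W x))))
      ∉j : ∀ {l} → l ∈ R → j ≢ l
      ∉j {l} l∈ = proj₂ (∈-filter⁻ (λ l → ¬? (j Fin.≟ l)) {xs = allFin r} l∈)
      Pj : ∀ x → ι (P g g≤s (j ∷ []) x) ≡ ι (at j b x)
      Pj x = cong ι (trans (ℕ.*-identityʳ _) (cong (λ h → at j h x) gj))
      ∏R : ∀ x → ∏g g g≤s R x ≡ ∏ (allFin r) (except j (λ l → ι (at l W x)))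
      ∏R x = trans (∏-except-filter j (λ l → ι (at l (g l) x))) (∏-cong (allFin r) same)
        where
        same : ∀ l → except j (λ l → ι (at l (g l) x)) l ≡ except j (λ l → ι (at l W x)) l
        same l with does (j Fin.≟ l)
        ... | true = refl
        ... | false = refl
      j∈ : length R ℕ.+ 1 ℕ.≤ r
      j∈ = ℕ.≤-trans (ℕ.≤-reflexive (ℕ.+-comm (length R) 1)) (ℕ.≤-trans (List.filter-notAll (λ l → ¬? (j Fin.≟ l)) (allFin r) any) (ℕ.≤-reflexive (length-allFin r)))
        where
        open import Data.List.Membership.Propositional using (lose)
        open import Data.List.Membership.Propositional.Properties using (∈-allFin)
        open import Data.List.Relation.Unary.Any using (Any)
        any : Any (λ l → ¬ (j ≢ l)) (allFin r)
        any = lose (∈-allFin j) (λ h → h refl)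
      tele : 1ℚ * (S - D * A) ≤ err
      tele = ≤-trans (≡-≤ (cong (1ℚ *_) (cong₂ _-_ (∑-cong (box ls) (λ x → trans (*-comm (ι (at j b x)) _) (sym (cong₂ _*_ (∏R x) (Pj x))))) (cong₂ _*_ (sym (∏-except-filter j d)) (∑-cong (box ls) (λ x → sym (Pj x))))))
        (telescope g g≤s true R (j ∷ []) (Unique.filter⁺ (λ l → ¬? (j Fin.≟ l)) (Unique.allFin⁺ r)) (λ { l∈ (here refl) → λ e → ∉j l∈ (sym e) }) (λ {l} l∈ → g≢ (∉j l∈) , reg l) j∈))
        (*-monoʳ (0≤* (0≤* (0≤ι K) 0≤ε) 0≤Z) (ι-mono (ℕ.≤-trans (ℕ.m≤m+n (length R) 1) j∈)))

-- The edges of F as numbered slots, and their relation to `covers`.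

module EdgeSlots where
  open import Data.Rational
  open import Data.Rational.Properties
  open RingIdentities
  open Rationals hiding (∑-tabulate)

  unique-lookup : ∀ {A : Set} {xs : List A} → Unique xs → ∀ {i j} → lookup xs i ≡ lookup xs j → i ≡ j
  unique-lookup {xs = x ∷ xs} (_ ∷ _) {zero} {zero} _ = refl
  unique-lookup {xs = x ∷ xs} (h ∷ _) {zero} {suc j} e = ⊥-elim (All.lookup h (∈-lookup j) e)
  unique-lookup {xs = x ∷ xs} (h ∷ _) {suc i} {zero} e = ⊥-elim (All.lookup h (∈-lookup i) (sym e))
  unique-lookup {xs = x ∷ xs} (_ ∷ u) {suc i} {suc j} e = cong suc (unique-lookup u e)

  anyL-true : ∀ {A : Set} (p : A → Bool) (xs : List A) {x} → x ∈ xs → p x ≡ true → anyL p xs ≡ true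
  anyL-true p (x ∷ xs) (here refl) px rewrite px = refl
  anyL-true p (x ∷ xs) (there h) px rewrite anyL-true p xs h px = Bool.∨-zeroʳ (p x)

  anyL-witness : ∀ {A : Set} (p : A → Bool) (xs : List A) → anyL p xs ≡ true → ∃[ x ] p x ≡ true
  anyL-witness p (x ∷ xs) h with p x in e
  ... | true = x , e
  ... | false = anyL-witness p xs h

  isYes-true : ∀ {P : Set} (d : Dec P) → P → isYes d ≡ true
  isYes-true (yes _) p = refl
  isYes-true (no ¬p) p = ⊥-elim (¬p p)

  isYes⇒ : ∀ {P : Set} (d : Dec P) → isYes d ≡ true → P
  isYes⇒ (yes p) _ = p

  covers-intro : ∀ {k n} (F : Graph k) (φ : Embedding k n) {a b} u v → adj F u v ≡ true → proj₁ φ u ≡ a → proj₁ φ v ≡ b → covers F φ a b ≡ true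
  covers-intro {k} F (φ , _) {a} {b} u v auv pa pb = anyL-true _ (allFin k) (∈-allFin u) (anyL-true _ (allFin k) (∈-allFin v)
    (cong₂ _∧_ auv (cong₂ _∧_ (isYes-true (φ u Fin.≟ a) pa) (isYes-true (φ v Fin.≟ b) pb))))

  covers-elim : ∀ {k n} (F : Graph k) (φ : Embedding k n) {a b} → covers F φ a b ≡ true → ∃[ u ] ∃[ v ] (adj F u v ≡ true × proj₁ φ u ≡ a × proj₁ φ v ≡ b)
  covers-elim {k} F (φ , _) {a} {b} h with anyL-witness _ (allFin k) h
  ... | u , h₁ with anyL-witness _ (allFin k) h₁
  ...   | v , h₂ with ∧³ (adj F u v) (isYes (φ u Fin.≟ a)) (isYes (φ v Fin.≟ b)) h₂
    where
    ∧³ : ∀ x y z → x ∧ (y ∧ z) ≡ true → x ≡ true × y ≡ true × z ≡ true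
    ∧³ true true true _ = refl , refl , refl
  ...     | p , q , q′ = u , v , p , isYes⇒ (φ u Fin.≟ a) q , isYes⇒ (φ v Fin.≟ b) q′

  module EdgesOf {k : ℕ} (F : Graph k) where

    IsEdge : Fin k × Fin k → Set
    IsEdge (u , v) = u 𝔽.< v × adj F u v ≡ true

    isEdge? : ∀ e → Dec (IsEdge e)
    isEdge? (u , v) = (u Fin.<? v) ×-dec (adj F u v Bool.≟ true)

    es : List (Fin k × Fin k)
    es = filter isEdge? (cartesianProduct (allFin k) (allFin k))

    r : ℕ
    r = length es

    E : Fin r → Fin k × Fin k
    E = lookup es

    es-unique : Unique es
    es-unique = Unique.filter⁺ isEdge? (Unique.cartesianProduct⁺ (Unique.allFin⁺ k) (Unique.allFin⁺ k))

    E-edge : ∀ l → IsEdge (E l)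
    E-edge l = proj₂ (∈-filter⁻ isEdge? {xs = cartesianProduct (allFin k) (allFin k)} (∈-lookup {xs = es} l))

    E-injective : ∀ {l l′} → E l ≡ E l′ → l ≡ l′
    E-injective = unique-lookup es-unique

    E-surjective : ∀ {u v} → u 𝔽.< v → adj F u v ≡ true → ∃[ l ] E l ≡ (u , v)
    E-surjective {u} {v} u<v h = Any.index m , sym (Any.lookup-index m)
      where
      m : (u , v) ∈ es
      m = ∈-filter⁺ isEdge? (∈-cartesianProduct⁺ (∈-allFin u) (∈-allFin v)) (u<v , h)

    loopless-E : ∀ l → proj₁ (E l) ≢ proj₂ (E l)
    loopless-E l = Fin.<⇒≢ (proj₁ (E-edge l))

    separated-E : ∀ {l l′} → l ≢ l′ →
      (proj₂ (E l) ≢ proj₁ (E l′) × proj₂ (E l) ≢ proj₂ (E l′)) ⊎ (proj₁ (E l) ≢ proj₁ (E l′) × proj₁ (E l) ≢ proj₂ (E l′))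
    separated-E {l} {l′} l≢l′ with proj₂ (E l) Fin.≟ proj₁ (E l′) | proj₂ (E l) Fin.≟ proj₂ (E l′) | proj₁ (E l) Fin.≟ proj₁ (E l′) | proj₁ (E l) Fin.≟ proj₂ (E l′)
    ... | no p | no q | _ | _ = inj₁ (p , q)
    ... | _ | _ | no p | no q = inj₂ (p , q)
    ... | _ | yes q | yes p | _ = ⊥-elim (l≢l′ (E-injective (cong₂ _,_ p q)))
    ... | yes p | _ | yes q | _ = ⊥-elim (loopless-E l (trans q (sym p)))
    ... | _ | yes p | _ | yes q = ⊥-elim (loopless-E l (trans q (sym p)))
    ... | yes p | _ | _ | yes q = ⊥-elim (Fin.<-asym (proj₁ (E-edge l)) (subst₂ 𝔽._<_ (sym p) (sym q) (proj₁ (E-edge l′))))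

    orient : ∀ {u v} → adj F u v ≡ true → ∃[ l ] (E l ≡ (u , v) ⊎ E l ≡ (v , u))
    orient {u} {v} h with Fin.<-cmp u v
    ... | tri< u<v _ _ = proj₁ (E-surjective u<v h) , inj₁ (proj₂ (E-surjective u<v h))
    ... | tri≈ _ refl _ with trans (sym h) (irref F u)
    ...   | ()
    orient {u} {v} h | tri> _ _ v<u = proj₁ (E-surjective v<u h′) , inj₂ (proj₂ (E-surjective v<u h′))
      where
      h′ : adj F v u ≡ true
      h′ = trans (Graph.sym F v u) h

    slots : ∀ {n} → (Fin k → Fin n) → Fin n → Fin n → Fin r → ℚ
    slots φ a b l = ⟦ φ (proj₁ (E l)) Fin.≟ a ⟧ᵈ * ⟦ φ (proj₂ (E l)) Fin.≟ b ⟧ᵈ + ⟦ φ (proj₁ (E l)) Fin.≟ b ⟧ᵈ * ⟦ φ (proj₂ (E l)) Fin.≟ a ⟧ᵈ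

    ∑-single : ∀ {m} (f : Fin m → ℚ) → (∀ l → f l ≤ 1ℚ) → (∀ {l} → ¬ (f l ≡ 0ℚ) → ∀ {l′} → ¬ (f l′ ≡ 0ℚ) → l ≡ l′) → ∑ (allFin m) f ≤ 1ℚ
    ∑-single {m} f f≤1 uni with Fin.any? (λ l → Relation.Nullary.Decidable.¬? (f l ≟ 0ℚ))
      where import Relation.Nullary.Decidable
    ... | no none = ≤-trans (≤-reflexive (trans (∑-cong (allFin m) (λ l → zero-at l)) (∑-0 (allFin m)))) 0≤1
      where
      zero-at : ∀ l → f l ≡ 0ℚ
      zero-at l with f l ≟ 0ℚ
      ... | yes e = e
      ... | no ¬e = ⊥-elim (none (l , ¬e))
    ... | yes (l₀ , nz) = ≤-trans (∑-mono (allFin m) at) (≤-reflexive (∑-δ l₀ (λ _ → 1ℚ)))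
      where
      at : ∀ l → f l ≤ ⟦ l₀ Fin.≟ l ⟧ᵈ * 1ℚ
      at l with l₀ Fin.≟ l
      ... | yes _ = ≤-≡ (f≤1 l) (sym (trans (cong (_* 1ℚ) ⟦true⟧) (*-identityˡ 1ℚ)))
      ... | no l₀≢l with f l ≟ 0ℚ
      ...   | yes e = ≤-reflexive (trans e (sym (trans (cong (_* 1ℚ) ⟦false⟧) (*-zeroˡ 1ℚ))))
      ...   | no nz′ = ⊥-elim (l₀≢l (uni nz nz′))

    ⟦⟧-*-nz : ∀ {P Q : Set} (d : Dec P) (e : Dec Q) → ¬ (⟦ d ⟧ᵈ * ⟦ e ⟧ᵈ ≡ 0ℚ) → P × Q
    ⟦⟧-*-nz (yes p) (yes q) _ = p , q
    ⟦⟧-*-nz (no _) e h = ⊥-elim (h (trans (cong (_* ⟦ e ⟧ᵈ) ⟦false⟧) (*-zeroˡ ⟦ e ⟧ᵈ)))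
    ⟦⟧-*-nz (yes _) (no _) h = ⊥-elim (h (trans (cong (⟦ true ⟧ *_) ⟦false⟧) (*-zeroʳ ⟦ true ⟧)))

    module _ {n : ℕ} (φ : Fin k → Fin n) (φ-inj : Injective _≡_ _≡_ φ) (a b : Fin n) where

      hits : Fin r → Set
      hits l = (φ (proj₁ (E l)) ≡ a × φ (proj₂ (E l)) ≡ b) ⊎ (φ (proj₁ (E l)) ≡ b × φ (proj₂ (E l)) ≡ a)

      slots-hits : ∀ {l} → ¬ (slots φ a b l ≡ 0ℚ) → hits l
      slots-hits {l} nz with (⟦ φ (proj₁ (E l)) Fin.≟ a ⟧ᵈ * ⟦ φ (proj₂ (E l)) Fin.≟ b ⟧ᵈ) ≟ 0ℚ | (⟦ φ (proj₁ (E l)) Fin.≟ b ⟧ᵈ * ⟦ φ (proj₂ (E l)) Fin.≟ a ⟧ᵈ) ≟ 0ℚ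
      ... | no h | _ = inj₁ (⟦⟧-*-nz (φ (proj₁ (E l)) Fin.≟ a) (φ (proj₂ (E l)) Fin.≟ b) h)
      ... | _ | no h = inj₂ (⟦⟧-*-nz (φ (proj₁ (E l)) Fin.≟ b) (φ (proj₂ (E l)) Fin.≟ a) h)
      ... | yes p | yes q = ⊥-elim (nz (trans (cong₂ _+_ p q) (+-identityˡ 0ℚ)))

      slots≤1 : ∀ l → slots φ a b l ≤ 1ℚ
      slots≤1 l with a Fin.≟ b
      ... | yes refl = ≡-≤ (cong₂ _+_ z z) (≡-≤ (+-identityˡ 0ℚ) 0≤1)
        where
        z : ⟦ φ (proj₁ (E l)) Fin.≟ a ⟧ᵈ * ⟦ φ (proj₂ (E l)) Fin.≟ a ⟧ᵈ ≡ 0ℚ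
        z with φ (proj₁ (E l)) Fin.≟ a | φ (proj₂ (E l)) Fin.≟ a
        ... | yes p | yes q = ⊥-elim (loopless-E l (φ-inj (trans p (sym q))))
        ... | no _ | d = trans (cong (_* ⟦ d ⟧ᵈ) ⟦false⟧) (*-zeroˡ ⟦ d ⟧ᵈ)
        ... | yes _ | no _ = trans (cong (⟦ true ⟧ *_) ⟦false⟧) (*-zeroʳ ⟦ true ⟧)
      ... | no a≢b = ≤-trans (+-mono-≤ (le (φ (proj₁ (E l)) Fin.≟ a) (φ (proj₂ (E l)) Fin.≟ b)) (le (φ (proj₁ (E l)) Fin.≟ b) (φ (proj₂ (E l)) Fin.≟ a))) one
        where
        le : ∀ {P Q : Set} (d : Dec P) (e : Dec Q) → ⟦ d ⟧ᵈ * ⟦ e ⟧ᵈ ≤ ⟦ d ⟧ᵈ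
        le d e = ≤-≡ (*-monoˡ (0≤⟦⟧ (does d)) (⟦⟧≤1 (does e))) (*-identityʳ ⟦ d ⟧ᵈ)
        one : ⟦ φ (proj₁ (E l)) Fin.≟ a ⟧ᵈ + ⟦ φ (proj₁ (E l)) Fin.≟ b ⟧ᵈ ≤ 1ℚ
        one with φ (proj₁ (E l)) Fin.≟ a | φ (proj₁ (E l)) Fin.≟ b
        ... | yes p | yes q = ⊥-elim (a≢b (trans (sym p) q))
        ... | yes _ | no _ = ≤-reflexive (trans (cong₂ _+_ ⟦true⟧ ⟦false⟧) (+-identityʳ 1ℚ))
        ... | no _ | d = ≤-trans (≤-reflexive (trans (cong (_+ ⟦ d ⟧ᵈ) ⟦false⟧) (+-identityˡ ⟦ d ⟧ᵈ))) (⟦⟧≤1 (does d))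

      same-edge : ∀ {l l′} → hits l → hits l′ → l ≡ l′
      same-edge (inj₁ (p , q)) (inj₁ (p′ , q′)) = E-injective (cong₂ _,_ (φ-inj (trans p (sym p′))) (φ-inj (trans q (sym q′))))
      same-edge (inj₂ (p , q)) (inj₂ (p′ , q′)) = E-injective (cong₂ _,_ (φ-inj (trans p (sym p′))) (φ-inj (trans q (sym q′))))
      same-edge {l} {l′} (inj₁ (p , q)) (inj₂ (p′ , q′)) = ⊥-elim (Fin.<-asym (proj₁ (E-edge l)) (subst₂ 𝔽._<_ (φ-inj (trans p′ (sym q))) (φ-inj (trans q′ (sym p))) (proj₁ (E-edge l′))))
      same-edge {l} {l′} (inj₂ (p , q)) (inj₁ (p′ , q′)) = ⊥-elim (Fin.<-asym (proj₁ (E-edge l)) (subst₂ 𝔽._<_ (φ-inj (trans p′ (sym q))) (φ-inj (trans q′ (sym p))) (proj₁ (E-edge l′))))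

      -- An injective map sends at most one edge onto the pair: equal images in the same order give
      -- equal edges, and in opposite orders they contradict u < v. For a = b all slots vanish.
      slots≤covers : ∑ (allFin r) (slots φ a b) ≤ ⟦ covers F (φ , φ-inj) a b ⟧
      slots≤covers with covers F (φ , φ-inj) a b in cov
      ... | true = ≤-≡ (∑-single (slots φ a b) slots≤1 (λ nz nz′ → same-edge (slots-hits nz) (slots-hits nz′))) (sym ⟦true⟧)
      ... | false = ≤-reflexive (trans (trans (∑-cong (allFin r) zero-at) (∑-0 (allFin r))) (sym ⟦false⟧))
        where
        absurd : ∀ l → hits l → covers F (φ , φ-inj) a b ≡ true
        absurd l (inj₁ (p , q)) = covers-intro F (φ , φ-inj) (proj₁ (E l)) (proj₂ (E l)) (proj₂ (E-edge l)) p q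
        absurd l (inj₂ (p , q)) = covers-intro F (φ , φ-inj) (proj₂ (E l)) (proj₁ (E l)) (trans (Graph.sym F _ _) (proj₂ (E-edge l))) q p
        zero-at : ∀ l → slots φ a b l ≡ 0ℚ
        zero-at l with slots φ a b l ≟ 0ℚ
        ... | yes e = e
        ... | no nz with trans (sym cov) (absurd l (slots-hits nz))
        ...   | ()

      covers⇒hits : covers F (φ , φ-inj) a b ≡ true → ∃[ l ] hits l
      covers⇒hits cov with covers-elim F (φ , φ-inj) cov
      ... | u , v , auv , pa , pb with orient auv
      ...   | l , inj₁ e = l , inj₁ (trans (cong (φ ∘ proj₁) e) pa , trans (cong (φ ∘ proj₂) e) pb)
      ...   | l , inj₂ e = l , inj₂ (trans (cong (φ ∘ proj₁) e) pb , trans (cong (φ ∘ proj₂) e) pa)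

  -- An interface with the number of edges as a parameter, so that graphs without edges can be split
  -- off by matching on `r`.
  record Slots {k : ℕ} (F : Graph k) (r : ℕ) : Set where
    field
      E : Fin r → Fin k × Fin k

    src : Fin r → Fin k
    src l = proj₁ (E l)

    tgt : Fin r → Fin k
    tgt l = proj₂ (E l)

    slotHits : ∀ {n} → (Fin k → Fin n) → Fin n → Fin n → Fin r → ℚ
    slotHits φ a b l = ⟦ φ (src l) Fin.≟ a ⟧ᵈ * ⟦ φ (tgt l) Fin.≟ b ⟧ᵈ + ⟦ φ (src l) Fin.≟ b ⟧ᵈ * ⟦ φ (tgt l) Fin.≟ a ⟧ᵈ

    field
      loopless-slot : ∀ l → src l ≢ tgt l
      separated : ∀ {l l′} → l ≢ l′ → (tgt l ≢ src l′ × tgt l ≢ tgt l′) ⊎ (src l ≢ src l′ × src l ≢ tgt l′)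
      hits≤covers : ∀ {n} (φ : Embedding k n) a b → ∑ (allFin r) (slotHits (proj₁ φ) a b) ≤ ⟦ covers F φ a b ⟧
      covers⇒slot : ∀ {n} (φ : Embedding k n) a b → covers F φ a b ≡ true →
        ∃[ l ] ((proj₁ φ (src l) ≡ a × proj₁ φ (tgt l) ≡ b) ⊎ (proj₁ φ (src l) ≡ b × proj₁ φ (tgt l) ≡ a))

  slotsOf : ∀ {k} (F : Graph k) → Slots F (EdgesOf.r F)
  slotsOf F = record
    { E = E
    ; loopless-slot = loopless-E
    ; separated = separated-E
    ; hits≤covers = λ φ a b → slots≤covers (proj₁ φ) (proj₂ φ) a b
    ; covers⇒slot = λ φ a b → covers⇒hits (proj₁ φ) (proj₂ φ) a b
    }
    where open EdgesOf F

-- A duality bound for the loads of ψ, and sums over tuples with prescribed coordinates.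

module Loads where
  open import Data.Rational
  open import Data.Rational.Properties
  open RingIdentities
  open Rationals
  open Boxes
  open EdgeSlots

  opaque
    unfolding ∑ ⟦_⟧
    load≡ : ∀ {k n} (F : Graph k) (ψ : FracPacking k n) a b → load F ψ a b ≡ ∑[ p ∈ ψ ] (⟦ covers F (proj₁ p) a b ⟧ * proj₂ p)
    load≡ F [] a b = refl
    load≡ F (p ∷ ψ) a b with covers F (proj₁ p) a b
    ... | true = cong₂ _+_ (sym (*-identityˡ (proj₂ p))) (load≡ F ψ a b)
    ... | false = trans (load≡ F ψ a b) (trans (sym (+-identityˡ _)) (cong (_+ ∑[ p ∈ ψ ] (⟦ covers F (proj₁ p) a b ⟧ * proj₂ p)) (sym (*-zeroˡ (proj₂ p)))))

    value≡ : ∀ {k n} (ψ : FracPacking k n) → value ψ ≡ ∑ ψ proj₂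
    value≡ [] = refl
    value≡ (p ∷ ψ) = cong (proj₂ p +_) (value≡ ψ)

  module LoadBound {k n r : ℕ} (F : Graph k) (Sl : Slots F r) (G : Multigraph n) (ψ : FracPacking k n) (isF : IsFracPacking F G ψ) where
    open Slots Sl

    Fins : List (Fin n)
    Fins = allFin n

    Wq : Fin n → Fin n → ℚ
    Wq a b = ι (mult G a b)

    emb : Embedding k n × ℚ → Fin k → Fin n
    emb p = proj₁ (proj₁ p)

    both : (Fin n → Fin n → ℚ) → Embedding k n × ℚ → Fin r → ℚ
    both t p l = t (emb p (src l)) (emb p (tgt l)) + t (emb p (tgt l)) (emb p (src l))

    both≡ : ∀ t p l → both t p l ≡ ∑[ a ∈ Fins ] ∑[ b ∈ Fins ] (t a b * slotHits (emb p) a b l)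
    both≡ t p l = sym (trans (∑-cong Fins (λ a → trans (∑-cong Fins (λ b → ring₁₀₆ (t a b) ⟦ x Fin.≟ a ⟧ᵈ ⟦ y Fin.≟ b ⟧ᵈ ⟦ x Fin.≟ b ⟧ᵈ ⟦ y Fin.≟ a ⟧ᵈ))
        (trans (∑-+ Fins (λ b → ⟦ x Fin.≟ a ⟧ᵈ * (⟦ y Fin.≟ b ⟧ᵈ * t a b)) (λ b → ⟦ y Fin.≟ a ⟧ᵈ * (⟦ x Fin.≟ b ⟧ᵈ * t a b)))
          (cong₂ _+_ (trans (∑-*ˡ Fins ⟦ x Fin.≟ a ⟧ᵈ (λ b → ⟦ y Fin.≟ b ⟧ᵈ * t a b)) (cong (⟦ x Fin.≟ a ⟧ᵈ *_) (∑-δ y (t a))))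
            (trans (∑-*ˡ Fins ⟦ y Fin.≟ a ⟧ᵈ (λ b → ⟦ x Fin.≟ b ⟧ᵈ * t a b)) (cong (⟦ y Fin.≟ a ⟧ᵈ *_) (∑-δ x (t a))))))))
      (trans (∑-+ Fins (λ a → ⟦ x Fin.≟ a ⟧ᵈ * t a y) (λ a → ⟦ y Fin.≟ a ⟧ᵈ * t a x)) (cong₂ _+_ (∑-δ x (λ a → t a y)) (∑-δ y (λ a → t a x)))))
      where
      x y : Fin n
      x = emb p (src l)
      y = emb p (tgt l)

    -- Weak linear programming duality: the load constraints are added up with the dual weights `t`.
    -- It is used with the constant 1, with the indicator of bad pairs and with averages over pairs
    -- of cells.
    load-bound : ∀ t → (∀ a b → 0ℚ ≤ t a b) → ∑[ p ∈ ψ ] (proj₂ p * ∑ (allFin r) (both t p)) ≤ ∑[ a ∈ Fins ] ∑[ b ∈ Fins ] (t a b * Wq a b)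
    load-bound t 0≤t = begin
      ∑[ p ∈ ψ ] (proj₂ p * ∑ (allFin r) (both t p))
        ≤⟨ ∑-mono∈ ψ (λ {p} p∈ → entry p (proj₁ isF p p∈)) ⟩
      ∑[ p ∈ ψ ] ∑[ a ∈ Fins ] ∑[ b ∈ Fins ] (t a b * (⟦ covers F (proj₁ p) a b ⟧ * proj₂ p))
        ≡⟨ trans (∑-swap ψ Fins (λ p a → ∑[ b ∈ Fins ] (t a b * (⟦ covers F (proj₁ p) a b ⟧ * proj₂ p)))) (∑-cong Fins (λ a →
             trans (∑-swap ψ Fins (λ p b → t a b * (⟦ covers F (proj₁ p) a b ⟧ * proj₂ p))) (∑-cong Fins (λ b →
               trans (∑-*ˡ ψ (t a b) (λ p → ⟦ covers F (proj₁ p) a b ⟧ * proj₂ p)) (cong (t a b *_) (sym (load≡ F ψ a b))))))) ⟩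
      ∑[ a ∈ Fins ] ∑[ b ∈ Fins ] (t a b * load F ψ a b)
        ≤⟨ ∑-mono Fins (λ a → ∑-mono Fins (λ b → *-monoˡ (0≤t a b) (≤-≡ (proj₂ isF a b) (sym (ι≡ℕtoℚ (mult G a b)))))) ⟩
      ∑[ a ∈ Fins ] ∑[ b ∈ Fins ] (t a b * Wq a b) ∎
      where
      open ≤-Reasoning
      entry : ∀ p → 0ℚ ≤ proj₂ p → proj₂ p * ∑ (allFin r) (both t p) ≤ ∑[ a ∈ Fins ] ∑[ b ∈ Fins ] (t a b * (⟦ covers F (proj₁ p) a b ⟧ * proj₂ p))
      entry p 0≤w = ≡-≤ (cong (proj₂ p *_) (trans (∑-cong (allFin r) (both≡ t p)) (trans (∑-swap (allFin r) Fins (λ l a → ∑[ b ∈ Fins ] (t a b * slotHits (emb p) a b l)))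
          (∑-cong Fins (λ a → trans (∑-swap (allFin r) Fins (λ l b → t a b * slotHits (emb p) a b l)) (∑-cong Fins (λ b → ∑-*ˡ (allFin r) (t a b) (slotHits (emb p) a b))))))))
        (≡-≤ (trans (sym (∑-*ˡ Fins (proj₂ p) (λ a → ∑[ b ∈ Fins ] (t a b * ∑ (allFin r) (slotHits (emb p) a b))))) (∑-cong Fins (λ a →
            trans (sym (∑-*ˡ Fins (proj₂ p) (λ b → t a b * ∑ (allFin r) (slotHits (emb p) a b)))) (∑-cong Fins (λ b → ring₇₅ (proj₂ p) (t a b) (∑ (allFin r) (slotHits (emb p) a b)))))))
          (∑-mono Fins (λ a → ∑-mono Fins (λ b → *-monoˡ (0≤t a b) (*-monoʳ 0≤w (hits≤covers (proj₁ p) a b))))))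

  inv-mul : ∀ {a b} → 0ℚ < a → 0ℚ < b → inv (a * b) * a ≡ inv b
  inv-mul {a} {b} 0<a 0<b = trans (sym (*-identityʳ (inv (a * b) * a))) (trans (cong (inv (a * b) * a *_) (sym (trans (*-comm b (inv b)) (inv-* 0<b))))
    (trans (ring₁₀₇ (inv (a * b)) a b (inv b)) (trans (cong (_* inv b) (inv-* (0<* 0<a 0<b))) (*-identityˡ (inv b)))))

  inv-anti : ∀ {a b} → 0ℚ < a → a ≤ b → inv b ≤ inv a
  inv-anti {a} {b} 0<a a≤b = ≤-trans (≡-≤ (trans (sym (*-identityʳ (inv b))) (cong (inv b *_) (sym (trans (*-comm a (inv a)) (inv-* 0<a)))))
    (≡-≤ (sym (*-assoc (inv b) a (inv a))) (*-monoʳ (<⇒≤ (0<inv 0<a)) (*-monoˡ (<⇒≤ (0<inv 0<b)) a≤b)))) (≤-reflexive (trans (cong (_* inv a) (inv-* 0<b)) (*-identityˡ (inv a))))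
    where
    0<b : 0ℚ < b
    0<b = <-≤-trans 0<a a≤b

  inv-move : ∀ {c x y} → 0ℚ < c → c * x ≤ y → x ≤ inv c * y
  inv-move {c} {x} {y} 0<c h = ≡-≤ (trans (sym (*-identityˡ x)) (trans (cong (_* x) (sym (inv-* 0<c))) (*-assoc (inv c) c x))) (*-monoˡ (<⇒≤ (0<inv 0<c)) h)

  module FixCoordinate {n k : ℕ} (ls : Vec (List (Fin n)) k) (g₀ : ℚ) (0<g₀ : 0ℚ < g₀) (g₀≤ : ∀ u → g₀ ≤ ι (length (Vec.lookup ls u)))
    (uniq : ∀ u b → ∑[ y ∈ Vec.lookup ls u ] ⟦ y Fin.≟ b ⟧ᵈ ≤ 1ℚ) where

    -- When coordinate `u` is redrawn, at most one of its at least `g₀` values is the prescribed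
    -- one, which does not depend on it.
    fix : ∀ u (a : Vec (Fin n) k → Fin n) (h : Vec (Fin n) k → ℚ) → (∀ x → 0ℚ ≤ h x) →
      (∀ x y → a (x [ u ]≔ y) ≡ a x) → (∀ x y → h (x [ u ]≔ y) ≡ h x) →
      ∑[ x ∈ box ls ] (⟦ Vec.lookup x u Fin.≟ a x ⟧ᵈ * h x) ≤ inv g₀ * ∑ (box ls) h
    fix u a h 0≤h a-inv h-inv = inv-move 0<g₀ (≤-trans (*-monoʳ (0≤∑ (box ls) (λ x → 0≤* (0≤⟦⟧ (does (Vec.lookup x u Fin.≟ a x))) (0≤h x))) (g₀≤ u))
      (≡-≤ (sym (resample ls u (λ x → ⟦ Vec.lookup x u Fin.≟ a x ⟧ᵈ * h x))) (∑-mono (box ls) bound)))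
      where
      bound : ∀ x → ∑[ y ∈ Vec.lookup ls u ] (⟦ Vec.lookup (x [ u ]≔ y) u Fin.≟ a (x [ u ]≔ y) ⟧ᵈ * h (x [ u ]≔ y)) ≤ h x
      bound x = ≡-≤ (trans (∑-cong (Vec.lookup ls u) (λ y → cong₂ _*_ (cong₂ (λ p q → ⟦ p Fin.≟ q ⟧ᵈ) (Vec.lookup∘update u x y) (a-inv x y)) (h-inv x y))) (∑-*ʳ (Vec.lookup ls u) (h x) (λ y → ⟦ y Fin.≟ a x ⟧ᵈ)))
        (≤-≡ (*-monoʳ (0≤h x) (uniq u (a x))) (*-identityˡ (h x)))

    fix₃ : ∀ {u v z} → u ≢ v → u ≢ z → v ≢ z → ∀ a b c →
      ∑[ x ∈ box ls ] (⟦ Vec.lookup x u Fin.≟ a ⟧ᵈ * (⟦ Vec.lookup x v Fin.≟ b ⟧ᵈ * (⟦ Vec.lookup x z Fin.≟ c ⟧ᵈ * 1ℚ))) ≤ inv g₀ * (inv g₀ * (inv g₀ * ∏len ls))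
    fix₃ {u} {v} {z} u≢v u≢z v≢z a b c = ≤-trans (fix u (λ _ → a) (λ x → I v b x * (I z c x * 1ℚ)) (λ x → 0≤* (0≤I v b x) (0≤* (0≤I z c x) 0≤1)) (λ _ _ → refl) (λ x y → cong₂ _*_ (I-inv u≢v b x y) (cong (_* 1ℚ) (I-inv u≢z c x y))))
      (*-monoˡ 0≤i (≤-trans (fix v (λ _ → b) (λ x → I z c x * 1ℚ) (λ x → 0≤* (0≤I z c x) 0≤1) (λ _ _ → refl) (λ x y → cong (_* 1ℚ) (I-inv v≢z c x y)))
        (*-monoˡ 0≤i (≤-≡ (fix z (λ _ → c) (λ _ → 1ℚ) (λ _ → 0≤1) (λ _ _ → refl) (λ _ _ → refl)) (cong (inv g₀ *_) (∑-box-1 ls))))))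
      where
      0≤i : 0ℚ ≤ inv g₀
      0≤i = <⇒≤ (0<inv 0<g₀)
      I : Fin k → Fin n → Vec (Fin n) k → ℚ
      I v b x = ⟦ Vec.lookup x v Fin.≟ b ⟧ᵈ
      0≤I : ∀ v b x → 0ℚ ≤ I v b x
      0≤I v b x = 0≤⟦⟧ (does (Vec.lookup x v Fin.≟ b))
      I-inv : ∀ {u v} → u ≢ v → ∀ b x y → I v b (x [ u ]≔ y) ≡ I v b x
      I-inv u≢v b x y = cong (λ p → ⟦ p Fin.≟ b ⟧ᵈ) (Vec.lookup∘update′ (u≢v ∘ sym) x y)

    fix-diagonal : ∀ {u v} → u ≢ v → ∑[ x ∈ box ls ] (⟦ Vec.lookup x u Fin.≟ Vec.lookup x v ⟧ᵈ * 1ℚ) ≤ inv g₀ * ∏len ls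
    fix-diagonal {u} {v} u≢v = ≤-≡ (fix u (λ x → Vec.lookup x v) (λ _ → 1ℚ) (λ _ → 0≤1) (λ x y → Vec.lookup∘update′ (u≢v ∘ sym) x y) (λ _ _ → refl)) (cong (inv g₀ *_) (∑-box-1 ls))

-- Spreading the fractional packing and the hypergraph of copies.

module Spread where
  open import Data.Rational
  open import Data.Rational.Properties
  open RingIdentities
  open Rationals
  open Boxes
  open Nibble using (except; ∏-except; 0≤except; ≢ᶠ; ≢ᶠ-≡; 0≤≢ᶠ; WeightedHypergraph; module Hypergraph)
  open NibbleTheorem using (module Params)
  open Regularity
  open Counting
  open EdgeSlots
  open Loads

  invˡ≤1 : ∀ {m} → 0ℚ ≤ m → inv m * m ≤ 1ℚ
  invˡ≤1 {m} 0≤m with 0ℚ <? m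
  ... | yes h = ≤-reflexive (inv-* h)
  ... | no ¬h = ≡-≤ (trans (cong (inv m *_) (≤-antisym (≮⇒≥ ¬h) 0≤m)) (*-zeroʳ (inv m))) 0≤1

  0≤inv : ∀ {m} → 0ℚ ≤ m → 0ℚ ≤ inv m
  0≤inv {m} 0≤m with 0ℚ <? m
  ... | yes h = <⇒≤ (0<inv h)
  ... | no ¬h rewrite ≤-antisym (≮⇒≥ ¬h) 0≤m = ≤-refl

  opaque
    unfolding ∏
    ρ^≤∏ : ∀ {A : Set} (xs : List A) (f : A → ℚ) {ρ} → 0ℚ ≤ ρ → (∀ x → ρ ≤ f x) → ρ ^ length xs ≤ ∏ xs f
    ρ^≤∏ [] f _ _ = ≤-refl
    ρ^≤∏ (x ∷ xs) f 0≤ρ h = *-mono (0≤^ (length xs) 0≤ρ) (≤-trans 0≤ρ (h x)) (h x) (ρ^≤∏ xs f 0≤ρ h)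

  opaque
    unfolding ∑
    ∑-cartesianProduct : ∀ {A B : Set} (xs : List A) (ys : List B) (f : A × B → ℚ) → ∑ (cartesianProduct xs ys) f ≡ ∑[ x ∈ xs ] ∑[ y ∈ ys ] f (x , y)
    ∑-cartesianProduct [] ys f = refl
    ∑-cartesianProduct (x ∷ xs) ys f = trans (∑-++ (map (x ,_) ys) (cartesianProduct xs ys) f) (cong₂ _+_ (∑-map (x ,_) ys f) (∑-cartesianProduct xs ys f))

  ∑-below : ∀ s m → m ℕ.≤ s → ∑[ t ∈ allFin s ] ⟦ toℕ t ℕ.<? m ⟧ᵈ ≡ ι m
  ∑-below s ℕ.zero _ = trans (∑-cong (allFin s) (λ t → ⟦⟧ᵈ-no (toℕ t ℕ.<? 0) (λ ()))) (trans (∑-0 (allFin s)) (sym ι-0))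
  ∑-below (ℕ.suc s) (ℕ.suc m) (ℕ.s≤s m≤s) = trans (∑-suc (λ t → ⟦ toℕ t ℕ.<? ℕ.suc m ⟧ᵈ)) (trans (cong₂ _+_ (⟦⟧ᵈ-yes (0 ℕ.<? ℕ.suc m) (ℕ.s≤s ℕ.z≤n))
    (trans (∑-cong (allFin s) (λ t → ⟦⟧ᵈ-cong (ℕ.suc (toℕ t) ℕ.<? ℕ.suc m) (toℕ t ℕ.<? m) ℕ.s≤s⁻¹ ℕ.s≤s)) (∑-below s m m≤s))) (sym (ι-suc m)))

  table : ∀ {A B C : Set} → (A → List B) → List C → List A → List (A × (B × C))
  table ys zs = concatMap (λ a → concatMap (λ b → map (λ c → (a , (b , c))) zs) (ys a))

  ∈-table : ∀ {A B C : Set} (ys : A → List B) (zs : List C) (ps : List A) {a b c} → (a , (b , c)) ∈ table ys zs ps → b ∈ ys a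
  ∈-table ys zs ps h with find (∈-concatMap⁻ (λ a → concatMap (λ b → map (λ c → (a , (b , c))) zs) (ys a)) {xs = ps} h)
  ... | a , _ , h₁ with find (∈-concatMap⁻ (λ b → map (λ c → (a , (b , c))) zs) {xs = ys a} h₁)
  ...   | b , b∈ , h₂ with ∈-map⁻ (λ c → (a , (b , c))) h₂
  ...     | _ , _ , refl = b∈

  ∑-table : ∀ {A B C : Set} (ys : A → List B) (zs : List C) (ps : List A) f → ∑ (table ys zs ps) f ≡ ∑[ a ∈ ps ] ∑[ b ∈ ys a ] ∑[ c ∈ zs ] f (a , (b , c))
  ∑-table ys zs ps f = trans (∑-concatMap (λ a → concatMap (λ b → map (λ c → (a , (b , c))) zs) (ys a)) ps f)
    (∑-cong ps (λ a → trans (∑-concatMap (λ b → map (λ c → (a , (b , c))) zs) (ys a) f) (∑-cong (ys a) (λ b → ∑-map (λ c → (a , (b , c))) zs f))))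

  module Pairs {n : ℕ} where

    order : ∀ {P : Set} → Dec P → Fin n → Fin n → Fin n × Fin n
    order (yes _) a b = a , b
    order (no _) a b = b , a

    -- A sorted representative of the unordered pair, so that both orientations load the same
    -- hypergraph vertex.
    key : Fin n → Fin n → Fin n × Fin n
    key a b = order (a Fin.<? b) a b

    key-cases : ∀ a b → key a b ≡ (a , b) ⊎ key a b ≡ (b , a)
    key-cases a b = go (a Fin.<? b)
      where
      go : ∀ {P : Set} (d : Dec P) → order d a b ≡ (a , b) ⊎ order d a b ≡ (b , a)
      go (yes _) = inj₁ refl
      go (no _) = inj₂ refl

    key-< : ∀ {a b} → a Data.Fin.< b → key a b ≡ (a , b)
    key-< {a} {b} a<b = go (a Fin.<? b)
      where
      go : (d : Dec (a Data.Fin.< b)) → order d a b ≡ (a , b)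
      go (yes _) = refl
      go (no ¬h) = ⊥-elim (¬h a<b)

    key-> : ∀ {a b} → ¬ (a Data.Fin.< b) → key a b ≡ (b , a)
    key-> {a} {b} ≮ = go (a Fin.<? b)
      where
      go : (d : Dec (a Data.Fin.< b)) → order d a b ≡ (b , a)
      go (yes h) = ⊥-elim (≮ h)
      go (no _) = refl

    key-sym : ∀ a b → key a b ≡ key b a
    key-sym a b with Fin.<-cmp a b
    ... | tri< a<b _ b≮a = trans (key-< a<b) (sym (key-> b≮a))
    ... | tri≈ _ refl _ = refl
    ... | tri> a≮b _ b<a = trans (key-> a≮b) (sym (key-< b<a))

    key-≡ : ∀ {a b a′ b′} → key a b ≡ (a′ , b′) → (a ≡ a′ × b ≡ b′) ⊎ (a ≡ b′ × b ≡ a′)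
    key-≡ {a} {b} e with key-cases a b
    ... | inj₁ h with trans (sym h) e
    ...   | refl = inj₁ (refl , refl)
    key-≡ {a} {b} e | inj₂ h with trans (sym h) e
    ...   | refl = inj₂ (refl , refl)

    key-key : ∀ {a b a′ b′} → key a b ≡ key a′ b′ → (a ≡ a′ × b ≡ b′) ⊎ (a ≡ b′ × b ≡ a′)
    key-key {a} {b} {a′} {b′} e with key-cases a′ b′
    ... | inj₁ h = key-≡ (trans e h)
    ... | inj₂ h with key-≡ (trans e h)
    ...   | inj₁ p = inj₂ p
    ...   | inj₂ p = inj₁ p

    _≟ₚ_ : (e e′ : Fin n × Fin n) → Dec (e ≡ e′)
    (a , b) ≟ₚ (a′ , b′) = map′ (λ { (refl , refl) → refl }) (λ { refl → refl , refl }) ((a Fin.≟ a′) ×-dec (b Fin.≟ b′))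

    ⟦≟ₚ⟧ : ∀ a b a′ b′ → ⟦ (a , b) ≟ₚ (a′ , b′) ⟧ᵈ ≡ ⟦ a Fin.≟ a′ ⟧ᵈ * ⟦ b Fin.≟ b′ ⟧ᵈ
    ⟦≟ₚ⟧ a b a′ b′ = ⟦∧⟧ (does (a Fin.≟ a′)) (does (b Fin.≟ b′))

    ∑-δₚ : ∀ e (f : Fin n × Fin n → ℚ) → ∑[ a ∈ allFin n ] ∑[ b ∈ allFin n ] (⟦ e ≟ₚ (a , b) ⟧ᵈ * f (a , b)) ≡ f e
    ∑-δₚ (x , y) f = trans (∑-cong (allFin n) (λ a → trans (∑-cong (allFin n) (λ b → trans (cong (_* f (a , b)) (⟦≟ₚ⟧ x y a b)) (*-assoc ⟦ x Fin.≟ a ⟧ᵈ ⟦ y Fin.≟ b ⟧ᵈ (f (a , b)))))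
      (trans (∑-*ˡ (allFin n) ⟦ x Fin.≟ a ⟧ᵈ (λ b → ⟦ y Fin.≟ b ⟧ᵈ * f (a , b))) (cong (⟦ x Fin.≟ a ⟧ᵈ *_) (∑-δ y (λ b → f (a , b))))))) (∑-δ x (λ a → f (a , y)))

  open Pairs

  record SpreadData : Set where
    field
      {k n r₁} : ℕ
      F : Graph k
      Sl : Slots F (ℕ.suc r₁)
      G : Multigraph n
      s : ℕ
      1≤s : 1 ℕ.≤ s
      bounded : MultBounded s G
      ψ : FracPacking k n
      isF : IsFracPacking F G ψ
      0<n : 0ℚ < ι n
      ε θ ρ γ : ℚ
      0≤ε : 0ℚ ≤ ε
      0<ρ : 0ℚ < ρ
      0<γ : 0ℚ < γ
      γ≤1 : γ ≤ 1ℚ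
      {M̄} : ℕ
      RP : RegularPartition (λ a b → ι (mult G a b)) (s ℕ.^ ℕ.suc r₁) ε θ M̄

  module Spreading (𝒟 : SpreadData) where
    open SpreadData 𝒟
    open Slots Sl
    open LoadBound F Sl G ψ isF
    open RegularPartition RP

    r : ℕ
    r = ℕ.suc r₁

    js : List (Fin r)
    js = allFin r

    W : Fin n → Fin n → ℕ
    W = mult G

    Entry : Set
    Entry = Embedding k n × ℚ

    -- The positive part makes w nonnegative off ψ too; on ψ it changes nothing.
    w : Entry → ℚ
    w p = proj₂ p ⁺

    0≤w : ∀ p → 0ℚ ≤ w p
    0≤w p = 0≤⁺ (proj₂ p)

    w≡ : ∀ {p} → p ∈ ψ → w p ≡ proj₂ p
    w≡ {p} p∈ = ⁺-0≤ (proj₁ isF p p∈)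

    sz : Fin n → ℚ
    sz a = size c (c a)

    g₀ : ℚ
    g₀ = γ * ι n

    0<g₀ : 0ℚ < g₀
    0<g₀ = 0<* 0<γ 0<n

    big? : ∀ a → Dec (g₀ ≤ sz a)
    big? a = g₀ ≤? sz a

    dens : Fin n → Fin n → ℚ
    dens a b = density Wq c (c a) (c b)

    Good : Fin n → Fin n → Set
    Good a b = reg (c a) (c b) ≡ true × g₀ ≤ sz a × g₀ ≤ sz b × ρ ≤ dens a b

    good? : ∀ a b → Dec (Good a b)
    good? a b = (reg (c a) (c b) Bool.≟ true) ×-dec (big? a ×-dec (big? b ×-dec (ρ ≤? dens a b)))

    GoodE : Entry → Set
    GoodE p = ∀ l → Good (emb p (src l)) (emb p (tgt l))

    goodE? : ∀ p → Dec (GoodE p)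
    goodE? p = Fin.all? (λ l → good? (emb p (src l)) (emb p (tgt l)))

    ψg : FracPacking k n
    ψg = filter goodE? ψ

    ∈ψg : ∀ {p} → p ∈ ψg → p ∈ ψ × GoodE p
    ∈ψg = ∈-filter⁻ goodE? {xs = ψ}

    -- A vertex of F in a small cell is isolated (the entry being good), so it may
    -- be spread over all of V(G); this keeps every side of the box large.
    part : Entry → Fin k → List (Fin n)
    part p u = if does (big? (emb p u)) then cell c (c (emb p u)) else allFin n

    ls : Entry → Vec (List (Fin n)) k
    ls p = Vec.tabulate (part p)

    ls≡part : ∀ p u → Vec.lookup (ls p) u ≡ part p u
    ls≡part p u = Vec.lookup∘tabulate (part p) u

    ls≡cell : ∀ p u → g₀ ≤ sz (emb p u) → Vec.lookup (ls p) u ≡ cell c (c (emb p u))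
    ls≡cell p u h = trans (ls≡part p u) (go (big? (emb p u)))
      where
      go : (d : Dec (g₀ ≤ sz (emb p u))) → (if does d then cell c (c (emb p u)) else allFin n) ≡ cell c (c (emb p u))
      go (yes _) = refl
      go (no ¬h) = ⊥-elim (¬h h)

    g₀≤len : ∀ p u → g₀ ≤ ι (length (Vec.lookup (ls p) u))
    g₀≤len p u = ≤-≡ (go (big? (emb p u))) (cong (λ l → ι (length l)) (sym (ls≡part p u)))
      where
      go : (d : Dec (g₀ ≤ sz (emb p u))) → g₀ ≤ ι (length (if does d then cell c (c (emb p u)) else allFin n))
      go (yes h) = h
      go (no _) = ≤-trans (*-monoʳ (<⇒≤ 0<n) γ≤1) (≤-reflexive (trans (*-identityˡ (ι n)) (cong ι (sym (length-allFin n)))))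

    ls-uniq : ∀ p u b → ∑[ y ∈ Vec.lookup (ls p) u ] ⟦ y Fin.≟ b ⟧ᵈ ≤ 1ℚ
    ls-uniq p u b = ≡-≤ (cong (λ l → ∑[ y ∈ l ] ⟦ y Fin.≟ b ⟧ᵈ) (ls≡part p u)) (go (does (big? (emb p u))))
      where
      all : ∑[ y ∈ allFin n ] ⟦ y Fin.≟ b ⟧ᵈ ≤ 1ℚ
      all = ≤-reflexive (trans (∑-cong (allFin n) (λ y → trans (⟦⟧ᵈ-cong (y Fin.≟ b) (b Fin.≟ y) sym sym) (sym (*-identityʳ ⟦ b Fin.≟ y ⟧ᵈ)))) (∑-δ b (λ _ → 1ℚ)))
      go : ∀ t → ∑[ y ∈ (if t then cell c (c (emb p u)) else allFin n) ] ⟦ y Fin.≟ b ⟧ᵈ ≤ 1ℚ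
      go true = ≡-≤ (∑-filter (λ a → c a Fin.≟ c (emb p u)) (allFin n) (λ y → ⟦ y Fin.≟ b ⟧ᵈ))
        (≤-trans (∑-mono (allFin n) (λ y → ≤-≡ (*-monoʳ (0≤⟦⟧ (does (y Fin.≟ b))) (⟦⟧≤1 (does (c y Fin.≟ c (emb p u))))) (*-identityˡ _))) all)
      go false = all

    d : Entry → Fin r → ℚ
    d p l = dens (emb p (src l)) (emb p (tgt l))

    dΠ : Entry → ℚ
    dΠ p = ∏ js (d p)

    Zp : Entry → ℚ
    Zp p = ∏len (ls p)

    -- The weight per homomorphism: the weighted number of homomorphisms into the box is about
    -- `Zp p * dΠ p`, so the total remains about `w p`.
    C : Entry → ℚ
    C p = w p * inv (Zp p * dΠ p)

    0<Zp : ∀ p → 0ℚ < Zp p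
    0<Zp p = 0<∏ (allFin k) (λ u → <-≤-trans 0<g₀ (g₀≤len p u))

    at : Fin r → (Fin n → Fin n → ℕ) → Vec (Fin n) k → ℕ
    at l b x = b (Vec.lookup x (src l)) (Vec.lookup x (tgt l))

    -- `R` bounds 1/dΠ for good entries, all r densities being at least ρ; `η₁` is the counting
    -- error relative to the weight of an entry.
    R η₁ K : ℚ
    R = inv (ρ ^ r)
    K = ι (s ℕ.^ r)
    η₁ = ι r * (K * ε) * R

    0<ρ^ : 0ℚ < ρ ^ r
    0<ρ^ = 0<^ r 0<ρ

    0≤R : 0ℚ ≤ R
    0≤R = <⇒≤ (0<inv 0<ρ^)

    0≤K : 0ℚ ≤ K
    0≤K = 0≤ι (s ℕ.^ r)

    0≤η₁ : 0ℚ ≤ η₁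
    0≤η₁ = 0≤* (0≤* (0≤ι r) (0≤* 0≤K 0≤ε)) 0≤R

    Bc : (Fin n → Fin n → ℕ) → Fin M → Fin M → ℚ
    Bc b i j = mass (λ x y → ι (b x y)) c i j

    density-mass : ∀ a b → dens a b * (sz a * sz b) ≡ mass Wq c (c a) (c b)
    density-mass a b = trans (ring₉₄ (inv (sz a * sz b)) (mass Wq c (c a) (c b)) (sz a * sz b)) (trans (cong (_* mass Wq c (c a) (c b)) (inv-* 0<S)) (*-identityˡ _))
      where
      0<S : 0ℚ < sz a * sz b
      0<S = 0<* (0<length (∈-cell-own c a)) (0<length (∈-cell-own c b))

    mass≤ : ∀ i j → mass Wq c i j ≤ size c i * size c j * ι s
    mass≤ i j = ≤-trans (∑-mono (cell c i) (λ a → ∑-mono (cell c j) (λ b → ι-mono (bounded a b))))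
      (≤-reflexive (trans (∑-cong (cell c i) (λ _ → ∑-const (cell c j) (ι s))) (trans (∑-const (cell c i) (size c j * ι s)) (sym (*-assoc (size c i) (size c j) (ι s))))))

    0≤mass : ∀ i j → 0ℚ ≤ mass Wq c i j
    0≤mass i j = 0≤∑ (cell c i) (λ a → 0≤∑ (cell c j) (λ b → 0≤ι (W a b)))

    0≤dens : ∀ a b → 0ℚ ≤ dens a b
    0≤dens a b = 0≤* (0≤inv (0≤* (0≤size c (c a)) (0≤size c (c b)))) (0≤mass (c a) (c b))

    dens≤s : ∀ a b → dens a b ≤ ι s
    dens≤s a b = ≤-trans (*-monoˡ (0≤inv 0≤S) (mass≤ (c a) (c b))) (≡-≤ (sym (*-assoc (inv S) S (ι s))) (≤-≡ (*-monoʳ (0≤ι s) (invˡ≤1 0≤S)) (*-identityˡ (ι s))))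
      where
      S : ℚ
      S = sz a * sz b
      0≤S : 0ℚ ≤ S
      0≤S = 0≤* (0≤size c (c a)) (0≤size c (c b))

    module GoodEntry (p : Entry) (gp : GoodE p) where

      ρ≤d : ∀ l → ρ ≤ d p l
      ρ≤d l = proj₂ (proj₂ (proj₂ (gp l)))

      cells : CellSystem n k r
      cells = record { s = s ; 1≤s = 1≤s ; E = E ; ends≢ = loopless-slot ; separated = separated ; W = W ; W≤s = bounded ; ls = ls p
        ; nonempty = λ u → <-≤-trans 0<g₀ (g₀≤len p u) ; d = d p ; ε = ε ; 0≤ε = 0≤ε
        ; 0≤d = λ l → 0≤dens (emb p (src l)) (emb p (tgt l)) ; d≤s = λ l → dens≤s (emb p (src l)) (emb p (tgt l)) }

      module Cn = Count cells

      srcCell : ∀ l → Vec.lookup (ls p) (src l) ≡ cell c (c (emb p (src l)))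
      srcCell l = ls≡cell p (src l) (proj₁ (proj₂ (gp l)))

      tgtCell : ∀ l → Vec.lookup (ls p) (tgt l) ≡ cell c (c (emb p (tgt l)))
      tgtCell l = ls≡cell p (tgt l) (proj₁ (proj₂ (proj₂ (gp l))))

      regular-slot : ∀ l → Cn.Regular l
      regular-slot l σ f g f≤ g≤ = subst₂ (λ A B → sgn σ * ∑[ y ∈ A ] ∑[ z ∈ B ] ((ι (W y z) - d p l) * (ι (f y) * ι (g z))) ≤ ε * (ι (length A) * ι (length B)))
        (sym (srcCell l)) (sym (tgtCell l)) (regular (emb p (src l)) (emb p (tgt l)) (proj₁ (gp l)) σ f g f≤ g≤)

      0<dΠ : 0ℚ < dΠ p
      0<dΠ = 0<∏ js (λ l → <-≤-trans 0<ρ (ρ≤d l))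

      0<ZdΠ : 0ℚ < Zp p * dΠ p
      0<ZdΠ = 0<* (0<Zp p) 0<dΠ

      0≤C : 0ℚ ≤ C p
      0≤C = 0≤* (0≤w p) (<⇒≤ (0<inv 0<ZdΠ))

      C* : C p * (dΠ p * Zp p) ≡ w p
      C* = trans (*-assoc (w p) (inv (Zp p * dΠ p)) (dΠ p * Zp p)) (trans (cong (λ z → w p * (inv (Zp p * dΠ p) * z)) (*-comm (dΠ p) (Zp p))) (trans (cong (w p *_) (inv-* 0<ZdΠ)) (*-identityʳ (w p))))

      CZ≤ : C p * Zp p ≤ w p * R
      CZ≤ = ≡-≤ (trans (*-assoc (w p) (inv (Zp p * dΠ p)) (Zp p)) (cong (w p *_) (inv-mul (0<Zp p) 0<dΠ)))
        (*-monoˡ (0≤w p) (inv-anti 0<ρ^ (≡-≤ (cong (ρ ^_) (sym (length-allFin r))) (ρ^≤∏ js (d p) (<⇒≤ 0<ρ) ρ≤d))))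

      C-err : C p * Cn.err ≤ w p * η₁
      C-err = ≡-≤ (ring₁₀₉ (C p) (ι r) K ε (Zp p)) (≤-≡ (*-monoʳ (0≤* (0≤ι r) (0≤* 0≤K 0≤ε)) CZ≤) (ring₇ (w p) R (ι r * (K * ε))))

      total≥ : w p - w p * η₁ ≤ C p * ∑[ x ∈ box (ls p) ] ∏[ l ∈ js ] ι (at l W x)
      total≥ = ≤-trans (≤-≡ (+-mono-≤ {w p} {C p * (dΠ p * Zp p)} { - (w p * η₁)} { - (C p * Cn.err)} (≤-reflexive (sym C*)) (neg-mono C-err)) (ring₅₃ (C p) (dΠ p * Zp p) Cn.err)) (*-monoˡ 0≤C (Cn.count-all regular-slot))

      -- The product of the other densities lacks the density at `l`, and this density times the two
      -- cell sizes is the mass of the pair of cells. So the entry meets `b` in the proportion that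
      -- the sum of `b` has to the mass.
      through≤ : ∀ l (b : Fin n → Fin n → ℕ) → (∀ x y → b x y ℕ.≤ s) →
        C p * ∑[ x ∈ box (ls p) ] (ι (at l b x) * ∏ js (except l (λ m → ι (at m W x))))
          ≤ w p * (inv (mass Wq c (c (emb p (src l))) (c (emb p (tgt l)))) * Bc b (c (emb p (src l))) (c (emb p (tgt l)))) + w p * η₁
      through≤ l b b≤s = ≤-trans (*-monoˡ 0≤C (Cn.count-through l b b≤s regular-slot)) (≡-≤ (*-distribˡ-+ (C p) (D * A) Cn.err) (+-mono-≤ (≤-reflexive X≡) C-err))
        where
        i j : Fin M
        i = c (emb p (src l))
        j = c (emb p (tgt l))
        D A B m S : ℚ
        D = ∏ js (except l (d p))
        A = ∑[ x ∈ box (ls p) ] ι (at l b x)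
        B = Bc b i j
        m = mass Wq c i j
        S = size c i * size c j
        m≡ : m ≡ d p l * S
        m≡ = sym (density-mass (emb p (src l)) (emb p (tgt l)))
        0<m : 0ℚ < m
        0<m = subst (0ℚ <_) (sym m≡) (0<* (<-≤-trans 0<ρ (ρ≤d l)) (0<* (0<length (∈-cell-own c (emb p (src l)))) (0<length (∈-cell-own c (emb p (tgt l))))))
        SA : S * A ≡ Zp p * B
        SA = trans (cong₂ (λ P Q → ι (length P) * ι (length Q) * A) (sym (srcCell l)) (sym (tgtCell l))) (trans (Cn.pair-sum l b) (cong (Zp p *_) (cong₂ (λ P Q → ∑[ y ∈ P ] ∑[ z ∈ Q ] ι (b y z)) (srcCell l) (tgtCell l))))
        Xm : C p * (D * A) * m ≡ w p * B
        Xm = trans (cong (C p * (D * A) *_) m≡) (trans (ring₁₀₈ (C p) D (d p l) S A) (trans (cong₂ (λ a z → C p * a * z) (sym (∏-except l (d p))) SA) (trans (ring₁₀₇ (C p) (dΠ p) (Zp p) B) (cong (_* B) C*))))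
        X≡ : C p * (D * A) ≡ w p * (inv m * B)
        X≡ = trans (sym (*-identityʳ (C p * (D * A)))) (trans (cong (C p * (D * A) *_) (sym (trans (*-comm m (inv m)) (inv-* 0<m)))) (trans (sym (*-assoc (C p * (D * A)) m (inv m))) (trans (cong (_* inv m) Xm) (ring₇ (w p) B (inv m)))))

    Fin² : (Fin n → Fin n → ℚ) → ℚ
    Fin² h = ∑[ a ∈ allFin n ] ∑[ b ∈ allFin n ] h a b

    n² : ℚ
    n² = ι n * ι n

    0≤n² : 0ℚ ≤ n²
    0≤n² = 0≤* (<⇒≤ 0<n) (<⇒≤ 0<n)

    Fin²-const : ∀ z → Fin² (λ _ _ → z) ≡ n² * z
    Fin²-const z = trans (∑-cong (allFin n) (λ _ → ∑-const (allFin n) z)) (trans (∑-const (allFin n) (ι (length (allFin n)) * z))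
      (trans (cong (λ m → ι m * (ι m * z)) (length-allFin n)) (sym (*-assoc (ι n) (ι n) z))))

    Fin²-mono : ∀ {g h : Fin n → Fin n → ℚ} → (∀ a b → g a b ≤ h a b) → Fin² g ≤ Fin² h
    Fin²-mono k = ∑-mono (allFin n) (λ a → ∑-mono (allFin n) (k a))

    Fin²-+ : ∀ g h → Fin² (λ a b → g a b + h a b) ≡ Fin² g + Fin² h
    Fin²-+ g h = trans (∑-cong (allFin n) (λ a → ∑-+ (allFin n) (g a) (h a))) (∑-+ (allFin n) (λ a → ∑ (allFin n) (g a)) (λ a → ∑ (allFin n) (h a)))

    colours : (Fin M → Fin M → ℚ) → ℚ
    colours h = ∑[ i ∈ allFin M ] ∑[ j ∈ allFin M ] h i j

    colours-mono : ∀ {g h : Fin M → Fin M → ℚ} → (∀ i j → g i j ≤ h i j) → colours g ≤ colours h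
    colours-mono k = ∑-mono (allFin M) (λ i → ∑-mono (allFin M) (k i))

    by-colour : ∀ (h : Fin M → Fin M → ℚ) (f : Fin n → Fin n → ℚ) → Fin² (λ a b → h (c a) (c b) * f a b) ≡ colours (λ i j → h i j * mass f c i j)
    by-colour h f = trans (sym (∑∑-cells c (λ a b → h (c a) (c b) * f a b))) (∑-cong (allFin M) (λ i → ∑-cong (allFin M) (λ j →
      trans (∑-cong∈ (cell c i) (λ {a} a∈ → trans (∑-cong∈ (cell c j) (λ {b} b∈ → cong (_* f a b) (cong₂ h (∈-cell c a∈) (∈-cell c b∈)))) (∑-*ˡ (cell c j) (h i j) (f a)))) (∑-*ˡ (cell c i) (h i j) (λ a → ∑ (cell c j) (f a))))))

    mass-1 : ∀ i j → mass (λ _ _ → 1ℚ) c i j ≡ size c i * size c j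
    mass-1 i j = trans (∑-cong (cell c i) (λ _ → ∑-1 (cell c j))) (∑-const (cell c i) (size c j))

    V : ℚ
    V = ∑ ψ proj₂

    -- Duality with the constant 1; every copy has an edge, as r is a successor.
    V≤ : V ≤ n² * ι s
    V≤ = ≤-trans (∑-mono∈ ψ (λ {p} p∈ → ≤-trans (≡-≤ (sym (*-identityʳ (proj₂ p))) (*-monoˡ (proj₁ isF p p∈) one)) ≤-refl))
      (≤-trans (load-bound (λ _ _ → 1ℚ) (λ _ _ → 0≤1)) (≤-≡ (Fin²-mono (λ a b → ≡-≤ (*-identityˡ (Wq a b)) (ι-mono (bounded a b)))) (Fin²-const (ι s))))
      where
      one : 1ℚ ≤ ∑[ l ∈ js ] (1ℚ + 1ℚ)
      one = ≤-trans (≤-by {1ℚ} {1ℚ + (1ℚ + ι r₁ * 2ℚ)} (1ℚ + ι r₁ * 2ℚ) (0≤+ 0≤1 (0≤* (0≤ι r₁) 0≤2)) refl)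
        (≤-reflexive (trans (ring₁₁₀ (ι r₁)) (trans (cong (_* 2ℚ) (trans (sym (ι-suc r₁)) (cong ι (sym (length-allFin r))))) (sym (∑-const js 2ℚ)))))

    miss : ∀ {P : Set} → Dec P → ℚ
    miss d = 1ℚ - ⟦ d ⟧ᵈ

    0≤miss : ∀ {P : Set} (d : Dec P) → 0ℚ ≤ miss d
    0≤miss d = 0≤-diff (⟦⟧≤1 (does d))

    miss≤1 : ∀ {P : Set} (d : Dec P) → miss d ≤ 1ℚ
    miss≤1 d = ≤-by {miss d} {1ℚ} ⟦ d ⟧ᵈ (0≤⟦⟧ (does d)) (ring₁₇ ⟦ d ⟧ᵈ)

    miss-yes : ∀ {P : Set} (d : Dec P) → P → miss d ≡ 0ℚ
    miss-yes d p = trans (cong (λ z → 1ℚ - z) (⟦⟧ᵈ-yes d p)) (+-inverseʳ 1ℚ)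

    miss-no : ∀ {P : Set} (d : Dec P) → ¬ P → miss d ≡ 1ℚ
    miss-no d ¬p = trans (cong (λ z → 1ℚ - z) (⟦⟧ᵈ-no d ¬p)) refl

    bad : Fin n → Fin n → ℚ
    bad a b = miss (good? a b)

    low? : ∀ i j → Dec (ρ ≤ density Wq c i j)
    low? i j = ρ ≤? density Wq c i j

    miss-× : ∀ {P Q : Set} (d : Dec P) (e : Dec Q) → miss (d ×-dec e) ≤ miss d + miss e
    miss-× d e = ≤-by {miss (d ×-dec e)} {miss d + miss e} (miss d * miss e) (0≤* (0≤miss d) (0≤miss e)) (trans (cong (λ z → 1ℚ - z + miss d * miss e) (⟦∧⟧ (does d) (does e))) (ring₁₁₁ ⟦ d ⟧ᵈ ⟦ e ⟧ᵈ))

    miss-true : ∀ b → miss (b Bool.≟ true) ≡ ⟦ not b ⟧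
    miss-true true = trans (miss-yes (true Bool.≟ true) refl) (sym ⟦false⟧)
    miss-true false = trans (miss-no (false Bool.≟ true) (λ ())) (sym ⟦true⟧)

    bad≤ : ∀ a b → bad a b ≤ ⟦ not (reg (c a) (c b)) ⟧ + (miss (big? a) + (miss (big? b) + miss (low? (c a) (c b))))
    bad≤ a b = ≤-trans (miss-× (reg (c a) (c b) Bool.≟ true) (big? a ×-dec (big? b ×-dec low? (c a) (c b))))
      (+-mono-≤ (≤-reflexive (miss-true (reg (c a) (c b)))) (≤-trans (miss-× (big? a) (big? b ×-dec low? (c a) (c b))) (+-monoʳ-≤ (miss (big? a)) (miss-× (big? b) (low? (c a) (c b))))))

    -- The terms stand for irregular pairs, a small cell on either side, and sparse pairs. There are
    -- at most `M̄` cells, and a small one has fewer than γn vertices.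
    bad-mass : Fin² (λ a b → bad a b * Wq a b) ≤ n² * (θ * ι s + (ι M̄ * γ * ι s + (ι M̄ * γ * ι s + ρ)))
    bad-mass = ≤-trans (Fin²-mono (λ a b → ≤-≡ (*-monoʳ (0≤ι (W a b)) (bad≤ a b)) (ring₁₁₂ (⟦ not (reg (c a) (c b)) ⟧) (miss (big? a)) (miss (big? b)) (miss (low? (c a) (c b))) (Wq a b))))
      (≡-≤ (trans (Fin²-+ T₁ (λ a b → T₂ a b + (T₃ a b + T₄ a b))) (cong (Fin² T₁ +_) (trans (Fin²-+ T₂ (λ a b → T₃ a b + T₄ a b)) (cong (Fin² T₂ +_) (Fin²-+ T₃ T₄)))))
      (≤-≡ (+-mono-≤ t₁ (+-mono-≤ t₂ (+-mono-≤ t₃ t₄))) (ring₁₁₃ n² (θ * ι s) (ι M̄ * γ * ι s) ρ)))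
      where
      T₁ T₂ T₃ T₄ : Fin n → Fin n → ℚ
      T₁ a b = ⟦ not (reg (c a) (c b)) ⟧ * Wq a b
      T₂ a b = miss (big? a) * Wq a b
      T₃ a b = miss (big? b) * Wq a b
      T₄ a b = miss (low? (c a) (c b)) * Wq a b
      t₁ : Fin² T₁ ≤ n² * (θ * ι s)
      t₁ = ≡-≤ (by-colour (λ i j → ⟦ not (reg i j) ⟧) Wq) (≤-trans (colours-mono (λ i j → ≤-≡ (*-monoˡ (0≤⟦⟧ (not (reg i j))) (mass≤ i j)) (sym (*-assoc ⟦ not (reg i j) ⟧ (size c i * size c j) (ι s)))))
        (≡-≤ (trans (∑-cong (allFin M) (λ i → ∑-*ʳ (allFin M) (ι s) (λ j → ⟦ not (reg i j) ⟧ * (size c i * size c j)))) (∑-*ʳ (allFin M) (ι s) (λ i → ∑[ j ∈ allFin M ] (⟦ not (reg i j) ⟧ * (size c i * size c j)))))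
        (≤-≡ (*-monoʳ (0≤ι s) few-irregular) (ring₁₀₁ θ n² (ι s)))))
      small-total : ∑[ a ∈ allFin n ] miss (big? a) ≤ ι M̄ * g₀
      small-total = ≡-≤ (sym (∑-cells c (λ a → miss (big? a)))) (≤-trans (∑-mono (allFin M) (λ i → one i)) (≡-≤ (trans (∑-const (allFin M) g₀) (cong (λ m → ι m * g₀) (length-allFin M))) (*-monoʳ (<⇒≤ 0<g₀) (ι-mono M≤))))
        where
        one : ∀ i → ∑[ a ∈ cell c i ] miss (big? a) ≤ g₀
        one i = ≡-≤ (∑-cong∈ (cell c i) (λ {a} a∈ → cong (λ z → miss (g₀ ≤? size c z)) (∈-cell c a∈))) (≡-≤ (∑-const (cell c i) (miss (g₀ ≤? size c i))) (go (g₀ ≤? size c i)))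
          where
          go : (d : Dec (g₀ ≤ size c i)) → size c i * miss d ≤ g₀
          go (yes h) = ≡-≤ (trans (cong (size c i *_) (miss-yes (yes h) h)) (*-zeroʳ (size c i))) (<⇒≤ 0<g₀)
          go (no ¬h) = ≡-≤ (trans (cong (size c i *_) (miss-no (no ¬h) ¬h)) (*-identityʳ (size c i))) (<⇒≤ (≰⇒> ¬h))
      row : ∑[ b ∈ allFin n ] ι s ≡ ι n * ι s
      row = trans (∑-const (allFin n) (ι s)) (cong (λ m → ι m * ι s) (length-allFin n))
      t₂ : Fin² T₂ ≤ n² * (ι M̄ * γ * ι s)
      t₂ = ≤-trans (∑-mono (allFin n) (λ a → ≡-≤ (∑-*ˡ (allFin n) (miss (big? a)) (Wq a)) (*-monoˡ (0≤miss (big? a)) (≤-≡ (∑-mono (allFin n) (λ b → ι-mono (bounded a b))) row))))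
        (≡-≤ (∑-*ʳ (allFin n) (ι n * ι s) (λ a → miss (big? a))) (≤-trans (*-monoʳ (0≤* (<⇒≤ 0<n) (0≤ι s)) small-total) (≤-reflexive (trans (*-comm (ι M̄ * g₀) (ι n * ι s)) (ring₁₁₄ (ι M̄) γ (ι n) (ι s))))))
      t₃ : Fin² T₃ ≤ n² * (ι M̄ * γ * ι s)
      t₃ = ≡-≤ (∑-swap (allFin n) (allFin n) T₃) (≤-trans (∑-mono (allFin n) (λ b → ≡-≤ (∑-*ˡ (allFin n) (miss (big? b)) (λ a → Wq a b)) (*-monoˡ (0≤miss (big? b)) (≤-≡ (∑-mono (allFin n) (λ a → ι-mono (bounded a b))) row))))
        (≡-≤ (∑-*ʳ (allFin n) (ι n * ι s) (λ a → miss (big? a))) (≤-trans (*-monoʳ (0≤* (<⇒≤ 0<n) (0≤ι s)) small-total) (≤-reflexive (trans (*-comm (ι M̄ * g₀) (ι n * ι s)) (ring₁₁₄ (ι M̄) γ (ι n) (ι s)))))))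
      sparse : ∀ i j → miss (low? i j) * mass Wq c i j ≤ ρ * mass (λ _ _ → 1ℚ) c i j
      sparse i j = ≤-≡ (go (low? i j)) (cong (ρ *_) (sym (mass-1 i j)))
        where
        S m : ℚ
        S = size c i * size c j
        m = mass Wq c i j
        0≤S : 0ℚ ≤ S
        0≤S = 0≤* (0≤size c i) (0≤size c j)
        go : (d : Dec (ρ ≤ density Wq c i j)) → miss d * m ≤ ρ * S
        go (yes h) = ≡-≤ (trans (cong (_* m) (miss-yes (yes h) h)) (*-zeroˡ m)) (0≤* (<⇒≤ 0<ρ) 0≤S)
        go (no ¬h) with 0ℚ <? S
        ... | yes 0<S = ≡-≤ (trans (cong (_* m) (miss-no (no ¬h) ¬h)) (trans (*-identityˡ m) (trans (sym (*-identityˡ m)) (trans (cong (_* m) (sym (inv-* 0<S))) (ring₉₄ (inv S) S m))))) (*-monoʳ 0≤S (<⇒≤ (≰⇒> ¬h)))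
        ... | no ¬0<S = ≤-trans (≡-≤ (trans (cong (_* m) (miss-no (no ¬h) ¬h)) (*-identityˡ m)) (mass≤ i j)) (≡-≤ (trans (cong (_* ι s) (≤-antisym (≮⇒≥ ¬0<S) 0≤S)) (*-zeroˡ (ι s))) (0≤* (<⇒≤ 0<ρ) 0≤S))
      t₄ : Fin² T₄ ≤ n² * ρ
      t₄ = ≡-≤ (by-colour (λ i j → miss (low? i j)) Wq) (≤-trans (colours-mono sparse) (≤-reflexive (trans (sym (by-colour (λ _ _ → ρ) (λ _ _ → 1ℚ))) (trans (∑-cong (allFin n) (λ _ → ∑-cong (allFin n) (λ _ → *-identityʳ ρ))) (Fin²-const ρ)))))

    ∑ψg : ∀ (h : Entry → ℚ) → (∀ p → 0ℚ ≤ h p) → ∑ ψg h ≤ ∑ ψ h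
    ∑ψg h 0≤h = ≡-≤ (∑-filter goodE? ψ h) (∑-mono ψ (λ p → ≤-≡ (*-monoʳ (0≤h p) (⟦⟧≤1 (does (goodE? p)))) (*-identityˡ (h p))))

    -- Duality with `bad` as the weight: an entry that is not good pays with one bad slot.
    good-mass : V ≤ ∑ ψg w + n² * (θ * ι s + (ι M̄ * γ * ι s + (ι M̄ * γ * ι s + ρ)))
    good-mass = ≤-trans (∑-mono∈ ψ split) (≡-≤ (∑-+ ψ (λ p → ⟦ goodE? p ⟧ᵈ * w p) (λ p → proj₂ p * ∑ js (both bad p)))
      (+-mono-≤ {∑[ p ∈ ψ ] (⟦ goodE? p ⟧ᵈ * w p)} {∑ ψg w} (≤-reflexive (sym (∑-filter goodE? ψ w))) (≤-trans (load-bound bad (λ a b → 0≤miss (good? a b))) bad-mass)))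
      where
      0≤both : ∀ p l → 0ℚ ≤ both bad p l
      0≤both p l = 0≤+ (0≤miss (good? (emb p (src l)) (emb p (tgt l)))) (0≤miss (good? (emb p (tgt l)) (emb p (src l))))
      split : ∀ {p} → p ∈ ψ → proj₂ p ≤ ⟦ goodE? p ⟧ᵈ * w p + proj₂ p * ∑ js (both bad p)
      split {p} p∈ = go (goodE? p)
        where
        go : (d : Dec (GoodE p)) → proj₂ p ≤ ⟦ d ⟧ᵈ * w p + proj₂ p * ∑ js (both bad p)
        go (yes g) = ≤-by {proj₂ p} (proj₂ p * ∑ js (both bad p)) (0≤* (proj₁ isF p p∈) (0≤∑ js (0≤both p))) (cong (_+ proj₂ p * ∑ js (both bad p)) (sym (trans (cong (_* w p) ⟦true⟧) (trans (*-identityˡ (w p)) (w≡ p∈)))))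
        go (no ¬g) with Fin.¬∀⟶∃¬ r _ (λ l → good? (emb p (src l)) (emb p (tgt l))) ¬g
        ... | l , ¬gl = ≤-trans (≡-≤ (sym (*-identityʳ (proj₂ p))) (*-monoˡ (proj₁ isF p p∈) (≤-trans (≡-≤ (sym (miss-no (good? (emb p (src l)) (emb p (tgt l))) ¬gl)) (≤-by (bad (emb p (tgt l)) (emb p (src l))) (0≤miss (good? (emb p (tgt l)) (emb p (src l)))) refl)) (term≤∑ {xs = js} {f = both bad p} (λ {l} _ → 0≤both p l) (∈-allFin l)))))
          (≤-by {proj₂ p * ∑ js (both bad p)} (⟦ false ⟧ * w p) (0≤* (0≤⟦⟧ false) (0≤w p)) (+-comm (proj₂ p * ∑ js (both bad p)) (⟦ false ⟧ * w p)))
          where open import Data.List.Membership.Propositional.Properties using (∈-allFin)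

    mass-sym : ∀ (f : Fin n → Fin n → ℚ) → (∀ a b → f a b ≡ f b a) → ∀ i j → mass f c i j ≡ mass f c j i
    mass-sym f f-sym i j = trans (∑-cong (cell c i) (λ a → ∑-cong (cell c j) (λ b → f-sym a b))) (∑-swap (cell c i) (cell c j) (λ a b → f b a))

    -- After spreading, an entry loads a pair of cells with the average of b there, so
    -- the total is at most half the sum of b (each pair is counted in both orders).
    through : (Fin n → Fin n → ℕ) → ℚ
    through b = ∑[ p ∈ ψg ] ∑[ l ∈ js ] (C p * ∑[ x ∈ box (ls p) ] (ι (at l b x) * ∏ js (except l (λ m → ι (at m W x)))))

    through-bound : ∀ (b : Fin n → Fin n → ℕ) → (∀ x y → b x y ℕ.≤ s) → (∀ x y → b x y ≡ b y x) →
      2ℚ * through b ≤ Fin² (λ x y → ι (b x y)) + 2ℚ * (V * (ι r * η₁))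
    through-bound b b≤s b-sym = ≤-trans (*-monoˡ 0≤2 (≤-trans (∑-mono∈ ψg (λ {p} p∈ → ≤-trans (∑-mono js (λ l → GoodEntry.through≤ p (proj₂ (∈ψg p∈)) l b b≤s)) (≤-reflexive (trans (∑-+ js (λ l → w p * T p l) (λ _ → w p * η₁)) (cong₂ _+_ (∑-*ˡ js (w p) (T p)) (trans (∑-const js (w p * η₁)) (trans (cong (λ m → ι m * (w p * η₁)) (length-allFin r)) (ring₁₆ (ι r) (w p) η₁))))))))
        (≤-reflexive (trans (∑-+ ψg (λ p → w p * ∑ js (T p)) (λ p → w p * (ι r * η₁))) (cong (∑[ p ∈ ψg ] (w p * ∑ js (T p)) +_) (∑-*ʳ ψg (ι r * η₁) w))))))
      (≡-≤ (*-distribˡ-+ 2ℚ (∑[ p ∈ ψg ] (w p * ∑ js (T p))) (∑ ψg w * (ι r * η₁))) (+-mono-≤ main (*-monoˡ 0≤2 (*-monoʳ (0≤* (0≤ι r) 0≤η₁) wg≤V))))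
      where
      t : Fin n → Fin n → ℚ
      t x y = inv (mass Wq c (c x) (c y)) * Bc b (c x) (c y)
      T : Entry → Fin r → ℚ
      T p l = t (emb p (src l)) (emb p (tgt l))
      0≤Bc : ∀ i j → 0ℚ ≤ Bc b i j
      0≤Bc i j = 0≤∑ (cell c i) (λ x → 0≤∑ (cell c j) (λ y → 0≤ι (b x y)))
      0≤t : ∀ x y → 0ℚ ≤ t x y
      0≤t x y = 0≤* (0≤inv (0≤mass (c x) (c y))) (0≤Bc (c x) (c y))
      t-sym : ∀ x y → t x y ≡ t y x
      t-sym x y = cong₂ (λ m B → inv m * B) (mass-sym Wq (λ a b → cong ι (msym G a b)) (c x) (c y)) (mass-sym (λ a b′ → ι (b a b′)) (λ a b′ → cong ι (b-sym a b′)) (c x) (c y))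
      wg≤V : ∑ ψg w ≤ V
      wg≤V = ≤-trans (∑ψg w 0≤w) (≤-reflexive (∑-cong∈ ψ w≡))
      double : ∀ p → 2ℚ * (w p * ∑ js (T p)) ≡ w p * ∑ js (both t p)
      double p = trans (ring₁₁₅ (w p) (∑ js (T p))) (cong (w p *_) (sym (trans (∑-cong js (λ l → cong (T p l +_) (t-sym (emb p (tgt l)) (emb p (src l))))) (∑-+ js (T p) (T p)))))
      main : 2ℚ * ∑[ p ∈ ψg ] (w p * ∑ js (T p)) ≤ Fin² (λ x y → ι (b x y))
      main = ≡-≤ (sym (∑-*ˡ ψg 2ℚ (λ p → w p * ∑ js (T p)))) (≡-≤ (∑-cong ψg double)
        (≤-trans (∑ψg (λ p → w p * ∑ js (both t p)) (λ p → 0≤* (0≤w p) (0≤∑ js (λ l → 0≤+ (0≤t _ _) (0≤t _ _)))))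
        (≡-≤ (∑-cong∈ ψ (λ {p} p∈ → cong (_* ∑ js (both t p)) (w≡ p∈))) (≤-trans (load-bound t 0≤t)
        (≡-≤ (by-colour (λ i j → inv (mass Wq c i j) * Bc b i j) Wq) (≤-trans (colours-mono cellwise) (≤-reflexive (∑∑-cells c (λ x y → ι (b x y)))))))))) 
        where
        cellwise : ∀ i j → inv (mass Wq c i j) * Bc b i j * mass Wq c i j ≤ Bc b i j
        cellwise i j = ≡-≤ (ring₉₄ (inv (mass Wq c i j)) (Bc b i j) (mass Wq c i j)) (≤-≡ (*-monoʳ (0≤Bc i j) (invˡ≤1 (0≤mass i j))) (*-identityˡ (Bc b i j)))

    module Labelled (δ′ : ℚ) (0<δ′ : 0ℚ < δ′) where

      α : ℚ
      α = Params.α r₁ δ′ 0<δ′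

      0<α : 0ℚ < α
      0<α = Params.0<α r₁ δ′ 0<δ′

      Vx : Set
      Vx = (Fin n × Fin n) × Fin s

      _≟V_ : DecidableEquality Vx
      (e , t) ≟V (e′ , t′) = map′ (λ { (refl , refl) → refl }) (λ { refl → refl , refl }) ((e ≟ₚ e′) ×-dec (t Fin.≟ t′))

      ⟦≟V⟧ : ∀ e t e′ t′ → ⟦ (e , t) ≟V (e′ , t′) ⟧ᵈ ≡ ⟦ e ≟ₚ e′ ⟧ᵈ * ⟦ t Fin.≟ t′ ⟧ᵈ
      ⟦≟V⟧ e t e′ t′ = ⟦∧⟧ (does (e ≟ₚ e′)) (does (t Fin.≟ t′))

      vs : List Vx
      vs = cartesianProduct (cartesianProduct (allFin n) (allFin n)) (allFin s)

      ∑-vs : ∀ f → ∑ vs f ≡ ∑[ a ∈ allFin n ] ∑[ b ∈ allFin n ] ∑[ t ∈ allFin s ] f ((a , b) , t)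
      ∑-vs f = trans (∑-cartesianProduct (cartesianProduct (allFin n) (allFin n)) (allFin s) f) (∑-cartesianProduct (allFin n) (allFin n) (λ e → ∑[ t ∈ allFin s ] f (e , t)))

      ∑-δV : ∀ v (f : Vx → ℚ) → ∑[ u ∈ vs ] (⟦ v ≟V u ⟧ᵈ * f u) ≡ f v
      ∑-δV (e , t) f = trans (∑-vs (λ u → ⟦ (e , t) ≟V u ⟧ᵈ * f u)) (trans (∑-cong (allFin n) (λ a → ∑-cong (allFin n) (λ b →
          trans (∑-cong (allFin s) (λ t′ → trans (cong (_* f ((a , b) , t′)) (⟦≟V⟧ e t (a , b) t′)) (*-assoc ⟦ e ≟ₚ (a , b) ⟧ᵈ ⟦ t Fin.≟ t′ ⟧ᵈ (f ((a , b) , t′)))))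
            (trans (∑-*ˡ (allFin s) ⟦ e ≟ₚ (a , b) ⟧ᵈ (λ t′ → ⟦ t Fin.≟ t′ ⟧ᵈ * f ((a , b) , t′))) (cong (⟦ e ≟ₚ (a , b) ⟧ᵈ *_) (∑-δ t (λ t′ → f ((a , b) , t′))))))))
        (∑-δₚ e (λ e′ → f (e′ , t))))

      length-vs : ι (length vs) ≡ n² * ι s
      length-vs = trans (sym (∑-1 vs)) (trans (∑-vs (λ _ → 1ℚ)) (trans (∑-cong (allFin n) (λ _ → ∑-cong (allFin n) (λ _ → trans (∑-1 (allFin s)) (cong ι (length-allFin s))))) (Fin²-const (ι s))))

      keyAt : Fin r → Vec (Fin n) k → Fin n × Fin n
      keyAt l x = key (Vec.lookup x (src l)) (Vec.lookup x (tgt l))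

      -- The load before any tuple is discarded, non-injective ones included. The multiplicity of
      -- slot `j` is left out, since this is the load on each single parallel edge.
      Dfull : Fin n × Fin n → ℚ
      Dfull e = ∑[ p ∈ ψg ] ∑[ x ∈ box (ls p) ] ∑[ j ∈ js ] (⟦ keyAt j x ≟ₚ e ⟧ᵈ * (C p * ∏ js (except j (λ l → ι (at l W x)))))

      over? : ∀ e → Dec (1ℚ + α < Dfull e)
      over? e = 1ℚ + α <? Dfull e

      Inj : Vec (Fin n) k → Set
      Inj x = ∀ u v → Vec.lookup x u ≡ Vec.lookup x v → u ≡ v

      inj? : ∀ x → Dec (Inj x)
      inj? x = Fin.all? (λ u → Fin.all? (λ v → (Vec.lookup x u Fin.≟ Vec.lookup x v) →-dec (u Fin.≟ v)))

      -- Tuples through an overloaded pair are dropped altogether, which brings all loads below 1 +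
      -- α without rescaling.
      Fits : Vec (Fin n) k → Set
      Fits x = ∀ l → ¬ (1ℚ + α < Dfull (keyAt l x))

      fits? : ∀ x → Dec (Fits x)
      fits? x = Fin.all? (λ l → ¬? (over? (keyAt l x)))

      ok? : ∀ x → Dec (Inj x × Fits x)
      ok? x = inj? x ×-dec fits? x

      xs : Entry → List (Vec (Fin n) k)
      xs p = filter ok? (box (ls p))

      labels : List (Vec (Fin s) r)
      labels = box (Vec.replicate r (allFin s))

      -- The hypergraph: its vertices are the parallel edges ((a , b) , t), t < s, of which
      -- those with t < mult a b are alive; an edge is a copy of F together with a choice
      -- of a parallel edge for each of its slots.
      I : Set
      I = Entry × (Vec (Fin n) k × Vec (Fin s) r)

      is : List I
      is = table xs labels ψg

      ∑-is : ∀ f → ∑ is f ≡ ∑[ p ∈ ψg ] ∑[ x ∈ xs p ] ∑[ t ∈ labels ] f (p , (x , t))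
      ∑-is = ∑-table xs labels ψg

      ∈-is : ∀ {p x t} → (p , (x , t)) ∈ is → Inj x × Fits x
      ∈-is {p} {x} {t} i∈ = proj₂ (∈-filter⁻ ok? {xs = box (ls p)} (∈-table xs labels ψg i∈))

      H : I → Fin r → Vx
      H (p , (x , t)) l = keyAt l x , Vec.lookup t l

      H-inj : ∀ {i} → i ∈ is → ∀ {j l} → H i j ≡ H i l → j ≡ l
      H-inj {p , (x , t)} i∈ {j} {l} e = go (j Fin.≟ l)
        where
        go : Dec (j ≡ l) → j ≡ l
        go (yes h) = h
        go (no j≢l) = ⊥-elim (clash (separated j≢l) (key-key (cong proj₁ e)))
         where
         inj : Inj x
         inj = proj₁ (∈-is i∈)
         clash : (tgt j ≢ src l × tgt j ≢ tgt l) ⊎ (src j ≢ src l × src j ≢ tgt l) →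
          (Vec.lookup x (src j) ≡ Vec.lookup x (src l) × Vec.lookup x (tgt j) ≡ Vec.lookup x (tgt l)) ⊎ (Vec.lookup x (src j) ≡ Vec.lookup x (tgt l) × Vec.lookup x (tgt j) ≡ Vec.lookup x (src l)) → Data.Empty.⊥
         clash (inj₁ (_ , h)) (inj₁ (_ , q)) = h (inj (tgt j) (tgt l) q)
         clash (inj₁ (h , _)) (inj₂ (_ , q)) = h (inj (tgt j) (src l) q)
         clash (inj₂ (h , _)) (inj₁ (q , _)) = h (inj (src j) (src l) q)
         clash (inj₂ (_ , h)) (inj₂ (q , _)) = h (inj (src j) (tgt l) q)

      weight : I → ℚ
      weight (p , _) = C p

      0≤C : ∀ p → 0ℚ ≤ C p
      0≤C p = 0≤* (0≤w p) (0≤inv (0≤* (<⇒≤ (0<Zp p)) (0≤∏ js (λ l → 0≤dens (emb′ (src l)) (emb′ (tgt l))))))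
        where
        emb′ : Fin k → Fin n
        emb′ = proj₁ (proj₁ p)

      0≤weight : ∀ i → 0ℚ ≤ weight i
      0≤weight (p , _) = 0≤C p

      alive : Vx → Bool
      alive ((a , b) , t) = does (toℕ t ℕ.<? W a b)

      W-key : ∀ a b → W (proj₁ (key a b)) (proj₂ (key a b)) ≡ W a b
      W-key a b with key-cases a b
      ... | inj₁ e = cong₂ W (cong proj₁ e) (cong proj₂ e)
      ... | inj₂ e = trans (cong₂ W (cong proj₁ e) (cong proj₂ e)) (msym G b a)

      ∑-alive : ∀ a b → ∑[ t ∈ allFin s ] ⟦ alive (key a b , t) ⟧ ≡ ι (W a b)
      ∑-alive a b = trans (∑-below s (W (proj₁ (key a b)) (proj₂ (key a b))) (bounded _ _)) (cong ι (W-key a b))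

      hypergraph : WeightedHypergraph r₁
      hypergraph = record { I = I ; V = Vx ; _≟V_ = _≟V_ ; is = is ; vs = vs ; H = H ; ψ = weight ; ∑-δV = ∑-δV ; 0≤ψ = 0≤weight ; H-inj = H-inj }

      open Hypergraph hypergraph using (deg; codeg; tot; IsMatching; live; liveBut; hit) public

      lookup-labels : ∀ l → Vec.lookup (Vec.replicate r (allFin s)) l ≡ allFin s
      lookup-labels l = Vec.lookup-replicate l (allFin s)

      ∑-labels-∏ : ∀ (f : Fin r → Fin s → ℚ) → ∑[ t ∈ labels ] ∏[ l ∈ js ] f l (Vec.lookup t l) ≡ ∏[ l ∈ js ] ∑[ a ∈ allFin s ] f l a
      ∑-labels-∏ f = trans (∑-box-∏ (Vec.replicate r (allFin s)) f) (∏-cong js (λ l → cong (λ A → ∑[ a ∈ A ] f l a) (lookup-labels l)))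

      labels-live : ∀ p x → ∑[ t ∈ labels ] live alive (p , (x , t)) ≡ ∏[ l ∈ js ] ι (at l W x)
      labels-live p x = trans (∑-labels-∏ (λ l a → ⟦ alive (keyAt l x , a) ⟧)) (∏-cong js (λ l → ∑-alive (Vec.lookup x (src l)) (Vec.lookup x (tgt l))))

      -- Labels vary independently over the slots, and a slot has as many live labels as its
      -- multiplicity. The value is the same for all `t₀`: parallel edges are loaded equally.
      labels-liveBut : ∀ p x j t₀ → ∑[ t ∈ labels ] (⟦ Vec.lookup t j Fin.≟ t₀ ⟧ᵈ * liveBut alive (p , (x , t)) j) ≡ ∏ js (except j (λ l → ι (at l W x)))
      labels-liveBut p x j t₀ = trans (∑-cong labels (λ t → sym (trans (∏-except j (λ l → f l (Vec.lookup t l))) (cong₂ _*_ (fj (Vec.lookup t j)) (∏-cong js (others t))))))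
        (trans (∑-labels-∏ f) (trans (∏-except j (λ l → ∑[ a ∈ allFin s ] f l a)) (trans (cong₂ _*_ sum-j (∏-cong js sum-others)) (*-identityˡ _))))
        where
        f : Fin r → Fin s → ℚ
        f l a = if does (j Fin.≟ l) then ⟦ a Fin.≟ t₀ ⟧ᵈ else ⟦ alive (keyAt l x , a) ⟧
        fj : ∀ a → f j a ≡ ⟦ a Fin.≟ t₀ ⟧ᵈ
        fj a with j Fin.≟ j
        ... | yes _ = refl
        ... | no ¬e = ⊥-elim (¬e refl)
        others : ∀ t l → except j (λ l → f l (Vec.lookup t l)) l ≡ except j (λ l → ⟦ alive (H (p , (x , t)) l) ⟧) l
        others t l with does (j Fin.≟ l)
        ... | true = refl
        ... | false = refl
        sum-j : ∑[ a ∈ allFin s ] f j a ≡ 1ℚ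
        sum-j = trans (∑-cong (allFin s) (λ a → trans (fj a) (trans (⟦⟧ᵈ-cong (a Fin.≟ t₀) (t₀ Fin.≟ a) sym sym) (sym (*-identityʳ ⟦ t₀ Fin.≟ a ⟧ᵈ))))) (∑-δ t₀ (λ _ → 1ℚ))
        sum-others : ∀ l → except j (λ l → ∑[ a ∈ allFin s ] f l a) l ≡ except j (λ l → ι (at l W x)) l
        sum-others l with does (j Fin.≟ l)
        ... | true = refl
        ... | false = ∑-alive (Vec.lookup x (src l)) (Vec.lookup x (tgt l))

      loadTerm : Fin n × Fin n → Entry → Vec (Fin n) k → Fin r → ℚ
      loadTerm e p x j = ⟦ keyAt j x ≟ₚ e ⟧ᵈ * (C p * ∏ js (except j (λ l → ι (at l W x))))

      0≤loadTerm : ∀ e p x j → 0ℚ ≤ loadTerm e p x j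
      0≤loadTerm e p x j = 0≤* (0≤⟦⟧ (does (keyAt j x ≟ₚ e))) (0≤* (0≤C p) (0≤∏ js (0≤except j (λ l → 0≤ι (at l W x)))))

      deg≡ : ∀ e t₀ → deg alive (e , t₀) ≡ ∑[ p ∈ ψg ] ∑[ x ∈ xs p ] ∑ js (loadTerm e p x)
      deg≡ e t₀ = trans (∑-is (λ i → ∑[ j ∈ js ] (hit i j (e , t₀) * (weight i * liveBut alive i j)))) (∑-cong ψg (λ p → ∑-cong (xs p) (λ x → trans (∑-swap labels js (λ t j → hit (p , (x , t)) j (e , t₀) * (C p * liveBut alive (p , (x , t)) j)))
        (∑-cong js (λ j → trans (∑-cong labels (λ t → trans (cong (_* (C p * liveBut alive (p , (x , t)) j)) (⟦≟V⟧ (keyAt j x) (Vec.lookup t j) e t₀)) (ring₁₁ ⟦ keyAt j x ≟ₚ e ⟧ᵈ ⟦ Vec.lookup t j Fin.≟ t₀ ⟧ᵈ (C p) (liveBut alive (p , (x , t)) j))))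
          (trans (∑-*ˡ labels (⟦ keyAt j x ≟ₚ e ⟧ᵈ * C p) (λ t → ⟦ Vec.lookup t j Fin.≟ t₀ ⟧ᵈ * liveBut alive (p , (x , t)) j)) (trans (cong (⟦ keyAt j x ≟ₚ e ⟧ᵈ * C p *_) (labels-liveBut p x j t₀)) (*-assoc ⟦ keyAt j x ≟ₚ e ⟧ᵈ (C p) _))))))))

      -- A pair that is not overloaded can only lose load when tuples are dropped; an overloaded one
      -- keeps no tuple at all.
      deg≤ : ∀ v → deg alive v ≤ 1ℚ + α
      deg≤ (e , t₀) = ≡-≤ (deg≡ e t₀) (go (over? e))
        where
        go : Dec (1ℚ + α < Dfull e) → ∑[ p ∈ ψg ] ∑[ x ∈ xs p ] ∑ js (loadTerm e p x) ≤ 1ℚ + α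
        go (no ¬o) = ≤-trans (∑-mono ψg (λ p → ≡-≤ (∑-filter ok? (box (ls p)) (λ x → ∑ js (loadTerm e p x))) (∑-mono (box (ls p)) (λ x → ≤-≡ (*-monoʳ (0≤∑ js (0≤loadTerm e p x)) (⟦⟧≤1 (does (ok? x)))) (*-identityˡ _))))) (≮⇒≥ ¬o)
        go (yes o) = ≡-≤ (trans (∑-cong ψg (λ p → trans (∑-cong∈ (xs p) (λ {x} x∈ → trans (∑-cong js (λ j → zero-term p x j (proj₂ (proj₂ (∈-filter⁻ ok? {xs = box (ls p)} x∈))))) (∑-0 js))) (∑-0 (xs p)))) (∑-0 ψg)) (0≤+ 0≤1 (<⇒≤ 0<α))
          where
          zero-term : ∀ p x j → Fits x → loadTerm e p x j ≡ 0ℚ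
          zero-term p x j fits = trans (cong (_* (C p * ∏ js (except j (λ l → ι (at l W x))))) (⟦⟧ᵈ-no (keyAt j x ≟ₚ e) (λ h → fits j (subst (λ e → 1ℚ + α < Dfull e) (sym h) o)))) (*-zeroˡ (C p * ∏ js (except j (λ l → ι (at l W x)))))

      tot≡ : tot alive ≡ ∑[ p ∈ ψg ] ∑[ x ∈ xs p ] (C p * ∏[ l ∈ js ] ι (at l W x))
      tot≡ = trans (∑-is (λ i → weight i * live alive i)) (∑-cong ψg (λ p → ∑-cong (xs p) (λ x → trans (∑-*ˡ labels (C p) (λ t → live alive (p , (x , t)))) (cong (C p *_) (labels-live p x)))))

      ∏W : Vec (Fin n) k → ℚ
      ∏W x = ∏[ l ∈ js ] ι (at l W x)

      0≤∏W : ∀ x → 0ℚ ≤ ∏W x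
      0≤∏W x = 0≤∏ js (λ l → 0≤ι (at l W x))

      ∏W≤K : ∀ x → ∏W x ≤ K
      ∏W≤K x = ≡-≤ (sym (ι-prodℕ js (λ l → at l W x))) (≤-≡ (ι-mono (prodℕ≤ js (λ l → at l W x) s (λ l → bounded _ _))) (cong (λ m → ι (s ℕ.^ m)) (length-allFin r)))

      miss-all : ∀ {m} {P : Fin m → Set} (P? : ∀ l → Dec (P l)) → miss (Fin.all? P?) ≤ ∑[ l ∈ allFin m ] miss (P? l)
      miss-all {m} {P} P? = go (Fin.all? P?)
        where
        open import Data.List.Membership.Propositional.Properties using (∈-allFin)
        go : (d : Dec (∀ l → P l)) → miss d ≤ ∑[ l ∈ allFin m ] miss (P? l)
        go (yes h) = ≡-≤ (miss-yes (yes h) h) (0≤∑ (allFin m) (λ l → 0≤miss (P? l)))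
        go (no ¬h) = ≡-≤ (miss-no (no ¬h) ¬h) (witness (Fin.¬∀⟶∃¬ m P P? ¬h))
          where
          witness : ∃[ l ] ¬ P l → 1ℚ ≤ ∑[ l ∈ allFin m ] miss (P? l)
          witness (l , ¬pl) = ≡-≤ (sym (miss-no (P? l) ¬pl)) (term≤∑ {xs = allFin m} {f = λ l → miss (P? l)} (λ {l} _ → 0≤miss (P? l)) (∈-allFin l))

      miss-→ : ∀ {P Q : Set} (d : Dec P) (e : Dec Q) → miss (d →-dec e) ≤ ⟦ d ⟧ᵈ * miss e
      miss-→ (yes p) (yes q) = ≡-≤ (miss-yes (yes p →-dec yes q) (λ _ → q)) (0≤* (0≤⟦⟧ true) (0≤miss (yes q)))
      miss-→ (yes p) (no ¬q) = ≤-≡ (miss≤1 (yes p →-dec no ¬q)) (sym (trans (cong₂ _*_ ⟦true⟧ (miss-no (no ¬q) ¬q)) (*-identityˡ 1ℚ)))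
      miss-→ (no ¬p) e = ≡-≤ (miss-yes (no ¬p →-dec e) (λ p → ⊥-elim (¬p p))) (0≤* (0≤⟦⟧ false) (0≤miss e))

      miss-¬ : ∀ {P : Set} (d : Dec P) → miss (¬? d) ≡ ⟦ d ⟧ᵈ
      miss-¬ (yes p) = trans (miss-no (¬? (yes p)) (λ h → h p)) (sym ⟦true⟧)
      miss-¬ (no ¬p) = trans (miss-yes (¬? (no ¬p)) ¬p) (sym ⟦false⟧)

      collisions : Vec (Fin n) k → ℚ
      collisions x = ∑[ u ∈ allFin k ] ∑[ v ∈ allFin k ] (⟦ Vec.lookup x u Fin.≟ Vec.lookup x v ⟧ᵈ * ≢ᶠ u v)

      overloads : Vec (Fin n) k → ℚ
      overloads x = ∑[ l ∈ js ] ⟦ over? (keyAt l x) ⟧ᵈ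

      miss-ok : ∀ x → miss (ok? x) ≤ collisions x + overloads x
      miss-ok x = ≤-trans (miss-× (inj? x) (fits? x)) (+-mono-≤ {miss (inj? x)} {collisions x} {miss (fits? x)} {overloads x}
        (≤-trans (miss-all (λ u → Fin.all? (λ v → (Vec.lookup x u Fin.≟ Vec.lookup x v) →-dec (u Fin.≟ v)))) (∑-mono (allFin k) (λ u → ≤-trans (miss-all (λ v → (Vec.lookup x u Fin.≟ Vec.lookup x v) →-dec (u Fin.≟ v)))
          (∑-mono (allFin k) (λ v → ≤-≡ (miss-→ (Vec.lookup x u Fin.≟ Vec.lookup x v) (u Fin.≟ v)) (cong (⟦ Vec.lookup x u Fin.≟ Vec.lookup x v ⟧ᵈ *_) (sym (≢ᶠ-≡ u v))))))))
        (≤-trans (miss-all (λ l → ¬? (over? (keyAt l x)))) (≤-reflexive (∑-cong js (λ l → miss-¬ (over? (keyAt l x)))))))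

      -- An admissible weight for `count-through`; `through overW` bounds what is lost by dropping
      -- overloaded tuples.
      overW : Fin n → Fin n → ℕ
      overW a b = if does (over? (key a b)) then W a b else 0

      ι-if : ∀ t m → ι (if t then m else 0) ≡ ⟦ t ⟧ * ι m
      ι-if true m = sym (trans (cong (_* ι m) ⟦true⟧) (*-identityˡ (ι m)))
      ι-if false m = trans ι-0 (sym (trans (cong (_* ι m) ⟦false⟧) (*-zeroˡ (ι m))))

      overW-ι : ∀ a b → ι (overW a b) ≡ ⟦ over? (key a b) ⟧ᵈ * ι (W a b)
      overW-ι a b = ι-if (does (over? (key a b))) (W a b)

      overW≤s : ∀ a b → overW a b ℕ.≤ s
      overW≤s a b = go (does (over? (key a b)))
        where
        go : ∀ t → (if t then W a b else 0) ℕ.≤ s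
        go true = bounded a b
        go false = ℕ.z≤n

      overW-sym : ∀ a b → overW a b ≡ overW b a
      overW-sym a b = cong₂ (λ e m → if does (over? e) then m else 0) (key-sym a b) (msym G a b)

      overW-∏ : ∀ l x → ι (at l overW x) * ∏ js (except l (λ m → ι (at m W x))) ≡ ⟦ over? (keyAt l x) ⟧ᵈ * ∏W x
      overW-∏ l x = trans (cong (_* ∏ js (except l (λ m → ι (at m W x)))) (overW-ι (Vec.lookup x (src l)) (Vec.lookup x (tgt l))))
        (trans (*-assoc ⟦ over? (keyAt l x) ⟧ᵈ (ι (at l W x)) (∏ js (except l (λ m → ι (at m W x))))) (cong (⟦ over? (keyAt l x) ⟧ᵈ *_) (sym (∏-except l (λ m → ι (at m W x))))))

      -- `ν₁` bounds the share of non-injective tuples: k² pairs of coordinates, agreement with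
      -- probability at most 1/g₀, weight at most `K`, and `R` for 1/dΠ.
      i₀ ν₁ : ℚ
      i₀ = inv g₀
      ν₁ = R * (ι k * ι k * (K * i₀))

      0≤i₀ : 0ℚ ≤ i₀
      0≤i₀ = <⇒≤ (0<inv 0<g₀)

      0≤ν₁ : 0ℚ ≤ ν₁
      0≤ν₁ = 0≤* 0≤R (0≤* (0≤* (0≤ι k) (0≤ι k)) (0≤* 0≤K 0≤i₀))

      module Fx (p : Entry) = FixCoordinate (ls p) g₀ 0<g₀ (g₀≤len p) (ls-uniq p)

      wg≤V : ∑ ψg w ≤ V
      wg≤V = ≤-trans (∑ψg w 0≤w) (≤-reflexive (∑-cong∈ ψ w≡))

      collision-mass : ∀ p → ∑[ x ∈ box (ls p) ] (collisions x * ∏W x) ≤ ι k * ι k * (K * i₀) * Zp p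
      collision-mass p = ≤-trans (∑-mono (box (ls p)) (λ x → *-monoˡ (0≤∑ (allFin k) (λ u → 0≤∑ (allFin k) (λ v → 0≤* (0≤⟦⟧ (does (Vec.lookup x u Fin.≟ Vec.lookup x v))) (0≤≢ᶠ u v)))) (∏W≤K x)))
        (≡-≤ (∑-*ʳ (box (ls p)) K collisions) (≤-trans (*-monoʳ 0≤K (≡-≤ (trans (∑-swap (box (ls p)) (allFin k) (λ x u → ∑[ v ∈ allFin k ] (⟦ Vec.lookup x u Fin.≟ Vec.lookup x v ⟧ᵈ * ≢ᶠ u v))) (∑-cong (allFin k) (λ u → ∑-swap (box (ls p)) (allFin k) (λ x v → ⟦ Vec.lookup x u Fin.≟ Vec.lookup x v ⟧ᵈ * ≢ᶠ u v))))
          (≤-trans (∑-mono (allFin k) (λ u → ∑-mono (allFin k) (λ v → one u v (u Fin.≟ v)))) (≤-reflexive (trans (∑-cong (allFin k) (λ _ → trans (∑-const (allFin k) (i₀ * Zp p)) (cong (λ m → ι m * (i₀ * Zp p)) (length-allFin k)))) (trans (∑-const (allFin k) (ι k * (i₀ * Zp p))) (cong (λ m → ι m * (ι k * (i₀ * Zp p))) (length-allFin k)))))))) (≤-reflexive (ring₁₁₆ (ι k) i₀ (Zp p) K))))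
        where
        one : ∀ u v → (d : Dec (u ≡ v)) → ∑[ x ∈ box (ls p) ] (⟦ Vec.lookup x u Fin.≟ Vec.lookup x v ⟧ᵈ * ⟦ not (does d) ⟧) ≤ i₀ * Zp p
        one u v (yes _) = ≡-≤ (trans (∑-cong (box (ls p)) (λ x → trans (cong (⟦ Vec.lookup x u Fin.≟ Vec.lookup x v ⟧ᵈ *_) ⟦false⟧) (*-zeroʳ ⟦ Vec.lookup x u Fin.≟ Vec.lookup x v ⟧ᵈ))) (∑-0 (box (ls p)))) (0≤* 0≤i₀ (<⇒≤ (0<Zp p)))
        one u v (no u≢v) = ≡-≤ (∑-cong (box (ls p)) (λ x → cong (⟦ Vec.lookup x u Fin.≟ Vec.lookup x v ⟧ᵈ *_) ⟦true⟧)) (Fx.fix-diagonal p u≢v)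

      -- Weight is lost to the counting error, to coinciding coordinates and to overloaded pairs, in
      -- this order.
      entry-lower : ∀ p → GoodE p → w p ≤ ∑[ x ∈ xs p ] (C p * ∏W x) + (w p * η₁ + (w p * ν₁ + ∑[ l ∈ js ] (C p * ∑[ x ∈ box (ls p) ] (ι (at l overW x) * ∏ js (except l (λ m → ι (at m W x)))))))
      entry-lower p gp = ≤-by {w p} (C p * A - (w p - w p * η₁) + (X + (w p * ν₁ + Y) - C p * A)) (0≤+ (0≤-diff (GoodEntry.total≥ p gp)) (0≤-diff split)) (ring₁₁₇ (w p) (C p * A) η₁ X (w p * ν₁) Y)
        where
        A X Y : ℚ
        A = ∑ (box (ls p)) ∏W
        X = ∑[ x ∈ xs p ] (C p * ∏W x)
        Y = ∑[ l ∈ js ] (C p * ∑[ x ∈ box (ls p) ] (ι (at l overW x) * ∏ js (except l (λ m → ι (at m W x)))))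
        A≡ : A ≤ ∑[ x ∈ box (ls p) ] (⟦ ok? x ⟧ᵈ * ∏W x) + (∑[ x ∈ box (ls p) ] (collisions x * ∏W x) + ∑[ x ∈ box (ls p) ] (overloads x * ∏W x))
        A≡ = ≤-trans (∑-mono (box (ls p)) (λ x → ≡-≤ (sym (ring₁₁₈ ⟦ ok? x ⟧ᵈ (∏W x))) (+-monoʳ-≤ (⟦ ok? x ⟧ᵈ * ∏W x) (≤-≡ (*-monoʳ (0≤∏W x) (miss-ok x)) (*-distribʳ-+ (∏W x) (collisions x) (overloads x))))))
          (≤-reflexive (trans (∑-+ (box (ls p)) (λ x → ⟦ ok? x ⟧ᵈ * ∏W x) (λ x → collisions x * ∏W x + overloads x * ∏W x)) (cong (∑[ x ∈ box (ls p) ] (⟦ ok? x ⟧ᵈ * ∏W x) +_) (∑-+ (box (ls p)) (λ x → collisions x * ∏W x) (λ x → overloads x * ∏W x)))))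
        first : C p * ∑[ x ∈ box (ls p) ] (⟦ ok? x ⟧ᵈ * ∏W x) ≡ X
        first = trans (sym (∑-*ˡ (box (ls p)) (C p) (λ x → ⟦ ok? x ⟧ᵈ * ∏W x))) (trans (∑-cong (box (ls p)) (λ x → ring₁₆ (C p) ⟦ ok? x ⟧ᵈ (∏W x))) (sym (∑-filter ok? (box (ls p)) (λ x → C p * ∏W x))))
        third : C p * ∑[ x ∈ box (ls p) ] (overloads x * ∏W x) ≡ Y
        third = trans (cong (C p *_) (trans (∑-cong (box (ls p)) (λ x → trans (sym (∑-*ʳ js (∏W x) (λ l → ⟦ over? (keyAt l x) ⟧ᵈ))) (∑-cong js (λ l → sym (overW-∏ l x))))) (∑-swap (box (ls p)) js (λ x l → ι (at l overW x) * ∏ js (except l (λ m → ι (at m W x)))))))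
          (sym (∑-*ˡ js (C p) (λ l → ∑[ x ∈ box (ls p) ] (ι (at l overW x) * ∏ js (except l (λ m → ι (at m W x)))))))
        second : C p * ∑[ x ∈ box (ls p) ] (collisions x * ∏W x) ≤ w p * ν₁
        second = ≤-trans (*-monoˡ (0≤C p) (collision-mass p)) (≡-≤ (ring₂₃ (C p) (ι k * ι k * (K * i₀)) (Zp p)) (≤-trans (*-monoʳ (0≤* (0≤* (0≤ι k) (0≤ι k)) (0≤* 0≤K 0≤i₀)) (GoodEntry.CZ≤ p gp)) (≤-reflexive (*-assoc (w p) R (ι k * ι k * (K * i₀))))))
        split : C p * A ≤ X + (w p * ν₁ + Y)
        split = ≤-trans (*-monoˡ (0≤C p) A≡) (≡-≤ (ring₁₁₉ (C p) (∑[ x ∈ box (ls p) ] (⟦ ok? x ⟧ᵈ * ∏W x)) (∑[ x ∈ box (ls p) ] (collisions x * ∏W x)) (∑[ x ∈ box (ls p) ] (overloads x * ∏W x)))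
          (+-mono-≤ (≤-reflexive first) (+-mono-≤ second (≤-reflexive third))))

      total-lower : ∑ ψg w ≤ tot alive + (V * η₁ + (V * ν₁ + through overW))
      total-lower = ≤-trans (∑-mono∈ ψg (λ {p} p∈ → entry-lower p (proj₂ (∈ψg p∈)))) (≡-≤ (trans (∑-+ ψg X (λ p → w p * η₁ + (w p * ν₁ + Y p))) (cong₂ _+_ (sym tot≡) (trans (∑-+ ψg (λ p → w p * η₁) (λ p → w p * ν₁ + Y p)) (cong₂ _+_ (∑-*ʳ ψg η₁ w) (trans (∑-+ ψg (λ p → w p * ν₁) Y) (cong (_+ through overW) (∑-*ʳ ψg ν₁ w)))))))
        (+-monoʳ-≤ (tot alive) (+-mono-≤ (*-monoʳ 0≤η₁ wg≤V) (+-monoˡ-≤ (through overW) (*-monoʳ 0≤ν₁ wg≤V)))))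
        where
        X Y : Entry → ℚ
        X p = ∑[ x ∈ xs p ] (C p * ∏W x)
        Y p = ∑[ l ∈ js ] (C p * ∑[ x ∈ box (ls p) ] (ι (at l overW x) * ∏ js (except l (λ m → ι (at m W x)))))

      overAt : Fin n × Fin n → ℚ
      overAt (a , b) = ⟦ over? (a , b) ⟧ᵈ * ι (W a b)

      0≤overAt : ∀ e → 0ℚ ≤ overAt e
      0≤overAt (a , b) = 0≤* (0≤⟦⟧ (does (over? (a , b)))) (0≤ι (W a b))

      overAt-key : ∀ a b → overAt (key a b) ≡ ι (overW a b)
      overAt-key a b = trans (cong (λ z → ⟦ over? (key a b) ⟧ᵈ * ι z) (W-key a b)) (sym (overW-ι a b))

      -- The capacity of the overloaded pairs, each counted in one order only.
      S : ℚ
      S = Fin² (λ a b → ⟦ a Fin.<? b ⟧ᵈ * overAt (a , b))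

      Fin²-pull : ∀ {Y : Set} (ys : List Y) (h : Fin n → Fin n → ℚ) (g : Y → Fin n → Fin n → ℚ) →
        Fin² (λ a b → h a b * ∑[ y ∈ ys ] g y a b) ≡ ∑[ y ∈ ys ] Fin² (λ a b → h a b * g y a b)
      Fin²-pull ys h g = trans (∑-cong (allFin n) (λ a → trans (∑-cong (allFin n) (λ b → sym (∑-*ˡ ys (h a b) (λ y → g y a b)))) (∑-swap (allFin n) ys (λ b y → h a b * g y a b)))) (∑-swap (allFin n) ys (λ a y → ∑[ b ∈ allFin n ] (h a b * g y a b)))

      -- The same weight, sorted by the pairs it passes through instead of by entries.
      through≡ : through overW ≡ Fin² (λ a b → overAt (a , b) * Dfull (a , b))
      through≡ = sym (trans (Fin²-pull ψg (λ a b → overAt (a , b)) (λ p a b → ∑[ x ∈ box (ls p) ] ∑ js (loadTerm (a , b) p x))) (∑-cong ψg (λ p →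
        trans (Fin²-pull (box (ls p)) (λ a b → overAt (a , b)) (λ x a b → ∑ js (loadTerm (a , b) p x))) (trans (∑-cong (box (ls p)) (λ x → trans (Fin²-pull js (λ a b → overAt (a , b)) (λ j a b → loadTerm (a , b) p x j)) (∑-cong js (λ j → at-key p x j))))
          (trans (∑-swap (box (ls p)) js (λ x j → C p * (ι (at j overW x) * ∏ js (except j (λ l → ι (at l W x)))))) (∑-cong js (λ j → ∑-*ˡ (box (ls p)) (C p) (λ x → ι (at j overW x) * ∏ js (except j (λ l → ι (at l W x)))))))))))
        where
        at-key : ∀ p x j → Fin² (λ a b → overAt (a , b) * loadTerm (a , b) p x j) ≡ C p * (ι (at j overW x) * ∏ js (except j (λ l → ι (at l W x))))
        at-key p x j = trans (∑-cong (allFin n) (λ a → ∑-cong (allFin n) (λ b → ring₁₂₀ (overAt (a , b)) ⟦ keyAt j x ≟ₚ (a , b) ⟧ᵈ (C p) (∏ js (except j (λ l → ι (at l W x)))))))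
          (trans (∑-δₚ (keyAt j x) (λ e → overAt e * (C p * ∏ js (except j (λ l → ι (at l W x)))))) (trans (cong (_* (C p * ∏ js (except j (λ l → ι (at l W x))))) (overAt-key (Vec.lookup x (src j)) (Vec.lookup x (tgt j)))) (ring₁₆ (ι (at j overW x)) (C p) (∏ js (except j (λ l → ι (at l W x)))))))

      heavy : (1ℚ + α) * S ≤ through overW
      heavy = ≡-≤ (trans (sym (∑-*ˡ (allFin n) (1ℚ + α) (λ a → ∑[ b ∈ allFin n ] (⟦ a Fin.<? b ⟧ᵈ * overAt (a , b))))) (∑-cong (allFin n) (λ a → sym (∑-*ˡ (allFin n) (1ℚ + α) (λ b → ⟦ a Fin.<? b ⟧ᵈ * overAt (a , b))))))
        (≤-≡ (Fin²-mono (λ a b → ≤-trans (*-monoˡ (0≤+ 0≤1 (<⇒≤ 0<α)) (≤-≡ (*-monoʳ (0≤overAt (a , b)) (⟦⟧≤1 (does (a Fin.<? b)))) (*-identityˡ (overAt (a , b))))) (one a b (over? (a , b))))) (sym through≡))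
        where
        one : ∀ a b (d : Dec (1ℚ + α < Dfull (a , b))) → (1ℚ + α) * (⟦ d ⟧ᵈ * ι (W a b)) ≤ ⟦ d ⟧ᵈ * ι (W a b) * Dfull (a , b)
        one a b (yes h) = ≡-≤ (*-comm (1ℚ + α) (⟦ true ⟧ * ι (W a b))) (*-monoˡ (0≤* (0≤⟦⟧ true) (0≤ι (W a b))) (<⇒≤ h))
        one a b (no _) = ≤-reflexive (trans (cong (λ z → (1ℚ + α) * (z * ι (W a b))) ⟦false⟧) (trans (ring₁₂₁ (1ℚ + α) (ι (W a b)) (Dfull (a , b))) (cong (λ z → z * ι (W a b) * Dfull (a , b)) (sym ⟦false⟧))))

      light : Fin² (λ a b → ι (overW a b)) ≤ S + S
      light = ≤-trans (Fin²-mono cases) (≤-reflexive (trans (Fin²-+ (λ a b → ⟦ a Fin.<? b ⟧ᵈ * overAt (a , b)) (λ a b → ⟦ b Fin.<? a ⟧ᵈ * overAt (b , a))) (cong (S +_) (∑-swap (allFin n) (allFin n) (λ a b → ⟦ b Fin.<? a ⟧ᵈ * overAt (b , a))))))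
        where
        T : Fin n → Fin n → ℚ
        T a b = ⟦ a Fin.<? b ⟧ᵈ * overAt (a , b)
        0≤T : ∀ a b → 0ℚ ≤ T a b
        0≤T a b = 0≤* (0≤⟦⟧ (does (a Fin.<? b))) (0≤overAt (a , b))
        T-yes : ∀ {a b} → a Data.Fin.< b → T a b ≡ overAt (a , b)
        T-yes {a} {b} h = trans (cong (_* overAt (a , b)) (⟦⟧ᵈ-yes (a Fin.<? b) h)) (*-identityˡ (overAt (a , b)))
        cases : ∀ a b → ι (overW a b) ≤ T a b + T b a
        cases a b = go (Fin.<-cmp a b)
          where
          open import Relation.Binary.Definitions using (Tri)
          go : Tri (a Data.Fin.< b) (a ≡ b) (b Data.Fin.< a) → ι (overW a b) ≤ T a b + T b a
          go (tri< h _ _) = ≤-trans (≤-reflexive (trans (sym (overAt-key a b)) (trans (cong overAt (key-< h)) (sym (T-yes h))))) (≤-by {T a b} (T b a) (0≤T b a) refl)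
          go (tri> _ _ h) = ≤-trans (≤-reflexive (trans (sym (overAt-key a b)) (trans (cong overAt (trans (key-sym a b) (key-< h))) (sym (T-yes h))))) (≤-by {T b a} (T a b) (0≤T a b) (+-comm (T b a) (T a b)))
          go (tri≈ _ refl _) = ≤-trans (≤-reflexive (trans (overW-ι a a) (trans (cong (λ m → ⟦ over? (key a a) ⟧ᵈ * ι m) (loopless G a)) (trans (cong (⟦ over? (key a a) ⟧ᵈ *_) ι-0) (*-zeroʳ ⟦ over? (key a a) ⟧ᵈ))))) (0≤+ (0≤T a a) (0≤T a a))

      -- Overloaded pairs carry at least 1+α times their capacity but, by
      -- through-bound, at most their capacity up to an error; so they are few.
      overload-mass : through overW ≤ (1ℚ + inv α) * (V * (ι r * η₁))
      overload-mass = ≤-trans t≤ (≤-≡ (+-monoˡ-≤ Y S≤) (ring₁₂₄ (inv α) Y))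
        where
        Y t : ℚ
        Y = V * (ι r * η₁)
        t = through overW
        t≤ : t ≤ S + Y
        t≤ = *-cancelˡ {t} {S + Y} {2ℚ} (<-≤-trans 0<1 (≤-by {1ℚ} {2ℚ} 1ℚ 0≤1 refl)) (≤-trans (through-bound overW overW≤s overW-sym) (≤-≡ (+-monoˡ-≤ (2ℚ * Y) light) (ring₁₂₂ S Y)))
        S≤ : S ≤ inv α * Y
        S≤ = inv-move 0<α (≤-by {α * S} {Y} (S + Y - (1ℚ + α) * S) (0≤-diff (≤-trans heavy t≤)) (ring₁₂₃ S α Y))

      -- Two distinct edges have at least three ends, so prescribing their images fixes three
      -- coordinates, each at a cost of 1/g₀, in at most 4 ways. As V is of order n² and `g₀` of
      -- order n, V·ν₂ is of order 1/n.
      4ℚ ν₂ : ℚ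
      4ℚ = 2ℚ * 2ℚ
      ν₂ = R * (ι r * ι r * (K * (4ℚ * (i₀ * (i₀ * i₀)))))

      0≤ν₂ : 0ℚ ≤ ν₂
      0≤ν₂ = 0≤* 0≤R (0≤* (0≤* (0≤ι r) (0≤ι r)) (0≤* 0≤K (0≤* (0≤* 0≤2 0≤2) (0≤* 0≤i₀ (0≤* 0≤i₀ 0≤i₀)))))

      at-coord : Fin k → Fin n → Vec (Fin n) k → ℚ
      at-coord u a x = ⟦ Vec.lookup x u Fin.≟ a ⟧ᵈ

      0≤at : ∀ u a x → 0ℚ ≤ at-coord u a x
      0≤at u a x = 0≤⟦⟧ (does (Vec.lookup x u Fin.≟ a))

      key≤ : ∀ j x a b → ⟦ keyAt j x ≟ₚ (a , b) ⟧ᵈ ≤ at-coord (src j) a x * at-coord (tgt j) b x + at-coord (src j) b x * at-coord (tgt j) a x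
      key≤ j x a b = go (keyAt j x ≟ₚ (a , b))
        where
        0≤p : ∀ a b → 0ℚ ≤ at-coord (src j) a x * at-coord (tgt j) b x
        0≤p a b = 0≤* (0≤at (src j) a x) (0≤at (tgt j) b x)
        both-1 : ∀ {a b} → Vec.lookup x (src j) ≡ a → Vec.lookup x (tgt j) ≡ b → 1ℚ ≡ at-coord (src j) a x * at-coord (tgt j) b x
        both-1 {a} {b} p q = sym (trans (cong₂ _*_ (⟦⟧ᵈ-yes (Vec.lookup x (src j) Fin.≟ a) p) (⟦⟧ᵈ-yes (Vec.lookup x (tgt j) Fin.≟ b) q)) (*-identityˡ 1ℚ))
        go : (d : Dec (keyAt j x ≡ (a , b))) → ⟦ d ⟧ᵈ ≤ at-coord (src j) a x * at-coord (tgt j) b x + at-coord (src j) b x * at-coord (tgt j) a x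
        go (no _) = ≡-≤ ⟦false⟧ (0≤+ (0≤p a b) (0≤p b a))
        go (yes e) = ≡-≤ ⟦true⟧ (case (key-≡ e))
          where
          case : _ → 1ℚ ≤ at-coord (src j) a x * at-coord (tgt j) b x + at-coord (src j) b x * at-coord (tgt j) a x
          case (inj₁ (p , q)) = ≡-≤ (both-1 p q) (≤-by (at-coord (src j) b x * at-coord (tgt j) a x) (0≤p b a) refl)
          case (inj₂ (p , q)) = ≡-≤ (both-1 p q) (≤-by (at-coord (src j) a x * at-coord (tgt j) b x) (0≤p a b) (+-comm (at-coord (src j) b x * at-coord (tgt j) a x) (at-coord (src j) a x * at-coord (tgt j) b x)))

      key≤-end : ∀ l x a b z → z ≡ src l ⊎ z ≡ tgt l → ⟦ keyAt l x ≟ₚ (a , b) ⟧ᵈ ≤ at-coord z a x + at-coord z b x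
      key≤-end l x a b z zl = ≤-trans (key≤ l x a b) (ends zl)
        where
        l≤ : ∀ u v a b → at-coord u a x * at-coord v b x ≤ at-coord u a x
        l≤ u v a b = ≤-≡ (*-monoˡ (0≤at u a x) (⟦⟧≤1 (does (Vec.lookup x v Fin.≟ b)))) (*-identityʳ (at-coord u a x))
        r≤ : ∀ u v a b → at-coord u a x * at-coord v b x ≤ at-coord v b x
        r≤ u v a b = ≤-≡ (*-monoʳ (0≤at v b x) (⟦⟧≤1 (does (Vec.lookup x u Fin.≟ a)))) (*-identityˡ (at-coord v b x))
        ends : z ≡ src l ⊎ z ≡ tgt l → at-coord (src l) a x * at-coord (tgt l) b x + at-coord (src l) b x * at-coord (tgt l) a x ≤ at-coord z a x + at-coord z b x
        ends (inj₁ refl) = +-mono-≤ (l≤ (src l) (tgt l) a b) (l≤ (src l) (tgt l) b a)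
        ends (inj₂ refl) = ≤-trans (+-mono-≤ (r≤ (src l) (tgt l) a b) (r≤ (src l) (tgt l) b a)) (≤-reflexive (+-comm (at-coord (tgt l) b x) (at-coord (tgt l) a x)))

      third : ∀ {j l} → j ≢ l → ∃[ z ] ((z ≡ src l ⊎ z ≡ tgt l) × src j ≢ z × tgt j ≢ z)
      third {j} {l} j≢l = go (separated (j≢l ∘ sym))
        where
        go : (tgt l ≢ src j × tgt l ≢ tgt j) ⊎ (src l ≢ src j × src l ≢ tgt j) → ∃[ z ] ((z ≡ src l ⊎ z ≡ tgt l) × src j ≢ z × tgt j ≢ z)
        go (inj₁ (p , q)) = tgt l , inj₂ refl , (p ∘ sym) , (q ∘ sym)
        go (inj₂ (p , q)) = src l , inj₁ refl , (p ∘ sym) , (q ∘ sym)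

      two-keys : ∀ p {j l} → j ≢ l → ∀ e e′ → ∑[ x ∈ box (ls p) ] (⟦ keyAt j x ≟ₚ e ⟧ᵈ * ⟦ keyAt l x ≟ₚ e′ ⟧ᵈ) ≤ 4ℚ * (i₀ * (i₀ * i₀)) * Zp p
      two-keys p {j} {l} j≢l (a , b) (a′ , b′) = bound (third j≢l)
        where
        f : Fin k → Fin k → Fin k → Fin n → Fin n → Fin n → Vec (Fin n) k → ℚ
        f u v z a b c x = at-coord u a x * (at-coord v b x * (at-coord z c x * 1ℚ))
        bound : ∃[ z ] ((z ≡ src l ⊎ z ≡ tgt l) × src j ≢ z × tgt j ≢ z) → ∑[ x ∈ box (ls p) ] (⟦ keyAt j x ≟ₚ (a , b) ⟧ᵈ * ⟦ keyAt l x ≟ₚ (a′ , b′) ⟧ᵈ) ≤ 4ℚ * (i₀ * (i₀ * i₀)) * Zp p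
        bound (z , zl , u≢z , v≢z) = ≤-trans (∑-mono (box (ls p)) (λ x → ≤-≡ (*-mono (0≤⟦⟧ (does (keyAt l x ≟ₚ (a′ , b′)))) (0≤+ (0≤* (0≤at u a x) (0≤at v b x)) (0≤* (0≤at u b x) (0≤at v a x))) (key≤ j x a b) (key≤-end l x a′ b′ z zl)) (ring₁₂₅ (at-coord u a x) (at-coord v b x) (at-coord u b x) (at-coord v a x) (at-coord z a′ x) (at-coord z b′ x))))
          (≡-≤ (trans (∑-+ (box (ls p)) (λ x → f u v z a b a′ x + f u v z a b b′ x) (λ x → f u v z b a a′ x + f u v z b a b′ x)) (cong₂ _+_ (∑-+ (box (ls p)) (f u v z a b a′) (f u v z a b b′)) (∑-+ (box (ls p)) (f u v z b a a′) (f u v z b a b′))))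
          (≤-≡ (+-mono-≤ (+-mono-≤ (fx a b a′) (fx a b b′)) (+-mono-≤ (fx b a a′) (fx b a b′))) (ring₁₂₆ i₀ (Zp p))))
          where
          u v : Fin k
          u = src j
          v = tgt j
          fx : ∀ a b c → ∑ (box (ls p)) (f u v z a b c) ≤ i₀ * (i₀ * (i₀ * Zp p))
          fx a b c = Fx.fix₃ p (loopless-slot j) u≢z v≢z a b c

      |labels| : ∑[ t ∈ labels ] 1ℚ ≡ K
      |labels| = trans (∑-box-1 (Vec.replicate r (allFin s))) (trans (∏-cong js (λ l → cong ι (trans (cong length (lookup-labels l)) (length-allFin s)))) (trans (sym (ι-prodℕ js (λ _ → s))) (cong ι (trans (power js) (cong (s ℕ.^_) (length-allFin r))))))
        where
        power : ∀ (ys : List (Fin r)) → prodℕ ys (λ _ → s) ≡ s ℕ.^ length ys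
        power [] = refl
        power (_ ∷ ys) = cong (s ℕ.*_) (power ys)

      -- The conditions on labels are dropped, at the price of the factor `K`, the number of label
      -- vectors; `two-keys` bounds what remains.
      codeg≤ : ∀ u v → codeg u v ≤ V * ν₂
      codeg≤ (e , t₀) (e′ , t₁) = ≡-≤ (∑-is (λ i → ∑[ j ∈ js ] ∑[ l ∈ js ] (weight i * (≢ᶠ j l * (hit i j (e , t₀) * hit i l (e′ , t₁))))))
        (≤-trans (∑-mono∈ ψg (λ {p} p∈ → entry p (proj₂ (∈ψg p∈)))) (≡-≤ (∑-*ʳ ψg ν₂ w) (*-monoʳ 0≤ν₂ wg≤V)))
        where
        kk : Vec (Fin n) k → Fin r → Fin r → ℚ
        kk x j l = ≢ᶠ j l * (⟦ keyAt j x ≟ₚ e ⟧ᵈ * ⟦ keyAt l x ≟ₚ e′ ⟧ᵈ)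
        0≤kk : ∀ x j l → 0ℚ ≤ kk x j l
        0≤kk x j l = 0≤* (0≤≢ᶠ j l) (0≤* (0≤⟦⟧ (does (keyAt j x ≟ₚ e))) (0≤⟦⟧ (does (keyAt l x ≟ₚ e′))))
        hit≤ : ∀ p x t j e t₀ → hit (p , (x , t)) j (e , t₀) ≤ ⟦ keyAt j x ≟ₚ e ⟧ᵈ
        hit≤ p x t j e t₀ = ≡-≤ (⟦≟V⟧ (keyAt j x) (Vec.lookup t j) e t₀) (≤-≡ (*-monoˡ (0≤⟦⟧ (does (keyAt j x ≟ₚ e))) (⟦⟧≤1 (does (Vec.lookup t j Fin.≟ t₀)))) (*-identityʳ ⟦ keyAt j x ≟ₚ e ⟧ᵈ))
        Kx : Entry → Vec (Fin n) k → ℚ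
        Kx p x = ∑[ j ∈ js ] ∑[ l ∈ js ] (C p * kk x j l)
        0≤Kx : ∀ p x → 0ℚ ≤ Kx p x
        0≤Kx p x = 0≤∑ js (λ j → 0≤∑ js (λ l → 0≤* (0≤C p) (0≤kk x j l)))
        pairBound : ∀ p j l (d : Dec (j ≡ l)) → ∑[ x ∈ box (ls p) ] (⟦ not (does d) ⟧ * (⟦ keyAt j x ≟ₚ e ⟧ᵈ * ⟦ keyAt l x ≟ₚ e′ ⟧ᵈ)) ≤ 4ℚ * (i₀ * (i₀ * i₀)) * Zp p
        pairBound p j l (yes _) = ≡-≤ (trans (∑-cong (box (ls p)) (λ x → trans (cong (_* (⟦ keyAt j x ≟ₚ e ⟧ᵈ * ⟦ keyAt l x ≟ₚ e′ ⟧ᵈ)) ⟦false⟧) (*-zeroˡ (⟦ keyAt j x ≟ₚ e ⟧ᵈ * ⟦ keyAt l x ≟ₚ e′ ⟧ᵈ)))) (∑-0 (box (ls p)))) (0≤* (0≤* (0≤* 0≤2 0≤2) (0≤* 0≤i₀ (0≤* 0≤i₀ 0≤i₀))) (<⇒≤ (0<Zp p)))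
        pairBound p j l (no j≢l) = ≡-≤ (∑-cong (box (ls p)) (λ x → trans (cong (_* (⟦ keyAt j x ≟ₚ e ⟧ᵈ * ⟦ keyAt l x ≟ₚ e′ ⟧ᵈ)) ⟦true⟧) (*-identityˡ (⟦ keyAt j x ≟ₚ e ⟧ᵈ * ⟦ keyAt l x ≟ₚ e′ ⟧ᵈ)))) (two-keys p j≢l e e′)
        entry : ∀ p → GoodE p → ∑[ x ∈ xs p ] ∑[ t ∈ labels ] ∑[ j ∈ js ] ∑[ l ∈ js ] (C p * (≢ᶠ j l * (hit (p , (x , t)) j (e , t₀) * hit (p , (x , t)) l (e′ , t₁)))) ≤ w p * ν₂
        entry p gp = begin
          ∑[ x ∈ xs p ] ∑[ t ∈ labels ] ∑[ j ∈ js ] ∑[ l ∈ js ] (C p * (≢ᶠ j l * (hit (p , (x , t)) j (e , t₀) * hit (p , (x , t)) l (e′ , t₁))))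
            ≤⟨ ∑-mono (xs p) (λ x → ≤-trans (∑-mono labels (λ t → ≤-trans (∑-mono js (λ j → ∑-mono js (λ l → *-monoˡ (0≤C p) (*-monoˡ (0≤≢ᶠ j l) (*-mono (0≤⟦⟧ (does (H (p , (x , t)) l ≟V (e′ , t₁)))) (0≤⟦⟧ (does (keyAt j x ≟ₚ e))) (hit≤ p x t j e t₀) (hit≤ p x t l e′ t₁)))))) (≤-reflexive (sym (*-identityˡ (Kx p x)))))) (≤-reflexive (trans (∑-*ʳ labels (Kx p x) (λ _ → 1ℚ)) (cong (_* Kx p x) |labels|)))) ⟩
          ∑[ x ∈ xs p ] (K * Kx p x)
            ≤⟨ ≡-≤ (∑-filter ok? (box (ls p)) (λ x → K * Kx p x)) (∑-mono (box (ls p)) (λ x → ≤-≡ (*-monoʳ (0≤* 0≤K (0≤Kx p x)) (⟦⟧≤1 (does (ok? x)))) (*-identityˡ (K * Kx p x)))) ⟩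
          ∑[ x ∈ box (ls p) ] (K * Kx p x)
            ≡⟨ trans (∑-*ˡ (box (ls p)) K (Kx p)) (cong (K *_) (trans (∑-swap (box (ls p)) js (λ x j → ∑[ l ∈ js ] (C p * kk x j l))) (∑-cong js (λ j → trans (∑-swap (box (ls p)) js (λ x l → C p * kk x j l)) (∑-cong js (λ l → ∑-*ˡ (box (ls p)) (C p) (λ x → kk x j l))))))) ⟩
          K * ∑[ j ∈ js ] ∑[ l ∈ js ] (C p * ∑[ x ∈ box (ls p) ] kk x j l)
            ≤⟨ *-monoˡ 0≤K (∑-mono js (λ j → ∑-mono js (λ l → *-monoˡ (0≤C p) (pairBound p j l (j Fin.≟ l))))) ⟩
          K * ∑[ j ∈ js ] ∑[ l ∈ js ] Q
            ≡⟨ trans (cong (K *_) (trans (∑-cong js (λ _ → trans (∑-const js Q) (cong (λ m → ι m * Q) (length-allFin r)))) (trans (∑-const js (ι r * Q)) (cong (λ m → ι m * (ι r * Q)) (length-allFin r))))) (ring₁₂₇ K (ι r) (C p) (4ℚ * (i₀ * (i₀ * i₀))) (Zp p)) ⟩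
          C p * Zp p * (ι r * ι r * (K * (4ℚ * (i₀ * (i₀ * i₀)))))
            ≤⟨ *-monoʳ (0≤* (0≤* (0≤ι r) (0≤ι r)) (0≤* 0≤K (0≤* (0≤* 0≤2 0≤2) (0≤* 0≤i₀ (0≤* 0≤i₀ 0≤i₀))))) (GoodEntry.CZ≤ p gp) ⟩
          w p * R * (ι r * ι r * (K * (4ℚ * (i₀ * (i₀ * i₀)))))
            ≡⟨ *-assoc (w p) R (ι r * ι r * (K * (4ℚ * (i₀ * (i₀ * i₀))))) ⟩
          w p * ν₂ ∎
          where
          open ≤-Reasoning
          Q : ℚ
          Q = C p * (4ℚ * (i₀ * (i₀ * i₀)) * Zp p)

      toEmbedding : ∀ {i} → i ∈ is → Embedding k n
      toEmbedding {p , (x , t)} i∈ = Vec.lookup x , λ {u} {v} → proj₁ (∈-is i∈) u v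

      embeddings : (P : List I) → (∀ {i} → i ∈ P → i ∈ is) → List (Embedding k n)
      embeddings [] _ = []
      embeddings (i ∷ P) h = toEmbedding (h (here refl)) ∷ embeddings P (h ∘ there)

      length-embeddings : ∀ P (h : ∀ {i} → i ∈ P → i ∈ is) → length (embeddings P h) ≡ length P
      length-embeddings [] h = refl
      length-embeddings (i ∷ P) h = cong ℕ.suc (length-embeddings P (h ∘ there))

      covers≤ : ∀ {i} (i∈ : i ∈ is) a b → ⟦ covers F (toEmbedding i∈) a b ⟧ ≤ ∑[ j ∈ js ] ⟦ keyAt j (proj₁ (proj₂ i)) ≟ₚ key a b ⟧ᵈ
      covers≤ {p , (x , t)} i∈ a b = go (covers F (toEmbedding i∈) a b) refl
        where
        open import Data.List.Membership.Propositional.Properties using (∈-allFin)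
        0≤ : ∀ j → 0ℚ ≤ ⟦ keyAt j x ≟ₚ key a b ⟧ᵈ
        0≤ j = 0≤⟦⟧ (does (keyAt j x ≟ₚ key a b))
        slot : ∃[ l ] ((Vec.lookup x (src l) ≡ a × Vec.lookup x (tgt l) ≡ b) ⊎ (Vec.lookup x (src l) ≡ b × Vec.lookup x (tgt l) ≡ a)) → 1ℚ ≤ ∑[ j ∈ js ] ⟦ keyAt j x ≟ₚ key a b ⟧ᵈ
        slot (l , h) = ≡-≤ (sym (⟦⟧ᵈ-yes (keyAt l x ≟ₚ key a b) (same h))) (term≤∑ {xs = js} {f = λ j → ⟦ keyAt j x ≟ₚ key a b ⟧ᵈ} (λ {j} _ → 0≤ j) (∈-allFin l))
          where
          same : (Vec.lookup x (src l) ≡ a × Vec.lookup x (tgt l) ≡ b) ⊎ (Vec.lookup x (src l) ≡ b × Vec.lookup x (tgt l) ≡ a) → keyAt l x ≡ key a b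
          same (inj₁ (q , q′)) = cong₂ key q q′
          same (inj₂ (q , q′)) = trans (cong₂ key q q′) (key-sym b a)
        go : ∀ t → covers F (toEmbedding i∈) a b ≡ t → ⟦ t ⟧ ≤ ∑[ j ∈ js ] ⟦ keyAt j x ≟ₚ key a b ⟧ᵈ
        go true h = ≡-≤ ⟦true⟧ (slot (covers⇒slot (toEmbedding i∈) a b h))
        go false _ = ≡-≤ ⟦false⟧ (0≤∑ js 0≤)

      -- Copies on the pair are sorted by the label they use. The matching admits one for each live
      -- label, and `mult G a b` labels are live.
      packing : ∀ P → IsMatching alive P → (h : ∀ {i} → i ∈ P → i ∈ is) → IsPacking F G (embeddings P h)
      packing P match h a b = ι-cancel (≤-trans (≤-reflexive count) (≤-trans (cover-sum P h) bound))
        where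
        import Data.Bool.Properties as Bool
        e : Fin n × Fin n
        e = key a b
        cov? : ∀ φ → Dec (covers F φ a b ≡ true)
        cov? φ = covers F φ a b Bool.≟ true
        ⟦cov?⟧ : ∀ φ → ⟦ cov? φ ⟧ᵈ ≡ ⟦ covers F φ a b ⟧
        ⟦cov?⟧ φ = go (covers F φ a b)
          where
          go : ∀ t → ⟦ t Bool.≟ true ⟧ᵈ ≡ ⟦ t ⟧
          go true = refl
          go false = refl
        count : ι (length (filter cov? (embeddings P h))) ≡ ∑[ φ ∈ embeddings P h ] ⟦ covers F φ a b ⟧
        count = trans (sym (∑-1 (filter cov? (embeddings P h)))) (trans (∑-filter cov? (embeddings P h) (λ _ → 1ℚ)) (∑-cong (embeddings P h) (λ φ → trans (*-identityʳ ⟦ cov? φ ⟧ᵈ) (⟦cov?⟧ φ))))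
        cover-sum : ∀ P (h : ∀ {i} → i ∈ P → i ∈ is) → ∑[ φ ∈ embeddings P h ] ⟦ covers F φ a b ⟧ ≤ ∑[ i ∈ P ] ∑[ j ∈ js ] ⟦ keyAt j (proj₁ (proj₂ i)) ≟ₚ e ⟧ᵈ
        cover-sum [] h = ≤-reflexive (trans (∑-[] {A = Embedding k n} (λ φ → ⟦ covers F φ a b ⟧)) (sym (∑-[] (λ i → ∑[ j ∈ js ] ⟦ keyAt j (proj₁ (proj₂ i)) ≟ₚ e ⟧ᵈ))))
        cover-sum (i ∷ P) h = ≡-≤ (∑-∷ (toEmbedding (h (here refl))) (embeddings P (h ∘ there)) (λ φ → ⟦ covers F φ a b ⟧))
          (≤-≡ (+-mono-≤ (covers≤ (h (here refl)) a b) (cover-sum P (h ∘ there))) (sym (∑-∷ i P (λ i → ∑[ j ∈ js ] ⟦ keyAt j (proj₁ (proj₂ i)) ≟ₚ e ⟧ᵈ))))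
        by-label : ∀ i j → ⟦ keyAt j (proj₁ (proj₂ i)) ≟ₚ e ⟧ᵈ ≡ ∑[ t ∈ allFin s ] hit i j (e , t)
        by-label (p , (x , t)) j = sym (trans (∑-cong (allFin s) (λ t′ → trans (⟦≟V⟧ (keyAt j x) (Vec.lookup t j) e t′) (*-comm ⟦ keyAt j x ≟ₚ e ⟧ᵈ ⟦ Vec.lookup t j Fin.≟ t′ ⟧ᵈ))) (∑-δ (Vec.lookup t j) (λ _ → ⟦ keyAt j x ≟ₚ e ⟧ᵈ)))
        bound : ∑[ i ∈ P ] ∑[ j ∈ js ] ⟦ keyAt j (proj₁ (proj₂ i)) ≟ₚ e ⟧ᵈ ≤ ι (W a b)
        bound = ≡-≤ (trans (∑-cong P (λ i → trans (∑-cong js (by-label i)) (∑-swap js (allFin s) (λ j t → hit i j (e , t))))) (∑-swap P (allFin s) (λ i t → ∑[ j ∈ js ] hit i j (e , t))))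
          (≤-≡ (∑-mono (allFin s) (λ t → match (e , t))) (∑-alive a b))

      -- The terms of the budget, per n²: the nibble, the counting error with the overloads it
      -- causes, coinciding coordinates, irregular pairs, a small cell on either side, sparse pairs.
      conclude : ∀ δ → ι (Params.N₀ r₁ δ′ 0<δ′) ≤ n² * ι s → n² * ι s * ν₂ ≤ α →
        ι s * δ′ + (ι s * η₁ + (1ℚ + inv α) * (ι s * (ι r * η₁))) + ι s * ν₁ + ι s * θ + ι M̄ * γ * ι s + ι M̄ * γ * ι s + ρ ≤ δ →
        ∃[ Q ] (IsPacking F G Q × value ψ ≤ ℕtoℚ (length Q) + δ * ℕtoℚ (n ℕ.* n))
      conclude δ N₀≤ codeg-small budget = embeddings P P⊆ , packing P (proj₁ (proj₂ matching)) P⊆ ,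
          ≡-≤ (value≡ ψ) (≤-≡ value-bound (cong₂ (λ a c → a + δ * c) (trans (cong ι (sym (length-embeddings P P⊆))) (ι≡ℕtoℚ (length (embeddings P P⊆)))) (trans (sym (ι-* n n)) (ι≡ℕtoℚ (n ℕ.* n)))))
        where
        matching : ∃[ P ] (IsMatching alive P × (∀ {i} → i ∈ P → i ∈ is) × tot alive ≤ ι (length P) + δ′ * ι (length vs))
        matching = Params.Apply.nibble r₁ δ′ 0<δ′ hypergraph (ι-cancel (≤-≡ N₀≤ (sym length-vs)))
          (λ u v → ≤-trans (codeg≤ u v) (≤-trans (*-monoʳ 0≤ν₂ V≤) codeg-small)) alive deg≤
        P : List I
        P = proj₁ matching
        P⊆ : ∀ {i} → i ∈ P → i ∈ is
        P⊆ = proj₁ (proj₂ (proj₂ matching))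
        p i b Σw D X Y Z : ℚ
        p = ι (length P)
        i = inv α
        b = ι M̄ * γ * ι s
        Σw = ∑ ψg w
        D = δ′ * (n² * ι s)
        X = n² * ι s * η₁ + (n² * ι s * ν₁ + (1ℚ + i) * (n² * ι s * (ι r * η₁)))
        Y = n² * (θ * ι s + (b + (b + ρ)))
        Z = ι s * δ′ + (ι s * η₁ + (1ℚ + i) * (ι s * (ι r * η₁))) + ι s * ν₁ + ι s * θ + b + b + ρ
        tot≤ : tot alive ≤ p + D
        tot≤ = ≤-≡ (proj₂ (proj₂ (proj₂ matching))) (cong (λ z → ι (length P) + δ′ * z) length-vs)
        errors : V * η₁ + (V * ν₁ + through overW) ≤ X
        errors = +-mono-≤ {V * η₁} {n² * ι s * η₁} {V * ν₁ + through overW} {n² * ι s * ν₁ + (1ℚ + i) * (n² * ι s * (ι r * η₁))} (*-monoʳ 0≤η₁ V≤)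
          (+-mono-≤ {V * ν₁} {n² * ι s * ν₁} {through overW} {(1ℚ + i) * (n² * ι s * (ι r * η₁))} (*-monoʳ 0≤ν₁ V≤) (≤-trans overload-mass (*-monoˡ (0≤+ 0≤1 (<⇒≤ (0<inv 0<α))) (*-monoʳ (0≤* (0≤ι r) 0≤η₁) V≤))))
        good≤ : Σw ≤ p + D + X
        good≤ = ≤-trans {Σw} {tot alive + (V * η₁ + (V * ν₁ + through overW))} {p + D + X} total-lower
          (+-mono-≤ {tot alive} {p + D} {V * η₁ + (V * ν₁ + through overW)} {X} tot≤ errors)
        value-bound : V ≤ p + δ * n²
        value-bound = ≤-trans {V} {Σw + Y} {p + δ * n²} good-mass (≤-trans {Σw + Y} {p + D + X + Y} {p + δ * n²}
          (+-monoˡ-≤ Y {Σw} {p + D + X} good≤) (≡-≤ (ring₁₃₁ p n² (ι s) δ′ η₁ ν₁ i (ι r) θ b ρ) (≤-≡ (+-monoʳ-≤ p {n² * Z} {n² * δ} (*-monoˡ {Z} {δ} {n²} 0≤n² budget)) (cong (p +_) (*-comm n² δ)))))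

-- Choice of the constants and the theorem.

module Conclusion where
  open import Data.Rational
  open import Data.Rational.Properties
  open RingIdentities
  open Rationals
  open NibbleTheorem
  open Regularity
  open EdgeSlots
  open Loads
  open Spread

  inv-distrib : ∀ {a b} → 0ℚ < a → 0ℚ < b → inv (a * b) ≡ inv a * inv b
  inv-distrib {a} {b} 0<a 0<b = trans (sym (*-identityʳ (inv (a * b)))) (trans (cong (inv (a * b) *_) (sym (trans (*-comm a (inv a)) (inv-* 0<a))))
    (trans (sym (*-assoc (inv (a * b)) a (inv a))) (trans (cong (_* inv a) (inv-mul 0<a 0<b)) (*-comm (inv b) (inv a)))))

  module Constants {k : ℕ} (F : Graph k) (s : ℕ) (1≤s : 1 ℕ.≤ s) {r₁ : ℕ} (Sl : Slots F (ℕ.suc r₁)) (δ : ℚ) (0<δ : 0ℚ < δ) where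

    r : ℕ
    r = ℕ.suc r₁

    Small : ℚ → ℚ → Set
    Small C d = ∃[ x ] (0ℚ < x × x ≤ 1ℚ × C * x ≤ d)

    -- The budget has seven terms of at most `η₀` each; 8 is the next power of two.
    8ℚ : ℚ
    8ℚ = 2ℚ * 2ℚ * 2ℚ

    sm₀ : Small 8ℚ δ
    sm₀ = small 8ℚ 0<δ

    η₀ : ℚ
    η₀ = proj₁ sm₀

    0<η₀ : 0ℚ < η₀
    0<η₀ = proj₁ (proj₂ sm₀)

    sm₁ : Small (ι s) η₀
    sm₁ = small (ι s) 0<η₀

    δ′ : ℚ
    δ′ = proj₁ sm₁

    module Nib = Params r₁ δ′ (proj₁ (proj₂ sm₁))

    sm₂ : Small 1ℚ η₀
    sm₂ = small 1ℚ 0<η₀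

    ρ : ℚ
    ρ = proj₁ sm₂

    0<ρ : 0ℚ < ρ
    0<ρ = proj₁ (proj₂ sm₂)

    R K : ℚ
    R = inv (ρ ^ r)
    K = ι (s ℕ.^ r)

    -- The estimate for overloads divides the counting error by α, and `R` comes from ρ; so ε is
    -- chosen after both.
    sm₃ : Small (ι s * (1ℚ + (1ℚ + inv Nib.α) * ι r) * (ι r * K * R)) η₀
    sm₃ = small (ι s * (1ℚ + (1ℚ + inv Nib.α) * ι r) * (ι r * K * R)) 0<η₀

    -- `θ` has to satisfy the same inequality as `δ′` and shares its value.
    ε θ : ℚ
    ε = proj₁ sm₃
    θ = proj₁ sm₁

    -- Makes the range of the test functions s^r, the bound for the products `F` and `G` in the
    -- counting lemma.
    K₁ : ℕ
    K₁ = ℕ.pred (s ℕ.^ r)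

    sucK₁ : ℕ.suc K₁ ≡ s ℕ.^ r
    sucK₁ = ℕ.suc-pred (s ℕ.^ r) {{ℕ.m^n≢0 s r {{ℕ.>-nonZero 1≤s}}}}

    accuracy : Accuracy
    accuracy = record { s = s ; K₁ = K₁ ; ε = ε ; θ = θ ; 0<ε = proj₁ (proj₂ sm₃) ; 0<θ = proj₁ (proj₂ sm₁) }

    module Reg = RegularityLemma accuracy

    sm₄ : Small (ι Reg.M̄ * ι s) η₀
    sm₄ = small (ι Reg.M̄ * ι s) 0<η₀

    γ : ℚ
    γ = proj₁ sm₄

    -- With g₀ = γn the codegree bound becomes c₁/n and the collision term c₂/n; `N₁` and `N₂` make
    -- n large enough for them.
    c₁ c₂ : ℚ
    c₁ = ι s * (R * (ι r * ι r * (K * (2ℚ * 2ℚ * (inv γ * (inv γ * inv γ))))))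
    c₂ = ι s * (R * (ι k * ι k * (K * inv γ)))

    sm₅ : Small c₁ Nib.α
    sm₅ = small c₁ Nib.0<α

    sm₆ : Small c₂ η₀
    sm₆ = small c₂ 0<η₀

    N₁ N₂ N : ℕ
    N₁ = proj₁ (archimedean (inv (proj₁ sm₅)))
    N₂ = proj₁ (archimedean (inv (proj₁ sm₆)))
    N = ℕ.suc (Nib.N₀ ℕ.+ (N₁ ℕ.+ N₂))

    inv-small : ∀ {x} → 0ℚ < x → ∀ {n} → 0ℚ < ι n → proj₁ (archimedean (inv x)) ℕ.≤ n → inv (ι n) ≤ x
    inv-small {x} 0<x {n} 0<n h = ≤-≡ (inv-anti (0<inv 0<x) (≤-trans (proj₂ (archimedean (inv x))) (ι-mono h))) inv-inv
      where
      inv-inv : inv (inv x) ≡ x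
      inv-inv = trans (sym (*-identityʳ (inv (inv x)))) (trans (cong (inv (inv x) *_) (sym (inv-* 0<x))) (trans (sym (*-assoc (inv (inv x)) (inv x) x)) (trans (cong (_* x) (inv-* (0<inv 0<x))) (*-identityˡ x))))

    module At (n : ℕ) (N≤n : N ℕ.≤ n) (G : Multigraph n) (bounded : MultBounded s G) (ψ : FracPacking k n) (isF : IsFracPacking F G ψ) where

      0<n : 0ℚ < ι n
      0<n = <-≤-trans (0<ι _) (ι-mono N≤n)

      Wq : Fin n → Fin n → ℚ
      Wq a b = ι (mult G a b)

      RP : RegularPartition Wq (s ℕ.^ r) ε θ Reg.M̄
      RP = subst (λ K → RegularPartition Wq K ε θ Reg.M̄) sucK₁ (Reg.regularPartition (record { W = Wq ; 0≤W = λ a b → 0≤ι (mult G a b) ; W≤s = λ a b → ι-mono (bounded a b) ; 0<n = 0<n }))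

      0≤ε : 0ℚ ≤ ε
      0≤ε = <⇒≤ (proj₁ (proj₂ sm₃))

      0<γ : 0ℚ < γ
      0<γ = proj₁ (proj₂ sm₄)

      γ≤1 : γ ≤ 1ℚ
      γ≤1 = proj₁ (proj₂ (proj₂ sm₄))

      n² : ℚ
      n² = ι n * ι n

      0≤n² : 0ℚ ≤ n²
      0≤n² = 0≤* (<⇒≤ 0<n) (<⇒≤ 0<n)

      j₀ : ℚ
      j₀ = inv (ι n)

      i₀ : ℚ
      i₀ = inv (γ * ι n)

      i₀≡ : i₀ ≡ inv γ * j₀
      i₀≡ = inv-distrib 0<γ 0<n

      nj : ι n * j₀ ≡ 1ℚ
      nj = trans (*-comm (ι n) j₀) (inv-* 0<n)

      N₀≤ : ι Nib.N₀ ≤ n² * ι s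
      N₀≤ = ≤-trans (ι-mono (ℕ.≤-trans (ℕ.≤-trans (ℕ.m≤m+n Nib.N₀ (N₁ ℕ.+ N₂)) (ℕ.n≤1+n _)) N≤n))
        (≤-trans (≡-≤ (sym (*-identityʳ (ι n))) (*-monoˡ (<⇒≤ 0<n) 1≤n)) (≡-≤ (sym (*-identityʳ n²)) (*-monoˡ 0≤n² 1≤s′)))
        where
        1≤n : 1ℚ ≤ ι n
        1≤n = ≡-≤ (sym ι-1) (ι-mono (ℕ.≤-trans (ℕ.s≤s ℕ.z≤n) N≤n))
        1≤s′ : 1ℚ ≤ ι s
        1≤s′ = ≡-≤ (sym ι-1) (ι-mono 1≤s)

      codeg-small : n² * ι s * (R * (ι r * ι r * (K * (2ℚ * 2ℚ * (i₀ * (i₀ * i₀)))))) ≤ Nib.α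
      codeg-small = ≡-≤ (cong (λ i → n² * ι s * (R * (ι r * ι r * (K * (2ℚ * 2ℚ * (i * (i * i))))))) i₀≡)
        (≡-≤ (trans (ring₁₂₈ (ι n) (ι s) R (ι r) K (inv γ) j₀) (trans (cong (λ z → c₁ * (z * z * j₀)) nj) (cong (c₁ *_) (trans (cong (_* j₀) (*-identityˡ 1ℚ)) (*-identityˡ j₀)))))
        (≤-trans (*-monoˡ 0≤c₁ (inv-small (proj₁ (proj₂ sm₅)) 0<n (ℕ.≤-trans (ℕ.≤-trans (ℕ.m≤m+n N₁ N₂) (ℕ.≤-trans (ℕ.m≤n+m (N₁ ℕ.+ N₂) Nib.N₀) (ℕ.n≤1+n _))) N≤n))) (proj₂ (proj₂ (proj₂ sm₅)))))
        where
        0≤γ′ : 0ℚ ≤ inv γ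
        0≤γ′ = <⇒≤ (0<inv 0<γ)
        0≤c₁ : 0ℚ ≤ c₁
        0≤c₁ = 0≤* (0≤ι s) (0≤* (<⇒≤ (0<inv (0<^ r 0<ρ))) (0≤* (0≤* (0≤ι r) (0≤ι r)) (0≤* (0≤ι (s ℕ.^ r)) (0≤* (0≤* 0≤2 0≤2) (0≤* 0≤γ′ (0≤* 0≤γ′ 0≤γ′))))))

      ν-small : ι s * (R * (ι k * ι k * (K * i₀))) ≤ η₀
      ν-small = ≡-≤ (trans (cong (λ i → ι s * (R * (ι k * ι k * (K * i)))) i₀≡) (ring₁₂₉ (ι s) R (ι k) K (inv γ) j₀))
        (≤-trans (*-monoˡ 0≤c₂ (inv-small (proj₁ (proj₂ sm₆)) 0<n (ℕ.≤-trans (ℕ.≤-trans (ℕ.m≤n+m N₂ N₁) (ℕ.≤-trans (ℕ.m≤n+m (N₁ ℕ.+ N₂) Nib.N₀) (ℕ.n≤1+n _))) N≤n))) (proj₂ (proj₂ (proj₂ sm₆))))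
        where
        0≤c₂ : 0ℚ ≤ c₂
        0≤c₂ = 0≤* (0≤ι s) (0≤* (<⇒≤ (0<inv (0<^ r 0<ρ))) (0≤* (0≤* (0≤ι k) (0≤ι k)) (0≤* (0≤ι (s ℕ.^ r)) (<⇒≤ (0<inv 0<γ)))))

      h i b : ℚ
      h = ι r * (K * ε) * R
      i = inv Nib.α
      b = ι Reg.M̄ * γ * ι s

      e₁ : ι s * δ′ ≤ η₀
      e₁ = proj₂ (proj₂ (proj₂ sm₁))

      e₃ : ι s * h + (1ℚ + i) * (ι s * (ι r * h)) ≤ η₀
      e₃ = ≡-≤ (ring₁₃₀ (ι s) i (ι r) (ι r) K R ε) (proj₂ (proj₂ (proj₂ sm₃)))

      eb : b ≤ η₀
      eb = ≡-≤ (ring₉₄ (ι Reg.M̄) γ (ι s)) (proj₂ (proj₂ (proj₂ sm₄)))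

      eρ : ρ ≤ η₀
      eρ = ≡-≤ (sym (*-identityˡ ρ)) (proj₂ (proj₂ (proj₂ sm₂)))

      budget : ι s * δ′ + (ι s * h + (1ℚ + i) * (ι s * (ι r * h))) + ι s * (R * (ι k * ι k * (K * i₀))) + ι s * θ + b + b + ρ ≤ δ
      budget = ≤-trans (+-mono-≤ (+-mono-≤ (+-mono-≤ (+-mono-≤ (+-mono-≤ (+-mono-≤ e₁ e₃) ν-small) e₁) eb) eb) eρ)
        (≤-trans (≤-by {η₀ + η₀ + η₀ + η₀ + η₀ + η₀ + η₀} {η₀ + η₀ + η₀ + η₀ + η₀ + η₀ + η₀ + η₀} η₀ (<⇒≤ 0<η₀) refl) (≡-≤ (ring₁₃₂ η₀) (proj₂ (proj₂ (proj₂ sm₀)))))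

      spread : SpreadData
      spread = record { F = F ; Sl = Sl ; G = G ; s = s ; 1≤s = 1≤s ; bounded = bounded ; ψ = ψ ; isF = isF ; 0<n = 0<n ; ε = ε ; θ = θ ; ρ = ρ ; γ = γ
        ; 0≤ε = 0≤ε ; 0<ρ = 0<ρ ; 0<γ = 0<γ ; γ≤1 = γ≤1 ; RP = RP }

      result : ∃[ Q ] (IsPacking F G Q × value ψ ≤ ℕtoℚ (length Q) + δ * ℕtoℚ (n ℕ.* n))
      result = Spreading.Labelled.conclude spread δ′ (proj₁ (proj₂ sm₁)) δ N₀≤ codeg-small budget

  Goal : ∀ {k} → Graph k → ℕ → ℚ → Set
  Goal {k} F s δ = ∃[ N ] (∀ (n : ℕ) → N ℕ.≤ n → (G : Multigraph n) → MultBounded s G → (ψ : FracPacking k n) → IsFracPacking F G ψ →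
    ∃[ P ] (IsPacking F G P × (value ψ ≤ (ℕtoℚ (length P) + δ * ℕtoℚ (n ℕ.* n)))))

  -- A copy without edges covers no pair, so one embedding may be repeated until the list outgrows
  -- the value of ψ. A nonempty ψ supplies the embedding, and an empty one has value 0.
  edgeless : ∀ {k} (F : Graph k) → Slots F 0 → ∀ s δ → 0ℚ < δ → Goal F s δ
  edgeless {k} F Sl s δ 0<δ = 0 , λ n _ G _ ψ _ → go n G ψ
    where
    go : ∀ n (G : Multigraph n) (ψ : FracPacking k n) → ∃[ P ] (IsPacking F G P × (value ψ ≤ (ℕtoℚ (length P) + δ * ℕtoℚ (n ℕ.* n))))
    go n G [] = [] , (λ a b → ℕ.z≤n) , 0≤+ (≤-≡ (0≤ι 0) (ι≡ℕtoℚ 0)) (0≤* (<⇒≤ 0<δ) (≤-≡ (0≤ι (n ℕ.* n)) (ι≡ℕtoℚ (n ℕ.* n))))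
    go n G ψ@((φ , _) ∷ _) with archimedean (value ψ)
    ... | m , h = replicate m φ , (λ a b → ℕ.≤-trans (ℕ.≤-reflexive (cong length (none a b))) ℕ.z≤n) ,
      ≤-trans h (≤-by {ι m} (δ * ℕtoℚ (n ℕ.* n)) (0≤* (<⇒≤ 0<δ) (≤-≡ (0≤ι (n ℕ.* n)) (ι≡ℕtoℚ (n ℕ.* n)))) (cong (_+ δ * ℕtoℚ (n ℕ.* n)) (trans (cong ι (sym (List.length-replicate m))) (ι≡ℕtoℚ (length (replicate m φ))))))
      where
      uncovered : ∀ a b → ¬ (covers F φ a b ≡ true)
      uncovered a b cov with Slots.covers⇒slot Sl φ a b cov
      ... | () , _
      none : ∀ a b → filter (λ φ → covers F φ a b Bool.≟ true) (replicate m φ) ≡ []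
      none a b = List.filter-none (λ φ → covers F φ a b Bool.≟ true) (All.replicate⁺ m (uncovered a b))

  main : ∀ {k} (F : Graph k) s → 1 ℕ.≤ s → ∀ δ → 0ℚ < δ → ∀ {r} → Slots F r → Goal F s δ
  main F s 1≤s δ 0<δ {ℕ.zero} Sl = edgeless F Sl s δ 0<δ
  main F s 1≤s δ 0<δ {ℕ.suc r₁} Sl = Cs.N , λ n N≤n G bounded ψ isF → Cs.At.result n N≤n G bounded ψ isF
    where module Cs = Constants F s 1≤s Sl δ 0<δ

open import Defs
open import Data.Nat using (ℕ; _≤_; _*_)
open import Data.List using (List; length)
open import Data.Product using (Σ; _×_; ∃-syntax)
open import Data.Rational using (ℚ; 0ℚ; _<_; _+_) renaming (_≤_ to _≤ℚ_; _*_ to _*ℚ_)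

theorem4p1 : (k : ℕ) (F : Graph k) (s : ℕ) → 1 ≤ s →
    (δ : ℚ) → 0ℚ < δ →
    ∃[ N ] (∀ (n : ℕ) → N ≤ n → (G : Multigraph n) → MultBounded s G →
    (ψ : FracPacking k n) → IsFracPacking F G ψ →
    ∃[ P ] (IsPacking F G P × (value ψ ≤ℚ (ℕtoℚ (length P) + δ *ℚ ℕtoℚ (n * n)))))
theorem4p1 k F s 1≤s δ 0<δ = Conclusion.main F s 1≤s δ 0<δ (EdgeSlots.slotsOf F)
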